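{- Let $D$ be a connected locally-finite triangle-free digraph with more than one end. If $D$ is connected-homogeneous then: (i) $D$ is highly arc-transitive; (ii) the reachability relation $\mathcal{A}$ on $ED$ is not universal, and hence $\Delta(D)$ is bipartite; (iii) in particular $\Delta(D)$ (viewed as an undirected bipartite graph) is isomorphic to one of: a cycle $C_m$ with $m$ even, a complete bipartite graph $K_{m,n}$ ($m,n\in\mathbb{N}$), the complement of a perfect matching $CP_n$ ($n\in\mathbb{N}$), or an infinite semiregular tree $T_{a,b}$ ($a,b\in\mathbb{N}$); (iv) conversely, for every bipartite graph $B$ listed in (iii), the digraph $DL(B)$ is a connected triangle-free locally-finite connected-homogeneous digraph with $\Delta(DL(B))$ isomorphic to $B$. In addition, if $D$ has more than two ends then (v) for every vertex $u\in VD$ the subdigraphs induced by $\mathrm{desc}(u)$ and by $\mathrm{anc}(u)$ are trees.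
   Context: A digraph is a set $VD$ with an irreflexive antisymmetric binary relation $ED$ (arcs); write $x\to y$ for $(x,y)\in ED$. $D^+(v)=\{w:v\to w\}$, $D^-(v)=\{w:w\to v\}$; $D$ is locally-finite if all these are finite. Connectivity, ends, "triangle-free" (no three mutually adjacent vertices) and "tree" refer to the underlying undirected graph. The ends of a connected locally-finite graph are equivalence classes of rays (one-way infinite paths), two rays being equivalent if some third ray meets each of them infinitely often. A digraph is connected-homogeneous if every isomorphism between finite connected induced subdigraphs extends to an automorphism. A $k$-arc is a sequence $(x_0,\dots,x_k)$ with $x_i\to x_{i+1}$; $D$ is highly arc-transitive if for every $k$ its automorphism group is transitive on $k$-arcs. An alternating walk is a sequence $(x_1,\dots,x_n)$ whose consecutive arcs alternate in direction; arcs $e,e'$ are related by $\mathcal{A}$ if some alternating walk has first arc $e$ and last arc $e'$; $\mathcal{A}$ is an equivalence relation on $ED$. For arc-transitive $D$, $\Delta(D)$ denotes the (common up to isomorphism) subdigraph induced by an $\mathcal{A}$-class; it is called bipartite if its vertex set splits into $X\cup Y$ with all arcs from $X$ to $Y$. $CP_n$ is the bipartite graph with parts $X,Y$ of size $n$, a bijection $\eta:X\to Y$, and $x\sim y$ iff $y\ne\eta(x)$. $T_{a,b}$ is the infinite tree in which vertices of one part of the bipartition have degree $a$ and those of the other have degree $b$. $\mathrm{desc}(u)$ is the set of vertices reachable from $u$ by a directed path; $\mathrm{anc}(u)$ the set of vertices from which $u$ is reachable by a directed path. Construction $DL(\Delta)$: for an edge-transitive connected bipartite graph $\Delta$ with bipartition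 $X\cup Y$, let $T$ be a directed tree with every in-degree $|X|$ and every out-degree $|Y|$; for each $t\in VT$ fix bijections $\varphi_t:T^-(t)\to X$, $\psi_t:T^+(t)\to Y$; $DL(\Delta)$ has vertex set $ET$ and an arc $(a,b)\to(c,d)$ iff $b=c$ and $\{\psi_b(a),\varphi_b(d)\}$ is an edge of $\Delta$ (up to isomorphism independent of choices). Here the bipartition of $B$ in (iv) is the natural one.
   Formalization: In DL(Δ) the arc condition is read as {φ_b(a), ψ_b(d)} being an edge, since ψ_b(a) and φ_b(d) are undefined; CP_n is taken with n ≥ 3 (CP_1, CP_2 are disconnected, so DL is undefined), C_m with m ≥ 3 and K_{m,n} with m, n ≥ 1. -}

module Defs where

open import Data.Fin.Base using (Fin; toℕ; inject₁) renaming (suc to fsuc)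
open import Data.Irrelevant using ([_])
open import Data.Nat.Base using (ℕ; zero; suc; _≤_; parity)
open import Data.Parity.Base using (Parity; 0ℙ; 1ℙ) renaming (_⁻¹ to opposite)
open import Data.Parity.Properties using (p≢p⁻¹)
open import Data.Product using (Σ-syntax; ∃-syntax; _×_; _,_; proj₁; proj₂; uncurry)
open import Data.Refinement using (Refinement-syntax; _,_; value; value-injective)
open import Data.Sum.Base using (_⊎_; inj₁; inj₂)
open import Function.Bundles using (_↔_; _⇔_; Inverse)
open import Function.Definitions using (Injective)
open import Level using (0ℓ)
open import Relation.Binary.Construct.Closure.ReflexiveTransitive using (Star)
open import Relation.Binary.Construct.Closure.Symmetric using (SymClosure; fwd; bwd)
  renaming (symmetric to symClosure-symmetric)
open import Relation.Binary.Core using (Rel)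
open import Relation.Binary.Definitions using (Irreflexive; Antisymmetric; Symmetric)
open import Relation.Binary.PropositionalEquality
  using (_≡_; _≢_; refl; sym; trans; cong)
open import Relation.Nullary.Negation.Core using (¬_; contradiction-irr)
open import Relation.Unary using (Pred)

Finite : Set → Set
Finite A = ∃[ n ] (A ↔ Fin n)

record RelIso {A B : Set} (R : Rel A 0ℓ) (S : Rel B 0ℓ) : Set where
  field
    bijection : A ↔ B
  open Inverse bijection public using (to; from)
  field
    edges : ∀ {x y} → R x y ⇔ S (to x) (to y)

------------------------------------------------------------------------
-- Undirected graphs

record Graph : Set₁ where
  infix 4 _~_
  field
    V      : Set
    _~_    : Rel V 0ℓ
    irrefl : Irreflexive _≡_ _~_
    ~-sym  : Symmetric _~_

infix 4 _≅_
_≅_ : Graph → Graph → Set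
G ≅ H = RelIso (Graph._~_ G) (Graph._~_ H)

-- i is followed by j in the cyclic order 0, 1, …, m - 1, 0.
CyclicSuc : ∀ {m} → Fin m → Fin m → Set
CyclicSuc {m} i j =
  toℕ j ≡ suc (toℕ i) ⊎ (suc (toℕ i) ≡ m × toℕ j ≡ 0)

module _ (G : Graph) where
  open Graph G

  Neighbours : V → Set
  Neighbours v = [ w ∈ V ∣ v ~ w ]

  -- Connected graphs (hence also trees) are non-empty.
  Connected : Set
  Connected = V × (∀ u v → Star _~_ u v)

  TriangleFree : Set
  TriangleFree = ∀ {x y z} → x ~ y → y ~ z → ¬ (x ~ z)

  record Cycle : Set where
    field
      {len}     : ℕ
      3≤len     : 3 ≤ len
      vertex    : Fin len → V
      injective : Injective _≡_ _≡_ vertex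
      adjacent  : ∀ {i j} → CyclicSuc i j → vertex i ~ vertex j

  IsTree : Set
  IsTree = Connected × ¬ Cycle

  record Ray : Set where
    field
      vertex    : ℕ → V
      injective : Injective _≡_ _≡_ vertex
      adjacent  : ∀ n → vertex n ~ vertex (suc n)

  MeetsInfinitelyOften : Ray → Ray → Set
  MeetsInfinitelyOften r s =
    ∀ N → ∃[ n ] (N ≤ n × ∃[ m ] (Ray.vertex r n ≡ Ray.vertex s m))

  SameEnd : Ray → Ray → Set
  SameEnd r s = ∃[ t ] (MeetsInfinitelyOften t r × MeetsInfinitelyOften t s)

  MoreThanOneEnd : Set
  MoreThanOneEnd = ∃[ r ] ∃[ s ] (¬ SameEnd r s)

  MoreThanTwoEnds : Set
  MoreThanTwoEnds =
    ∃[ r ] ∃[ s ] ∃[ t ] (¬ SameEnd r s × ¬ SameEnd r t × ¬ SameEnd s t)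

------------------------------------------------------------------------
-- Bipartite graphs

-- A graph together with a chosen ordered bipartition: the part X consists of
-- the vertices labelled 0ℙ, the part Y of those labelled 1ℙ.
record BipartiteGraph : Set₁ where
  field
    graph : Graph
  open Graph graph public
  field
    part   : V → Parity
    proper : ∀ {u v} → u ~ v → part u ≢ part v

  X Y : Set
  X = [ v ∈ V ∣ part v ≡ 0ℙ ]
  Y = [ v ∈ V ∣ part v ≡ 1ℙ ]

private
  parity-suc : ∀ n → parity (suc n) ≡ opposite (parity n)
  parity-suc zero          = refl
  parity-suc (suc zero)    = refl
  parity-suc (suc (suc n)) = parity-suc n

  parity-alternates : ∀ {m} → parity m ≡ 0ℙ → {i j : Fin m} →
                      CyclicSuc i j → parity (toℕ i) ≢ parity (toℕ j)
  parity-alternates even {i} {j} (inj₁ j≡1+i) eq =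
    p≢p⁻¹ (parity (toℕ i)) (trans eq (trans (cong parity j≡1+i) (parity-suc (toℕ i))))
  parity-alternates even {i} {j} (inj₂ (1+i≡m , j≡0)) eq =
    p≢p⁻¹ (parity (toℕ i))
      (trans (trans eq (cong parity j≡0))
             (trans (sym (trans (cong parity 1+i≡m) even)) (parity-suc (toℕ i))))

-- C_m for even m; the natural bipartition is into even and odd residues.
evenCycle : (m : ℕ) → parity m ≡ 0ℙ → BipartiteGraph
evenCycle m even = record
  { graph = record
    { V      = Fin m
    ; _~_    = SymClosure CyclicSuc
    ; irrefl = λ { refl e → alternates e refl }
    ; ~-sym  = symClosure-symmetric CyclicSuc
    }
  ; part   = λ i → parity (toℕ i)
  ; proper = alternates
  }
  where
  alternates : ∀ {i j : Fin m} → SymClosure CyclicSuc i j → parity (toℕ i) ≢ parity (toℕ j)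
  alternates (fwd e) eq = parity-alternates even e eq
  alternates (bwd e) eq = parity-alternates even e (sym eq)

-- The bipartite graph with parts A and B and with a ∈ A joined to b ∈ B
-- exactly when E a b.
module _ {A B : Set} (E : A → B → Set) where

  data BipartiteEdge : Rel (A ⊎ B) 0ℓ where
    edge  : ∀ {a b} → E a b → BipartiteEdge (inj₁ a) (inj₂ b)
    edge˘ : ∀ {a b} → E a b → BipartiteEdge (inj₂ b) (inj₁ a)

  bipartite : BipartiteGraph
  bipartite = record
    { graph = record
      { V      = A ⊎ B
      ; _~_    = BipartiteEdge
      ; irrefl = λ { refl () }
      ; ~-sym  = λ { (edge e) → edge˘ e ; (edge˘ e) → edge e }
      }
    ; part   = λ { (inj₁ _) → 0ℙ ; (inj₂ _) → 1ℙ }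
    ; proper = λ { (edge _) () ; (edge˘ _) () }
    }

data Always {A B : Set} (a : A) (b : B) : Set where
  always : Always a b

K : ℕ → ℕ → BipartiteGraph
K m n = bipartite {Fin m} {Fin n} Always

-- CP_n, with both parts indexed by Fin n so that η is the identity on indices.
CP : ℕ → BipartiteGraph
CP n = bipartite {Fin n} {Fin n} _≢_

-- B, with its bipartition, is the infinite semiregular tree T_{a,b}.
record IsSemiregularTree (a b : ℕ) (B : BipartiteGraph) : Set where
  open BipartiteGraph B
  field
    isTree   : IsTree graph
    infinite : ¬ Finite V
    degreeX  : ∀ {v} → part v ≡ 0ℙ → Neighbours graph v ↔ Fin a
    degreeY  : ∀ {v} → part v ≡ 1ℙ → Neighbours graph v ↔ Fin b

-- The ranges of the parameters exclude only degenerate cases: cycles have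
-- length at least 3, K_{m,n} has both parts non-empty, and CP₁ and CP₂ are
-- disconnected.
data Listed : BipartiteGraph → Set₁ where
  cycle    : ∀ {m} → 3 ≤ m → (even : parity m ≡ 0ℙ) → Listed (evenCycle m even)
  complete : ∀ {m n} → 1 ≤ m → 1 ≤ n → Listed (K m n)
  matching : ∀ {n} → 3 ≤ n → Listed (CP n)
  tree     : ∀ {a b B} → IsSemiregularTree a b B → Listed B

------------------------------------------------------------------------
-- Digraphs

record Digraph : Set₁ where
  infix 4 _⟶_
  field
    V       : Set
    _⟶_     : Rel V 0ℓ
    irrefl  : Irreflexive _≡_ _⟶_
    antisym : Antisymmetric _≡_ _⟶_

underlying : Digraph → Graph
underlying D = record
  { V      = V
  ; _~_    = SymClosure _⟶_
  ; irrefl = λ { eq (fwd a) → irrefl eq a ; eq (bwd a) → irrefl (sym eq) a }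
  ; ~-sym  = symClosure-symmetric _⟶_
  }
  where open Digraph D

data Direction : Set where
  forward backward : Direction

module _ (D : Digraph) where
  open Digraph D

  Out In : V → Set
  Out v = [ w ∈ V ∣ v ⟶ w ]
  In  v = [ w ∈ V ∣ w ⟶ v ]

  LocallyFinite : Set
  LocallyFinite = ∀ v → Finite (Out v) × Finite (In v)

  -- A set of pairs: the proof of adjacency is irrelevant to equality of arcs.
  Arc : Set
  Arc = [ e ∈ V × V ∣ uncurry _⟶_ e ]

  arc : ∀ {x y} → .(x ⟶ y) → Arc
  arc {x} {y} a = (x , y) , [ a ]

  tail head : Arc → V
  tail e = proj₁ (value e)
  head e = proj₂ (value e)

  induced : Pred V 0ℓ → Digraph
  induced P = record
    { V       = [ v ∈ V ∣ P v ]
    ; _⟶_     = λ u v → value u ⟶ value v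
    ; irrefl  = λ { refl → irrefl refl }
    ; antisym = λ a b → value-injective (antisym a b)
    }

  Automorphism : Set
  Automorphism = RelIso _⟶_ _⟶_

  ConnectedHomogeneous : Set₁
  ConnectedHomogeneous =
    (P Q : Pred V 0ℓ) →
    Finite [ v ∈ V ∣ P v ] → Connected (underlying (induced P)) →
    Finite [ v ∈ V ∣ Q v ] → Connected (underlying (induced Q)) →
    (f : RelIso (Digraph._⟶_ (induced P)) (Digraph._⟶_ (induced Q))) →
    Σ[ α ∈ Automorphism ] (∀ v → RelIso.to α (value v) ≡ value (RelIso.to f v))

  record KArc (k : ℕ) : Set where
    field
      vertex : Fin (suc k) → V
      steps  : ∀ (i : Fin k) → vertex (inject₁ i) ⟶ vertex (fsuc i)

  HighlyArcTransitive : Set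
  HighlyArcTransitive =
    ∀ k (s t : KArc k) →
    Σ[ α ∈ Automorphism ] (∀ i → RelIso.to α (KArc.vertex s i) ≡ KArc.vertex t i)

  -- An alternating walk, given by its successive arcs, with first arc e; the
  -- remaining indices are its last arc and the direction in which the walk
  -- traverses that arc.
  data AlternatingWalk (e : Arc) : Direction → Arc → Set where
    start  : ∀ d → AlternatingWalk e d e
    atHead : ∀ {f g} → AlternatingWalk e forward f → head f ≡ head g →
             AlternatingWalk e backward g
    atTail : ∀ {f g} → AlternatingWalk e backward f → tail f ≡ tail g →
             AlternatingWalk e forward g

  𝒜 : Rel Arc 0ℓ
  𝒜 e f = ∃[ d ] AlternatingWalk e d f

  -- The subdigraph formed by the arcs in the 𝒜-class of e and their endpoints.
  ⟨𝒜_⟩ : Arc → Digraph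
  ⟨𝒜 e ⟩ = record
    { V       = [ v ∈ V ∣ ∃[ f ] (𝒜 e f × (v ≡ tail f ⊎ v ≡ head f)) ]
    ; _⟶_     = λ u v → Σ[ a ∈ value u ⟶ value v ] 𝒜 e (arc a)
    ; irrefl  = λ { refl (a , _) → irrefl refl a }
    ; antisym = λ { (a , _) (b , _) → value-injective (antisym a b) }
    }

  -- "Δ(D) has the property P": there is an 𝒜-class, and every one of them
  -- has P.  When D is arc-transitive all the classes are isomorphic.
  Δ-satisfies : ∀ {ℓ} → (Digraph → Set ℓ) → Set ℓ
  Δ-satisfies P = Arc × (∀ e → P ⟨𝒜 e ⟩)

  IsBipartite : Set
  IsBipartite =
    Σ[ part ∈ (V → Parity) ] (∀ {u v} → u ⟶ v → part u ≡ 0ℙ × part v ≡ 1ℙ)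

  desc anc : V → Digraph
  desc u = induced (λ v → Star _⟶_ u v)
  anc  u = induced (λ v → Star _⟶_ v u)

ΔIsomorphicTo : Digraph → BipartiteGraph → Set
ΔIsomorphicTo D B =
  Δ-satisfies D (λ Δ → underlying Δ ≅ BipartiteGraph.graph B)

------------------------------------------------------------------------
-- The construction DL

-- The choices made in the construction.  The bijections say in particular
-- that all in-degrees of T are |X| and all out-degrees are |Y|.
record LabelledTree (B : BipartiteGraph) : Set₁ where
  open BipartiteGraph B using (X; Y)
  field
    T      : Digraph
    isTree : IsTree (underlying T)
    φ      : ∀ t → In T t ↔ X
    ψ      : ∀ t → Out T t ↔ Y

DL : (B : BipartiteGraph) → LabelledTree B → Digraph
DL B L = record
  { V       = Arc T
  ; _⟶_     = _⇒_
  ; irrefl  = λ { {(a , b) , [ p ]} refl (b≡a , _) →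
                  contradiction-irr p (irrefl (sym b≡a)) }
  ; antisym = λ { {(a , b) , [ p ]} {(c , d) , [ q ]} (refl , _) (refl , _) →
                  contradiction-irr p (λ p′ → contradiction-irr q (λ q′ →
                    irrefl (antisym p′ q′) p′)) }
  }
  where
  open LabelledTree L
  open Digraph T using (irrefl; antisym)
  open BipartiteGraph B using (_~_)

  infix 4 _⇒_
  _⇒_ : Rel (Arc T) 0ℓ
  ((a , b) , a⟶b) ⇒ ((c , d) , c⟶d) =
    b ≡ c × value (Inverse.to (φ b) (a , a⟶b)) ~ value (Inverse.to (ψ c) (d , c⟶d))

-- Everything finite about D is extracted from one observation.  If independent leaves are attached to a connected induced
-- subdigraph in two places, then every permutation of the leaves in one place extends to an automorphism fixing the subdigraph
-- and permuting the leaves in the other place.  So the matrix recording the adjacencies between two such sets of leaves is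
-- constant or, up to exchanging two entries, a permutation matrix (Matrix, leafMatrix).
--
-- Together with counting of degrees and the infinitude of V this shows by induction on k that k-arcs are induced, so that D is
-- highly arc-transitive.  A shortest alternating walk whose ends are also joined by a longer directed path is induced, and
-- exchanging its first arc for the last arc of that path again gives an induced walk, whence a chord of a k-arc.  So no such walk
-- exists, 𝒜 is not universal, and its classes are bipartite, induced and again homogeneous.  If Δ(D) contains a 4-cycle, the
-- matrix of the edges that are adjacent to an edge is constant or all but a matching, which gives K_{m,n} or CP_n; otherwise
-- Δ(D) is a cycle or, since a hexagon would lead to concurrent lines with non-concurrent images, has no cycle at all.  Two
-- directed paths with the same ends of minimal length have length two by the matrix argument, and then D is a
-- sequence of levels with all arcs between consecutive levels, so it has at most two ends.
--
-- Conversely, T is built from reduced words, and an isomorphism between finite connected subdigraphs of DL(B) is extended along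
-- T outwards from one node: around each node it is given by an automorphism of B, chosen to agree with the partial map there.
module Submission where

open import Axiom.ExcludedMiddle using (ExcludedMiddle)
open import Data.Bool.Base using (Bool; true; false)
open import Data.Empty using (⊥; ⊥-elim)
open import Data.Fin.Base using (Fin; zero; suc; toℕ; fromℕ<)
open import Data.Irrelevant using ([_])
open import Data.List.Base using (List; []; _∷_)
open import Data.List.Membership.Propositional using (_∈_; _∉_)
open import Data.Nat.Base using (ℕ; zero; suc; _+_; _<_; _≤_; s≤s; z≤n)
open import Data.Parity.Base using (Parity; 0ℙ; 1ℙ) renaming (_⁻¹ to opposite)
open import Data.Product using (Σ; Σ-syntax; ∃-syntax; _×_; _,_; proj₁; proj₂)
open import Data.Refinement using (Refinement-syntax; _,_; value; value-injective)
open import Data.Sum.Base using (_⊎_; inj₁; inj₂; swap)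
open import Data.Unit.Base using (⊤; tt)
open import Function.Base using (_∘_; flip)
open import Function.Bundles using (_↔_; Inverse; mk↔ₛ′; mk⇔; Equivalence)
open import Level using (0ℓ)
open import Relation.Binary.Construct.Closure.ReflexiveTransitive using (Star; ε; _◅_; _◅◅_)
open import Relation.Binary.Construct.Closure.Symmetric using (SymClosure; fwd; bwd)
open import Relation.Binary.PropositionalEquality hiding (J)
open import Relation.Nullary.Decidable.Core using (Dec; yes; no)
open import Relation.Nullary.Negation.Core using (¬_; contradiction)

-- Homogeneity speaks only of induced subdigraphs, so leaves can be exchanged only after all
-- unwanted arcs between the chosen vertices are excluded. This is why most arguments take a
-- smallest counterexample: everything smaller is already known to be induced. Neighbourhoods are
-- compared without cardinal numbers: an injective relation between equally large finite sets is
-- onto, and contradictions come from a member that is visibly missed.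
--
-- The sides of an 𝒜-class have to be respected: a vertex is a tail in one class and a head in
-- another, so an extension that exchanged the sides could leave the class. Homogeneity therefore
-- carries a colouring `κ`, and the same exchange of leaves serves D and its classes.
--
-- In the converse, a partial isomorphism of DL(B) is cut into partial isomorphisms of single copies
-- of B. The obstacle is that the piece inside one copy must be connected. It is, because the copies
-- are glued along a tree: a walk that leaves a node through an edge can return only through that
-- edge.

module Proof (em : ExcludedMiddle 0ℓ) where

  -- Finite sets, choice and transpositions under excluded middle

  module Base where

    open import Data.Fin.Properties using (pigeonhole)
    open import Data.List.Base using (_++_; filter; deduplicate; length; lookup; map; concatMap; tabulate)
    open import Data.List.Membership.Propositional.Properties using (∈-filter⁺; ∈-filter⁻; ∈-deduplicate⁺; ∈-deduplicate⁻; ∈-++⁺ˡ; ∈-++⁺ʳ; ∈-map⁺; ∈-lookup; ∈-tabulate⁺)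
    open import Data.List.Relation.Unary.All using (All) renaming (lookup to All-lookup)
    open import Data.List.Relation.Unary.Any using (here; there; index)
    open import Data.List.Relation.Unary.Any.Properties using (lookup-index)
    open import Data.List.Relation.Unary.AllPairs using (_∷_)
    open import Data.List.Relation.Unary.Unique.Propositional using (Unique)
    import Data.List.Relation.Unary.Unique.DecPropositional.Properties as UniqueDec
    open import Data.Nat.Properties using (≤-refl; m≤n⇒∃[o]m+o≡n; +-suc; m≤n⇒m<n∨m≡n)
    open import Relation.Nullary.Decidable.Core using (recompute)
    open import Defs using (Finite)

    private variable
      A B : Set

    dec : (P : Set) → Dec P
    dec P = em

    infix 4 _≟_
    _≟_ : (x y : A) → Dec (x ≡ y)
    x ≟ y = em

    dne : {P : Set} → ¬ ¬ P → P
    dne {P} ¬¬p with dec P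
    ... | yes p = p
    ... | no ¬p = contradiction ¬p ¬¬p

    -- Refinements keep their membership proof irrelevant. Excluded middle decides every
    -- proposition, so such a proof can always be recomputed.
    recover : {P : Set} → .P → P
    recover = recompute em

    proofOf : {P : A → Set} (r : [ v ∈ A ∣ P v ]) → P (value r)
    proofOf (_ , [ p ]) = recover p

    ¬∀⇒∃¬ : {P : A → Set} → ¬ (∀ x → P x) → ∃[ x ] ¬ P x
    ¬∀⇒∃¬ ¬∀ = dne λ ¬∃ → ¬∀ λ x → dne λ ¬p → ¬∃ (x , ¬p)

    ↔-injective : (i : A ↔ B) → ∀ {x y} → Inverse.to i x ≡ Inverse.to i y → x ≡ y
    ↔-injective i {x} {y} eq = trans (sym (Inverse.strictlyInverseʳ i x)) (trans (cong (Inverse.from i) eq) (Inverse.strictlyInverseʳ i y))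

    -- Deciding `P x` makes the chosen value independent of the proof at hand, and `b` is an
    -- arbitrary value outside `P`.
    choose : {P : A → Set} {Q : A → B → Set} → (∀ x → P x → ∃[ y ] Q x y) → B →
             Σ[ g ∈ (A → B) ] (∀ x → P x → Q x (g x))
    choose {A} {B} {P} {Q} f b = g , g-spec
      where
      g : A → B
      g x with dec (P x)
      ... | yes p = proj₁ (f x p)
      ... | no _  = b
      g-spec : ∀ x → P x → Q x (g x)
      g-spec x p with dec (P x)
      ... | yes p′ = proj₂ (f x p′)
      ... | no ¬p  = contradiction p ¬p

    -- Finiteness as an upper bound: the list may repeat entries and may leave `P`, which makes
    -- passing to a smaller predicate trivial.
    Listing : (A → Set) → Set
    Listing {A} P = Σ[ xs ∈ List A ] (∀ {x} → P x → x ∈ xs)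

    lookup-injective : {xs : List A} → Unique xs → ∀ i j → lookup xs i ≡ lookup xs j → i ≡ j
    lookup-injective {xs = _ ∷ _} _ zero zero _ = refl
    lookup-injective {xs = _ ∷ xs} (h ∷ _) zero (suc j) eq = contradiction eq (All-lookup h (∈-lookup {xs = xs} j))
    lookup-injective {xs = _ ∷ xs} (h ∷ _) (suc i) zero eq = contradiction (sym eq) (All-lookup h (∈-lookup {xs = xs} i))
    lookup-injective {xs = _ ∷ _} (_ ∷ u) (suc i) (suc j) eq = cong suc (lookup-injective u i j eq)

    abstract
      listing⇒finite : {P : A → Set} → Listing P → Finite [ v ∈ A ∣ P v ]
      listing⇒finite {A} {P} (xs , complete) = length ys , mk↔ₛ′ to from to∘from from∘to
        where
        ys : List A
        ys = deduplicate _≟_ (filter (λ v → dec (P v)) xs)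
        ys-unique : Unique ys
        ys-unique = UniqueDec.deduplicate-! _≟_ _
        ∈ys : ∀ {v} → P v → v ∈ ys
        ∈ys p = ∈-deduplicate⁺ _≟_ (∈-filter⁺ (λ v → dec (P v)) (complete p) p)
        ys⊆P : ∀ {v} → v ∈ ys → P v
        ys⊆P v∈ys = proj₂ (∈-filter⁻ (λ v → dec (P v)) {xs = xs} (∈-deduplicate⁻ _≟_ _ v∈ys))
        to : [ v ∈ A ∣ P v ] → Fin (length ys)
        to r = index (∈ys (proofOf r))
        from : Fin (length ys) → [ v ∈ A ∣ P v ]
        from i = lookup ys i , [ ys⊆P (∈-lookup {xs = ys} i) ]
        from∘to : ∀ r → from (to r) ≡ r
        from∘to r = value-injective (sym (lookup-index (∈ys (proofOf r))))
        to∘from : ∀ i → to (from i) ≡ i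
        to∘from i = lookup-injective ys-unique _ _ (cong value (from∘to (from i)))

    finite⇒listing : {P : A → Set} → Finite [ v ∈ A ∣ P v ] → Listing P
    finite⇒listing {A} {P} (n , iso) = tabulate (value ∘ Inverse.from iso) , complete
      where
      complete : ∀ {x} → P x → x ∈ tabulate (value ∘ Inverse.from iso)
      complete {x} p = subst (_∈ tabulate (value ∘ Inverse.from iso))
        (cong value (Inverse.strictlyInverseʳ iso (x , [ p ])))
        (∈-tabulate⁺ (Inverse.to iso (x , [ p ])))

    listing-⊆ : {P Q : A → Set} → (∀ {x} → Q x → P x) → Listing P → Listing Q
    listing-⊆ Q⊆P (xs , c) = xs , λ q → c (Q⊆P q)

    listing-≡ : (x : A) → Listing (_≡ x)
    listing-≡ x = x ∷ [] , λ { refl → here refl }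

    listing-∪ : {P Q : A → Set} → Listing P → Listing Q → Listing (λ x → P x ⊎ Q x)
    listing-∪ (xs , c) (ys , d) = xs ++ ys , λ { (inj₁ p) → ∈-++⁺ˡ (c p) ; (inj₂ q) → ∈-++⁺ʳ xs (d q) }

    listing-∃ : {P : A → Set} {R : A → B → Set} → Listing P → (∀ x → Listing (R x)) →
                Listing (λ y → ∃[ x ] (P x × R x y))
    listing-∃ {R = R} (xs , c) f = concatMap (λ x → proj₁ (f x)) xs , λ { (x , p , r) → go (c p) (proj₂ (f x) r) }
      where
      go : ∀ {x y zs} → x ∈ zs → y ∈ proj₁ (f x) → y ∈ concatMap (λ x → proj₁ (f x)) zs
      go (here refl) m = ∈-++⁺ˡ m
      go {zs = z ∷ _} (there i) m = ∈-++⁺ʳ (proj₁ (f z)) (go i m)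

    listing-image : {P : A → Set} {Q : B → Set} (f : A → B) → Listing P →
                    (∀ {y} → Q y → ∃[ x ] (P x × f x ≡ y)) → Listing Q
    listing-image f (xs , c) g = map f xs , λ q → let (x , p , eq) = g q in subst (_∈ map f xs) eq (∈-map⁺ f (c p))

    listing-Fin : ∀ {n} (x : Fin n → A) → Listing (λ v → ∃[ i ] (x i ≡ v))
    listing-Fin x = tabulate x , λ { (i , refl) → ∈-tabulate⁺ i }

    listing-up-to : (x : ℕ → A) → ∀ n → Listing (λ v → ∃[ i ] (i ≤ n × x i ≡ v))
    listing-up-to x zero = listing-⊆ (λ { (zero , _ , eq) → sym eq }) (listing-≡ (x 0))
    listing-up-to x (suc n) = listing-⊆ split (listing-∪ (listing-up-to x n) (listing-≡ (x (suc n))))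
      where
      split : ∀ {v} → ∃[ i ] (i ≤ suc n × x i ≡ v) → (∃[ i ] (i ≤ n × x i ≡ v)) ⊎ v ≡ x (suc n)
      split (i , p , eq) with m≤n⇒m<n∨m≡n p
      ... | inj₁ (s≤s q) = inj₁ (i , q , eq)
      ... | inj₂ refl = inj₂ (sym eq)

    repetition : (f : ℕ → A) (xs : List A) → (∀ n → f n ∈ xs) →
                 ∃[ i ] ∃[ d ] (f i ≡ f (i + suc d))
    repetition f xs f∈xs with pigeonhole ≤-refl (λ (i : Fin (suc (length xs))) → index (f∈xs (toℕ i)))
    ... | i , j , i<j , eq with m≤n⇒∃[o]m+o≡n i<j
    ... | d , eq′ = toℕ i , d ,
      trans (trans (lookup-index (f∈xs (toℕ i))) (trans (cong (lookup xs) eq) (sym (lookup-index (f∈xs (toℕ j))))))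
            (cong f (sym (trans (+-suc (toℕ i) d) eq′)))

    -- Follow R from v until it returns to v, using that an injective map on a finite set has only periodic orbits.
    abstract
      injective⇒surjective : {P : A → Set} → Listing P → (R : A → A → Set) →
        (∀ x → P x → ∃[ y ] (P y × R x y)) →
        (∀ {x x′ y} → P x → P x′ → R x y → R x′ y → x ≡ x′) →
        ∀ y → P y → ∃[ x ] (P x × R x y)
      injective⇒surjective {A} {P} (xs , c) R total inj y Py =
        let (i , d , eq) = repetition orbit xs (λ n → c (orbit∈P n)) in back d i eq
        where
        g : A → A
        g = proj₁ (choose total y)
        g-spec : ∀ x → P x → P (g x) × R x (g x)
        g-spec = proj₂ (choose total y)
        orbit : ℕ → A
        orbit zero    = y
        orbit (suc n) = g (orbit n)
        orbit∈P : ∀ n → P (orbit n)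
        orbit∈P zero    = Py
        orbit∈P (suc n) = proj₁ (g-spec _ (orbit∈P n))
        back : ∀ d i → orbit i ≡ orbit (i + suc d) → ∃[ x ] (P x × R x y)
        back d zero eq = orbit d , orbit∈P d , subst (R (orbit d)) (sym eq) (proj₂ (g-spec _ (orbit∈P d)))
        back d (suc i) eq = back d i (inj (orbit∈P i) (orbit∈P (i + suc d)) (proj₂ (g-spec _ (orbit∈P i)))
          (subst (R (orbit (i + suc d))) (sym eq) (proj₂ (g-spec _ (orbit∈P (i + suc d))))))

    transpose : (s s′ : A) → A → A
    transpose s s′ x with x ≟ s
    ... | yes _ = s′
    ... | no _ with x ≟ s′
    ... | yes _ = s
    ... | no _ = x

    transpose-ˡ : (s s′ : A) → transpose s s′ s ≡ s′
    transpose-ˡ s s′ with s ≟ s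
    ... | yes _ = refl
    ... | no ¬r = contradiction refl ¬r

    transpose-ʳ : (s s′ : A) → transpose s s′ s′ ≡ s
    transpose-ʳ s s′ with s′ ≟ s
    ... | yes eq = eq
    ... | no _ with s′ ≟ s′
    ... | yes _ = refl
    ... | no ¬r = contradiction refl ¬r

    transpose-≢ : {s s′ x : A} → x ≢ s → x ≢ s′ → transpose s s′ x ≡ x
    transpose-≢ {s = s} {s′} {x} x≢s x≢s′ with x ≟ s
    ... | yes eq = contradiction eq x≢s
    ... | no _ with x ≟ s′
    ... | yes eq = contradiction eq x≢s′
    ... | no _ = refl

    -- Indexed by a point together with its image, so that a single match makes both concrete.
    data TransposeView (s s′ : A) : A → A → Set where
      left  : TransposeView s s′ s s′
      right : TransposeView s s′ s′ s
      fixed : ∀ {x} → x ≢ s → x ≢ s′ → TransposeView s s′ x x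

    transposeView : (s s′ x : A) → TransposeView s s′ x (transpose s s′ x)
    transposeView s s′ x with x ≟ s
    ... | yes refl = left
    ... | no x≢s with x ≟ s′
    ... | yes refl = right
    ... | no x≢s′ = fixed x≢s x≢s′

    transpose-involutive : (s s′ x : A) → transpose s s′ (transpose s s′ x) ≡ x
    transpose-involutive s s′ x with transpose s s′ x | transposeView s s′ x
    ... | _ | left = transpose-ʳ s s′
    ... | _ | right = transpose-ˡ s s′
    ... | _ | fixed n n′ = transpose-≢ n n′

    transpose-injective : (s s′ : A) {x y : A} → transpose s s′ x ≡ transpose s s′ y → x ≡ y
    transpose-injective s s′ {x} {y} eq = trans (sym (transpose-involutive s s′ x))
      (trans (cong (transpose s s′) eq) (transpose-involutive s s′ y))

    transpose-closed : {P : A → Set} {s s′ : A} → P s → P s′ → ∀ {x} → P x → P (transpose s s′ x)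
    transpose-closed {s = s} {s′} p p′ {x} q with transpose s s′ x | transposeView s s′ x
    ... | _ | left = p′
    ... | _ | right = p
    ... | _ | fixed _ _ = q

  -- Matrices with exchangeable rows and exchangeable columns

  module Matrix where

    open Base

    module _ {A B C : Set} (R : A → Set) (S : B → Set) (colour : A → B → C) where

      -- `σ` is the effect on the columns of an automorphism that exchanges the rows `r` and `r′`;
      -- it is known only to map `S` onto itself. Surjectivity allows a column to be pulled back
      -- when rows are moved.
      RowSwaps : Set
      RowSwaps = ∀ r r′ → R r → R r′ → Σ[ σ ∈ (B → B) ]
        ((∀ {t} → S t → S (σ t)) × (∀ {t} → S t → ∃[ t′ ] (S t′ × σ t′ ≡ t)) ×
         (∀ {u t} → R u → S t → colour (transpose r r′ u) (σ t) ≡ colour u t))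

      ColumnSwaps : Set
      ColumnSwaps = ∀ s s′ → S s → S s′ → Σ[ ρ ∈ (A → A) ]
        ((∀ {r} → R r → R (ρ r)) × (∀ {r t} → R r → S t → colour (ρ r) (transpose s s′ t) ≡ colour r t))

      Constant : Set
      Constant = ∀ {r r′ s s′} → R r → R r′ → S s → S s′ → colour r s ≡ colour r′ s′

      record Matching : Set where
        field
          on off     : C
          on≢off     : on ≢ off
          θ          : A → B
          θ∈S        : ∀ {r} → R r → S (θ r)
          θ-inj      : ∀ {r r′} → R r → R r′ → θ r ≡ θ r′ → r ≡ r′
          θ-surj     : ∀ {s} → S s → ∃[ r ] (R r × θ r ≡ s)
          colour-on  : ∀ {r} → R r → colour r (θ r) ≡ on
          colour-off : ∀ {r s} → R r → S s → s ≢ θ r → colour r s ≡ off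

      module NonConstant (rowSwaps : RowSwaps) (columnSwaps : ColumnSwaps)
        {r₀ s₀ s₁} (r₀∈R : R r₀) (s₀∈S : S s₀) (s₁∈S : S s₁) (c₀≢c₁ : colour r₀ s₀ ≢ colour r₀ s₁) where

        -- The row `ρ r` supplied by a column exchange does it. Hence the rows, as functions of the
        -- columns, are closed under all permutations of the columns.
        permuted : ∀ {s s′} → S s → S s′ → ∀ {r} → R r →
                   ∃[ r′ ] (R r′ × (∀ {t} → S t → colour r′ t ≡ colour r (transpose s s′ t)))
        permuted {s} {s′} p p′ {r} q with columnSwaps s s′ p p′
        ... | ρ , ρ∈R , eq = ρ r , ρ∈R q , λ {t} tS →
          trans (cong (colour (ρ r)) (sym (transpose-involutive s s′ t))) (eq q (transpose-closed {P = S} p p′ tS))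

        Differ : A → A → B → Set
        Differ u v t = S t × colour u t ≢ colour v t

        -- A row that differs from `r₀` in exactly the two columns `s₀` and `s₁`. By `move` any two
        -- distinct rows then differ in exactly two columns.
        r₁ : A
        r₁ = proj₁ (permuted s₀∈S s₁∈S r₀∈R)
        r₁∈R : R r₁
        r₁∈R = proj₁ (proj₂ (permuted s₀∈S s₁∈S r₀∈R))
        r₁-colour : ∀ {t} → S t → colour r₁ t ≡ colour r₀ (transpose s₀ s₁ t)
        r₁-colour = proj₂ (proj₂ (permuted s₀∈S s₁∈S r₀∈R))
        differ-s₀ : Differ r₀ r₁ s₀
        differ-s₀ = s₀∈S , λ eq → c₀≢c₁ (trans eq (trans (r₁-colour s₀∈S) (cong (colour r₀) (transpose-ˡ s₀ s₁))))
        r₀≢r₁ : r₀ ≢ r₁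
        r₀≢r₁ eq = proj₂ differ-s₀ (cong (λ z → colour z s₀) eq)
        differ-only : ∀ {t} → Differ r₀ r₁ t → t ≡ s₀ ⊎ t ≡ s₁
        differ-only {t} (tS , d) with t ≟ s₀ | t ≟ s₁
        ... | yes eq | _ = inj₁ eq
        ... | no _ | yes eq = inj₂ eq
        ... | no n | no n′ = contradiction (sym (trans (r₁-colour tS) (cong (colour r₀) (transpose-≢ n n′)))) d

        -- Transpositions of rows act 2-transitively: after exchanging `a` and `u`, the image `b′`
        -- of `b` is different from `u`, so exchanging `b′` and `v` leaves `u` in place.
        move : ∀ {a b u v} → R a → R b → R u → R v → a ≢ b → u ≢ v → Σ[ σ ∈ (B → B) ]
          ((∀ {t} → S t → S (σ t)) × (∀ {t} → S t → ∃[ t′ ] (S t′ × σ t′ ≡ t)) ×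
           (∀ {t} → S t → colour u (σ t) ≡ colour a t) × (∀ {t} → S t → colour v (σ t) ≡ colour b t))
        move {a} {b} {u} {v} a∈ b∈ u∈ v∈ a≢b u≢v with rowSwaps a u a∈ u∈
        ... | σ₁ , σ₁∈ , σ₁s , e₁ with rowSwaps (transpose a u b) v (transpose-closed {P = R} a∈ u∈ b∈) v∈
        ... | σ₂ , σ₂∈ , σ₂s , e₂ = (λ t → σ₂ (σ₁ t)) , (λ p → σ₂∈ (σ₁∈ p)) ,
          (λ p → let (t′ , p′ , eq′) = σ₂s p ; (t″ , p″ , eq″) = σ₁s p′ in t″ , p″ , trans (cong σ₂ eq″) eq′) ,
          (λ {t} p → trans (cong (λ z → colour z (σ₂ (σ₁ t))) (sym u-fixed)) (trans (e₂ u∈ (σ₁∈ p))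
             (trans (cong (λ z → colour z (σ₁ t)) (sym (transpose-ˡ a u))) (e₁ a∈ p)))) ,
          (λ {t} p → trans (cong (λ z → colour z (σ₂ (σ₁ t))) (sym (transpose-ˡ b′ v)))
             (trans (e₂ (transpose-closed {P = R} a∈ u∈ b∈) (σ₁∈ p)) (e₁ b∈ p)))
          where
          b′ = transpose a u b
          u-fixed : transpose b′ v u ≡ u
          u-fixed = transpose-≢ (λ eq → a≢b (transpose-injective a u (trans (transpose-ˡ a u) eq))) u≢v

        -- By `move` the pair `u`, `v` can be carried to `r₀`, `r₁`, and the column that goes to
        -- `s₀` separates it.
        differ-somewhere : ∀ {u v} → R u → R v → u ≢ v → ∃[ t ] Differ u v t
        differ-somewhere u∈ v∈ u≢v with move u∈ v∈ r₀∈R r₁∈R u≢v r₀≢r₁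
        ... | σ , _ , σs , e , e′ with σs s₀∈S
        ... | t , tS , refl = t , tS , λ eq → proj₂ differ-s₀ (trans (e tS) (trans eq (sym (e′ tS))))

        no-three-differ : ∀ {u v t₁ t₂ t₃} → R u → R v → t₁ ≢ t₂ → t₁ ≢ t₃ → t₂ ≢ t₃ →
                          Differ u v t₁ → Differ u v t₂ → Differ u v t₃ → ⊥
        no-three-differ {u} {v} u∈ v∈ n₁₂ n₁₃ n₂₃ d₁ d₂ d₃
          with move r₀∈R r₁∈R u∈ v∈ r₀≢r₁ (λ { refl → proj₂ d₁ refl })
        ... | σ , _ , σs , e , e′ with σs (proj₁ d₁) | σs (proj₁ d₂) | σs (proj₁ d₃)
        ... | t₁′ , p₁ , refl | t₂′ , p₂ , refl | t₃′ , p₃ , refl =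
          two-values (differ-only (pull p₁ d₁)) (differ-only (pull p₂ d₂)) (differ-only (pull p₃ d₃))
          where
          pull : ∀ {t} → S t → Differ u v (σ t) → Differ r₀ r₁ t
          pull p (_ , d) = p , λ eq → d (trans (e p) (trans eq (sym (e′ p))))
          two-values : t₁′ ≡ s₀ ⊎ t₁′ ≡ s₁ → t₂′ ≡ s₀ ⊎ t₂′ ≡ s₁ → t₃′ ≡ s₀ ⊎ t₃′ ≡ s₁ → ⊥
          two-values (inj₁ refl) (inj₁ refl) _ = n₁₂ refl
          two-values (inj₂ refl) (inj₂ refl) _ = n₁₂ refl
          two-values (inj₁ refl) (inj₂ refl) (inj₁ refl) = n₁₃ refl
          two-values (inj₁ refl) (inj₂ refl) (inj₂ refl) = n₂₃ refl
          two-values (inj₂ refl) (inj₁ refl) (inj₁ refl) = n₂₃ refl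
          two-values (inj₂ refl) (inj₁ refl) (inj₂ refl) = n₁₃ refl

        -- A 3-cycle of columns would change the row r₀ in three places.
        no-three-colours : ∀ {t₁ t₂ t₃} → S t₁ → S t₂ → S t₃ → colour r₀ t₁ ≢ colour r₀ t₂ →
                           colour r₀ t₁ ≢ colour r₀ t₃ → colour r₀ t₂ ≢ colour r₀ t₃ → ⊥
        no-three-colours {t₁} {t₂} {t₃} p₁ p₂ p₃ n₁₂ n₁₃ n₂₃
          with permuted p₂ p₃ r₀∈R
        ... | u , u∈ , eu with permuted p₁ p₂ u∈
        ... | v , v∈ , ev = no-three-differ r₀∈R v∈ (λ { refl → n₁₂ refl }) (λ { refl → n₁₃ refl }) (λ { refl → n₂₃ refl })
          (p₁ , λ eq → n₁₃ (trans eq (trans (ev p₁) (trans (cong (colour u) (transpose-ˡ t₁ t₂))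
                 (trans (eu p₂) (cong (colour r₀) (transpose-ˡ t₂ t₃)))))))
          (p₂ , λ eq → n₁₂ (sym (trans eq (trans (ev p₂) (trans (cong (colour u) (transpose-ʳ t₁ t₂))
                 (trans (eu p₁) (cong (colour r₀) (transpose-≢ (λ { refl → n₁₂ refl }) (λ { refl → n₁₃ refl })))))))))
          (p₃ , λ eq → n₂₃ (sym (trans eq (trans (ev p₃) (trans (cong (colour u) (transpose-≢ (λ { refl → n₁₃ refl }) (λ { refl → n₂₃ refl })))
                 (trans (eu p₃) (cong (colour r₀) (transpose-ʳ t₂ t₃))))))))

        -- A double transposition of columns would change the row r₀ in four places.
        no-two-pairs : ∀ {t₁ t₂ t₃ t₄} → S t₁ → S t₂ → S t₃ → S t₄ → t₁ ≢ t₂ → t₃ ≢ t₄ →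
                       colour r₀ t₁ ≡ colour r₀ t₂ → colour r₀ t₃ ≡ colour r₀ t₄ → colour r₀ t₁ ≢ colour r₀ t₃ → ⊥
        no-two-pairs {t₁} {t₂} {t₃} {t₄} p₁ p₂ p₃ p₄ n₁₂ n₃₄ e₁₂ e₃₄ n₁₃
          with permuted p₁ p₃ r₀∈R
        ... | u , u∈ , eu with permuted p₂ p₄ u∈
        ... | v , v∈ , ev = no-three-differ r₀∈R v∈ n₁₂ (λ { refl → n₁₃ refl }) (λ { refl → n₁₃ e₁₂ })
          (p₁ , λ eq → n₁₃ (trans eq (trans (ev p₁) (trans (cong (colour u) (transpose-≢ n₁₂ (λ { refl → n₁₃ (sym e₃₄) })))
                 (trans (eu p₁) (cong (colour r₀) (transpose-ˡ t₁ t₃)))))))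
          (p₂ , λ eq → n₁₃ (trans e₁₂ (trans eq (trans (ev p₂) (trans (cong (colour u) (transpose-ˡ t₂ t₄))
                 (trans (eu p₄) (trans (cong (colour r₀) (transpose-≢ (λ { refl → n₁₃ (sym e₃₄) }) (λ eq → n₃₄ (sym eq)))) (sym e₃₄))))))))
          (p₃ , λ eq → n₁₃ (sym (trans eq (trans (ev p₃) (trans (cong (colour u) (transpose-≢ (λ { refl → n₁₃ e₁₂ }) n₃₄))
                 (trans (eu p₃) (cong (colour r₀) (transpose-ʳ t₁ t₃))))))))

        Special : B → Set
        Special s = S s × ∃[ off ] (colour r₀ s ≢ off × (∀ {t} → S t → t ≢ s → colour r₀ t ≡ off))

        -- If neither `s₀` nor `s₁` is exceptional, each has a rival column. As there are no three
        -- colours, the rivals repeat the colours of `s₀` and `s₁`, and these are two pairs, which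
        -- is excluded as well.
        special : ∃[ s ] Special s
        special with dec (∃[ t ] (S t × t ≢ s₀ × colour r₀ t ≢ colour r₀ s₁))
                   | dec (∃[ t ] (S t × t ≢ s₁ × colour r₀ t ≢ colour r₀ s₀))
        ... | no none | _ = s₀ , s₀∈S , colour r₀ s₁ , c₀≢c₁ , λ {t} p n → dne λ d → none (t , p , n , d)
        ... | yes _ | no none = s₁ , s₁∈S , colour r₀ s₀ , (λ eq → c₀≢c₁ (sym eq)) , λ {t} p n → dne λ d → none (t , p , n , d)
        ... | yes (t , p , n , d) | yes (t′ , p′ , n′ , d′) with colour r₀ t ≟ colour r₀ s₀ | colour r₀ t′ ≟ colour r₀ s₁
        ... | no e | _ = ⊥-elim (no-three-colours s₀∈S s₁∈S p c₀≢c₁ (λ eq → e (sym eq)) (λ eq → d (sym eq)))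
        ... | yes _ | no e = ⊥-elim (no-three-colours s₀∈S s₁∈S p′ c₀≢c₁ (λ eq → d′ (sym eq)) (λ eq → e (sym eq)))
        ... | yes e | yes e′ = ⊥-elim (no-two-pairs s₀∈S p s₁∈S p′ (λ eq → n (sym eq)) (λ eq → n′ (sym eq)) (sym e) (sym e′) c₀≢c₁)

        s* : B
        s* = proj₁ special
        s*∈S : S s*
        s*∈S = proj₁ (proj₂ special)
        on off : C
        on = colour r₀ s*
        off = proj₁ (proj₂ (proj₂ special))
        on≢off : on ≢ off
        on≢off = proj₁ (proj₂ (proj₂ (proj₂ special)))
        r₀-off : ∀ {t} → S t → t ≢ s* → colour r₀ t ≡ off
        r₀-off = proj₂ (proj₂ (proj₂ (proj₂ special)))

        on-column : ∀ u → R u → ∃[ s ] (S s × colour u s ≡ on × (∀ {t} → S t → t ≢ s → colour u t ≡ off))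
        on-column u u∈ with u ≟ r₀
        ... | yes refl = s* , s*∈S , refl , r₀-off
        -- `move` needs a second target row; only the image of `r₀` matters, and `r₀` itself serves
        -- as a row other than `u`.
        ... | no u≢r₀ with move r₀∈R r₁∈R u∈ r₀∈R r₀≢r₁ u≢r₀
        ... | σ , σ∈ , σs , e , _ = σ s* , σ∈ s*∈S , e s*∈S , rest
          where
          rest : ∀ {t} → S t → t ≢ σ s* → colour u t ≡ off
          rest tS n with σs tS
          ... | t′ , p′ , refl = trans (e p′) (r₀-off p′ (λ eq → n (cong σ eq)))

        θ-choice : Σ[ θ ∈ (A → B) ] (∀ u → R u → S (θ u) × colour u (θ u) ≡ on × (∀ {t} → S t → t ≢ θ u → colour u t ≡ off))
        θ-choice = choose on-column s₀

        matching : Matching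
        matching = record
          { on = on ; off = off ; on≢off = on≢off ; θ = θ
          ; θ∈S = λ p → proj₁ (θ-spec _ p)
          ; θ-inj = inj
          ; θ-surj = surj
          ; colour-on = λ p → proj₁ (proj₂ (θ-spec _ p))
          ; colour-off = λ p → proj₂ (proj₂ (θ-spec _ p))
          }
          where
          θ = proj₁ θ-choice
          θ-spec = proj₂ θ-choice
          inj : ∀ {r r′} → R r → R r′ → θ r ≡ θ r′ → r ≡ r′
          inj {r} {r′} p p′ eq = dne λ n → let (t , tS , d) = differ-somewhere p p′ n in d (same t tS)
            where
            same : ∀ t → S t → colour r t ≡ colour r′ t
            same t tS with t ≟ θ r
            ... | yes refl = trans (proj₁ (proj₂ (θ-spec r p))) (sym (trans (cong (colour r′) eq) (proj₁ (proj₂ (θ-spec r′ p′)))))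
            ... | no n = trans (proj₂ (proj₂ (θ-spec r p)) tS n)
                           (sym (proj₂ (proj₂ (θ-spec r′ p′)) tS (λ e → n (trans e (sym eq)))))
          surj : ∀ {s} → S s → ∃[ r ] (R r × θ r ≡ s)
          -- Exchanging the columns `s*` and `s` in `r₀` gives a row whose exceptional entry is in
          -- column `s`.
          surj {s} sS with permuted s*∈S sS r₀∈R
          ... | r , r∈ , er = r , r∈ , dne λ n → on≢off (trans
                (sym (trans (er sS) (cong (colour r₀) (transpose-ʳ s* s))))
                (proj₂ (proj₂ (θ-spec r r∈)) sS (λ eq → n (sym eq))))

      abstract
        matrix : RowSwaps → ColumnSwaps → Constant ⊎ Matching
        matrix rowSwaps columnSwaps
          with dec (∃[ r ] ∃[ s ] ∃[ s′ ] (R r × S s × S s′ × colour r s ≢ colour r s′))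
        ... | yes (r , s , s′ , p , q , q′ , d) = inj₂ (NonConstant.matching rowSwaps columnSwaps p q q′ d)
        ... | no none = inj₁ constant
          where
          row-constant : ∀ {r s s′} → R r → S s → S s′ → colour r s ≡ colour r s′
          row-constant p q q′ = dne λ d → none (_ , _ , _ , p , q , q′ , d)
          constant : Constant
          -- Each row is constant, and exchanging two rows shows that their constants agree.
          constant {r} {r′} {s} {s′} p p′ q q′ with rowSwaps r r′ p p′
          ... | σ , σ∈ , _ , e = trans (sym (trans (cong (λ z → colour z (σ s)) (sym (transpose-ˡ r r′))) (e p q)))
                                       (row-constant p′ (σ∈ q) q′)

  -- Homogeneity and the exchange of leaves

  module Homogeneous where

    open Base
    open Matrix

    infixl 5 _▻_
    -- Steps are added at the far end, so that induction follows a walk away from its fixed start.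
    data Reach {I : Set} (T : I → I → Set) (i₀ : I) : I → Set where
      here : Reach T i₀ i₀
      _▻_  : ∀ {i j} → Reach T i₀ i → T i j → Reach T i₀ j

    reach-map : {I J : Set} {T : I → I → Set} {U : J → J → Set} (f : I → J) →
                (∀ {i j} → T i j → U (f i) (f j)) → ∀ {i₀ i} → Reach T i₀ i → Reach U (f i₀) (f i)
    reach-map f g here    = here
    reach-map f g (r ▻ t) = reach-map f g r ▻ g t

    reach-crossing : {I : Set} {T : I → I → Set} (P : I → Set) {i j : I} → Reach T i j → ¬ P i → P j →
                     ∃[ a ] ∃[ b ] (T a b × ¬ P a × P b)
    reach-crossing P here n p = contradiction p n
    reach-crossing P (_▻_ {i = a} {b} r t) n p with dec (P a)
    ... | yes q = reach-crossing P r n q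
    ... | no n′ = a , b , t , n′ , p

    -- κ is constant for digraphs and the bipartition for bipartite graphs.
    record Aut {V K : Set} (κ : V → K) (_⟶_ : V → V → Set) : Set where
      field
        to from   : V → V
        to∘from   : ∀ v → to (from v) ≡ v
        from∘to   : ∀ v → from (to v) ≡ v
        to-κ      : ∀ v → κ (to v) ≡ κ v
        to-arc    : ∀ {u v} → u ⟶ v → to u ⟶ to v
        to-arc⁻   : ∀ {u v} → to u ⟶ to v → u ⟶ v

      to-inj : ∀ {u v} → to u ≡ to v → u ≡ v
      to-inj {u} {v} eq = trans (sym (from∘to u)) (trans (cong from eq) (from∘to v))

    open Aut

    inverse : ∀ {V K : Set} {κ : V → K} {_⟶_ : V → V → Set} → Aut κ _⟶_ → Aut κ _⟶_
    inverse {κ = κ} {_⟶_} α = record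
      { to = from α ; from = to α ; to∘from = from∘to α ; from∘to = to∘from α
      ; to-κ = λ v → trans (sym (to-κ α (from α v))) (cong κ (to∘from α v))
      ; to-arc = λ {u} {v} a → to-arc⁻ α (subst₂ _⟶_ (sym (to∘from α u)) (sym (to∘from α v)) a)
      ; to-arc⁻ = λ {u} {v} a → subst₂ _⟶_ (to∘from α u) (to∘from α v) (to-arc α a)
      }

    opAut : ∀ {V K : Set} {κ : V → K} {_⟶_ : V → V → Set} → Aut κ _⟶_ → Aut κ (flip _⟶_)
    opAut α = record
      { to = to α ; from = from α ; to∘from = to∘from α ; from∘to = from∘to α ; to-κ = to-κ α
      ; to-arc = to-arc α ; to-arc⁻ = to-arc⁻ α }

    -- A partial isomorphism is a pair of families over one finite index type. Indices may repeat
    -- points; the conditions on equality and arcs make `x i ↦ y i` a well-defined isomorphism of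
    -- induced subdigraphs. Connectedness is asked of `x` alone, since it carries over to `y`.
    Homogeneity : {V K : Set} (κ : V → K) (_⟶_ : V → V → Set) → Set₁
    Homogeneity {V} κ _⟶_ = {I : Set} (x y : I → V) → Listing {I} (λ _ → ⊤) →
      (i₀ : I) → (∀ i → Reach (λ i j → x i ⟶ x j ⊎ x j ⟶ x i) i₀ i) →
      (∀ i → κ (x i) ≡ κ (y i)) →
      (∀ i j → x i ≡ x j → y i ≡ y j) → (∀ i j → y i ≡ y j → x i ≡ x j) →
      (∀ i j → x i ⟶ x j → y i ⟶ y j) → (∀ i j → y i ⟶ y j → x i ⟶ x j) →
      Σ[ α ∈ Aut κ _⟶_ ] (∀ i → to α (x i) ≡ y i)

    record HomogeneousDigraph : Set₁ where
      infix 4 _⟶_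
      field
        V K         : Set
        κ           : V → K
        _⟶_         : V → V → Set
        asym        : ∀ {u v} → u ⟶ v → ¬ (v ⟶ u)
        out-listing : ∀ v → Listing (v ⟶_)
        in-listing  : ∀ v → Listing (_⟶ v)
        homogeneous : Homogeneity κ _⟶_

      Adj : V → V → Set
      Adj u v = u ⟶ v ⊎ v ⟶ u

      Automorphism : Set
      Automorphism = Aut κ _⟶_

      irrefl : ∀ {v} → ¬ (v ⟶ v)
      irrefl a = asym a a

      Fixes : Automorphism → (V → Set) → Set
      Fixes α Q = ∀ {u} → Q u → to α u ≡ u

      fixes-inverse : ∀ {α Q} → Fixes α Q → Fixes (inverse α) Q
      fixes-inverse {α} fix q = trans (cong (from α) (sym (fix q))) (from∘to α _)

      record Core (Q : V → Set) : Set where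
        field
          listing : Listing Q
          root    : V
          root∈Q  : Q root
          reach   : ∀ {u} → Q u → Reach (λ u v → Q v × Adj u v) root u

      -- S is a set of leaves of the induced subdigraph on Q ∪ S, all hanging in the same way from the vertex stem of Q.
      record Leaves (Q S : V → Set) : Set where
        field
          listing     : Listing S
          disjoint    : ∀ {s} → S s → ¬ Q s
          colour      : ∀ {s s′} → S s → S s′ → κ s ≡ κ s′
          stem        : V
          stem∈Q      : Q stem
          attached    : (∀ {s} → S s → stem ⟶ s) ⊎ (∀ {s} → S s → s ⟶ stem)
          independent : ∀ {s s′} → S s → S s′ → ¬ (s ⟶ s′)
          free        : ∀ {s u} → S s → Q u → u ≢ stem → ¬ Adj s u

      -- Independent leaves with a common stem are twins in the subdigraph induced on `Q` and `S`,
      -- so transposing two of them is an automorphism of that subdigraph, and homogeneity extends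
      -- it.
      swapLeaves-construction : ∀ {Q S} → Core Q → Leaves Q S → ∀ {s s′} → S s → S s′ →
        Σ[ α ∈ Automorphism ] (Fixes α Q × (∀ {u} → S u → to α u ≡ transpose s s′ u))
      swapLeaves-construction {Q} {S} core leaves {s} {s′} s∈S s′∈S =
        let (α , eq) = homogeneous {I} value y listing-I root′ reach′ y-κ
                         (λ i j → cong (transpose s s′)) (λ i j → transpose-injective s s′) fwd-arc bwd-arc
        in α , (λ {u} q → trans (eq (u , [ inj₁ q ])) (fixed-Q q)) , (λ {u} p → eq (u , [ inj₂ p ]))
        where
        open Leaves leaves
        module Q = Core core
        P : V → Set
        P u = Q u ⊎ S u
        I = [ u ∈ V ∣ P u ]
        y : I → V
        y i = transpose s s′ (value i)
        fixed-Q : ∀ {u} → Q u → transpose s s′ u ≡ u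
        fixed-Q q = transpose-≢ (λ { refl → disjoint s∈S q }) (λ { refl → disjoint s′∈S q })
        listing-I : Listing {I} (λ _ → ⊤)
        listing-I = let (n , b) = listing⇒finite (listing-∪ Q.listing listing)
                        (xs , c) = listing-Fin (Inverse.from b)
                    in xs , λ {i} _ → c (Inverse.to b i , Inverse.strictlyInverseʳ b i)
        root′ : I
        root′ = Q.root , [ inj₁ Q.root∈Q ]
        AdjI : I → I → Set
        AdjI i j = Adj (value i) (value j)
        reach-Q : ∀ {u} → Reach (λ u v → Q v × Adj u v) Q.root u → .(p : P u) → Reach AdjI root′ (u , [ p ])
        reach-Q here _ = here
        reach-Q (r ▻ (q , a)) _ = extend r a
          where
          extend : ∀ {u v} .{p : P v} → Reach (λ u v → Q v × Adj u v) Q.root u → Adj u v → Reach AdjI root′ (v , [ p ])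
          extend here a = here ▻ a
          extend (r ▻ (q , b)) a = reach-Q (r ▻ (q , b)) (inj₁ q) ▻ a
        stem-adj : ∀ {u} → S u → Adj stem u
        stem-adj p with attached
        ... | inj₁ out = inj₁ (out p)
        ... | inj₂ inn = inj₂ (inn p)
        reach′ : ∀ i → Reach AdjI root′ i
        reach′ i@(u , [ p ]) with recover p
        ... | inj₁ q = reach-Q (Q.reach q) p
        ... | inj₂ q = reach-Q (Q.reach stem∈Q) (inj₁ stem∈Q) ▻ stem-adj q
        y-κ : ∀ i → κ (value i) ≡ κ (y i)
        y-κ (u , _) with transpose s s′ u | transposeView s s′ u
        ... | _ | left = colour s∈S s′∈S
        ... | _ | right = colour s′∈S s∈S
        ... | _ | fixed _ _ = refl
        twins-out : ∀ {a b u} → S a → S b → P u → a ⟶ u → b ⟶ u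
        twins-out a∈ b∈ (inj₂ u∈) e = ⊥-elim (independent a∈ u∈ e)
        twins-out {u = u} a∈ b∈ (inj₁ q) e with u ≟ stem
        ... | no n = ⊥-elim (free a∈ q n (inj₁ e))
        ... | yes refl with attached
        ...   | inj₁ out = ⊥-elim (asym e (out a∈))
        ...   | inj₂ inn = inn b∈
        twins-in : ∀ {a b u} → S a → S b → P u → u ⟶ a → u ⟶ b
        twins-in a∈ b∈ (inj₂ u∈) e = ⊥-elim (independent u∈ a∈ e)
        twins-in {u = u} a∈ b∈ (inj₁ q) e with u ≟ stem
        ... | no n = ⊥-elim (free a∈ q n (inj₂ e))
        ... | yes refl with attached
        ...   | inj₁ out = out b∈
        ...   | inj₂ inn = ⊥-elim (asym e (inn a∈))
        arc : ∀ {u v} → P u → P v → u ⟶ v → transpose s s′ u ⟶ transpose s s′ v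
        arc {u} {v} p q e with transpose s s′ u | transposeView s s′ u | transpose s s′ v | transposeView s s′ v
        ... | _ | left | _ | left = ⊥-elim (irrefl e)
        ... | _ | left | _ | right = ⊥-elim (independent s∈S s′∈S e)
        ... | _ | left | _ | fixed _ _ = twins-out s∈S s′∈S q e
        ... | _ | right | _ | left = ⊥-elim (independent s′∈S s∈S e)
        ... | _ | right | _ | right = ⊥-elim (irrefl e)
        ... | _ | right | _ | fixed _ _ = twins-out s′∈S s∈S q e
        ... | _ | fixed _ _ | _ | left = twins-in s∈S s′∈S p e
        ... | _ | fixed _ _ | _ | right = twins-in s′∈S s∈S p e
        ... | _ | fixed _ _ | _ | fixed _ _ = e
        P-closed : ∀ {u} → P u → P (transpose s s′ u)
        P-closed = transpose-closed {P = P} (inj₂ s∈S) (inj₂ s′∈S)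
        fwd-arc : ∀ i j → value i ⟶ value j → y i ⟶ y j
        fwd-arc i j = arc (proofOf i) (proofOf j)
        bwd-arc : ∀ i j → y i ⟶ y j → value i ⟶ value j
        bwd-arc i j e = subst₂ _⟶_ (transpose-involutive s s′ (value i)) (transpose-involutive s s′ (value j))
          (arc (P-closed (proofOf i)) (P-closed (proofOf j)) e)

      abstract
        swapLeaves : ∀ {Q S} → Core Q → Leaves Q S → ∀ {s s′} → S s → S s′ →
          Σ[ α ∈ Automorphism ] (Fixes α Q × (∀ {u} → S u → to α u ≡ transpose s s′ u))
        swapLeaves = swapLeaves-construction

      abstract
        -- An automorphism that fixes `Q` and transposes two row leaves permutes the column leaves
        -- and keeps all colours, so it acts on the columns as the `σ` wanted in `RowSwaps`.
        -- Invariance under the inverse automorphism makes this action onto.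
        leafMatrix : ∀ {Q R S} {C : Set} {colour : V → V → C} → Core Q → Leaves Q R → Leaves Q S →
          (∀ {α} → Fixes α Q → ∀ {u} → R u → R (to α u)) →
          (∀ {α} → Fixes α Q → ∀ {u} → S u → S (to α u)) →
          (∀ {α} → Fixes α Q → ∀ {u v} → colour (to α u) (to α v) ≡ colour u v) →
          Constant R S colour ⊎ Matching R S colour
        leafMatrix {Q} {R} {S} {colour = colour} core lr ls R-inv S-inv c-inv = matrix R S colour rows columns
          where
          rows : RowSwaps R S colour
          rows r r′ p p′ with swapLeaves core lr p p′
          ... | α , fix , sw = to α , S-inv {α} fix , (λ {t} tS → from α t , S-inv {inverse α} (fixes-inverse {α} fix) tS , to∘from α t) ,
            λ {u} {t} pu pt → trans (cong (λ z → colour z (to α t)) (sym (sw pu))) (c-inv {α} fix)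
          columns : ColumnSwaps R S colour
          columns s s′ q q′ with swapLeaves core ls q q′
          ... | α , fix , sw = to α , R-inv {α} fix ,
            λ {r} {t} pr pt → trans (cong (colour (to α r)) (sym (sw pt))) (c-inv {α} fix)

      Core-edge : ∀ {a b} → Adj a b → Core (λ u → u ≡ a ⊎ u ≡ b)
      Core-edge {a} {b} e = record
        { listing = listing-∪ (listing-≡ a) (listing-≡ b) ; root = a ; root∈Q = inj₁ refl
        ; reach = λ { (inj₁ refl) → here ; (inj₂ refl) → here ▻ (inj₂ refl , e) } }

      Core-point : ∀ a → Core (_≡ a)
      Core-point a = record { listing = listing-≡ a ; root = a ; root∈Q = refl ; reach = λ { refl → here } }

      Core-extend : ∀ {Q S} → Core Q → Leaves Q S → Core (λ u → Q u ⊎ S u)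
      Core-extend {Q} {S} core leaves = record
        { listing = listing-∪ Q.listing L.listing ; root = Q.root ; root∈Q = inj₁ Q.root∈Q
        ; reach = λ { (inj₁ q) → lift (Q.reach q) ; (inj₂ s) → lift (Q.reach L.stem∈Q) ▻ (inj₂ s , adj L.attached s) } }
        where
        module Q = Core core
        module L = Leaves leaves
        lift : ∀ {u} → Reach (λ u v → Q v × Adj u v) Q.root u → Reach (λ u v → (Q v ⊎ S v) × Adj u v) Q.root u
        lift = reach-map (λ u → u) (λ { (q , a) → inj₁ q , a })
        adj : (∀ {s} → S s → L.stem ⟶ s) ⊎ (∀ {s} → S s → s ⟶ L.stem) → ∀ {u} → S u → Adj L.stem u
        adj (inj₁ out) s = inj₁ (out s)
        adj (inj₂ inn) s = inj₂ (inn s)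

    opHD : HomogeneousDigraph → HomogeneousDigraph
    opHD C = record
      { V = V ; K = K ; κ = κ ; _⟶_ = flip _⟶_ ; asym = asym
      ; out-listing = in-listing ; in-listing = out-listing
      ; homogeneous = λ x y l i₀ r k e e′ a a′ →
          let (α , eq) = homogeneous x y l i₀ (λ i → reach-map (λ i → i) swap (r i)) k e e′ (λ i j → a j i) (λ i j → a′ j i)
          in opAut α , eq }
      where open HomogeneousDigraph C

  -- Directed arcs, transitivity and diamonds

  module Arcs where

    open import Data.Fin.Properties using (toℕ<n; toℕ-fromℕ<; fromℕ<-toℕ)
    open import Data.List.Base using (allFin)
    open import Data.List.Membership.Propositional.Properties using (∈-allFin)
    open import Data.List.Relation.Unary.Any using (here)
    open import Data.Nat.Properties using (≤-trans; <⇒≤; suc-injective; ≤-pred; n≤1+n; _≤?_; 1+n≰n; m≤n⇒m<n∨m≡n)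
    open import Relation.Nullary.Decidable.Core using (does)
    open Base
    open Matrix
    open Homogeneous
    open Aut

    record TriangleFreeCHD : Set₁ where
      field
        homogeneousDigraph : HomogeneousDigraph
      open HomogeneousDigraph homogeneousDigraph public
      field
        κ-const      : ∀ u v → κ u ≡ κ v
        triangleFree : ∀ {x y z} → Adj x y → Adj y z → ¬ Adj x z
        connected    : ∀ u v → Reach Adj u v
        infinite     : ∀ (xs : List V) → ∃[ v ] v ∉ xs
        base         : V

    op : TriangleFreeCHD → TriangleFreeCHD
    op C = record
      { homogeneousDigraph = opHD homogeneousDigraph
      ; κ-const = κ-const
      ; triangleFree = λ a b c → triangleFree (swap a) (swap b) (swap c)
      ; connected = λ u v → reach-map (λ u → u) swap (connected u v)
      ; infinite = infinite ; base = base }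
      where open TriangleFreeCHD C

    does-≡ : {P Q : Set} → (P → Q) → (Q → P) → does (dec P) ≡ does (dec Q)
    does-≡ {P} {Q} f g with dec P | dec Q
    ... | yes _ | yes _ = refl
    ... | no _  | no _  = refl
    ... | yes p | no ¬q = contradiction (f p) ¬q
    ... | no ¬p | yes q = contradiction (g q) ¬p

    does-true : {P : Set} → P → does (dec P) ≡ true
    does-true {P} p with dec P
    ... | yes _ = refl
    ... | no ¬p = contradiction p ¬p

    true-does : {P : Set} → does (dec P) ≡ true → P
    true-does {P} eq with dec P
    true-does eq | yes p = p

    module ArcSequences {V : Set} (_⟶_ : V → V → Set) where

      -- A k-arc is an infinite sequence of which only the entries up to `k` are meaningful.
      -- Truncating and shifting then need no casts between index types.
      Arc : ℕ → (ℕ → V) → Set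
      Arc k x = ∀ i → i < k → x i ⟶ x (suc i)

      Induced : ℕ → (ℕ → V) → Set
      Induced k x = ∀ i j → i ≤ k → j ≤ k → x i ⟶ x j → j ≡ suc i

      cons : V → (ℕ → V) → ℕ → V
      cons v x zero    = v
      cons v x (suc i) = x i

      arc-cons : ∀ {k v x} → v ⟶ x 0 → Arc k x → Arc (suc k) (cons v x)
      arc-cons a ax zero _ = a
      arc-cons a ax (suc i) (s≤s i<k) = ax i i<k

      snoc : (ℕ → V) → ℕ → V → ℕ → V
      snoc x k v i with i ≤? k
      ... | yes _ = x i
      ... | no _  = v

      snoc-≤ : ∀ {x k v i} → i ≤ k → snoc x k v i ≡ x i
      snoc-≤ {k = k} {i = i} i≤k with i ≤? k
      ... | yes _ = refl
      ... | no n  = contradiction i≤k n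

      snoc-> : ∀ {x v} k → snoc x k v (suc k) ≡ v
      snoc-> k with suc k ≤? k
      ... | yes p = contradiction p 1+n≰n
      ... | no _  = refl

      arc-snoc : ∀ {x k v} → Arc k x → x k ⟶ v → Arc (suc k) (snoc x k v)
      arc-snoc {x} {k} {v} ax a i (s≤s i≤k) with m≤n⇒m<n∨m≡n i≤k
      ... | inj₁ i<k = subst₂ _⟶_ (sym (snoc-≤ i≤k)) (sym (snoc-≤ i<k)) (ax i i<k)
      ... | inj₂ refl = subst₂ _⟶_ (sym (snoc-≤ {x} {k} {v} i≤k)) (sym (snoc-> {x} {v} k)) a

      arc-≤ : ∀ {k l x} → l ≤ k → Arc k x → Arc l x
      arc-≤ l≤k ax i i<l = ax i (≤-trans i<l l≤k)

      arc-tail : ∀ {k x} → Arc (suc k) x → Arc k (x ∘ suc)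
      arc-tail ax i i<k = ax (suc i) (s≤s i<k)

      -- Equal vertices have the same out-neighbours: for `i < k` the arc from `x i` to `x (suc i)`
      -- also starts at `x j`, which forces `suc i ≡ suc j`.
      induced-injective : ∀ {k x} → Arc k x → Induced k x → ∀ {i j} → i ≤ k → j ≤ k → x i ≡ x j → i ≡ j
      induced-injective {k} {x} ax ind {i} {j} i≤k j≤k eq with m≤n⇒m<n∨m≡n i≤k | m≤n⇒m<n∨m≡n j≤k
      ... | inj₁ i<k | _ = suc-injective (ind j (suc i) j≤k i<k (subst (_⟶ x (suc i)) eq (ax i i<k)))
      ... | inj₂ _ | inj₁ j<k = sym (suc-injective (ind i (suc j) i≤k j<k (subst (_⟶ x (suc j)) (sym eq) (ax j j<k))))
      ... | inj₂ refl | inj₂ refl = refl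

    module _ (C : HomogeneousDigraph) where
      open HomogeneousDigraph C
      open ArcSequences _⟶_

      arc-transitive : ∀ {k x y} → (∀ i → κ (x i) ≡ κ (y i)) → Arc k x → Arc k y → Induced k x → Induced k y →
                       Σ[ α ∈ Automorphism ] (∀ i → i ≤ k → to α (x i) ≡ y i)
      arc-transitive {k} {x} {y} κ≡ ax ay ix iy =
        let (α , eq) = homogeneous {Fin (suc k)} (x ∘ toℕ) (y ∘ toℕ) (allFin (suc k) , λ {i} _ → ∈-allFin i) zero
              reach (κ≡ ∘ toℕ)
              (λ i j e → cong y (induced-injective ax ix (bound i) (bound j) e))
              (λ i j e → cong x (induced-injective ay iy (bound i) (bound j) e))
              (λ i j a → subst (λ z → y (toℕ i) ⟶ y z) (sym (ix _ _ (bound i) (bound j) a))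
                           (ay (toℕ i) (subst (_≤ k) (ix _ _ (bound i) (bound j) a) (bound j))))
              (λ i j a → subst (λ z → x (toℕ i) ⟶ x z) (sym (iy _ _ (bound i) (bound j) a))
                           (ax (toℕ i) (subst (_≤ k) (iy _ _ (bound i) (bound j) a) (bound j))))
        in α , λ i i≤k → subst₂ (λ u v → to α u ≡ v) (cong x (toℕ-fromℕ< (s≤s i≤k))) (cong y (toℕ-fromℕ< (s≤s i≤k))) (eq (fromℕ< (s≤s i≤k)))
        where
        bound : (i : Fin (suc k)) → toℕ i ≤ k
        bound i = ≤-pred (toℕ<n i)
        Step : Fin (suc k) → Fin (suc k) → Set
        Step i j = Adj (x (toℕ i)) (x (toℕ j))
        reachℕ : ∀ n (n<k : n < suc k) → Reach Step zero (fromℕ< n<k)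
        reachℕ zero (s≤s z≤n) = here
        reachℕ (suc n) n<k = reachℕ n (<⇒≤ n<k) ▻
          inj₁ (subst₂ (λ i j → x i ⟶ x j) (sym (toℕ-fromℕ< (<⇒≤ n<k))) (sym (toℕ-fromℕ< n<k)) (ax n (≤-pred n<k)))
        reach : ∀ i → Reach Step zero i
        reach i = subst (Reach Step zero) (fromℕ<-toℕ i (toℕ<n i)) (reachℕ (toℕ i) (toℕ<n i))

    module Basics (C : TriangleFreeCHD) where
      open TriangleFreeCHD C public
      open ArcSequences _⟶_ public

      Ind : ℕ → Set
      Ind k = ∀ x → Arc k x → Induced k x

      κ≡ : ∀ {u v} → κ u ≡ κ v
      κ≡ = κ-const _ _

      karc-transitive : ∀ {k x y} → Ind k → Arc k x → Arc k y → Σ[ α ∈ Automorphism ] (∀ i → i ≤ k → to α (x i) ≡ y i)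
      karc-transitive ind ax ay = arc-transitive homogeneousDigraph (λ _ → κ≡) ax ay (ind _ ax) (ind _ ay)

      vertex-transitive : ∀ u v → Σ[ α ∈ Automorphism ] (to α u ≡ v)
      vertex-transitive u v = let (α , eq) = homogeneous {⊤} (λ _ → u) (λ _ → v) (tt ∷ [] , λ _ → here refl) tt
                                    (λ _ → here) (λ _ → κ≡) (λ _ _ _ → refl) (λ _ _ _ → refl)
                                    (λ _ _ a → ⊥-elim (irrefl a)) (λ _ _ a → ⊥-elim (irrefl a))
                              in α , eq tt

      some-arc : ∃[ u ] ∃[ v ] (u ⟶ v)
      some-arc with infinite (base ∷ [])
      ... | w , w∉ with connected base w
      ... | here = ⊥-elim (w∉ (here refl))
      ... | _▻_ {i = i} _ (inj₁ a) = i , w , a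
      ... | _▻_ {i = i} _ (inj₂ a) = w , i , a

      has-succ : ∀ v → ∃[ w ] (v ⟶ w)
      has-succ v = let (a , b , e) = some-arc ; (α , eq) = vertex-transitive a v
                   in to α b , subst (_⟶ to α b) eq (to-arc α e)

      has-pred : ∀ v → ∃[ w ] (w ⟶ v)
      has-pred v = let (a , b , e) = some-arc ; (α , eq) = vertex-transitive b v
                   in to α a , subst (to α a ⟶_) eq (to-arc α e)

      forward-arc : V → ℕ → V
      forward-arc v zero    = v
      forward-arc v (suc n) = proj₁ (has-succ (forward-arc v n))

      forward-arc-steps : ∀ v k → Arc k (forward-arc v)
      forward-arc-steps v k i _ = proj₂ (has-succ (forward-arc v i))

      arc-ending-at : ∀ v k → Σ[ x ∈ (ℕ → V) ] (Arc k x × x k ≡ v)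
      arc-ending-at v zero = (λ _ → v) , (λ _ ()) , refl
      arc-ending-at v (suc k) with arc-ending-at (proj₁ (has-pred v)) k
      ... | x , ax , eq = snoc x k v , arc-snoc ax (subst (_⟶ v) (sym eq) (proj₂ (has-pred v))) , snoc-> k

      from-arc : ∀ {α : Automorphism} {t q r} → t ⟶ r → to α q ≡ r → from α t ⟶ q
      from-arc {α} {t} {q} a refl = to-arc⁻ α (subst (_⟶ to α q) (sym (to∘from α t)) a)

      -- By vertex-transitivity `a` and `w` have equally many out-neighbours, so a total injective
      -- relation between these is onto. This is how degrees are compared throughout.
      out-surjective : ∀ {a w} (R : V → V → Set) → (∀ {x} → a ⟶ x → ∃[ y ] (w ⟶ y × R x y)) →
        (∀ {x x′ y} → a ⟶ x → a ⟶ x′ → R x y → R x′ y → x ≡ x′) →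
        ∀ {y} → w ⟶ y → ∃[ x ] (a ⟶ x × R x y)
      out-surjective {a} {w} R total inj {y} wy with vertex-transitive w a
      ... | α , refl with injective⇒surjective (out-listing w) (λ x y → R (to α x) y)
                           (λ x wx → total (to-arc α wx))
                           (λ p p′ r r′ → to-inj α (inj (to-arc α p) (to-arc α p′) r r′)) y wy
      ... | x , wx , r = to α x , to-arc α wx , r

      closed-finite : {W : V → Set} → Listing W → ∃[ w ] W w → (∀ {u v} → W u → Adj u v → W v) → ⊥
      closed-finite {W} (xs , c) (w , p) closed with infinite xs
      ... | v , v∉ = v∉ (c (go (connected w v)))
        where
        go : ∀ {v} → Reach Adj w v → W v
        go here = p
        go (r ▻ a) = closed (go r) a

      ind-0 : Ind 0
      ind-0 x _ zero zero _ _ a = ⊥-elim (irrefl a)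

      ind-1 : Ind 1
      ind-1 x ax zero zero _ _ a = ⊥-elim (irrefl a)
      ind-1 x ax zero (suc zero) _ _ a = refl
      ind-1 x ax (suc zero) zero _ _ a = ⊥-elim (asym a (ax 0 (s≤s z≤n)))
      ind-1 x ax (suc zero) (suc zero) _ _ a = ⊥-elim (irrefl a)
      ind-1 x ax (suc (suc _)) _ (s≤s ()) _ _
      ind-1 x ax _ (suc (suc _)) _ (s≤s ()) _

      -- A chord that does not join the two ends lies in the initial or in the final subsequence of
      -- length `k`.
      ind-extend : ∀ {k} → Ind k → (∀ x → Arc (suc k) x → ¬ Adj (x 0) (x (suc k))) → 1 ≤ k → Ind (suc k)
      ind-extend {k} ind none 1≤k x ax zero zero p q a = ⊥-elim (irrefl a)
      ind-extend {k} ind none 1≤k x ax zero (suc j) p (s≤s q) a with m≤n⇒m<n∨m≡n q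
      ... | inj₁ j<k = ind x (arc-≤ (n≤1+n k) ax) 0 (suc j) z≤n j<k a
      ... | inj₂ refl = ⊥-elim (none x ax (inj₁ a))
      ind-extend {k} ind none 1≤k x ax (suc i) zero (s≤s p) q a with m≤n⇒m<n∨m≡n p
      ... | inj₁ i<k = ind x (arc-≤ (n≤1+n k) ax) (suc i) 0 i<k z≤n a
      ... | inj₂ refl = ⊥-elim (none x ax (inj₂ a))
      ind-extend ind none 1≤k x ax (suc i) (suc j) (s≤s p) (s≤s q) a = cong suc (ind (x ∘ suc) (arc-tail ax) i j p q a)

      ind-2 : Ind 2
      ind-2 = ind-extend ind-1 (λ x ax → triangleFree (inj₁ (ax 0 (s≤s z≤n))) (inj₁ (ax 1 (s≤s (s≤s z≤n))))) (s≤s z≤n)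

      two-arc : V → V → V → ℕ → V
      two-arc a b c = cons a (cons b λ _ → c)

      two-arc-transitive : ∀ {a b c a′ b′ c′} → a ⟶ b → b ⟶ c → a′ ⟶ b′ → b′ ⟶ c′ →
        Σ[ α ∈ Automorphism ] (to α a ≡ a′ × to α b ≡ b′ × to α c ≡ c′)
      two-arc-transitive {a} {b} {c} {a′} {b′} {c′} p q p′ q′ =
        let (α , eq) = karc-transitive ind-2 (steps p q) (steps p′ q′)
        in α , eq 0 z≤n , eq 1 (s≤s z≤n) , eq 2 (s≤s (s≤s z≤n))
        where
        steps : ∀ {a b c} → a ⟶ b → b ⟶ c → Arc 2 (two-arc a b c)
        steps p q = arc-cons p (arc-cons q (λ _ ()))

      Diamond : Set
      Diamond = ∃[ w ] ∃[ a ] ∃[ a′ ] ∃[ v ] (w ⟶ a × w ⟶ a′ × a ⟶ v × a′ ⟶ v × a ≢ a′)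

      -- The matrix with rows N⁺(a) and columns N⁺(w) ∖ {a} has more rows than columns, so it is constant.
      diamond-complete : Diamond → ∀ {w a v s} → w ⟶ a → a ⟶ v → w ⟶ s → s ⟶ v
      diamond-complete (w₀ , a₀ , a₁ , v₀ , w₀a₀ , w₀a₁ , a₀v₀ , a₁v₀ , a₀≢a₁) {w} {a} {v} {s} wa av ws
        with s ≟ a
      ... | yes refl = av
      ... | no s≢a with leafMatrix {colour = λ u v → does (dec (v ⟶ u))} core rows columns
                         (λ { {α} fix ar → subst (_⟶ _) (fix (inj₂ refl)) (to-arc α ar) })
                         (λ { {α} fix (wu , n) → subst (_⟶ _) (fix (inj₁ refl)) (to-arc α wu) ,
                                λ eq → n (to-inj α (trans eq (sym (fix (inj₂ refl))))) })
                         (λ {α} _ → does-≡ (to-arc⁻ α) (to-arc α))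
        where
        core = Core-edge (inj₁ wa)
        rows : Leaves (λ u → u ≡ w ⊎ u ≡ a) (a ⟶_)
        rows = record
          { listing = out-listing a
          ; disjoint = λ { as (inj₁ refl) → asym wa as ; as (inj₂ refl) → irrefl as }
          ; colour = λ _ _ → κ≡ ; stem = a ; stem∈Q = inj₂ refl ; attached = inj₁ (λ e → e)
          ; independent = λ e e′ f → triangleFree (inj₁ e) (inj₁ f) (inj₁ e′)
          ; free = λ { e (inj₁ refl) _ f → triangleFree (inj₁ wa) (inj₁ e) (swap f) ; e (inj₂ refl) n _ → n refl } }
        columns : Leaves (λ u → u ≡ w ⊎ u ≡ a) (λ u → w ⟶ u × u ≢ a)
        columns = record
          { listing = listing-⊆ proj₁ (out-listing w)
          ; disjoint = λ { (e , _) (inj₁ refl) → irrefl e ; (_ , n) (inj₂ refl) → n refl }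
          ; colour = λ _ _ → κ≡ ; stem = w ; stem∈Q = inj₁ refl ; attached = inj₁ proj₁
          ; independent = λ (e , _) (e′ , _) f → triangleFree (inj₁ e) (inj₁ f) (inj₁ e′)
          ; free = λ { e (inj₁ refl) n _ → n refl ; (e , _) (inj₂ refl) _ f → triangleFree (inj₁ e) f (inj₁ wa) } }
      ... | inj₁ constant = result (two-arc-transitive w₀a₀ a₀v₀ wa av)
        where
        result : Σ[ α ∈ Automorphism ] (to α w₀ ≡ w × to α a₀ ≡ a × to α v₀ ≡ v) → s ⟶ v
        result (α , refl , refl , refl) = true-does (trans
          (constant {r = v} {r′ = v} av av (ws , s≢a) (to-arc α w₀a₁ , λ eq → a₀≢a₁ (to-inj α (sym eq))))
          (does-true (to-arc α a₁v₀)))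
      ... | inj₂ m = ⊥-elim (conflict (out-surjective (λ x y → Matching.θ m x ≡ y)
                       (λ e → Matching.θ m _ , proj₁ (Matching.θ∈S m e) , refl)
                       (λ e e′ r r′ → Matching.θ-inj m e e′ (trans r (sym r′))) wa))
        where
        conflict : ∃[ x ] (a ⟶ x × Matching.θ m x ≡ a) → ⊥
        conflict (x , e , eq) = proj₂ (Matching.θ∈S m e) eq

  -- All k-arcs are induced

  module InducedArcs where

    open import Data.Nat.Properties using (≤-refl; ≤-trans; <⇒≤; n≤1+n; m≤n⇒m<n∨m≡n)
    open Base
    open Matrix
    open Homogeneous
    open Arcs
    open Aut

    module _ (C : TriangleFreeCHD) where
      open Basics C

      NoDiamond : Set
      NoDiamond = ∀ {w a a′ v} → w ⟶ a → w ⟶ a′ → a ⟶ v → a′ ⟶ v → a ≡ a′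

      NoShortcut : Set
      NoShortcut = ∀ {a b c d} → a ⟶ b → b ⟶ c → c ⟶ d → ¬ (a ⟶ d)

      -- Here some grandparents above `p` and `p′` have a common in-neighbour; exchanging leaves
      -- will upgrade this to all of them, which is `GrandparentsMeet`.
      Ladder : Set
      Ladder = ∀ {x p p′} → p ⟶ x → p′ ⟶ x → ∃[ t ] ∃[ z ] ∃[ z′ ] (t ⟶ z × t ⟶ z′ × z ⟶ p × z′ ⟶ p′)

      GrandparentsMeet : Set
      GrandparentsMeet = ∀ {x p p′ q q′} → p ⟶ x → p′ ⟶ x → p ≢ p′ → q ⟶ p → q′ ⟶ p′ → ∃[ w ] (w ⟶ q × w ⟶ q′)

      -- Colours for `leafMatrix`. Three are needed because a matching matrix shows only two, and
      -- the occurrence of a third is the contradiction sought.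
      data Orientation : Set where
        right left apart : Orientation

      orientation : V → V → Orientation
      orientation u v with dec (u ⟶ v) | dec (v ⟶ u)
      ... | yes _ | _     = right
      ... | no _  | yes _ = left
      ... | no _  | no _  = apart

      orientation-right : ∀ {u v} → u ⟶ v → orientation u v ≡ right
      orientation-right {u} {v} a with dec (u ⟶ v)
      ... | yes _ = refl
      ... | no n  = contradiction a n

      orientation-left : ∀ {u v} → v ⟶ u → orientation u v ≡ left
      orientation-left {u} {v} a with dec (u ⟶ v) | dec (v ⟶ u)
      ... | yes b | _     = ⊥-elim (asym a b)
      ... | no _  | yes _ = refl
      ... | no _  | no n  = contradiction a n

      orientation-apart : ∀ {u v} → ¬ Adj u v → orientation u v ≡ apart
      orientation-apart {u} {v} n with dec (u ⟶ v) | dec (v ⟶ u)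
      ... | yes b | _     = ⊥-elim (n (inj₁ b))
      ... | no _  | yes b = ⊥-elim (n (inj₂ b))
      ... | no _  | no _  = refl

      orientation-aut : ∀ (α : Automorphism) {u v} → orientation (to α u) (to α v) ≡ orientation u v
      orientation-aut α {u} {v} with dec (u ⟶ v) | dec (v ⟶ u)
      ... | yes b | _     = orientation-right (to-arc α b)
      ... | no n  | yes b = orientation-left (to-arc α b)
      ... | no n  | no n′ = orientation-apart λ { (inj₁ b) → n (to-arc⁻ α b) ; (inj₂ b) → n′ (to-arc⁻ α b) }

      module _ (noDiamond : NoDiamond) (noShortcut : NoShortcut) (ladder : Ladder) where

        module TwoParents {x p₁ p₂} (p₁x : p₁ ⟶ x) (p₂x : p₂ ⟶ x) (p₁≢p₂ : p₁ ≢ p₂) where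

          Q : V → Set
          Q u = (u ≡ x ⊎ u ≡ p₁) ⊎ u ≡ p₂

          core : Core Q
          core = record
            { listing = listing-∪ (listing-∪ (listing-≡ x) (listing-≡ p₁)) (listing-≡ p₂)
            ; root = x ; root∈Q = inj₁ (inj₁ refl)
            ; reach = λ { (inj₁ (inj₁ refl)) → here ; (inj₁ (inj₂ refl)) → here ▻ (inj₁ (inj₂ refl) , inj₂ p₁x)
                        ; (inj₂ refl) → here ▻ (inj₂ refl , inj₂ p₂x) } }

          separate : ∀ {p p′ s} → p ⟶ x → p′ ⟶ x → p ≢ p′ → s ⟶ p → ¬ Adj s p′
          separate px p′x n sp (inj₁ a) = n (noDiamond sp a px p′x)
          separate px p′x n sp (inj₂ a) = noShortcut a sp px p′x

          parents₁ : Leaves Q (_⟶ p₁)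
          parents₁ = record
            { listing = in-listing p₁
            ; disjoint = λ { e (inj₁ (inj₁ refl)) → asym e p₁x ; e (inj₁ (inj₂ refl)) → irrefl e
                           ; e (inj₂ refl) → triangleFree (inj₁ e) (inj₁ p₁x) (inj₁ p₂x) }
            ; colour = λ _ _ → κ≡ ; stem = p₁ ; stem∈Q = inj₁ (inj₂ refl) ; attached = inj₂ λ e → e
            ; independent = λ e e′ f → triangleFree (inj₁ f) (inj₁ e′) (inj₁ e)
            ; free = λ { e (inj₁ (inj₁ refl)) _ f → triangleFree (inj₁ e) (inj₁ p₁x) f
                       ; e (inj₁ (inj₂ refl)) n _ → n refl
                       ; e (inj₂ refl) _ f → separate p₁x p₂x p₁≢p₂ e f } }

          parents₂ : Leaves Q (_⟶ p₂)
          parents₂ = record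
            { listing = in-listing p₂
            ; disjoint = λ { e (inj₁ (inj₁ refl)) → asym e p₂x ; e (inj₂ refl) → irrefl e
                           ; e (inj₁ (inj₂ refl)) → triangleFree (inj₁ e) (inj₁ p₂x) (inj₁ p₁x) }
            ; colour = λ _ _ → κ≡ ; stem = p₂ ; stem∈Q = inj₂ refl ; attached = inj₂ λ e → e
            ; independent = λ e e′ f → triangleFree (inj₁ f) (inj₁ e′) (inj₁ e)
            ; free = λ { e (inj₁ (inj₁ refl)) _ f → triangleFree (inj₁ e) (inj₁ p₂x) f
                       ; e (inj₂ refl) n _ → n refl
                       ; e (inj₁ (inj₂ refl)) _ f → separate p₂x p₁x (λ eq → p₁≢p₂ (sym eq)) e f } }

          -- Exchanging p₁ and p₂ reverses the orientation between N⁻(p₁) and N⁻(p₂), so an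
          -- arc there would produce all three orientations in the matrix.
          parents-apart : ∀ {q₁ q₂} → q₁ ⟶ p₁ → q₂ ⟶ p₂ → ¬ Adj q₁ q₂
          parents-apart {q₁} {q₂} a₁ a₂ adj with ladder p₁x p₂x
          ... | t , z₁ , z₂ , tz₁ , tz₂ , z₁p₁ , z₂p₂
            with leafMatrix {colour = orientation} core parents₁ parents₂
                   (λ {α} fix e → subst (_ ⟶_) (fix (inj₁ (inj₂ refl))) (to-arc α e))
                   (λ {α} fix e → subst (_ ⟶_) (fix (inj₂ refl)) (to-arc α e))
                   (λ {α} _ → orientation-aut α)
          ... | inj₁ constant = adjacent adj
            where
            z-apart : orientation z₁ z₂ ≡ apart
            z-apart = orientation-apart λ f → triangleFree (inj₁ tz₁) f (inj₁ tz₂)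
            adjacent : ¬ Adj q₁ q₂
            adjacent (inj₁ f) with trans (sym (orientation-right f)) (trans (constant a₁ z₁p₁ a₂ z₂p₂) z-apart)
            ... | ()
            adjacent (inj₂ f) with trans (sym (orientation-left f)) (trans (constant a₁ z₁p₁ a₂ z₂p₂) z-apart)
            ... | ()
          ... | inj₂ m = three-colours adj
            where
            open Matching m
            z-apart : orientation z₁ z₂ ≡ apart
            z-apart = orientation-apart λ f → triangleFree (inj₁ tz₁) f (inj₁ tz₂)
            Entry : Orientation → Set
            Entry c = ∃[ u ] ∃[ v ] (u ⟶ p₁ × v ⟶ p₂ × orientation u v ≡ c)
            entry-value : ∀ {c} → Entry c → c ≡ on ⊎ c ≡ off
            entry-value (u , v , up , vp , refl) with v ≟ θ u
            ... | yes refl = inj₁ (colour-on up)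
            ... | no n = inj₂ (colour-off up vp n)
            contra : ∀ {c d e} → Entry c → Entry d → Entry e → c ≢ d → c ≢ e → d ≢ e → ⊥
            contra {c} {d} {e} x y z n₁ n₂ n₃ with entry-value x | entry-value y | entry-value z
            ... | inj₁ refl | inj₁ refl | _ = n₁ refl
            ... | inj₂ refl | inj₂ refl | _ = n₁ refl
            ... | inj₁ refl | inj₂ refl | inj₁ refl = n₂ refl
            ... | inj₁ refl | inj₂ refl | inj₂ refl = n₃ refl
            ... | inj₂ refl | inj₁ refl | inj₁ refl = n₃ refl
            ... | inj₂ refl | inj₁ refl | inj₂ refl = n₂ refl
            siblings : Leaves (_≡ x) (_⟶ x)
            siblings = record
              { listing = in-listing x ; disjoint = λ { e refl → irrefl e } ; colour = λ _ _ → κ≡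
              ; stem = x ; stem∈Q = refl ; attached = inj₂ λ e → e
              ; independent = λ e e′ f → triangleFree (inj₁ f) (inj₁ e′) (inj₁ e)
              ; free = λ _ eq n → ⊥-elim (n eq) }
            flipped : ∀ {u v} → u ⟶ p₁ → v ⟶ p₂ → Σ[ β ∈ Automorphism ] (to β v ⟶ p₁ × to β u ⟶ p₂)
            flipped up vp with swapLeaves (Core-point x) siblings p₁x p₂x
            ... | β , _ , sw = β , subst (_ ⟶_) (trans (sw p₂x) (transpose-ʳ p₁ p₂)) (to-arc β vp) ,
                                   subst (_ ⟶_) (trans (sw p₁x) (transpose-ˡ p₁ p₂)) (to-arc β up)
            three-colours : ¬ Adj q₁ q₂
            three-colours (inj₁ f) with flipped a₁ a₂
            ... | β , e , e′ = contra (_ , _ , a₁ , a₂ , orientation-right f) (_ , _ , e , e′ , orientation-left (to-arc β f))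
                                 (_ , _ , z₁p₁ , z₂p₂ , z-apart) (λ ()) (λ ()) (λ ())
            three-colours (inj₂ f) with flipped a₁ a₂
            ... | β , e , e′ = contra (_ , _ , e , e′ , orientation-right (to-arc β f)) (_ , _ , a₁ , a₂ , orientation-left f)
                                 (_ , _ , z₁p₁ , z₂p₂ , z-apart) (λ ()) (λ ()) (λ ())

          -- No arcs run between the parents of `p₁` and those of `p₂`, so either set can be
          -- permuted while the other is fixed. Carrying `q₂` to `z₂` and `q₁` to `z₁` one after the
          -- other, and pulling `t` back through both automorphisms, gives the common parent.
          move-parents : ∀ {q₁ q₂ z₁ z₂ t} → q₁ ⟶ p₁ → q₂ ⟶ p₂ → z₁ ⟶ p₁ → z₂ ⟶ p₂ → t ⟶ z₁ → t ⟶ z₂ →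
                         ∃[ w ] (w ⟶ q₁ × w ⟶ q₂)
          move-parents {q₁} {q₂} {z₁} {z₂} {t} q₁p₁ q₂p₂ z₁p₁ z₂p₂ tz₁ tz₂
            with swapLeaves (Core-extend core parents₁) parents₂′ q₂p₂ z₂p₂
               | swapLeaves (Core-extend core parents₂) parents₁′ q₁p₁ z₁p₁
            where
            parents₂′ : Leaves (λ u → Q u ⊎ u ⟶ p₁) (_⟶ p₂)
            parents₂′ = record
              { Leaves parents₂ hiding (disjoint; stem∈Q; free)
              ; disjoint = λ { e (inj₁ q) → Leaves.disjoint parents₂ e q ; e (inj₂ e′) → separate p₁x p₂x p₁≢p₂ e′ (inj₁ e) }
              ; stem∈Q = inj₁ (inj₂ refl)
              ; free = λ { e (inj₁ q) n f → Leaves.free parents₂ e q n f ; e (inj₂ e′) _ f → parents-apart e′ e (swap f) } }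
            parents₁′ : Leaves (λ u → Q u ⊎ u ⟶ p₂) (_⟶ p₁)
            parents₁′ = record
              { Leaves parents₁ hiding (disjoint; stem∈Q; free)
              ; disjoint = λ { e (inj₁ q) → Leaves.disjoint parents₁ e q ; e (inj₂ e′) → separate p₁x p₂x p₁≢p₂ e (inj₁ e′) }
              ; stem∈Q = inj₁ (inj₁ (inj₂ refl))
              ; free = λ { e (inj₁ q) n f → Leaves.free parents₁ e q n f ; e (inj₂ e′) _ f → parents-apart e e′ f } }
          ... | α , fix , sw | β , fix′ , sw′ = from β (from α t) ,
            from-arc {β} (from-arc {α} tz₁ (fix (inj₂ z₁p₁))) (trans (sw′ q₁p₁) (transpose-ˡ q₁ z₁)) ,
            from-arc {β} (from-arc {α} tz₂ (trans (sw q₂p₂) (transpose-ˡ q₂ z₂))) (fix′ (inj₂ q₂p₂))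

        grandparentsMeet : GrandparentsMeet
        grandparentsMeet p₁x p₂x n q₁p₁ q₂p₂ =
          let (t , z₁ , z₂ , tz₁ , tz₂ , z₁p₁ , z₂p₂) = ladder p₁x p₂x
          in TwoParents.move-parents p₁x p₂x n q₁p₁ q₂p₂ z₁p₁ z₂p₂ tz₁ tz₂

      Grandparent : V → V → Set
      Grandparent x e = ∃[ p ] (e ⟶ p × p ⟶ x)

      listing-Grandparent : ∀ x → Listing (Grandparent x)
      listing-Grandparent x = listing-⊆ (λ (p , ep , px) → p , px , ep) (listing-∃ (in-listing x) in-listing)

      module Siblings (noDiamond : NoDiamond) (meet : GrandparentsMeet)
        (meetᵒᵖ : ∀ {x p p′ q q′} → x ⟶ p → x ⟶ p′ → p ≢ p′ → p ⟶ q → p′ ⟶ q′ → ∃[ w ] (q ⟶ w × q′ ⟶ w)) where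

        -- Every child `p′` of `e′` has a common child with `p`. Without diamonds this relation is
        -- injective from the children of `e′` to those of `p`, hence onto, so `x` is among the
        -- vertices hit.
        co-children : ∀ {x e e′ w} → Grandparent x e → w ⟶ e → w ⟶ e′ → Grandparent x e′
        co-children {x} {e} {e′} {w} (p , ep , px) we we′ with e ≟ e′
        ... | yes refl = p , ep , px
        ... | no n with out-surjective (λ p′ y → p ⟶ y × p′ ⟶ y)
                         (λ {p′} e′p′ → let (y , py , p′y) = meetᵒᵖ we we′ n ep e′p′ in y , py , py , p′y)
                         (λ a a′ (_ , r) (_ , r′) → noDiamond a a′ r r′) px
        ... | p′ , e′p′ , _ , p′x = p′ , e′p′ , p′x

        -- A detour through a grandparent `e₂` of `x` above another parent `p₂`: `e` and `e₂` have a
        -- common parent, so `e₂` is also a grandparent of a child `x′` of `p′`. There `e₂` and `e′`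
        -- lie above different parents and meet in turn, and `co-children` leads from `e₂` to `e′`.
        -- The second parent `p₂` exists because `p′` has two parents.
        co-parents : ∀ {x e e′ p′} → Grandparent x e → e ⟶ p′ → e′ ⟶ p′ → Grandparent x e′
        co-parents {x} {e} {e′} {p′} (p , ep , px) ep′ e′p′ with e ≟ e′ | p ≟ p′
        ... | yes refl | _ = p , ep , px
        ... | no _ | yes refl = p , e′p′ , px
        ... | no e≢e′ | no p≢p′ = through other-parent
          where
          other-parent : ∃[ p₂ ] (p₂ ⟶ x × p₂ ≢ p)
          other-parent with vertex-transitive p′ x
          ... | α , refl with to α e ≟ p
          ... | no n = to α e , to-arc α ep′ , n
          ... | yes refl = to α e′ , to-arc α e′p′ , λ eq → e≢e′ (to-inj α (sym eq))
          through : ∃[ p₂ ] (p₂ ⟶ x × p₂ ≢ p) → Grandparent x e′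
          through (p₂ , p₂x , p₂≢p) =
            let (e₂ , e₂p₂) = has-pred p₂
                (w , we , we₂) = meet px p₂x (λ eq → p₂≢p (sym eq)) ep e₂p₂
                (x′ , p′x′) = has-succ p′
                (p₃ , e₂p₃ , p₃x′) = co-children (p′ , ep′ , p′x′) we we₂
                e≢e₂ = λ eq → p₂≢p (noDiamond e₂p₂ (subst (_⟶ p) eq ep) p₂x px)
                p₃≢p′ = λ eq → e≢e₂ (noDiamond we we₂ ep′ (subst (e₂ ⟶_) eq e₂p₃))
                (w′ , w′e₂ , w′e′) = meet p₃x′ p′x′ p₃≢p′ e₂p₃ e′p′
            in co-children (p₂ , e₂p₂ , p₂x) w′e₂ w′e′

        -- A common parent `w` of `e` and of a parent of `y` is a grandparent of `y`, and `w` and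
        -- `e″` are both parents of `e`.
        parents-grandparent : ∀ {x e p y} → e ⟶ p → p ⟶ x → y ⟶ x → p ≢ y → ∀ {e″} → e″ ⟶ e → Grandparent y e″
        parents-grandparent {y = y} ep px yx p≢y e″e =
          let (z , zy) = has-pred y
              (w , we , wz) = meet px yx p≢y ep zy
          in co-parents (z , wz , zy) we e″e

      record Circulation : Set₁ where
        field
          member  : V → Set
          listing : Listing member
          start   : ∃[ c ] member c
          next    : ∀ {c} → member c → ∃[ d ] (member d × c ⟶ d)
          prev    : ∀ {c} → member c → ∃[ d ] (member d × d ⟶ c)

      -- Completing diamonds makes a neighbour of an out-neighbour of a member an out-neighbour of
      -- the next or previous member. So these vertices form a finite set that no edge leaves.
      no-circulation-diamond : (∀ {w a v s} → w ⟶ a → a ⟶ v → w ⟶ s → s ⟶ v) →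
        (∀ {w a v p} → w ⟶ a → a ⟶ v → p ⟶ v → w ⟶ p) → Circulation → ⊥
      no-circulation-diamond complete complete′ circ =
        closed-finite {λ v → ∃[ c ] (member c × c ⟶ v)} (listing-∃ listing out-listing)
          (let (c , m) = start ; (d , _ , e) = next m in d , c , m , e) closed
        where
        open Circulation circ
        closed : ∀ {u v} → ∃[ c ] (member c × c ⟶ u) → Adj u v → ∃[ c ] (member c × c ⟶ v)
        closed (c , m , cu) (inj₁ uv) = let (d , m′ , cd) = next m in d , m′ , complete cu uv cd
        closed (c , m , cu) (inj₂ vu) = let (b , m′ , bc) = prev m in b , m′ , complete′ bc cu vu

      -- Without diamonds the grandparents of the members play the same part: a step down is
      -- followed by passing to the next member, a step up by passing to the previous one.
      no-circulation : NoDiamond → GrandparentsMeet →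
        (∀ {x p p′ q q′} → x ⟶ p → x ⟶ p′ → p ≢ p′ → p ⟶ q → p′ ⟶ q′ → ∃[ w ] (q ⟶ w × q′ ⟶ w)) → Circulation → ⊥
      no-circulation noDiamond meet meetᵒᵖ circ =
        closed-finite {λ v → ∃[ c ] (member c × Grandparent c v)} (listing-∃ listing listing-Grandparent)
          (let (c , m) = start ; (p , pc) = has-pred c ; (v , vp) = has-pred p in v , c , m , p , vp , pc) closed
        where
        open Circulation circ
        open Siblings noDiamond meet meetᵒᵖ
        closed : ∀ {u v} → ∃[ c ] (member c × Grandparent c u) → Adj u v → ∃[ c ] (member c × Grandparent c v)
        closed (c , m , p , up , pc) (inj₁ uv) =
          let (d , m′ , cd) = next m in d , m′ , co-children (c , pc , cd) up uv
        closed (c , m , p , up , pc) (inj₂ vu) with prev m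
        ... | b , m′ , bc with p ≟ b
        ...   | yes refl = b , m′ , _ , vu , up
        ...   | no n = b , m′ , parents-grandparent up pc bc n vu

      module Step {m} (1≤m : 1 ≤ m) (ind : Ind (suc m))
        (complete : Diamond → ∀ {w a v s} → w ⟶ a → a ⟶ v → w ⟶ s → s ⟶ v)
        (complete′ : Diamond → ∀ {w a v p} → w ⟶ a → a ⟶ v → p ⟶ v → w ⟶ p) where

        no-diamond : ¬ Diamond → NoDiamond
        no-diamond none wa wa′ av a′v = dne λ n → none (_ , _ , _ , _ , wa , wa′ , av , a′v , n)

        -- Without diamonds, sending c ∈ N⁺(x_m) to a common out-neighbour of x₀ and c injects N⁺(x_m) into N⁺(x₀) ∖ {x₁}.
        no-forward-chord : ∀ x → Arc (suc (suc m)) x → ¬ (x 0 ⟶ x (suc (suc m)))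
        no-forward-chord x ax chord with dec Diamond
        ... | yes d = contradiction (ind x (arc-≤ (n≤1+n _) ax) (suc m) 1 ≤-refl (s≤s z≤n) back) λ ()
          where
          v = proj₁ (has-succ (x 1))
          x₁v : x 1 ⟶ v
          x₁v = proj₂ (has-succ (x 1))
          -- Completing the diamond under `x 0` gives an arc from `x (suc (suc m))` to `v`, and
          -- completing the one over `v` turns it into a backward chord of an arc already known to
          -- be induced.
          back : x (suc m) ⟶ x 1
          back = complete′ d (ax (suc m) ≤-refl) (complete d (ax 0 (s≤s z≤n)) x₁v chord) x₁v
        ... | no none = conflict (out-surjective (λ c z → c ⟶ z) total (λ e e′ r r′ → no-diamond none e e′ r r′) (ax 0 (s≤s z≤n)))
          where
          am : Arc m x
          am = arc-≤ (≤-trans (n≤1+n _) (n≤1+n _)) ax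
          total : ∀ {c} → x m ⟶ c → ∃[ z ] (x 0 ⟶ z × c ⟶ z)
          total {c} e with karc-transitive ind (arc-≤ (n≤1+n _) ax) (arc-snoc am e)
          ... | α , eq = to α (x (suc (suc m))) ,
            subst (_⟶ to α (x (suc (suc m)))) (trans (eq 0 z≤n) (snoc-≤ {x} {m} {c} z≤n)) (to-arc α chord) ,
            subst (_⟶ _) (trans (eq (suc m) ≤-refl) (snoc-> {x} m)) (to-arc α (ax (suc m) ≤-refl))
          conflict : ∃[ c ] (x m ⟶ c × c ⟶ x 1) → ⊥
          conflict (c , e , r) = contradiction (ind (snoc x m c) (arc-snoc am e) (suc m) 1 ≤-refl (s≤s z≤n)
            (subst₂ _⟶_ (sym (snoc-> {x} m)) (sym (snoc-≤ {x} {m} {c} 1≤m)) r)) λ ()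

        -- For `m ≡ 1` this is the chord just excluded; for larger `m` the 3-arc is prolonged
        -- forwards to an arc of length `suc m`, which is induced.
        noShortcut : NoShortcut
        noShortcut {a} {b} {c} {d} ab bc cd ad with m≤n⇒m<n∨m≡n 1≤m
        ... | inj₂ refl = no-forward-chord (cons a (two-arc b c d)) (arc-cons ab (arc-cons bc (arc-cons cd (λ _ ())))) ad
        ... | inj₁ 2≤m = contradiction (ind y ay 0 3 z≤n (s≤s 2≤m) ad) λ ()
          where
          y : ℕ → V
          y = cons a (cons b (cons c (forward-arc d)))
          ay : Arc (suc m) y
          ay i _ = steps i
            where
            steps : ∀ i → y i ⟶ y (suc i)
            steps zero = ab
            steps (suc zero) = bc
            steps (suc (suc zero)) = cd
            steps (suc (suc (suc i))) = proj₂ (has-succ (forward-arc d i))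

        module Backward {x} (ax : Arc (suc (suc m)) x) (chord : x (suc (suc m)) ⟶ x 0) where

          -- Arcs of length `suc m` are induced and therefore all equivalent under automorphisms, so
          -- each of them closes up as the given one does.
          closing : ∀ y → Arc (suc m) y → ∃[ z ] (y (suc m) ⟶ z × z ⟶ y 0)
          closing y ay with karc-transitive ind (arc-≤ (n≤1+n _) ax) ay
          ... | α , eq = to α (x (suc (suc m))) , subst (_⟶ _) (eq (suc m) ≤-refl) (to-arc α (ax (suc m) ≤-refl)) ,
                         subst (_ ⟶_) (eq 0 z≤n) (to-arc α chord)

          -- Both arcs into `x₁` are prolonged by the same forward arc; the two closings then start
          -- at its common last vertex `y m`, which serves as `t`.
          ladder : Ladder
          ladder {x₁} p₁x p₂x =
            let y = forward-arc x₁
                (z , e , f) = closing (cons _ y) (arc-cons p₁x (forward-arc-steps x₁ m))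
                (z′ , e′ , f′) = closing (cons _ y) (arc-cons p₂x (forward-arc-steps x₁ m))
            in y m , z , z′ , e , e′ , f , f′

          ladderᵒᵖ : ∀ {w e e′} → w ⟶ e → w ⟶ e′ → ∃[ t ] ∃[ z ] ∃[ z′ ] (z ⟶ t × z′ ⟶ t × e ⟶ z × e′ ⟶ z′)
          ladderᵒᵖ {w} we we′ with arc-ending-at w m
          ... | y , ay , refl =
            let (z , f , g) = close we ; (z′ , f′ , g′) = close we′ in y 0 , z , z′ , g , g′ , f , f′
            where
            close : ∀ {e} → y m ⟶ e → ∃[ z ] (e ⟶ z × z ⟶ y 0)
            close {e} we = let (z , f , g) = closing (snoc y m e) (arc-snoc ay we)
                           in z , subst (_⟶ z) (snoc-> {y} m) f , subst (z ⟶_) (snoc-≤ {y} {m} {e} z≤n) g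

          circulation : Circulation
          circulation = record
            { member = λ v → ∃[ i ] (i ≤ suc (suc m) × x i ≡ v)
            ; listing = listing-up-to x (suc (suc m))
            ; start = x 0 , 0 , z≤n , refl
            ; next = λ { (i , p , refl) → next′ i p }
            ; prev = λ { (zero , p , refl) → x (suc (suc m)) , (suc (suc m) , ≤-refl , refl) , chord
                       ; (suc i , p , refl) → x i , (i , <⇒≤ p , refl) , ax i p } }
            where
            next′ : ∀ i → i ≤ suc (suc m) → ∃[ d ] ((∃[ j ] (j ≤ suc (suc m) × x j ≡ d)) × x i ⟶ d)
            next′ i p with m≤n⇒m<n∨m≡n p
            ... | inj₁ q = x (suc i) , (suc i , q , refl) , ax i q
            ... | inj₂ refl = x 0 , (0 , z≤n , refl) , chord

    module _ (C : TriangleFreeCHD) where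
      open Basics C
      private module Cᵒᵖ = Basics (op C)

      diamond-op : Diamond → Cᵒᵖ.Diamond
      diamond-op (w , a , a′ , v , wa , wa′ , av , a′v , n) = v , a , a′ , w , av , a′v , wa , wa′ , n

      diamond-complete′ : Diamond → ∀ {w a v p} → w ⟶ a → a ⟶ v → p ⟶ v → w ⟶ p
      diamond-complete′ d wa av pv = Cᵒᵖ.diamond-complete (diamond-op d) av wa pv

      ind-suc : ∀ {m} → 1 ≤ m → Ind (suc m) → Ind (suc (suc m))
      ind-suc {m} 1≤m ind = ind-extend ind no-chord (s≤s z≤n)
        where
        open Step C 1≤m ind diamond-complete diamond-complete′
        no-chord : ∀ x → Arc (suc (suc m)) x → ¬ Adj (x 0) (x (suc (suc m)))
        no-chord x ax (inj₁ chord) = no-forward-chord x ax chord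
        no-chord x ax (inj₂ chord) with dec Diamond
        ... | yes d = no-circulation-diamond C (diamond-complete d) (diamond-complete′ d) (Backward.circulation ax chord)
        ... | no none = no-circulation C nd (grandparentsMeet C nd noShortcut ladder)
                          (grandparentsMeet (op C) (λ a b c d → nd c d a b) (λ a b c d → noShortcut c b a d) ladderᵒᵖ) circulation
          where
          nd = no-diamond none
          open Backward ax chord

      all-arcs-induced : ∀ k → Ind k
      all-arcs-induced 0 = ind-0
      all-arcs-induced 1 = ind-1
      all-arcs-induced 2 = ind-2
      all-arcs-induced (suc (suc (suc k))) = ind-suc (s≤s z≤n) (all-arcs-induced (suc (suc k)))

  -- Alternating walks against directed paths

  module Alternating where

    open import Data.Fin.Properties using (toℕ<n; toℕ-fromℕ<; fromℕ<-toℕ)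
    open import Data.List.Base using (allFin; map; _++_)
    open import Data.List.Membership.Propositional.Properties using (∈-allFin; ∈-map⁺; ∈-++⁺ˡ; ∈-++⁺ʳ)
    open import Data.Nat.Base using (_∸_)
    open import Data.Nat.Properties
    open import Data.Nat.Induction using (<-rec)
    open import Relation.Binary.Definitions using (tri<; tri≈; tri>)
    open Base hiding (_≟_)
    open Homogeneous
    open Arcs
    open InducedArcs
    open Aut

    module Paths {V : Set} (_⟶_ : V → V → Set) where

      Path : ℕ → V → V → Set
      Path zero u v    = u ≡ v
      Path (suc k) u v = ∃[ w ] (u ⟶ w × Path k w v)

      path-++ : ∀ k {l u v w} → Path k u v → Path l v w → Path (k + l) u w
      path-++ zero refl q = q
      path-++ (suc k) (x , a , p) q = x , a , path-++ k p q

      path-snoc : ∀ k {u v w} → Path k u v → v ⟶ w → Path (suc k) u w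
      path-snoc zero refl a = _ , a , refl
      path-snoc (suc k) (x , b , p) a = x , b , path-snoc k p a

      path-unsnoc : ∀ k {u w} → Path (suc k) u w → ∃[ v ] (Path k u v × v ⟶ w)
      path-unsnoc zero (w , a , refl) = _ , refl , a
      path-unsnoc (suc k) (x , b , p) = let (v , q , a) = path-unsnoc k p in v , (x , b , q) , a

      -- Alt n x y: an alternating walk x → · ← · → ⋯ → y with n + 1 forward arcs.
      data Alt : ℕ → V → V → Set where
        one  : ∀ {x y} → x ⟶ y → Alt 0 x y
        more : ∀ {n x v x′ y} → x ⟶ v → x′ ⟶ v → Alt n x′ y → Alt (suc n) x y

      alt-snoc : ∀ {n x y x′ z} → Alt n x y → x′ ⟶ y → x′ ⟶ z → Alt (suc n) x z
      alt-snoc (one a) b c = more a b (one c)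
      alt-snoc (more a a′ w) b c = more a a′ (alt-snoc w b c)

      Walk : ℕ → (ℕ → V) → (ℕ → V) → Set
      Walk n x v = (∀ i → i ≤ n → x i ⟶ v i) × (∀ i → i < n → x (suc i) ⟶ v i)

      alt⇒walk : ∀ {n a b} → Alt n a b → ∃[ x ] ∃[ v ] (Walk n x v × x 0 ≡ a × v n ≡ b)
      alt⇒walk {a = a} {b} (one e) = (λ _ → a) , (λ _ → b) , ((λ _ _ → e) , (λ _ ())) , refl , refl
      alt⇒walk {suc n} {a} (more {v = c} e f w) with alt⇒walk w
      ... | x , v , (o , i) , refl , refl = (λ { zero → a ; (suc j) → x j }) , (λ { zero → c ; (suc j) → v j }) ,
        ((λ { zero _ → e ; (suc j) (s≤s p) → o j p }) , (λ { zero _ → f ; (suc j) (s≤s p) → i j p })) , refl , refl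

      module _ {n x v} (walk : Walk n x v) where

        sub-walk : ∀ d i → i + d ≤ n → Alt d (x i) (v (i + d))
        sub-walk zero i p = subst (λ z → Alt 0 (x i) (v z)) (sym (+-identityʳ i))
          (one (proj₁ walk i (subst (_≤ n) (+-identityʳ i) p)))
        sub-walk (suc d) i p = subst (λ z → Alt (suc d) (x i) (v z)) (sym (+-suc i d))
          (more (proj₁ walk i (≤-trans (m≤m+n i _) p)) (proj₂ walk i (≤-trans (s≤s (m≤m+n i d)) q)) (sub-walk d (suc i) q))
          where
          q : suc i + d ≤ n
          q = subst (_≤ n) (+-suc i d) p

        reverse-walk : ∀ d i → suc i + d ≤ n → Alt d (x (suc i + d)) (v i)
        reverse-walk zero i p = subst (λ z → Alt 0 (x (suc z)) (v i)) (sym (+-identityʳ i))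
          (one (proj₂ walk i (subst (λ z → suc z ≤ n) (+-identityʳ i) p)))
        reverse-walk (suc d) i p = subst (λ z → Alt (suc d) (x (suc z)) (v i)) (sym (+-suc i d))
          (more (proj₂ walk (suc (i + d)) q) (proj₁ walk (suc (i + d)) (<⇒≤ q)) (reverse-walk d i (<⇒≤ q)))
          where
          q : suc (suc (i + d)) ≤ n
          q = subst (λ z → suc z ≤ n) (+-suc i d) p

        prefix-to : ∀ i {z} → i ≤ n → x i ⟶ z → Alt i (x 0) z
        prefix-to zero p a = one a
        prefix-to (suc i) p a = alt-snoc (prefix-to i (<⇒≤ p) (proj₁ walk i (<⇒≤ p))) (proj₂ walk i p) a

        -- Reattaches the rest of the walk after a chord has given a new way, of index `a`, to
        -- `v j`.
        with-suffix : ∀ d {a j z} → Alt a z (v j) → j + d ≡ n → Alt (a + d) z (v n)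
        with-suffix zero {a} {j} {z} w eq =
          subst₂ (λ s t → Alt s z (v t)) (sym (+-identityʳ a)) (trans (sym (+-identityʳ j)) eq) w
        with-suffix (suc d) {a} {j} {z} w eq = subst (λ s → Alt s z (v n)) (sym (+-suc a d))
          (with-suffix d (alt-snoc w (proj₂ walk j j<n) (proj₁ walk (suc j) j<n)) eq′)
          where
          eq′ : suc j + d ≡ n
          eq′ = trans (sym (+-suc j d)) eq
          j<n : suc j ≤ n
          j<n = subst (suc j ≤_) eq′ (m≤m+n (suc j) d)

      -- The walk is an induced path. Distinctness of its vertices is not demanded because it
      -- follows from these conditions.
      record Standard (n : ℕ) (x v : ℕ → V) : Set where
        field
          xv : ∀ {i j} → i ≤ n → j ≤ n → x i ⟶ v j → j ≡ i ⊎ suc j ≡ i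
          vv : ∀ {i j} → i ≤ n → j ≤ n → ¬ (v i ⟶ v j)
          xx : ∀ {i j} → i ≤ n → j ≤ n → ¬ (x i ⟶ x j)
          vx : ∀ {i j} → i ≤ n → j ≤ n → ¬ (v j ⟶ x i)

      module StandardProperties (irrefl : ∀ {v} → ¬ (v ⟶ v)) {n x v} (walk : Walk n x v) (std : Standard n x v) where
        open Standard std

        both : ∀ {i j} → i ≤ n → j ≤ n → x i ⟶ v j → x j ⟶ v i → i ≡ j
        both p q a b with xv p q a | xv q p b
        ... | inj₁ eq | _ = sym eq
        ... | _ | inj₁ eq = eq
        ... | inj₂ refl | inj₂ eq = contradiction eq λ ()

        x-injective : ∀ {i j} → i ≤ n → j ≤ n → x i ≡ x j → i ≡ j
        x-injective {i} {j} p q eq = both p q (subst (_⟶ v j) (sym eq) (proj₁ walk _ q)) (subst (_⟶ v i) eq (proj₁ walk _ p))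

        v-injective : ∀ {i j} → i ≤ n → j ≤ n → v i ≡ v j → i ≡ j
        v-injective {i} {j} p q eq = both p q (subst (x i ⟶_) eq (proj₁ walk _ p)) (subst (x j ⟶_) (sym eq) (proj₁ walk _ q))

        x≢v : ∀ {i j} → i ≤ n → j ≤ n → x i ≢ v j
        x≢v {i} {j} p q eq = xx q p (subst (x j ⟶_) (sym eq) (proj₁ walk _ q))

    module _ (C : HomogeneousDigraph) where
      open HomogeneousDigraph C
      open Paths _⟶_

      path-aut : ∀ (α : Automorphism) k {u v} → Path k u v → Path k (to α u) (to α v)
      path-aut α zero refl = refl
      path-aut α (suc k) (w , a , p) = to α w , to-arc α a , path-aut α k p

      standard-transitive : (∀ u v → κ u ≡ κ v) → ∀ {n x v x′ v′} → Walk n x v → Standard n x v → Walk n x′ v′ → Standard n x′ v′ →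
        Σ[ α ∈ Automorphism ] (to α (x 0) ≡ x′ 0 × to α (v n) ≡ v′ n)
      standard-transitive κ≡ {n} {x} {v} {x′} {v′} walk std walk′ std′ =
        let (α , eq) = homogeneous {I} (point x v) (point x′ v′) (map inj₁ (allFin _) ++ map inj₂ (allFin _) , λ {i} _ → complete i)
                         (inj₁ zero) reach (λ _ → κ≡ _ _)
                         (equal walk std x′ v′) (equal walk′ std′ x v)
                         (arcs walk std walk′) (arcs walk′ std′ walk)
        in α , eq (inj₁ zero) , subst (λ z → to α (v z) ≡ v′ z) (toℕ-fromℕ< ≤-refl) (eq (inj₂ (fromℕ< ≤-refl)))
        where
        I : Set
        I = Fin (suc n) ⊎ Fin (suc n)
        point : (ℕ → V) → (ℕ → V) → I → V
        point x v (inj₁ i) = x (toℕ i)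
        point x v (inj₂ i) = v (toℕ i)
        complete : ∀ i → i ∈ map inj₁ (allFin _) ++ map inj₂ (allFin _)
        complete (inj₁ i) = ∈-++⁺ˡ (∈-map⁺ inj₁ (∈-allFin i))
        complete (inj₂ i) = ∈-++⁺ʳ (map inj₁ (allFin _)) (∈-map⁺ inj₂ (∈-allFin i))
        bound : (i : Fin (suc n)) → toℕ i ≤ n
        bound i = ≤-pred (toℕ<n i)
        equal : ∀ {x v} → Walk n x v → Standard n x v → ∀ x′ v′ i j → point x v i ≡ point x v j → point x′ v′ i ≡ point x′ v′ j
        equal walk std x′ v′ i j eq with i | j
        ... | inj₁ i | inj₁ j = cong x′ (StandardProperties.x-injective irrefl walk std (bound i) (bound j) eq)
        ... | inj₂ i | inj₂ j = cong v′ (StandardProperties.v-injective irrefl walk std (bound i) (bound j) eq)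
        ... | inj₁ i | inj₂ j = ⊥-elim (StandardProperties.x≢v irrefl walk std (bound i) (bound j) eq)
        ... | inj₂ i | inj₁ j = ⊥-elim (StandardProperties.x≢v irrefl walk std (bound j) (bound i) (sym eq))
        arcs : ∀ {x v x′ v′} → Walk n x v → Standard n x v → Walk n x′ v′ → ∀ i j → point x v i ⟶ point x v j → point x′ v′ i ⟶ point x′ v′ j
        arcs {x′ = x′} {v′} walk std (o , b) i j a with i | j
        ... | inj₁ i | inj₁ j = ⊥-elim (Standard.xx std (bound i) (bound j) a)
        ... | inj₂ i | inj₂ j = ⊥-elim (Standard.vv std (bound i) (bound j) a)
        ... | inj₂ i | inj₁ j = ⊥-elim (Standard.vx std (bound j) (bound i) a)
        ... | inj₁ i | inj₂ j with Standard.xv std (bound i) (bound j) a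
        ...   | inj₁ eq = subst (λ z → x′ (toℕ i) ⟶ v′ z) (sym eq) (o (toℕ i) (bound i))
        ...   | inj₂ eq = subst (λ z → x′ z ⟶ v′ (toℕ j)) eq (b (toℕ j) (subst (_≤ n) (sym eq) (bound i)))
        Step : I → I → Set
        Step i j = Adj (point x v i) (point x v j)
        reachℕ : ∀ i (p : i < suc n) → Reach Step (inj₁ zero) (inj₁ (fromℕ< p)) × Reach Step (inj₁ zero) (inj₂ (fromℕ< p))
        reachℕ i p = r i p , (r i p ▻ inj₁ (subst₂ (λ s t → x s ⟶ v t) (sym (toℕ-fromℕ< p)) (sym (toℕ-fromℕ< p)) (proj₁ walk i (≤-pred p))))
          where
          r : ∀ i (p : i < suc n) → Reach Step (inj₁ zero) (inj₁ (fromℕ< p))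
          r zero (s≤s z≤n) = here
          r (suc i) p = proj₂ (reachℕ i (<⇒≤ p)) ▻
            inj₂ (subst₂ (λ s t → x s ⟶ v t) (sym (toℕ-fromℕ< p)) (sym (toℕ-fromℕ< (<⇒≤ p))) (proj₂ walk i (≤-pred p)))
        reach : ∀ i → Reach Step (inj₁ zero) i
        reach (inj₁ i) = subst (λ z → Reach Step (inj₁ zero) (inj₁ z)) (fromℕ<-toℕ i (toℕ<n i)) (proj₁ (reachℕ (toℕ i) (toℕ<n i)))
        reach (inj₂ i) = subst (λ z → Reach Step (inj₁ zero) (inj₂ z)) (fromℕ<-toℕ i (toℕ<n i)) (proj₂ (reachℕ (toℕ i) (toℕ<n i)))

    module DirectedPaths (C : TriangleFreeCHD) where
      open Basics C
      open Paths _⟶_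

      path⇒arc : ∀ k {u v} → Path k u v → ∃[ x ] (Arc k x × x 0 ≡ u × x k ≡ v)
      path⇒arc zero {u} refl = (λ _ → u) , (λ _ ()) , refl , refl
      path⇒arc (suc k) {u} (w , a , p) with path⇒arc k p
      ... | x , ax , refl , refl = cons u x , arc-cons a ax , refl , refl

      no-chord : ∀ k {u v} → Path k u v → u ⟶ v → k ≡ 1
      no-chord k p a with path⇒arc k p
      ... | x , ax , refl , refl = all-arcs-induced C k x ax 0 k z≤n ≤-refl a

      acyclic : ∀ k {u} → ¬ Path (suc k) u u
      acyclic k (w , a , p) with path⇒arc k p
      ... | x , ax , refl , refl = contradiction (all-arcs-induced C k x ax k 0 ≤-refl z≤n a) λ ()

      -- For a shortest alternating walk P = (x₀, v₀, x₁, …, v_n) whose ends are joined by a directed path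
      -- x₀ → ⋯ → w → v_n, both P and (w, v_n, x_n, …, x₁, v₀) are induced, so the ends of the latter are joined
      -- by a directed path too, and the arc x₀ → v₀ becomes a chord of x₀ → ⋯ → w → ⋯ → v₀.
      no-alternating-path : ∀ n {x y} k → Alt n x y → ¬ Path (suc (suc k)) x y
      no-alternating-path n {x} {y} = <-rec (λ n → ∀ {x y} k → Alt n x y → ¬ Path (suc (suc k)) x y) step n
        where
        step : ∀ n → (∀ {m} → m < n → ∀ {x y} k → Alt m x y → ¬ Path (suc (suc k)) x y) →
               ∀ {x y} k → Alt n x y → ¬ Path (suc (suc k)) x y
        step zero ih k (one a) p = contradiction (no-chord (suc (suc k)) p a) λ ()
        step n@(suc _) ih k alt path with alt⇒walk alt
        ... | x , v , walk@(o , b) , refl , refl with path-unsnoc (suc k) path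
        ... | w , to-w , w-end = finish (standard-transitive homogeneousDigraph κ-const walk std walk′ std′)
          where
          std : Standard n x v
          std = record { xv = xv ; vv = vv ; xx = xx ; vx = vx }
            where
            -- Any other arc from an `x i` to a `v j` would shorten the alternating walk, while its
            -- ends stay joined by `path`.
            xv : ∀ {i j} → i ≤ n → j ≤ n → x i ⟶ v j → j ≡ i ⊎ suc j ≡ i
            xv {i} {j} p q a with <-cmp i j
            ... | tri≈ _ eq _ = inj₁ (sym eq)
            ... | tri< i<j _ _ with m≤n⇒∃[o]m+o≡n q
            ...   | d , eq = ⊥-elim (ih (subst (i + d <_) eq (+-monoˡ-< d i<j)) k (with-suffix walk d (prefix-to walk i p a) eq) path)
            xv {i} {j} p q a | tri> _ _ j<i with m≤n⇒m<n∨m≡n j<i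
            ... | inj₂ eq = inj₂ eq
            ... | inj₁ 1+j<i with m≤n⇒∃[o]m+o≡n p
            ...   | d , eq = ⊥-elim (ih (subst (suc j + d <_) eq (+-monoˡ-< d 1+j<i)) k
                      (with-suffix walk d (alt-snoc (prefix-to walk j q (o j q)) a (o i p)) eq) path)
            -- The remaining chords either contradict asymmetry or combine with arcs of the walk to
            -- a directed path of length two or three that joins the ends of a shorter part of the
            -- walk.
            vv : ∀ {i j} → i ≤ n → j ≤ n → ¬ (v i ⟶ v j)
            vv {i} {j} p q a with <-cmp i j
            ... | tri≈ _ refl _ = irrefl a
            ... | tri< i<j _ _ with m≤n⇒∃[o]m+o≡n i<j
            ...   | d , refl = ih (≤-trans (s≤s (m≤n+m d i)) q) 0 (sub-walk walk d (suc i) q)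
                                 (_ , b i (≤-trans i<j q) , _ , a , refl)
            vv {i} {j} p q a | tri> _ _ j<i with m≤n⇒∃[o]m+o≡n j<i
            ...   | d , refl = ih (≤-trans (s≤s (m≤n+m d j)) p) 0 (reverse-walk walk d j p) (_ , o i p , _ , a , refl)
            xx : ∀ {i j} → i ≤ n → j ≤ n → ¬ (x i ⟶ x j)
            xx {i} {j} p q a with <-cmp i j
            ... | tri≈ _ refl _ = irrefl a
            ... | tri< i<j _ _ with m≤n⇒∃[o]m+o≡n i<j
            ...   | d , refl = ih (≤-trans (s≤s (m≤n+m d i)) q) 0 (sub-walk walk d i (<⇒≤ q)) (_ , a , _ , b (i + d) q , refl)
            xx {i} {j} p q a | tri> _ _ j<i with m≤n⇒∃[o]m+o≡n j<i
            ...   | d , refl = ih (≤-trans (s≤s (m≤n+m d j)) p) 0 (reverse-walk walk d j p) (_ , a , _ , o j q , refl)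
            vx : ∀ {i j} → i ≤ n → j ≤ n → ¬ (v j ⟶ x i)
            vx {i} {j} p q a with <-cmp i j
            ... | tri≈ _ refl _ = asym a (o i p)
            ... | tri< i<j _ _ with m≤n⇒∃[o]m+o≡n i<j
            ...   | d , refl = ih (≤-trans (s≤s (m≤n+m d i)) q) 1 (reverse-walk walk d i q) (_ , o j q , _ , a , _ , o i p , refl)
            vx {i} {j} p q a | tri> _ _ j<i with m≤n⇒∃[o]m+o≡n j<i
            ...   | zero , refl = asym a (subst (λ z → x (suc z) ⟶ v j) (sym (+-identityʳ j)) (b j (≤-trans j<i p)))
            ...   | suc d , refl = ih (≤-trans (s≤s (m≤n+m d j)) (<⇒≤ r)) 1 (sub-walk walk d (suc j) (<⇒≤ r))
                      (_ , b j (≤-trans j<i p) , _ , a , _ , subst (λ z → x (suc z) ⟶ v (suc j + d)) (sym (+-suc j d)) (b (suc j + d) r) , refl)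
              where
              r : suc (suc (j + d)) ≤ n
              r = subst (λ z → suc z ≤ n) (+-suc j d) p
          -- An unwanted arc leaving `w` prolongs the directed path from `x 0`, and one entering `w`
          -- gives a directed path that ends with `w ⟶ v n`. Either would join the ends of a shorter
          -- alternating walk.
          wv : ∀ {j} → j ≤ n → w ⟶ v j → j ≡ n
          wv {j} q a with m≤n⇒m<n∨m≡n q
          ... | inj₂ eq = eq
          ... | inj₁ j<n = ⊥-elim (ih j<n k (prefix-to walk j q (o j q)) (path-snoc (suc k) to-w a))
          vw : ∀ {j} → j ≤ n → ¬ (v j ⟶ w)
          vw {j} q a with m≤n⇒m<n∨m≡n q
          ... | inj₂ refl = asym a w-end
          ... | inj₁ j<n with m≤n⇒∃[o]m+o≡n j<n
          ...   | d , eq = ih (subst (suc d ≤_) eq (s≤s (m≤n+m d j))) 1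
                             (subst (λ z → Alt d (x (suc j)) (v z)) eq (sub-walk walk d (suc j) (≤-reflexive eq)))
                             (_ , b j j<n , _ , a , _ , w-end , refl)
          wx : ∀ {i} → suc i ≤ n → ¬ (w ⟶ x (suc i))
          wx {i} p a = ih p (suc k) (prefix-to walk i (<⇒≤ p) (o i (<⇒≤ p))) (path-snoc (suc (suc k)) (path-snoc (suc k) to-w a) (b i p))
          xw : ∀ {i} → suc i ≤ n → ¬ (x (suc i) ⟶ w)
          xw {i} p a with m≤n⇒∃[o]m+o≡n p
          ... | d , eq = ih (subst (suc d ≤_) eq (s≤s (m≤n+m d i))) 0
                           (subst (λ z → Alt d (x (suc i)) (v z)) eq (sub-walk walk d (suc i) (≤-reflexive eq)))
                           (_ , a , _ , w-end , refl)
          x′ v′ : ℕ → V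
          x′ zero = w
          x′ (suc i) = x (n ∸ i)
          v′ i = v (n ∸ i)
          ∸-suc′ : ∀ {i} → suc i ≤ n → n ∸ i ≡ suc (n ∸ suc i)
          ∸-suc′ p = +-∸-assoc 1 p
          walk′ : Walk n x′ v′
          walk′ = o′ , λ i p → o (n ∸ i) (m∸n≤m n i)
            where
            o′ : ∀ i → i ≤ n → x′ i ⟶ v′ i
            o′ zero p = w-end
            o′ (suc i) p = subst (λ z → x z ⟶ v (n ∸ suc i)) (sym (∸-suc′ p))
              (b (n ∸ suc i) (subst (_≤ n) (∸-suc′ p) (m∸n≤m n i)))
          std′ : Standard n x′ v′
          std′ = record
            { xv = xv′
            ; vv = λ {i} {j} p q → Standard.vv std (m∸n≤m n i) (m∸n≤m n j)
            ; xx = xx′ ; vx = vx′ }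
            where
            positive : ∀ {i} → suc i ≤ n → n ∸ i ≡ suc (n ∸ suc i) × suc (n ∸ suc i) ≤ n
            positive {i} p = ∸-suc′ p , subst (_≤ n) (∸-suc′ p) (m∸n≤m n i)
            xv′ : ∀ {i j} → i ≤ n → j ≤ n → x′ i ⟶ v′ j → j ≡ i ⊎ suc j ≡ i
            xv′ {zero} {j} p q a = inj₁ (∸-cancelˡ-≡ q z≤n (wv (m∸n≤m n j) a))
            xv′ {suc i} {j} p q a with Standard.xv std (m∸n≤m n i) (m∸n≤m n j) a
            ... | inj₁ eq = inj₂ (cong suc (∸-cancelˡ-≡ q (<⇒≤ p) eq))
            ... | inj₂ eq = inj₁ (∸-cancelˡ-≡ q p (suc-injective (trans eq (∸-suc′ p))))
            xx′ : ∀ {i j} → i ≤ n → j ≤ n → ¬ (x′ i ⟶ x′ j)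
            xx′ {zero} {zero} p q a = irrefl a
            xx′ {zero} {suc j} p q a = wx (proj₂ (positive q)) (subst (λ z → w ⟶ x z) (proj₁ (positive q)) a)
            xx′ {suc i} {zero} p q a = xw (proj₂ (positive p)) (subst (λ z → x z ⟶ w) (proj₁ (positive p)) a)
            xx′ {suc i} {suc j} p q a = Standard.xx std (m∸n≤m n i) (m∸n≤m n j) a
            vx′ : ∀ {i j} → i ≤ n → j ≤ n → ¬ (v′ j ⟶ x′ i)
            vx′ {zero} {j} p q a = vw (m∸n≤m n j) a
            vx′ {suc i} {j} p q a = Standard.vx std (m∸n≤m n i) (m∸n≤m n j) a
          finish : ¬ (Σ[ α ∈ Automorphism ] (to α (x 0) ≡ w × to α (v n) ≡ v (n ∸ n)))
          finish (α , eq , eq′) = contradiction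
            (no-chord (suc k + suc (suc k)) (path-++ (suc k) to-w
              (subst₂ (Path (suc (suc k))) eq (trans eq′ (cong v (n∸n≡0 n))) (path-aut homogeneousDigraph α (suc (suc k)) path))) (o 0 z≤n))
            (λ eq → contradiction (trans (sym (+-suc k (suc k))) (suc-injective eq)) λ ())

  -- Uniqueness of directed paths, and the levels in the presence of diamonds

  module Descendants where

    open import Data.Bool.Base using (not; if_then_else_)
    open import Data.Fin.Properties using (toℕ<n; toℕ-fromℕ<; fromℕ<-toℕ)
    open import Data.List.Base using (allFin; map; _++_)
    open import Data.List.Membership.Propositional.Properties using (∈-allFin; ∈-map⁺; ∈-++⁺ˡ; ∈-++⁺ʳ)
    open import Data.Nat.Properties hiding (_≟_)
    open import Data.Nat.Induction using (<-rec)
    open import Function.Definitions using (Injective)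
    open import Relation.Binary.Definitions using (tri<; tri≈; tri>)
    open import Relation.Nullary.Decidable.Core using (does)
    open Base
    open Matrix
    open Homogeneous
    open Arcs
    open InducedArcs
    open Alternating
    open Aut

    module UniquePaths (C : TriangleFreeCHD) where
      open Basics C
      open Paths _⟶_
      open DirectedPaths C

      ind : ∀ k → Ind k
      ind = all-arcs-induced C

      arc⇒path : ∀ {k x} → Arc k x → ∀ i d → i + d ≤ k → Path d (x i) (x (i + d))
      arc⇒path {x = x} ax i zero p = cong x (sym (+-identityʳ i))
      arc⇒path {k} {x} ax i (suc d) p = x (suc i) , ax i (≤-trans (s≤s (m≤m+n i d)) q) ,
        subst (λ z → Path d (x (suc i)) (x z)) (sym (+-suc i d)) (arc⇒path ax (suc i) d q)
        where
        q : suc i + d ≤ k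
        q = subst (_≤ k) (+-suc i d) p

      path-forward : ∀ d v → ∃[ w ] Path d v w
      path-forward d v = forward-arc v d , arc⇒path (forward-arc-steps v d) 0 d ≤-refl

      -- Only one of the two lengths is an index, namely the one used for induction; the other is
      -- arbitrary, and `lengths-agree` recovers its value afterwards.
      NoSplit : ℕ → Set
      NoSplit l = ∀ {u v y x} i → u ⟶ y → Path l y v → u ⟶ x → Path i x v → x ≡ y

      lengths-agree : ∀ l → (∀ {m} → m < l → NoSplit m) → ∀ m {y v} → Path l y v → Path m y v → l ≡ m
      lengths-agree zero ns zero p q = refl
      lengths-agree zero ns (suc m) refl q = ⊥-elim (acyclic m q)
      lengths-agree (suc l) ns zero p refl = ⊥-elim (acyclic l p)
      lengths-agree (suc l) ns (suc m) (a , ya , p) (b , yb , q) =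
        cong suc (lengths-agree l (λ m<l → ns (m<n⇒m<1+n m<l)) m p
          (subst (λ z → Path m z _) (ns ≤-refl m ya p yb q) q))

      unique-parent : (∀ l → NoSplit l) → ∀ k k′ {u p p′ v} → Path k u p → p ⟶ v → Path k′ u p′ → p′ ⟶ v → p ≡ p′
      unique-parent ns zero k′ refl a q b with no-chord (suc k′) (path-snoc k′ q b) a
      unique-parent ns zero zero refl a refl b | refl = refl
      unique-parent ns (suc k) zero p a refl b with no-chord (suc (suc k)) (path-snoc (suc k) p a) b
      ... | ()
      unique-parent ns (suc k) (suc k′) (y , uy , p) a (x , ux , q) b
        with ns (suc k) (suc k′) uy (path-snoc k p a) ux (path-snoc k′ q b)
      unique-parent ns (suc k) (suc k′) (y , uy , p) a (x , ux , q) b | refl = unique-parent ns k k′ p a q b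

      -- Both branches are induced as k-arcs, so `cross` makes their union induced as well;
      -- homogeneity then identifies any two forks of the same positive length.
      record Fork (l : ℕ) (g h : ℕ → V) : Set where
        field
          arc₁  : Arc l g
          arc₂  : Arc l h
          root  : g 0 ≡ h 0
          cross : ∀ {i j} → suc i ≤ l → suc j ≤ l → g (suc i) ≢ h (suc j) × ¬ Adj (g (suc i)) (h (suc j))

      fork-transitive : ∀ {l g h g′ h′} → Fork (suc l) g h → Fork (suc l) g′ h′ →
        Σ[ α ∈ Automorphism ] (to α (g (suc l)) ≡ g′ (suc l) × to α (h (suc l)) ≡ h′ (suc l))
      fork-transitive {l′} {g} {h} {g′} {h′} F F′ =
        let (α , eq) = homogeneous {I} (point g h) (point g′ h′) (map inj₁ (allFin _) ++ map inj₂ (allFin _) , λ {i} _ → complete i)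
                         (inj₁ zero) reach (λ _ → κ≡) (equal F F′) (equal F′ F) (arcs F F′) (arcs F′ F)
        in α , subst (λ z → to α (g z) ≡ g′ z) (toℕ-fromℕ< ≤-refl) (eq (inj₁ (fromℕ< ≤-refl)))
             , subst (λ z → to α (h z) ≡ h′ z) (toℕ-fromℕ< ≤-refl) (eq (inj₂ (fromℕ< ≤-refl)))
        where
        l : ℕ
        l = suc l′
        I : Set
        I = Fin (suc l) ⊎ Fin (suc l)
        point : (ℕ → V) → (ℕ → V) → I → V
        point g h (inj₁ i) = g (toℕ i)
        point g h (inj₂ i) = h (toℕ i)
        complete : ∀ i → i ∈ map inj₁ (allFin _) ++ map inj₂ (allFin _)
        complete (inj₁ i) = ∈-++⁺ˡ (∈-map⁺ inj₁ (∈-allFin i))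
        complete (inj₂ i) = ∈-++⁺ʳ (map inj₁ (allFin _)) (∈-map⁺ inj₂ (∈-allFin i))
        bound : (i : Fin (suc l)) → toℕ i ≤ l
        bound i = ≤-pred (toℕ<n i)
        module _ {g h g′ h′} (F : Fork l g h) (F′ : Fork l g′ h′) where
          open Fork
          same₁ : ∀ {i j} → i ≤ l → j ≤ l → g i ≡ g j → i ≡ j
          same₁ p q = induced-injective (arc₁ F) (ind l g (arc₁ F)) p q
          same₂ : ∀ {i j} → i ≤ l → j ≤ l → h i ≡ h j → i ≡ j
          same₂ p q = induced-injective (arc₂ F) (ind l h (arc₂ F)) p q
          same-cross : ∀ {i j} → i ≤ l → j ≤ l → g i ≡ h j → g′ i ≡ h′ j
          same-cross {zero} {zero} p q eq = root F′
          same-cross {zero} {suc j} p q eq with same₂ z≤n q (trans (sym (root F)) eq)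
          ... | ()
          same-cross {suc i} {zero} p q eq with same₁ p z≤n (trans eq (sym (root F)))
          ... | ()
          same-cross {suc i} {suc j} p q eq = ⊥-elim (proj₁ (cross F p q) eq)
          equal : ∀ i j → point g h i ≡ point g h j → point g′ h′ i ≡ point g′ h′ j
          equal (inj₁ i) (inj₁ j) eq = cong g′ (same₁ (bound i) (bound j) eq)
          equal (inj₂ i) (inj₂ j) eq = cong h′ (same₂ (bound i) (bound j) eq)
          equal (inj₁ i) (inj₂ j) eq = same-cross (bound i) (bound j) eq
          equal (inj₂ i) (inj₁ j) eq = sym (same-cross (bound j) (bound i) (sym eq))
          arc-g : ∀ {i j} → i ≤ l → j ≤ l → g i ⟶ g j → g′ i ⟶ g′ j
          arc-g {i} {j} p q a with ind l g (arc₁ F) i j p q a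
          ... | refl = arc₁ F′ i q
          arc-h : ∀ {i j} → i ≤ l → j ≤ l → h i ⟶ h j → h′ i ⟶ h′ j
          arc-h {i} {j} p q a with ind l h (arc₂ F) i j p q a
          ... | refl = arc₂ F′ i q
          arc-gh : ∀ {i j} → i ≤ l → j ≤ l → g i ⟶ h j → g′ i ⟶ h′ j
          arc-gh {zero} p q a = subst (_⟶ _) (sym (root F′)) (arc-h p q (subst (_⟶ _) (root F) a))
          arc-gh {suc i} {zero} p q a = subst (_ ⟶_) (root F′) (arc-g p q (subst (_ ⟶_) (sym (root F)) a))
          arc-gh {suc i} {suc j} p q a = ⊥-elim (proj₂ (cross F p q) (inj₁ a))
          arc-hg : ∀ {i j} → i ≤ l → j ≤ l → h j ⟶ g i → h′ j ⟶ g′ i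
          arc-hg {zero} p q a = subst (_ ⟶_) (sym (root F′)) (arc-h q p (subst (_ ⟶_) (root F) a))
          arc-hg {suc i} {zero} p q a = subst (_⟶ _) (root F′) (arc-g q p (subst (_⟶ _) (sym (root F)) a))
          arc-hg {suc i} {suc j} p q a = ⊥-elim (proj₂ (cross F p q) (inj₂ a))
          arcs : ∀ i j → point g h i ⟶ point g h j → point g′ h′ i ⟶ point g′ h′ j
          arcs (inj₁ i) (inj₁ j) a = arc-g (bound i) (bound j) a
          arcs (inj₂ i) (inj₂ j) a = arc-h (bound i) (bound j) a
          arcs (inj₁ i) (inj₂ j) a = arc-gh (bound i) (bound j) a
          arcs (inj₂ i) (inj₁ j) a = arc-hg (bound j) (bound i) a
        Step : I → I → Set
        Step i j = Adj (point g h i) (point g h j)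
        reach₁ : ∀ i (p : i < suc l) → Reach Step (inj₁ zero) (inj₁ (fromℕ< p))
        reach₁ zero (s≤s z≤n) = here
        reach₁ (suc i) p = reach₁ i (<⇒≤ p) ▻
          inj₁ (subst₂ (λ s t → g s ⟶ g t) (sym (toℕ-fromℕ< (<⇒≤ p))) (sym (toℕ-fromℕ< p)) (Fork.arc₁ F i (≤-pred p)))
        reach₂ : ∀ i (p : suc i < suc l) → Reach Step (inj₁ zero) (inj₂ (fromℕ< p))
        reach₂ zero p = here ▻
          inj₁ (subst₂ (λ s t → s ⟶ h t) (sym (Fork.root F)) (sym (toℕ-fromℕ< p)) (Fork.arc₂ F 0 (≤-pred p)))
        reach₂ (suc i) p = reach₂ i (<⇒≤ p) ▻
          inj₁ (subst₂ (λ s t → h s ⟶ h t) (sym (toℕ-fromℕ< (<⇒≤ p))) (sym (toℕ-fromℕ< p)) (Fork.arc₂ F (suc i) (≤-pred p)))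
        reach-root : Reach Step (inj₁ zero) (inj₂ zero)
        reach-root = reach₂ 0 (s≤s (s≤s z≤n)) ▻
          inj₂ (subst (λ t → h 0 ⟶ h t) (sym (toℕ-fromℕ< {1} {suc l} (s≤s (s≤s z≤n)))) (Fork.arc₂ F 0 (s≤s z≤n)))
        reach : ∀ i → Reach Step (inj₁ zero) i
        reach (inj₁ i) = subst (λ z → Reach Step (inj₁ zero) (inj₁ z)) (fromℕ<-toℕ i (toℕ<n i)) (reach₁ (toℕ i) (toℕ<n i))
        reach (inj₂ zero) = reach-root
        reach (inj₂ (suc i)) = subst (λ z → Reach Step (inj₁ zero) (inj₂ z)) (fromℕ<-toℕ (suc i) (toℕ<n (suc i))) (reach₂ (toℕ i) (toℕ<n (suc i)))

      module _ (noDiamond : NoDiamond C) where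

        module MinimalSplit {m} (ih : ∀ {n} → n < suc m → NoSplit n) {u₀ v₀ y₀ x₀} (i₀ : ℕ)
          (u₀y₀ : u₀ ⟶ y₀) (p₀ : Path (suc m) y₀ v₀) (u₀x₀ : u₀ ⟶ x₀) (q₀ : Path i₀ x₀ v₀) (x₀≢y₀ : x₀ ≢ y₀) where

          l : ℕ
          l = suc m

          -- The matrix with rows N⁺(z_l) and columns N⁺(u) ∖ {y}, recording which pairs are
          -- joined by a directed path of length i₀, has too many rows to be a matching.
          all-split : ∀ {u y v x} → u ⟶ y → Path l y v → u ⟶ x → x ≢ y → Path i₀ x v
          all-split {u} {y} {v} {x} uy p ux x≢y with path⇒arc l p | path⇒arc l p₀
          ... | z⁻ , az⁻ , refl , refl | w⁻ , aw⁻ , refl , refl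
            with karc-transitive (ind (suc l)) (arc-cons u₀y₀ aw⁻) (arc-cons uy az⁻)
          ... | α , eq = conclude (leafMatrix {colour = λ r s → does (dec (Path i₀ s r))} core rows columns
                    (λ {β} fix e → subst (_⟶ _) (fix (l , ≤-refl , refl)) (to-arc β e))
                    (λ {β} fix (e , n) → subst (_⟶ _) (fix (0 , z≤n , refl)) (to-arc β e) ,
                       λ eq → n (to-inj β (trans eq (sym (fix (1 , s≤s z≤n , refl))))))
                    (λ {β} _ {r} {s} → does-≡
                       (λ p → subst₂ (Path i₀) (from∘to β s) (from∘to β r) (path-aut homogeneousDigraph (inverse β) i₀ p))
                       (path-aut homogeneousDigraph β i₀)))
            where
            z : ℕ → V
            z = cons u z⁻
            az : Arc (suc l) z
            az = arc-cons uy az⁻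
            al : Arc l z
            al = arc-≤ (n≤1+n l) az
            Q R S : V → Set
            Q v = ∃[ i ] (i ≤ l × z i ≡ v)
            R r = z l ⟶ r
            S s = u ⟶ s × s ≢ y
            core : Core Q
            core = record { listing = listing-up-to z l ; root = u ; root∈Q = 0 , z≤n , refl ; reach = λ { (i , p , refl) → reach i p } }
              where
              reach : ∀ i → i ≤ l → Reach (λ a b → Q b × Adj a b) u (z i)
              reach zero _ = here
              reach (suc i) p = reach i (<⇒≤ p) ▻ ((suc i , p , refl) , inj₁ (al i p))
            free-row : ∀ {r} i → i ≤ l → R r → z i ≢ z l → ¬ Adj r (z i)
            free-row {r} i p e n (inj₁ a) = contradiction
              (ind (suc l) (snoc z l r) (arc-snoc al e) (suc l) i ≤-refl (m≤n⇒m≤1+n p)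
                (subst₂ _⟶_ (sym (snoc-> {z} l)) (sym (snoc-≤ {z} {l} {r} p)) a))
              λ { refl → <-irrefl refl (<⇒≤ p) }
            free-row {r} i p e n (inj₂ a) = n (cong z (suc-injective (sym
              (ind (suc l) (snoc z l r) (arc-snoc al e) i (suc l) (m≤n⇒m≤1+n p) ≤-refl
                (subst₂ _⟶_ (sym (snoc-≤ {z} {l} {r} p)) (sym (snoc-> {z} l)) a)))))
            rows : Leaves Q R
            rows = record
              { listing = out-listing (z l)
              ; disjoint = λ { e (i , p , refl) → <-irrefl refl (subst (_≤ l) (ind l z al l i ≤-refl p e) p) }
              ; colour = λ _ _ → κ≡ ; stem = z l ; stem∈Q = l , ≤-refl , refl ; attached = inj₁ λ e → e
              ; independent = λ e e′ f → triangleFree (inj₁ e) (inj₁ f) (inj₁ e′)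
              ; free = λ { e (i , p , refl) n a → free-row i p e n a } }
            columns : Leaves Q S
            columns = record
              { listing = listing-⊆ proj₁ (out-listing u)
              ; disjoint = λ { (e , _) (zero , _ , refl) → irrefl e
                             ; (e , n) (suc i , p , refl) → n (ih p 0 uy (arc⇒path (arc-tail az) 0 i (<⇒≤ p)) e refl) }
              ; colour = λ _ _ → κ≡ ; stem = u ; stem∈Q = 0 , z≤n , refl ; attached = inj₁ proj₁
              ; independent = λ (e , _) (e′ , _) f → triangleFree (inj₁ e) (inj₁ f) (inj₁ e′)
              ; free = λ { _ (zero , _ , refl) n _ → n refl
                         ; (e , n) (suc i , p , refl) _ (inj₁ a) → n (ih p 1 uy (arc⇒path (arc-tail az) 0 i (<⇒≤ p)) e (_ , a , refl))
                         ; (e , _) (suc i , p , refl) _ (inj₂ a) → contradiction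
                             (no-chord (suc (suc i)) (path-snoc (suc i) (arc⇒path az 0 (suc i) (m≤n⇒m≤1+n p)) a) e) λ () } }
            zl⟶v : R (z⁻ l)
            zl⟶v = az l ≤-refl
            conclude : Constant R S (λ r s → does (dec (Path i₀ s r))) ⊎ Matching R S (λ r s → does (dec (Path i₀ s r))) → Path i₀ x (z⁻ l)
            conclude (inj₁ constant) = true-does (trans (constant zl⟶v zl⟶v (ux , x≢y) image) (does-true image-path))
              where
              image : S (to α x₀)
              image = subst (_⟶ _) (eq 0 z≤n) (to-arc α u₀x₀) ,
                      λ eq′ → x₀≢y₀ (to-inj α (trans eq′ (sym (eq 1 (s≤s z≤n)))))
              image-path : Path i₀ (to α x₀) (z⁻ l)
              image-path = subst (Path i₀ (to α x₀)) (eq (suc l) ≤-refl) (path-aut homogeneousDigraph α i₀ q₀)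
            conclude (inj₂ μ) = ⊥-elim (conflict (out-surjective (λ a b → Matching.θ μ a ≡ b)
                (λ e → Matching.θ μ _ , proj₁ (Matching.θ∈S μ e) , refl)
                (λ e e′ r r′ → Matching.θ-inj μ e e′ (trans r (sym r′))) uy))
              where
              conflict : ¬ (∃[ a ] (z l ⟶ a × Matching.θ μ a ≡ z⁻ 0))
              conflict (a , e , eq) = proj₂ (Matching.θ∈S μ e) eq

          l≤i₀ : l ≤ i₀
          l≤i₀ = ≮⇒≥ λ i₀<l → x₀≢y₀ (sym (ih i₀<l l u₀x₀ q₀ u₀y₀ p₀))

          split-path : ∀ d {x v} → Path (l + d) x v → ∃[ c ] (Path l x c × Path d c v)
          split-path d = go l
            where
            go : ∀ l {x v} → Path (l + d) x v → ∃[ c ] (Path l x c × Path d c v)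
            go zero p = _ , refl , p
            go (suc l) (w , a , p) = let (c , q , r) = go l p in c , (w , a , q) , r

          -- If `i₀` exceeded `l`, let `c` be the vertex `l` steps along `q₀`. Applying `all-split`
          -- with `x₀` and `y₀` exchanged takes `y₀` to `c` in `i₀` steps, and on to `v₀` by a path
          -- too long to agree with `p₀`.
          i₀≡l : i₀ ≡ l
          i₀≡l with m≤n⇒∃[o]m+o≡n l≤i₀
          ... | zero , eq = trans (sym eq) (+-identityʳ l)
          ... | suc d , refl =
            let (c , q , r) = split-path (suc d) q₀
                long = path-++ (l + suc d) (all-split u₀x₀ q u₀y₀ (λ eq → x₀≢y₀ (sym eq))) r
            in ⊥-elim (m≢1+m+n l (trans (lengths-agree l ih _ p₀ long) (arith l d)))
            where
            arith : ∀ l d → l + suc d + suc d ≡ suc (l + (d + suc d))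
            arith l d = trans (+-assoc l (suc d) (suc d)) (+-suc l (d + suc d))

        -- Two distinct children of one vertex have descendants, l steps below the vertex, with a common out-neighbour;
        -- using this below a child y of u and across two children of u produces a diamond.
        module LongSplit {m} (ih : ∀ {n} → n < suc (suc m) → NoSplit n) {u₀ v₀ y₀ x₀}
          (u₀y₀ : u₀ ⟶ y₀) (p₀ : Path (suc (suc m)) y₀ v₀) (u₀x₀ : u₀ ⟶ x₀) (q₀ : Path (suc (suc m)) x₀ v₀) (x₀≢y₀ : x₀ ≢ y₀) where

          l : ℕ
          l = suc (suc m)

          fork : ∀ {u x y g h} → u ⟶ y → u ⟶ x → x ≢ y → g 0 ≡ y → h 0 ≡ x → Arc (suc m) g → Arc (suc m) h →
                 Fork l (cons u g) (cons u h)
          fork {u} {x} {y} {g} {h} uy ux x≢y refl refl ag ah = record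
            { arc₁ = arc-cons uy ag ; arc₂ = arc-cons ux ah ; root = refl
            ; cross = cross }
            where
            cross : ∀ {i j} → suc i ≤ l → suc j ≤ l → g i ≢ h j × ¬ Adj (g i) (h j)
            cross {i} {j} (s≤s p) (s≤s q) =
                (λ eq → x≢y (ih (s≤s p) j uy (arc⇒path ag 0 i p) ux (subst (Path j _) (sym eq) (arc⇒path ah 0 j q)))) ,
                λ { (inj₁ a) → x≢y (sym (ih (s≤s q) (suc i) ux (arc⇒path ah 0 j q) uy (path-snoc i (arc⇒path ag 0 i p) a)))
                  ; (inj₂ a) → x≢y (ih (s≤s p) (suc j) uy (arc⇒path ag 0 i p) ux (path-snoc j (arc⇒path ah 0 j q) a)) }

          meet : ∀ {u x y a b} → u ⟶ y → u ⟶ x → x ≢ y → Path (suc m) y a → Path (suc m) x b → ∃[ v ] (a ⟶ v × b ⟶ v)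
          meet uy ux x≢y pa pb with path-unsnoc (suc m) p₀ | path-unsnoc (suc m) q₀
          ... | a₀ , pa₀ , a₀v₀ | b₀ , pb₀ , b₀v₀
            with path⇒arc (suc m) pa | path⇒arc (suc m) pb | path⇒arc (suc m) pa₀ | path⇒arc (suc m) pb₀
          ... | g , ag , g0 , refl | h , ah , h0 , refl | g₀ , ag₀ , g₀0 , refl | h₀ , ah₀ , h₀0 , refl
            with fork-transitive (fork u₀y₀ u₀x₀ x₀≢y₀ g₀0 h₀0 ag₀ ah₀) (fork uy ux x≢y g0 h0 ag ah)
          ... | α , eq , eq′ = to α v₀ , subst (_⟶ _) eq (to-arc α a₀v₀) , subst (_⟶ _) eq′ (to-arc α b₀v₀)

          contradictory : ⊥
          contradictory with vertex-transitive u₀ y₀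
          ... | α , refl =
            let a₁ = to α y₀ ; a₂ = to α x₀
                ya₁ = to-arc α u₀y₀ ; ya₂ = to-arc α u₀x₀
                a₂≢a₁ = λ eq → x₀≢y₀ (to-inj α eq)
                (q₁ , d₁) = path-forward m a₁ ; (q₂ , d₂) = path-forward m a₂
                (t , dt) = path-forward (suc m) x₀
                (s₁ , q₁s₁ , ts₁) = meet u₀y₀ u₀x₀ x₀≢y₀ (a₁ , ya₁ , d₁) dt
                (s₂ , q₂s₂ , ts₂) = meet u₀y₀ u₀x₀ x₀≢y₀ (a₂ , ya₂ , d₂) dt
                e₁ = path-snoc m d₁ q₁s₁ ; e₂ = path-snoc m d₂ q₂s₂
                s₁≢s₂ = λ eq → a₂≢a₁ (ih ≤-refl (suc m) ya₁ e₁ ya₂ (subst (Path (suc m) a₂) (sym eq) e₂))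
                (v , s₁v , s₂v) = meet ya₁ ya₂ a₂≢a₁ e₁ e₂
            in s₁≢s₂ (noDiamond ts₁ ts₂ s₁v s₂v)

        -- For length zero a split is a chord of a directed path, and for length one a diamond,
        -- because `i₀≡l` equalises the two lengths. All longer splits fall to `LongSplit`.
        noSplit : ∀ l → NoSplit l
        noSplit = <-rec NoSplit step
          where
          step : ∀ l → (∀ {m} → m < l → NoSplit m) → NoSplit l
          step zero ih i uy refl ux q with no-chord (suc i) (_ , ux , q) uy
          step zero ih zero uy refl ux refl | refl = refl
          step (suc zero) ih i uy p ux q = dne λ n → short uy ux n (MinimalSplit.i₀≡l ih i uy p ux q n) p q
            where
            short : ∀ {u v y x i} → u ⟶ y → u ⟶ x → x ≢ y → i ≡ 1 → Path 1 y v → Path i x v → ⊥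
            short uy ux n refl (_ , a , refl) (_ , b , refl) = n (noDiamond ux uy b a)
          step (suc (suc m)) ih i uy p ux q = dne λ n →
            LongSplit.contradictory ih uy p ux (subst (λ k → Path k _ _) (MinimalSplit.i₀≡l ih i uy p ux q n) q) n

    -- If there are diamonds, D is a bi-infinite sequence of finite levels with all arcs from each level to the next.
    module TwoEnds (C : TriangleFreeCHD) where
      open Basics C

      record RayIn : Set where
        field
          vertex    : ℕ → V
          injective : Injective _≡_ _≡_ vertex
          adjacent  : ∀ n → Adj (vertex n) (vertex (suc n))
      open RayIn

      Meets : RayIn → RayIn → Set
      Meets r s = ∀ N → ∃[ n ] (N ≤ n × ∃[ m ] (vertex r n ≡ vertex s m))

      up : ℕ → V
      up = forward-arc base

      up-arc : ∀ n → up n ⟶ up (suc n)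
      up-arc n = proj₂ (has-succ (up n))

      up-path : ∀ n d → Paths.Path _⟶_ d (up n) (up (n + d))
      up-path n zero = cong up (sym (+-identityʳ n))
      up-path n (suc d) = up (suc n) , up-arc n , subst (λ z → Paths.Path _⟶_ d (up (suc n)) (up z)) (sym (+-suc n d)) (up-path (suc n) d)

      Up : ℕ → V → Set
      Up n v = up n ⟶ v

      -- The arc from `up m` to `v` would be a chord of the directed path that goes through `up n`
      -- to `v`.
      Up-disjoint : ∀ {m n v} → m < n → Up m v → ¬ Up n v
      Up-disjoint {m} m<n a b with m≤n⇒∃[o]m+o≡n m<n
      ... | d , refl with DirectedPaths.no-chord C (suc (suc d))
                            (up (suc m) , up-arc m , Paths.path-snoc _⟶_ d (up-path (suc m) d) b) a
      ... | ()

      Up-unique : ∀ {m n v} → Up m v → Up n v → m ≡ n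
      Up-unique {m} {n} a b with <-cmp m n
      ... | tri≈ _ eq _ = eq
      ... | tri< m<n _ _ = ⊥-elim (Up-disjoint {m} {n} m<n a b)
      ... | tri> _ _ n<m = ⊥-elim (Up-disjoint {n} {m} n<m b a)

      High : RayIn → Set
      High r = ∀ N → ∃[ n ] (N ≤ n × ∃[ k ] Up n (vertex r k))

      module _ (complete : ∀ {w a v s} → w ⟶ a → a ⟶ v → w ⟶ s → s ⟶ v)
               (complete′ : ∀ {w a v p} → w ⟶ a → a ⟶ v → p ⟶ v → w ⟶ p) where

        Up-next : ∀ {n v v′} → Up n v → v ⟶ v′ → Up (suc n) v′
        Up-next {n} a b = complete a b (up-arc n)

        Up-prev : ∀ {n v v′} → Up (suc n) v → v′ ⟶ v → Up n v′
        Up-prev {n} a b = complete′ (up-arc n) a b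

        even : ℕ → Bool
        even zero    = true
        even (suc n) = not (even n)

        flip-parity : ∀ b {c} → c ≡ not b → b ≡ true ⊎ c ≡ true
        flip-parity true _ = inj₁ refl
        flip-parity false eq = inj₂ eq

        Visits : RayIn → ℕ → Set
        Visits r n = ∃[ k ] Up n (vertex r k)

        -- Consecutive vertices of a ray lie on consecutive levels, so a high ray visits high levels of either parity.
        visits-parity : ∀ r → High r → ∀ (f : ℕ → Bool) → (∀ n → f (suc n) ≡ not (f n)) → ∀ N → ∃[ n ] (N ≤ n × f n ≡ true × Visits r n)
        visits-parity r high f f-suc N with high (suc N)
        ... | suc n , s≤s N≤n , k , a with adjacent r k
        ... | inj₁ b = choose-parity (flip-parity (f (suc n)) (f-suc (suc n)))
          where
          choose-parity : f (suc n) ≡ true ⊎ f (suc (suc n)) ≡ true → _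
          choose-parity (inj₁ eq) = suc n , m≤n⇒m≤1+n N≤n , eq , k , a
          choose-parity (inj₂ eq) = suc (suc n) , m≤n⇒m≤1+n (m≤n⇒m≤1+n N≤n) , eq , suc k , Up-next {suc n} a b
        ... | inj₂ b = choose-parity (flip-parity (f n) (f-suc n))
          where
          choose-parity : f n ≡ true ⊎ f (suc n) ≡ true → _
          choose-parity (inj₂ eq) = suc n , m≤n⇒m≤1+n N≤n , eq , k , a
          choose-parity (inj₁ eq) = n , N≤n , eq , suc k , Up-prev {n} a b

        pick : ∀ r n → ∃[ v ] (Up n v × (Visits r n → ∃[ k ] v ≡ vertex r k))
        pick r n with dec (Visits r n)
        ... | yes (k , a) = vertex r k , a , λ _ → k , refl
        -- A level that the ray misses is represented by the reference arc `up`.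
        ... | no none = up (suc n) , up-arc n , λ v → contradiction v none

        -- All arcs between consecutive levels exist, so one vertex can be chosen freely on each
        -- level. Taking vertices of `r` on even and of `s` on odd positions, where possible, gives
        -- a ray that meets both infinitely often.
        highRays-same : ∀ r s → High r → High s → ∃[ t ] (Meets t r × Meets t s)
        highRays-same r s high-r high-s = t , meets-r , meets-s
          where
          tv : ℕ → V
          tv n = if even n then proj₁ (pick r n) else proj₁ (pick s n)
          tv-up : ∀ n → Up n (tv n)
          tv-up n with even n
          ... | true = proj₁ (proj₂ (pick r n))
          ... | false = proj₁ (proj₂ (pick s n))
          t : RayIn
          t = record
            { vertex = tv
            ; injective = λ {m} {n} eq → Up-unique {m} {n} (tv-up m) (subst (Up n) (sym eq) (tv-up n))
            ; adjacent = λ n → inj₁ (complete (up-arc n) (tv-up (suc n)) (tv-up n)) }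
          meets-r : Meets t r
          meets-r N with visits-parity r high-r even (λ _ → refl) N
          ... | n , N≤n , eq , visit = n , N≤n , hit
            where
            hit : ∃[ k ] tv n ≡ vertex r k
            hit with even n
            hit | true = proj₂ (proj₂ (pick r n)) visit
          meets-s : Meets t s
          meets-s N with visits-parity s high-s (λ n → not (even n)) (λ _ → refl) N
          ... | n , N≤n , eq , visit = n , N≤n , hit
            where
            hit : ∃[ k ] tv n ≡ vertex s k
            hit with even n
            hit | false = proj₂ (proj₂ (pick s n)) visit

    module _ (C : TriangleFreeCHD) where
      open Basics C

      module _ (complete : ∀ {w a v s} → w ⟶ a → a ⟶ v → w ⟶ s → s ⟶ v)
               (complete′ : ∀ {w a v p} → w ⟶ a → a ⟶ v → p ⟶ v → w ⟶ p) where

        private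
          module ↑ = TwoEnds C
          module ↓ = TwoEnds (op C)

        opRay : ↑.RayIn → ↓.RayIn
        opRay r = record { vertex = ↑.RayIn.vertex r ; injective = ↑.RayIn.injective r ; adjacent = λ n → swap (↑.RayIn.adjacent r n) }

        -- The levels above `base`, the level of `base` itself, recognised by the arcs to `up 1`,
        -- and the levels below.
        Level : V → Set
        Level v = (∃[ n ] ↑.Up n v) ⊎ (v ⟶ ↑.up 1) ⊎ (∃[ n ] ↓.Up n v)

        levels-cover : ∀ v → Level v
        levels-cover v = go (connected base v)
          where
          below : ∀ {v v′} → v ⟶ ↑.up 1 → v′ ⟶ v → ↓.Up 0 v′
          below v→ v′v = complete′ v′v v→ (↑.up-arc 0)
          above : ∀ {v v′} → v ⟶ ↑.up 1 → v ⟶ v′ → ↑.Up 0 v′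
          above v→ vv′ = complete (complete′ (↓.up-arc 0) (↑.up-arc 0) v→) vv′ (↓.up-arc 0)
          down-mid : ∀ {v v′} → ↓.Up 0 v → v ⟶ v′ → v′ ⟶ ↑.up 1
          down-mid v→ vv′ = complete v→ (↑.up-arc 0) vv′
          up-mid : ∀ {v v′} → ↑.Up 0 v → v′ ⟶ v → v′ ⟶ ↑.up 1
          up-mid →v v′v = complete′ v′v (complete (↑.up-arc 0) (↑.up-arc 1) →v) (↑.up-arc 1)
          step : ∀ {v v′} → Level v → Adj v v′ → Level v′
          step (inj₁ (n , a)) (inj₁ b) = inj₁ (suc n , ↑.Up-next complete complete′ {n} a b)
          step (inj₁ (zero , a)) (inj₂ b) = inj₂ (inj₁ (up-mid a b))
          step (inj₁ (suc n , a)) (inj₂ b) = inj₁ (n , ↑.Up-prev complete complete′ {n} a b)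
          step (inj₂ (inj₁ a)) (inj₁ b) = inj₁ (0 , above a b)
          step (inj₂ (inj₁ a)) (inj₂ b) = inj₂ (inj₂ (0 , below a b))
          step (inj₂ (inj₂ (n , a))) (inj₂ b) = inj₂ (inj₂ (suc n , complete′ b a (↓.up-arc n)))
          step (inj₂ (inj₂ (zero , a))) (inj₁ b) = inj₂ (inj₁ (down-mid a b))
          step (inj₂ (inj₂ (suc n , a))) (inj₁ b) = inj₂ (inj₂ (n , complete a (↓.up-arc n) b))
          go : ∀ {v} → Reach Adj base v → Level v
          go here = inj₂ (inj₁ (↑.up-arc 0))
          go (r ▻ a) = step (go r) a

        -- A ray that is bounded in both directions stays in finitely many levels, which are finite,
        -- and would have to repeat a vertex.
        high-or-low : ∀ r → ↑.High r ⊎ ↓.High (opRay r)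
        high-or-low r with dec (↑.High r) | dec (↓.High (opRay r))
        ... | yes h | _ = inj₁ h
        ... | no _ | yes l = inj₂ l
        ... | no ¬h | no ¬l with ¬∀⇒∃¬ ¬h | ¬∀⇒∃¬ ¬l
        ... | M , bounded | N , bounded′ with repetition (↑.RayIn.vertex r) (proj₁ listing) (λ k → proj₂ listing (low (levels-cover (↑.RayIn.vertex r k)) k refl))
          where
          Bounded : V → Set
          Bounded v = (∃[ n ] (n ≤ M × ↑.Up n v)) ⊎ (v ⟶ ↑.up 1) ⊎ (∃[ n ] (n ≤ N × ↓.Up n v))
          from-list : ∀ (x : ℕ → V) (R : V → V → Set) → (∀ v → Listing (R v)) → ∀ M → Listing (λ v → ∃[ n ] (n ≤ M × R (x n) v))
          from-list x R l M = listing-⊆ (λ (n , p , a) → x n , (n , p , refl) , a) (listing-∃ (listing-up-to x M) l)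
          listing : Listing Bounded
          listing = listing-∪ (from-list ↑.up _⟶_ out-listing M)
                      (listing-∪ (in-listing (↑.up 1)) (from-list ↓.up (flip _⟶_) in-listing N))
          low : ∀ {v} → Level v → ∀ k → ↑.RayIn.vertex r k ≡ v → Bounded v
          low (inj₁ (n , a)) k refl = inj₁ (n , <⇒≤ (≰⇒> λ M≤n → bounded (n , M≤n , k , a)) , a)
          low (inj₂ (inj₁ a)) k eq = inj₂ (inj₁ a)
          low (inj₂ (inj₂ (n , a))) k refl = inj₂ (inj₂ (n , <⇒≤ (≰⇒> λ N≤n → bounded′ (n , N≤n , k , a)) , a))
        ... | i , d , eq = ⊥-elim (m≢1+m+n i (trans (↑.RayIn.injective r eq) (+-suc i d)))

        two-ends : ∀ r s t → (∃[ q ] (↑.Meets q r × ↑.Meets q s)) ⊎ (∃[ q ] (↑.Meets q r × ↑.Meets q t)) ⊎ (∃[ q ] (↑.Meets q s × ↑.Meets q t))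
        two-ends r s t = choose-pair (high-or-low r) (high-or-low s) (high-or-low t)
          where
          Same : ↑.RayIn → ↑.RayIn → Set
          Same r s = ∃[ q ] (↑.Meets q r × ↑.Meets q s)
          both-high : ∀ r s → ↑.High r → ↑.High s → Same r s
          both-high = ↑.highRays-same complete complete′
          both-low : ∀ r s → ↓.High (opRay r) → ↓.High (opRay s) → Same r s
          both-low r s h h′ =
            let (q , m , m′) = ↓.highRays-same (λ a b c → complete′ b a c) (λ a b c → complete b a c) (opRay r) (opRay s) h h′
            in record { vertex = ↓.RayIn.vertex q ; injective = ↓.RayIn.injective q ; adjacent = λ n → swap (↓.RayIn.adjacent q n) } , m , m′
          choose-pair : ↑.High r ⊎ ↓.High (opRay r) → ↑.High s ⊎ ↓.High (opRay s) → ↑.High t ⊎ ↓.High (opRay t) →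
                        Same r s ⊎ Same r t ⊎ Same s t
          choose-pair (inj₁ a) (inj₁ b) _ = inj₁ (both-high r s a b)
          choose-pair (inj₂ a) (inj₂ b) _ = inj₁ (both-low r s a b)
          choose-pair (inj₁ a) (inj₂ b) (inj₁ c) = inj₂ (inj₁ (both-high r t a c))
          choose-pair (inj₂ a) (inj₁ b) (inj₂ c) = inj₂ (inj₁ (both-low r t a c))
          choose-pair (inj₁ a) (inj₂ b) (inj₂ c) = inj₂ (inj₂ (both-low s t b c))
          choose-pair (inj₂ a) (inj₁ b) (inj₁ c) = inj₂ (inj₂ (both-high s t b c))

  -- Walks, routes and rooted structure in trees

  module Trees where

    open import Data.Fin.Base using (fromℕ)
    open import Data.Fin.Properties using (toℕ<n; toℕ-fromℕ<; toℕ-injective; toℕ-fromℕ)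
    open import Data.List.Base using (length; lookup)
    open import Data.List.Properties using (∷-injectiveˡ)
    open import Data.List.Relation.Unary.All using (All; []; _∷_) renaming (lookup to All-lookup; tabulate to All-tabulate)
    open import Data.List.Relation.Unary.AllPairs using ([]; _∷_)
    open import Data.List.Relation.Unary.Any using (here; there; index)
    open import Data.List.Relation.Unary.Any.Properties using (lookup-index)
    open import Data.List.Relation.Unary.Unique.Propositional using (Unique)
    open import Data.Nat.Properties hiding (_≟_)
    open Base
    open import Defs using (Graph; Cycle; CyclicSuc; IsTree)

    module Walks (G : Graph) where
      open Graph G

      data NonBacktracking : List V → Set where
        single : ∀ {u} → NonBacktracking (u ∷ [])
        pair   : ∀ {u v} → u ~ v → NonBacktracking (u ∷ v ∷ [])
        step   : ∀ {u v w l} → u ~ v → u ≢ w → NonBacktracking (v ∷ w ∷ l) → NonBacktracking (u ∷ v ∷ w ∷ l)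

      consecutive : ∀ {l} → NonBacktracking l → ∀ i j → toℕ j ≡ suc (toℕ i) → lookup l i ~ lookup l j
      consecutive single zero zero ()
      consecutive (pair a) zero (suc zero) _ = a
      consecutive (pair a) (suc zero) (suc zero) ()
      consecutive (step a n w) zero (suc zero) _ = a
      consecutive (step a n w) zero (suc (suc j)) ()
      consecutive (step a n w) (suc i) (suc j) eq = consecutive w i j (suc-injective eq)

      far : ∀ {u l} → NonBacktracking (u ∷ l) → (m : u ∈ l) → 2 ≤ toℕ (index m)
      far (pair a) (here refl) = ⊥-elim (irrefl refl a)
      far (step a n w) (here refl) = ⊥-elim (irrefl refl a)
      far (step a n w) (there (here refl)) = ⊥-elim (n refl)
      far (step a n w) (there (there m)) = s≤s (s≤s z≤n)

      -- The cycle consists of `u` and the entries of `l` before `u` reappears at position `k`.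
      -- Since the walk does not backtrack, `k` is at least two, which makes the length at least
      -- three.
      closing-cycle : ∀ {u l} → NonBacktracking (u ∷ l) → Unique l → u ∈ l → Cycle G
      closing-cycle {u} {l} w uniq m = record
        { len = suc k ; 3≤len = s≤s (far w m) ; vertex = vertex ; injective = λ {i} {j} → injective i j ; adjacent = λ {i} {j} → adjacent i j }
        where
        k : ℕ
        k = toℕ (index m)
        bound : ∀ {i} → i < suc k → i < suc (length l)
        bound p = ≤-trans p (s≤s (<⇒≤ (toℕ<n (index m))))
        at : (i : Fin (suc k)) → Fin (suc (length l))
        at i = fromℕ< (bound (toℕ<n i))
        toℕ-at : ∀ i → toℕ (at i) ≡ toℕ i
        toℕ-at i = toℕ-fromℕ< (bound (toℕ<n i))
        vertex : Fin (suc k) → V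
        vertex i = lookup (u ∷ l) (at i)
        early : ∀ i → toℕ i < k → lookup l i ≢ u
        early i p eq = <-irrefl (cong toℕ (lookup-injective uniq i (index m) (trans eq (lookup-index m)))) p
        lookup-inj : ∀ (i j : Fin (suc (length l))) → toℕ i ≤ k → toℕ j ≤ k → lookup (u ∷ l) i ≡ lookup (u ∷ l) j → i ≡ j
        lookup-inj zero zero p q eq = refl
        lookup-inj zero (suc j) p q eq = ⊥-elim (early j q (sym eq))
        lookup-inj (suc i) zero p q eq = ⊥-elim (early i p eq)
        lookup-inj (suc i) (suc j) p q eq = cong suc (lookup-injective uniq i j eq)
        at≤ : ∀ i → toℕ (at i) ≤ k
        at≤ i = subst (_≤ k) (sym (toℕ-at i)) (≤-pred (toℕ<n i))
        injective : ∀ i j → vertex i ≡ vertex j → i ≡ j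
        injective i j eq = toℕ-injective (trans (sym (toℕ-at i))
          (trans (cong toℕ (lookup-inj (at i) (at j) (at≤ i) (at≤ j) eq)) (toℕ-at j)))
        adjacent : ∀ i j → CyclicSuc i j → vertex i ~ vertex j
        adjacent i j (inj₁ eq) = consecutive w (at i) (at j) (trans (toℕ-at j) (trans eq (cong suc (sym (toℕ-at i)))))
        adjacent i zero (inj₂ (eq , _)) = subst (vertex i ~_) (sym (lookup-index m))
          (consecutive w (at i) (suc (index m)) (cong suc (trans (suc-injective (sym eq)) (sym (toℕ-at i)))))
        adjacent i (suc j) (inj₂ (_ , ()))

      unique-or-cycle : ∀ {l} → NonBacktracking l → Unique l ⊎ Cycle G
      unique-or-cycle single = inj₁ ([] ∷ [])
      unique-or-cycle w@(pair {u} {v} a) = inj₁ (((λ { refl → irrefl refl a }) ∷ []) ∷ ([] ∷ []))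
      unique-or-cycle w@(step {u} {v} {x} {l} a n w′) with unique-or-cycle w′
      ... | inj₂ c = inj₂ c
      ... | inj₁ uniq with dec (u ∈ v ∷ x ∷ l)
      ... | yes m = inj₂ (closing-cycle w uniq m)
      ... | no ∉ = inj₁ (All-tabulate (λ m → λ { refl → ∉ m }) ∷ uniq)

      module _ (acyclic : ¬ Cycle G) where

        walk-unique : ∀ {l} → NonBacktracking l → Unique l
        walk-unique w with unique-or-cycle w
        ... | inj₁ u = u
        ... | inj₂ c = ⊥-elim (acyclic c)

        not-closed : ∀ {u l} → NonBacktracking (u ∷ l) → u ∉ l
        not-closed w m with walk-unique w
        ... | h ∷ _ = All-lookup h m refl

      -- Walks to the fixed end `r` without backtracking, listed from their start, so that the list
      -- of a parent is the tail of the list of its child.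
      data Route (r : V) : V → List V → Set where
        stop  : Route r r (r ∷ [])
        first : ∀ {x} → x ~ r → Route r x (x ∷ r ∷ [])
        next  : ∀ {x y w l} → x ~ y → x ≢ w → Route r y (y ∷ w ∷ l) → Route r x (x ∷ y ∷ w ∷ l)

      route-walk : ∀ {r x l} → Route r x l → NonBacktracking l
      route-walk stop = single
      route-walk (first a) = pair a
      route-walk (next a n ρ) = step a n (route-walk ρ)

      route-end : ∀ {r x l} → Route r x l → r ∈ l
      route-end stop = here refl
      route-end (first a) = there (here refl)
      route-end (next a n ρ) = there (route-end ρ)

      extend-route : ∀ {r x y l} → x ~ y → Route r y l → ∃[ l′ ] (Route r x l′ × (l′ ≡ x ∷ l ⊎ l ≡ y ∷ l′))
      extend-route a stop = _ , first a , inj₁ refl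
      extend-route {r} {x} a (first b) with x ≟ r
      ... | yes refl = _ , stop , inj₂ refl
      ... | no n = _ , next a n (first b) , inj₁ refl
      extend-route {r} {x} a (next {y = y₁} b n ρ) with x ≟ y₁
      ... | yes refl = _ , ρ , inj₂ refl
      ... | no m = _ , next a m (next b n ρ) , inj₁ refl

      data Second≢ (x : V) : List V → Set where
        long  : ∀ {y w l} → w ≢ x → Second≢ x (y ∷ w ∷ l)

      -- Glues the reversal of a route to a walk that sets out from the same vertex in another
      -- direction, which `Second≢` ensures. If that walk also ends in `r`, the result is a closed
      -- walk without backtracking, impossible in a tree.
      reverse-onto : ∀ {r y l x m} → Route r y l → NonBacktracking (y ∷ x ∷ m) → Second≢ x l →
                     ∃[ m′ ] (NonBacktracking (r ∷ m′) × (∀ {v} → v ∈ x ∷ m → v ∈ m′))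
      reverse-onto stop w _ = _ , w , λ i → i
      reverse-onto (first a) w (long n) = _ , step (~-sym a) n w , there
      reverse-onto (next a n ρ) w (long m) with reverse-onto ρ (step (~-sym a) m w) (long (λ eq → n (sym eq)))
      ... | m′ , w′ , sub = m′ , w′ , λ i → sub (there i)

      module _ (acyclic : ¬ Cycle G) where

        route-unique : ∀ {r x l l′} → Route r x l → Route r x l′ → l ≡ l′
        route-unique stop stop = refl
        route-unique stop ρ@(first _) = ⊥-elim (not-closed acyclic (route-walk ρ) (here refl))
        route-unique stop ρ@(next _ _ ρ′) = ⊥-elim (not-closed acyclic (route-walk ρ) (route-end ρ′))
        route-unique ρ@(first _) stop = ⊥-elim (not-closed acyclic (route-walk ρ) (here refl))
        route-unique ρ@(next _ _ ρ′) stop = ⊥-elim (not-closed acyclic (route-walk ρ) (route-end ρ′))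
        route-unique (first a) (first _) = refl
        route-unique {r} {x} (first a) (next {y = y} b n ρ) =
          ⊥-elim (not-closed acyclic (step (~-sym a) (r≢y ρ) (route-walk (next b n ρ))) (there (route-end ρ)))
          where
          r≢y : ∀ {w l} → Route r y (y ∷ w ∷ l) → r ≢ y
          r≢y (first a) refl = irrefl refl a
          r≢y ρ@(next _ _ ρ′) refl = not-closed acyclic (route-walk ρ) (route-end ρ′)
        route-unique {r} {x} (next {y = y} b n ρ) (first a) =
          ⊥-elim (not-closed acyclic (step (~-sym a) (r≢y ρ) (route-walk (next b n ρ))) (there (route-end ρ)))
          where
          r≢y : ∀ {w l} → Route r y (y ∷ w ∷ l) → r ≢ y
          r≢y (first a) refl = irrefl refl a
          r≢y ρ@(next _ _ ρ′) refl = not-closed acyclic (route-walk ρ) (route-end ρ′)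
        route-unique {x = x} (next {y = y} {w} a n ρ) (next {y = y′} a′ n′ ρ′) with y ≟ y′
        ... | yes refl = cong (x ∷_) (route-unique ρ ρ′)
        ... | no y≢y′ with reverse-onto ρ (step (~-sym a) y≢y′ (route-walk (next a′ n′ ρ′))) (long (λ eq → n (sym eq)))
        ... | m , walk , sub = ⊥-elim (not-closed acyclic walk (sub (there (route-end ρ′))))

    record Rooted (G : Graph) (r : Graph.V G) : Set where
      open Graph G
      field
        path       : V → List V
        path-root  : path r ≡ r ∷ []
        path-head  : ∀ x → ∃[ l ] path x ≡ x ∷ l
        path-edge  : ∀ {x y} → x ~ y → path x ≡ x ∷ path y ⊎ path y ≡ y ∷ path x
        path-route : ∀ x → Walks.Route G r x (path x)
        parent     : ∀ x → x ≡ r ⊎ (∃[ p ] (x ~ p × path x ≡ x ∷ path p))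

      path-injective : ∀ {x y} → path x ≡ path y → x ≡ y
      path-injective {x} {y} eq with path-head x | path-head y
      ... | l , e | l′ , e′ = ∷-injectiveˡ (trans (sym e) (trans eq e′))

      path-self : ∀ x → x ∈ path x
      path-self x = let (l , e) = path-head x in subst (x ∈_) (sym e) (here refl)

      -- `u ∈ path x` says that `x` lies in the subtree hanging from `u`. The only edge into this
      -- subtree is the one from the parent of `u` to `u`.
      enter-subtree : ∀ {u x y} → x ~ y → u ∉ path x → u ∈ path y → u ≡ y × path y ≡ y ∷ path x
      enter-subtree {u} {x} {y} a n m with path-edge a
      ... | inj₁ eq = contradiction (subst (u ∈_) (sym eq) (there m)) n
      ... | inj₂ eq with subst (u ∈_) eq m
      ...   | here e = e , eq
      ...   | there m′ = contradiction m′ n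

    tree⇒rooted-construction : ∀ {G} → IsTree G → ∀ r → Rooted G r
    tree⇒rooted-construction {G} ((_ , connected) , acyclic) r = record
      { path = path ; path-root = route-unique acyclic (route r) stop
      ; path-head = λ x → head (route x)
      ; path-edge = λ a → edge a (extend-route a (route _))
      ; path-route = route ; parent = parent }
      where
      open Graph G
      open Walks G
      routes : ∀ {x} → Star _~_ x r → ∃[ l ] Route r x l
      routes ε = _ , stop
      routes (a ◅ s) = let (l , ρ) = routes s ; (l′ , ρ′ , _) = extend-route a ρ in l′ , ρ′
      path : V → List V
      path x = proj₁ (routes (connected x r))
      route : ∀ x → Route r x (path x)
      route x = proj₂ (routes (connected x r))
      head : ∀ {x l} → Route r x l → ∃[ m ] l ≡ x ∷ m
      head stop = _ , refl
      head (first _) = _ , refl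
      head (next _ _ _) = _ , refl
      edge : ∀ {x y} → x ~ y → ∃[ l ] (Route r x l × (l ≡ x ∷ path y ⊎ path y ≡ y ∷ l)) → path x ≡ x ∷ path y ⊎ path y ≡ y ∷ path x
      edge {x} a (l , ρ , e) with route-unique acyclic (route x) ρ
      ... | refl = e

      parent : ∀ x → x ≡ r ⊎ (∃[ p ] (x ~ p × path x ≡ x ∷ path p))
      parent x with path x | route x
      ... | _ | stop = inj₁ refl
      ... | _ | first a = inj₂ (r , a , cong (x ∷_) (route-unique acyclic stop (route r)))
      ... | _ | next {y = y} a _ ρ = inj₂ (y , a , cong (x ∷_) (route-unique acyclic ρ (route y)))

    abstract
      tree⇒rooted : ∀ {G} → IsTree G → ∀ r → Rooted G r
      tree⇒rooted = tree⇒rooted-construction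

    maximum : ∀ {n} (f : Fin (suc n) → ℕ) → ∃[ i ] (∀ j → f j ≤ f i)
    maximum {zero} f = zero , λ { zero → ≤-refl }
    maximum {suc n} f with maximum (λ i → f (suc i))
    ... | i , max with ≤-total (f zero) (f (suc i))
    ... | inj₁ p = suc i , λ { zero → p ; (suc j) → max j }
    ... | inj₂ p = zero , λ { zero → ≤-refl ; (suc j) → ≤-trans (max j) p }

    module CyclicOrder {n : ℕ} where

      size : ℕ
      size = suc (suc (suc n))

      successor : (i : Fin size) → ∃[ j ] CyclicSuc i j
      successor i with m≤n⇒m<n∨m≡n (toℕ<n i)
      ... | inj₁ p = fromℕ< p , inj₁ (toℕ-fromℕ< p)
      ... | inj₂ eq = zero , inj₂ (eq , refl)

      predecessor : (i : Fin size) → ∃[ k ] CyclicSuc k i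
      predecessor zero = fromℕ _ , inj₂ (cong suc (toℕ-fromℕ _) , refl)
      predecessor (suc i) = fromℕ< (m<n⇒m<1+n (toℕ<n i)) , inj₁ (cong suc (sym (toℕ-fromℕ< _)))

      distinct : ∀ (i : Fin size) j k → CyclicSuc i j → CyclicSuc k i → j ≢ k
      distinct i j k (inj₁ p) (inj₁ q) refl = m≢1+n+m (toℕ j) {1} (trans p (cong suc q))
      distinct i j k (inj₁ p) (inj₂ (q , i≡0)) refl with trans (sym q) (cong suc (trans p (cong suc i≡0)))
      ... | ()
      distinct i j k (inj₂ (p , j≡0)) (inj₁ q) refl with trans (sym p) (cong suc (trans q (cong suc j≡0)))
      ... | ()
      distinct i j k (inj₂ (p , j≡0)) (inj₂ (q , _)) refl with trans (sym q) (cong suc j≡0)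
      ... | ()

    -- A cycle would have a vertex of maximal depth, and both neighbours of that vertex on the cycle would be its parent.
    parents⇒acyclic : ∀ {G} (depth : Graph.V G → ℕ) (parent : Graph.V G → Graph.V G) →
      (∀ {x y} → Graph._~_ G x y → (depth x ≡ suc (depth y) × parent x ≡ y) ⊎ (depth y ≡ suc (depth x) × parent y ≡ x)) → ¬ Cycle G
    parents⇒acyclic {G} depth parent edge record { len = suc (suc (suc n)) ; vertex = vertex ; injective = injective ; adjacent = adjacent } =
      let (i , max) = maximum (λ i → depth (vertex i))
          (j , ij) = successor i
          (k , ki) = predecessor i
          p = is-parent i j max (adjacent ij)
          q = is-parent i k max (~-sym (adjacent ki))
      in distinct i j k ij ki (injective (trans (sym p) q))
      where
      open Graph G
      open CyclicOrder
      is-parent : ∀ i j → (∀ j → depth (vertex j) ≤ depth (vertex i)) → vertex i ~ vertex j → parent (vertex i) ≡ vertex j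
      is-parent i j max a with edge a
      ... | inj₁ (_ , eq) = eq
      ... | inj₂ (deeper , _) = ⊥-elim (<-irrefl refl (subst (_≤ depth (vertex i)) deeper (max j)))
    parents⇒acyclic depth parent edge record { len = zero ; 3≤len = () }
    parents⇒acyclic depth parent edge record { len = suc zero ; 3≤len = s≤s () }
    parents⇒acyclic depth parent edge record { len = suc (suc zero) ; 3≤len = s≤s (s≤s ()) }

  -- Homogeneous bipartite digraphs and the complete bipartite case

  module BipartiteBasics where

    open import Relation.Binary.Construct.Closure.Symmetric using () renaming (symmetric to symClosure-symmetric)
    open import Relation.Nullary.Decidable.Core using (does)
    open Base
    open Matrix
    open Homogeneous
    open Arcs
    open import Defs using (Graph; BipartiteGraph; RelIso; BipartiteEdge; edge; edge˘; Always; always; Listed; complete) renaming (K to completeBipartite)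
    open Aut

    opposite-injective : ∀ {p q} → opposite p ≡ opposite q → p ≡ q
    opposite-injective {0ℙ} {0ℙ} _ = refl
    opposite-injective {1ℙ} {1ℙ} _ = refl

    record BipartiteHD : Set₁ where
      field
        homogeneousDigraph : HomogeneousDigraph
      open HomogeneousDigraph homogeneousDigraph public
      field
        part      : V → Parity
        part-arc  : ∀ {u v} → u ⟶ v → part u ≡ 0ℙ × part v ≡ 1ℙ
        κ-part    : ∀ {u v} → part u ≡ part v → κ u ≡ κ v
        connected : ∀ u v → Reach Adj u v
        x₀ y₀     : V
        x₀y₀      : x₀ ⟶ y₀

    opB : BipartiteHD → BipartiteHD
    opB B = record
      { homogeneousDigraph = opHD homogeneousDigraph
      ; part = opposite ∘ part
      ; part-arc = λ a → cong opposite (proj₂ (part-arc a)) , cong opposite (proj₁ (part-arc a))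
      ; κ-part = λ eq → κ-part (opposite-injective eq)
      ; connected = λ u v → reach-map (λ u → u) swap (connected u v)
      ; x₀ = y₀ ; y₀ = x₀ ; x₀y₀ = x₀y₀ }
      where open BipartiteHD B

    module Bipartite (B : BipartiteHD) where
      open BipartiteHD B public
      open ArcSequences _⟶_

      IsX IsY : V → Set
      IsX v = part v ≡ 0ℙ
      IsY v = part v ≡ 1ℙ

      tail-X : ∀ {u v} → u ⟶ v → IsX u
      tail-X a = proj₁ (part-arc a)

      head-Y : ∀ {u v} → u ⟶ v → IsY v
      head-Y a = proj₂ (part-arc a)

      side : ∀ v → IsX v ⊎ IsY v
      side v with part v
      ... | 0ℙ = inj₁ refl
      ... | 1ℙ = inj₂ refl

      X≢Y : ∀ {v} → IsX v → ¬ IsY v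
      X≢Y p q with trans (sym p) q
      ... | ()

      no-2-arc : ∀ {u v w} → u ⟶ v → ¬ (v ⟶ w)
      no-2-arc a b = X≢Y (tail-X b) (head-Y a)

      same-κ : ∀ {u v p} → part u ≡ p → part v ≡ p → κ u ≡ κ v
      same-κ p q = κ-part (trans p (sym q))

      Adj-part : ∀ {u v} → Adj u v → part v ≡ opposite (part u)
      Adj-part (inj₁ a) = trans (head-Y a) (cong opposite (sym (tail-X a)))
      Adj-part (inj₂ a) = trans (tail-X a) (cong opposite (sym (head-Y a)))

      Adj-from-X : ∀ {u v} → IsX u → Adj u v → u ⟶ v
      Adj-from-X p (inj₁ a) = a
      Adj-from-X p (inj₂ a) = ⊥-elim (X≢Y p (head-Y a))

      Adj-from-Y : ∀ {u v} → IsY u → Adj u v → v ⟶ u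
      Adj-from-Y p (inj₂ a) = a
      Adj-from-Y p (inj₁ a) = ⊥-elim (X≢Y (tail-X a) p)

      has-arc : ∀ v → ∃[ w ] Adj v w
      has-arc v = go (connected x₀ v)
        where
        go : ∀ {v} → Reach Adj x₀ v → ∃[ w ] Adj v w
        go here = y₀ , inj₁ x₀y₀
        go (_ ▻ a) = _ , swap a

      out-arc : ∀ {x} → IsX x → ∃[ y ] x ⟶ y
      out-arc p = let (y , a) = has-arc _ in y , Adj-from-X p a

      in-arc : ∀ {y} → IsY y → ∃[ x ] x ⟶ y
      in-arc p = let (x , a) = has-arc _ in x , Adj-from-Y p a

      abstract
        edge-transitive : ∀ {a b c d} → a ⟶ b → c ⟶ d → Σ[ α ∈ Automorphism ] (to α a ≡ c × to α b ≡ d)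
        edge-transitive {a} {b} {c} {d} ab cd =
          let (α , eq) = arc-transitive homogeneousDigraph {1} {cons a (λ _ → b)} {cons c (λ _ → d)}
                           (λ { zero → same-κ (tail-X ab) (tail-X cd) ; (suc _) → same-κ (head-Y ab) (head-Y cd) })
                           (steps ab) (steps cd) (induced ab) (induced cd)
          in α , eq 0 z≤n , eq 1 (s≤s z≤n)
          where
          steps : ∀ {a b} → a ⟶ b → Arc 1 (cons a (λ _ → b))
          steps ab = arc-cons ab (λ _ ())
          induced : ∀ {a b} → a ⟶ b → Induced 1 (cons a (λ _ → b))
          induced ab zero zero _ _ e = ⊥-elim (irrefl e)
          induced ab zero (suc zero) _ _ e = refl
          induced ab (suc zero) zero _ _ e = ⊥-elim (asym ab e)
          induced ab (suc zero) (suc zero) _ _ e = ⊥-elim (irrefl e)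
          induced ab (suc (suc _)) _ (s≤s ()) _ _
          induced ab _ (suc (suc _)) _ (s≤s ()) _

      OtherTails OtherHeads : V → V → V → Set
      OtherTails x y u = u ⟶ y × u ≢ x
      OtherHeads x y v = x ⟶ v × v ≢ y

      EdgeColour : V → V → _
      EdgeColour u v = does (dec (u ⟶ v))

      abstract
        -- The other neighbours of `y` and of `x` are two sets of leaves over the core formed by the
        -- edge, because arcs run only from one side to the other.
        edge-matrix : ∀ {x y} → x ⟶ y → Constant (OtherTails x y) (OtherHeads x y) EdgeColour ⊎
                                        Matching (OtherTails x y) (OtherHeads x y) EdgeColour
        edge-matrix {x} {y} xy = leafMatrix (Core-edge (inj₁ xy))
          (record
            { listing = listing-⊆ proj₁ (in-listing y)
            ; disjoint = λ { (_ , n) (inj₁ refl) → n refl ; (a , _) (inj₂ refl) → irrefl a }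
            ; colour = λ (a , _) (b , _) → same-κ (tail-X a) (tail-X b)
            ; stem = y ; stem∈Q = inj₂ refl ; attached = inj₂ proj₁
            ; independent = λ _ (b , _) e → no-2-arc e b
            ; free = λ { (a , _) (inj₁ refl) _ (inj₁ e) → no-2-arc e xy ; (a , _) (inj₁ refl) _ (inj₂ e) → no-2-arc e a
                       ; _ (inj₂ refl) n _ → n refl } })
          (record
            { listing = listing-⊆ proj₁ (out-listing x)
            ; disjoint = λ { (a , _) (inj₁ refl) → irrefl a ; (_ , n) (inj₂ refl) → n refl }
            ; colour = λ (a , _) (b , _) → same-κ (head-Y a) (head-Y b)
            ; stem = x ; stem∈Q = inj₁ refl ; attached = inj₁ proj₁
            ; independent = λ (a , _) _ e → no-2-arc a e
            ; free = λ { _ (inj₁ refl) n _ → n refl ; (a , _) (inj₂ refl) _ (inj₁ e) → no-2-arc a e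
                       ; (a , _) (inj₂ refl) _ (inj₂ e) → no-2-arc xy e } })
          (λ {α} fix (a , n) → subst (_ ⟶_) (fix (inj₂ refl)) (to-arc α a) , λ eq → n (to-inj α (trans eq (sym (fix (inj₁ refl))))))
          (λ {α} fix (a , n) → subst (_⟶ _) (fix (inj₁ refl)) (to-arc α a) , λ eq → n (to-inj α (trans eq (sym (fix (inj₂ refl))))))
          (λ {α} _ → does-≡ (to-arc⁻ α) (to-arc α))

      graph : Graph
      graph = record
        { V = V ; _~_ = SymClosure _⟶_
        ; irrefl = λ { refl (fwd a) → irrefl a ; refl (bwd a) → irrefl a }
        ; ~-sym = symClosure-symmetric _⟶_ }

      toAdj : ∀ {u v} → SymClosure _⟶_ u v → Adj u v
      toAdj (fwd a) = inj₁ a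
      toAdj (bwd a) = inj₂ a

      fromAdj : ∀ {u v} → Adj u v → SymClosure _⟶_ u v
      fromAdj (inj₁ a) = fwd a
      fromAdj (inj₂ a) = bwd a

      bipartiteGraph : BipartiteGraph
      bipartiteGraph = record
        { graph = graph ; part = part
        ; proper = λ { (fwd a) eq → X≢Y (tail-X a) (trans eq (head-Y a)) ; (bwd a) eq → X≢Y (tail-X a) (trans (sym eq) (head-Y a)) } }

      bipartiteIso : {A C : Set} (E : A → C → Set) (iX : [ v ∈ V ∣ IsX v ] ↔ A) (iY : [ v ∈ V ∣ IsY v ] ↔ C) →
        (∀ x y → value x ⟶ value y → E (Inverse.to iX x) (Inverse.to iY y)) →
        (∀ x y → E (Inverse.to iX x) (Inverse.to iY y) → value x ⟶ value y) →
        RelIso (SymClosure _⟶_) (BipartiteEdge E)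
      bipartiteIso {A} {C} E iX iY arc⇒E E⇒arc = record { bijection = mk↔ₛ′ to′ from′ to∘from′ from∘to′ ; edges = mk⇔ edge⇒ edge⇐ }
        where
        toP : ∀ p v → part v ≡ p → A ⊎ C
        toP 0ℙ v eq = inj₁ (Inverse.to iX (v , [ eq ]))
        toP 1ℙ v eq = inj₂ (Inverse.to iY (v , [ eq ]))
        to′ : V → A ⊎ C
        to′ v = toP (part v) v refl
        to-X : ∀ {v} (q : IsX v) → to′ v ≡ inj₁ (Inverse.to iX (v , [ q ]))
        to-X {v} q = go (part v) refl
          where
          go : ∀ p (e : part v ≡ p) → toP p v e ≡ inj₁ (Inverse.to iX (v , [ q ]))
          go 0ℙ e = refl
          go 1ℙ e = ⊥-elim (X≢Y q e)
        to-Y : ∀ {v} (q : IsY v) → to′ v ≡ inj₂ (Inverse.to iY (v , [ q ]))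
        to-Y {v} q = go (part v) refl
          where
          go : ∀ p (e : part v ≡ p) → toP p v e ≡ inj₂ (Inverse.to iY (v , [ q ]))
          go 1ℙ e = refl
          go 0ℙ e = ⊥-elim (X≢Y e q)
        from′ : A ⊎ C → V
        from′ (inj₁ a) = value (Inverse.from iX a)
        from′ (inj₂ c) = value (Inverse.from iY c)
        to∘from′ : ∀ z → to′ (from′ z) ≡ z
        to∘from′ (inj₁ a) = trans (to-X (proofOf (Inverse.from iX a))) (cong inj₁ (Inverse.strictlyInverseˡ iX a))
        to∘from′ (inj₂ c) = trans (to-Y (proofOf (Inverse.from iY c))) (cong inj₂ (Inverse.strictlyInverseˡ iY c))
        from∘to′ : ∀ v → from′ (to′ v) ≡ v
        from∘to′ v with side v
        ... | inj₁ q = trans (cong from′ (to-X q)) (cong value (Inverse.strictlyInverseʳ iX (v , [ q ])))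
        ... | inj₂ q = trans (cong from′ (to-Y q)) (cong value (Inverse.strictlyInverseʳ iY (v , [ q ])))
        edge⇒ : ∀ {u v} → SymClosure _⟶_ u v → BipartiteEdge E (to′ u) (to′ v)
        edge⇒ (fwd a) = subst₂ (BipartiteEdge E) (sym (to-X (tail-X a))) (sym (to-Y (head-Y a))) (edge (arc⇒E _ _ a))
        edge⇒ (bwd a) = subst₂ (BipartiteEdge E) (sym (to-Y (head-Y a))) (sym (to-X (tail-X a))) (edge˘ (arc⇒E _ _ a))
        edge⇐ : ∀ {u v} → BipartiteEdge E (to′ u) (to′ v) → SymClosure _⟶_ u v
        edge⇐ {u} {v} e with side u | side v
        ... | inj₁ p | inj₁ q with subst₂ (BipartiteEdge E) (to-X p) (to-X q) e
        ...   | ()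
        edge⇐ {u} {v} e | inj₂ p | inj₂ q with subst₂ (BipartiteEdge E) (to-Y p) (to-Y q) e
        ...   | ()
        edge⇐ {u} {v} e | inj₁ p | inj₂ q with subst₂ (BipartiteEdge E) (to-X p) (to-Y q) e
        ...   | edge a = fwd (E⇒arc (u , [ p ]) (v , [ q ]) a)
        edge⇐ {u} {v} e | inj₂ p | inj₁ q with subst₂ (BipartiteEdge E) (to-Y p) (to-X q) e
        ...   | edge˘ a = bwd (E⇒arc (v , [ q ]) (u , [ p ]) a)

      Classified : Set₁
      Classified = Σ[ B ∈ BipartiteGraph ] (Listed B × RelIso (SymClosure _⟶_) (BipartiteGraph._~_ B))

      positive : ∀ {A : Set} {n} → (A ↔ Fin n) → A → 1 ≤ n
      positive {n = zero} i a with Inverse.to i a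
      ... | ()
      positive {n = suc n} i a = s≤s z≤n

      Twins : Set
      Twins = ∀ {x y x′ y′} → x ⟶ y → x′ ⟶ y → x ⟶ y′ → x′ ⟶ y′

      -- `Twins` closes every walk with three edges by an edge between its ends. So distances do not
      -- exceed two, and every vertex is adjacent to `x₀` or to `y₀` according to its side.
      classify-complete : Twins → Classified
      classify-complete twins = completeBipartite m n , complete (positive iX (x₀ , [ tail-X x₀y₀ ])) (positive iY (y₀ , [ head-Y x₀y₀ ])) ,
        bipartiteIso Always iX iY (λ _ _ _ → always) (λ x y _ → all x y)
        where
        cover : ∀ v → x₀ ⟶ v ⊎ v ⟶ y₀
        cover v = go (connected x₀ v)
          where
          go : ∀ {v} → Reach Adj x₀ v → x₀ ⟶ v ⊎ v ⟶ y₀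
          go here = inj₂ x₀y₀
          go (r ▻ a) with go r | a
          ... | inj₁ b | inj₂ c = inj₂ (twins b c x₀y₀)
          ... | inj₂ b | inj₁ c = inj₁ (twins b x₀y₀ c)
          ... | inj₁ b | inj₁ c = ⊥-elim (no-2-arc b c)
          ... | inj₂ b | inj₂ c = ⊥-elim (no-2-arc c b)
        x-arc : ∀ {v} → IsX v → v ⟶ y₀
        x-arc {v} p with cover v
        ... | inj₁ a = ⊥-elim (X≢Y p (head-Y a))
        ... | inj₂ a = a
        y-arc : ∀ {v} → IsY v → x₀ ⟶ v
        y-arc {v} p with cover v
        ... | inj₁ a = a
        ... | inj₂ a = ⊥-elim (X≢Y (tail-X a) p)
        finX = listing⇒finite (listing-⊆ x-arc (in-listing y₀))
        finY = listing⇒finite (listing-⊆ y-arc (out-listing x₀))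
        m = proj₁ finX
        n = proj₁ finY
        iX = proj₂ finX
        iY = proj₂ finY
        all : ∀ (x : [ v ∈ V ∣ IsX v ]) (y : [ v ∈ V ∣ IsY v ]) → value x ⟶ value y
        all x y = twins x₀y₀ (x-arc (proofOf x)) (y-arc (proofOf y))

  -- Four-cycles and complements of perfect matchings

  module FourCycles where

    open import Data.Fin.Properties using (injective⇒≤)
    open import Function.Construct.Composition using (_↔-∘_)
    open import Relation.Nullary.Decidable.Core using (does)
    open Base
    open Matrix
    open Homogeneous
    open Arcs
    open BipartiteBasics
    open import Defs using (matching; CP)
    open Aut

    does-false : {P : Set} → does (dec P) ≡ false → ¬ P
    does-false {P} eq p with trans (sym eq) (does-true p)
    ... | ()

    record Three {A : Set} (P : A → Set) : Set where
      constructor three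
      field
        {v₁ v₂ v₃} : A
        p₁ : P v₁
        p₂ : P v₂
        p₃ : P v₃
        v₁≢v₂ : v₁ ≢ v₂
        v₁≢v₃ : v₁ ≢ v₃
        v₂≢v₃ : v₂ ≢ v₃

    three-map : {A : Set} {P Q : A → Set} (f : A → A) → (∀ {u v} → f u ≡ f v → u ≡ v) → (∀ {v} → P v → Q (f v)) → Three P → Three Q
    three-map f inj g (three p₁ p₂ p₃ n₁ n₂ n₃) =
      three (g p₁) (g p₂) (g p₃) (λ e → n₁ (inj e)) (λ e → n₂ (inj e)) (λ e → n₃ (inj e))

    -- Each of `Q` and `R` fails for at most one element of `P`, so among three elements one
    -- satisfies both.
    both-hold : {A : Set} {P Q R : A → Set} → Three P → (∀ {u v} → P u → P v → ¬ Q u → ¬ Q v → u ≡ v) →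
      (∀ {u v} → P u → P v → ¬ R u → ¬ R v → u ≡ v) → ∃[ v ] (P v × Q v × R v)
    both-hold {Q = Q} {R} (three {a} {b} {c} pa pb pc ab ac bc) q r with dec (Q a × R a) | dec (Q b × R b) | dec (Q c × R c)
    ... | yes (x , y) | _ | _ = a , pa , x , y
    ... | no _ | yes (x , y) | _ = b , pb , x , y
    ... | no _ | no _ | yes (x , y) = c , pc , x , y
    ... | no na | no nb | no nc = ⊥-elim (clash (fails na) (fails nb) (fails nc))
      where
      fails : ∀ {v} → ¬ (Q v × R v) → ¬ Q v ⊎ ¬ R v
      fails {v} n with dec (Q v)
      ... | no ¬q = inj₁ ¬q
      ... | yes x = inj₂ λ y → n (x , y)
      clash : ¬ Q a ⊎ ¬ R a → ¬ Q b ⊎ ¬ R b → ¬ Q c ⊎ ¬ R c → ⊥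
      clash (inj₁ x) (inj₁ y) _ = ab (q pa pb x y)
      clash (inj₂ x) (inj₂ y) _ = ab (r pa pb x y)
      clash (inj₁ x) (inj₂ y) (inj₁ z) = ac (q pa pc x z)
      clash (inj₁ x) (inj₂ y) (inj₂ z) = bc (r pb pc y z)
      clash (inj₂ x) (inj₁ y) (inj₁ z) = bc (q pb pc y z)
      clash (inj₂ x) (inj₁ y) (inj₂ z) = ac (r pa pc x z)

    module _ (B : BipartiteHD) where
      open Bipartite B

      OneMissing : Set
      OneMissing = ∀ {x x′ y} → x ≢ x′ → x ⟶ y → x′ ⟶ y →
                   ∃[ m ] (x ⟶ m × ¬ (x′ ⟶ m) × (∀ {m′} → x ⟶ m′ → ¬ (x′ ⟶ m′) → m′ ≡ m))

      module Meeting (oneMissing : OneMissing) (degree : ∀ {x} → IsX x → Three (x ⟶_)) where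

        Meet : V → V → Set
        Meet x x′ = ∃[ y ] (x ⟶ y × x′ ⟶ y)

        fails-once : ∀ {x x′} → Meet x x′ → ∀ {u v} → x ⟶ u → x ⟶ v → ¬ (x′ ⟶ u) → ¬ (x′ ⟶ v) → u ≡ v
        fails-once {x} {x′} (y , a , b) xu xv nu nv with x ≟ x′
        ... | yes refl = contradiction xu nu
        ... | no n = let (m , _ , _ , u) = oneMissing n a b in trans (u xu nu) (sym (u xv nv))

        -- Among the three or more neighbours of `x′`, each of `x` and `x″` misses at most one.
        meet-trans : ∀ {x x′ x″} → Meet x x′ → Meet x′ x″ → Meet x x″
        meet-trans s@(y , a , b) t =
          let (m , _ , p , q) = both-hold (degree (tail-X b)) (fails-once (y , b , a)) (fails-once t) in m , p , q

        all-meet : ∀ {x x′} → IsX x → IsX x′ → Meet x x′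
        all-meet {x} {x′} p p′ = conclude (go (connected x x′))
          where
          Near : V → Set
          Near v = Meet x v ⊎ (∃[ z ] (Meet x z × z ⟶ v))
          go : ∀ {v} → Reach Adj x v → Near v
          go here = let (y , a) = out-arc p in inj₁ (y , a , a)
          go (r ▻ a) with go r | a
          ... | inj₁ s | inj₁ b = inj₂ (_ , s , b)
          ... | inj₁ (y , c , d) | inj₂ b = ⊥-elim (no-2-arc b d)
          ... | inj₂ (z , s , c) | inj₁ b = ⊥-elim (no-2-arc c b)
          ... | inj₂ (z , s , c) | inj₂ b = inj₁ (meet-trans s (_ , c , b))
          conclude : Near x′ → Meet x x′
          conclude (inj₁ s) = s
          conclude (inj₂ (z , s , c)) = ⊥-elim (X≢Y p′ (head-Y c))

    module _ (B : BipartiteHD) where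
      open Bipartite B

      record PerfectMatchingComplement : Set where
        field
          missingX : OneMissing B
          missingY : OneMissing (opB B)
          degreeX  : ∀ {x} → IsX x → Three (x ⟶_)
          degreeY  : ∀ {y} → IsY y → Three (_⟶ y)

      module _ (cp : PerfectMatchingComplement) where
        open PerfectMatchingComplement cp
        private
          module MX = Meeting B missingX degreeX
          module MY = Meeting (opB B) missingY (λ p → degreeY (opposite-injective p))

        meetX : ∀ {x x′} → IsX x → IsX x′ → ∃[ y ] (x ⟶ y × x′ ⟶ y)
        meetX = MX.all-meet

        meetY : ∀ {y y′} → IsY y → IsY y′ → ∃[ x ] (x ⟶ y × x ⟶ y′)
        meetY p p′ = MY.all-meet (cong opposite p) (cong opposite p′)

        another : ∀ {P : V → Set} (v : V) → Three P → ∃[ w ] (P w × w ≢ v)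
        another v (three {a} {b} pa pb _ ab _ _) with a ≟ v
        ... | no n = a , pa , n
        ... | yes refl = b , pb , λ e → ab (sym e)

        η : ∀ x → IsX x → ∃[ y ] (IsY y × ¬ (x ⟶ y))
        η x p = let (y , a) = out-arc p
                    (x′ , b , n) = another x (degreeY (head-Y a))
                    (m , c , d , _) = missingX n b a
                in m , head-Y c , d

        -- Some `x′` is adjacent to both `y` and `y′`. It meets `x`, so only one of its neighbours
        -- can be missed by `x`.
        η-unique : ∀ {x y y′} → IsX x → IsY y → IsY y′ → ¬ (x ⟶ y) → ¬ (x ⟶ y′) → y ≡ y′
        η-unique {x} {y} p q q′ n n′ with meetY q q′
        ... | x′ , a , b with meetX (tail-X a) p
        ... | z , c , d with missingX (λ { refl → n a }) c d
        ... | m , _ , _ , u = trans (u a n) (sym (u b n′))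

        η⁻¹ : ∀ y → IsY y → ∃[ x ] (IsX x × ¬ (x ⟶ y))
        η⁻¹ y p = let (x , a) = in-arc p
                      (y′ , b , n) = another y (degreeX (tail-X a))
                      (m , c , d , _) = missingY n b a
                  in m , tail-X c , d

        η⁻¹-unique : ∀ {y x x′} → IsY y → IsX x → IsX x′ → ¬ (x ⟶ y) → ¬ (x′ ⟶ y) → x ≡ x′
        η⁻¹-unique {y} {x} p q q′ n n′ with meetX q q′
        ... | y′ , a , b with meetY (head-Y a) p
        ... | z , c , d with missingY (λ { refl → n a }) c d
        ... | m , _ , _ , u = trans (u a n) (sym (u b n′))

        classify-matching : Classified
        classify-matching = CP n , matching (injective⇒≤ {f = f} f-injective) ,
          bipartiteIso _≢_ iX iY
            (λ x y a eq → proj₂ (proj₂ (η⁻¹ (value y) (proofOf y)))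
               (subst (_⟶ value y) (cong value (↔-injective iX {x} {Inverse.to matched y} eq)) a))
            (λ x y n → dne λ ¬a → n (cong (Inverse.to iX) (value-injective
               (η⁻¹-unique (proofOf y) (proofOf x) (proj₁ (proj₂ (η⁻¹ (value y) (proofOf y)))) ¬a
                  (proj₂ (proj₂ (η⁻¹ (value y) (proofOf y))))))))
          where
          X Y : Set
          X = [ v ∈ V ∣ IsX v ]
          Y = [ v ∈ V ∣ IsY v ]
          finX = listing⇒finite (listing-⊆ (λ p → let (y , a , b) = meetX (tail-X x₀y₀) p in y , a , b)
                                  (listing-∃ (out-listing x₀) in-listing))
          n : ℕ
          n = proj₁ finX
          iX : X ↔ Fin n
          iX = proj₂ finX
          matched : Y ↔ X
          matched = mk↔ₛ′
            (λ y → let (x , p , _) = η⁻¹ (value y) (proofOf y) in x , [ p ])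
            (λ x → let (y , p , _) = η (value x) (proofOf x) in y , [ p ])
            (λ x → let (y , q , m) = η (value x) (proofOf x) ; (x′ , p′ , m′) = η⁻¹ y (recover q)
                   in value-injective (η⁻¹-unique q p′ (proofOf x) m′ m))
            (λ y → let (x , p , m) = η⁻¹ (value y) (proofOf y) ; (y′ , q′ , m′) = η x (recover p)
                   in value-injective (η-unique p q′ (proofOf y) m′ m))
          iY : Y ↔ Fin n
          iY = iX ↔-∘ matched
          open Three (degreeY (head-Y x₀y₀))
          f : Fin 3 → Fin n
          f zero = Inverse.to iX (v₁ , [ tail-X p₁ ])
          f (suc zero) = Inverse.to iX (v₂ , [ tail-X p₂ ])
          f (suc (suc zero)) = Inverse.to iX (v₃ , [ tail-X p₃ ])
          down : ∀ {x x′ : X} → Inverse.to iX x ≡ Inverse.to iX x′ → value x ≡ value x′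
          down {x} {x′} eq = cong value (↔-injective iX {x} {x′} eq)
          f-injective : ∀ {i j} → f i ≡ f j → i ≡ j
          f-injective {zero} {zero} eq = refl
          f-injective {zero} {suc zero} eq = contradiction (down eq) v₁≢v₂
          f-injective {zero} {suc (suc zero)} eq = contradiction (down eq) v₁≢v₃
          f-injective {suc zero} {zero} eq = contradiction (sym (down eq)) v₁≢v₂
          f-injective {suc zero} {suc zero} eq = refl
          f-injective {suc zero} {suc (suc zero)} eq = contradiction (down eq) v₂≢v₃
          f-injective {suc (suc zero)} {zero} eq = contradiction (sym (down eq)) v₁≢v₃
          f-injective {suc (suc zero)} {suc zero} eq = contradiction (sym (down eq)) v₂≢v₃
          f-injective {suc (suc zero)} {suc (suc zero)} eq = refl

      ThreeCommon : Set
      ThreeCommon = ∃[ x ] ∃[ x′ ] (x ≢ x′ × Three (λ y → x ⟶ y × x′ ⟶ y))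

      module FourCycle {x₁ y₁ x₂ y₂} (x₁y₁ : x₁ ⟶ y₁) (x₂y₁ : x₂ ⟶ y₁) (x₁y₂ : x₁ ⟶ y₂) (x₂y₂ : x₂ ⟶ y₂) (x₁≢x₂ : x₁ ≢ x₂) (y₁≢y₂ : y₁ ≢ y₂)
        {a b a′ b′} (ab : a ⟶ b) (a′b : a′ ⟶ b) (ab′ : a ⟶ b′) (a′b′ : ¬ (a′ ⟶ b′)) where

        a≢a′ : a ≢ a′
        a≢a′ refl = a′b′ ab′

        b≢b′ : b ≢ b′
        b≢b′ refl = a′b′ a′b

        module AtEdge {x y} (xy : x ⟶ y) where
          R S : V → Set
          R = OtherTails x y
          S = OtherHeads x y

          true-entry : ∃[ r ] ∃[ s ] (R r × S s × r ⟶ s)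
          true-entry with edge-transitive x₁y₁ xy
          ... | α , refl , refl = to α x₂ , to α y₂ , (to-arc α x₂y₁ , λ e → x₁≢x₂ (sym (to-inj α e))) ,
                                  (to-arc α x₁y₂ , λ e → y₁≢y₂ (sym (to-inj α e))) , to-arc α x₂y₂

          false-entry : ∃[ r ] ∃[ s ] (R r × S s × ¬ (r ⟶ s))
          false-entry with edge-transitive ab xy
          ... | α , refl , refl = to α a′ , to α b′ , (to-arc α a′b , λ e → a≢a′ (sym (to-inj α e))) ,
                                  (to-arc α ab′ , λ e → b≢b′ (sym (to-inj α e))) , λ e → a′b′ (to-arc⁻ α e)

          abstract
            -- Edge-transitivity carries the four-cycle and the path with non-adjacent ends to the
            -- edge at hand; they yield a true and a false entry, so the matrix is not constant.
            edgeMatching : Matching R S EdgeColour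
            edgeMatching with edge-matrix xy
            ... | inj₂ m = m
            ... | inj₁ constant = let (r , s , p , q , t) = true-entry ; (r′ , s′ , p′ , q′ , f) = false-entry
                                  in ⊥-elim (f (true-does (trans (constant p′ p q′ q) (does-true t))))

          open Matching edgeMatching public

          entry : ∀ {c r s} → c ≡ true → EdgeColour r s ≡ c → r ⟶ s
          entry refl eq = true-does eq

          no-entry : ∀ {c r s} → c ≡ false → EdgeColour r s ≡ c → ¬ (r ⟶ s)
          no-entry refl eq = does-false eq

          -- If the true and the false entry lie in one row, they lie in different columns, and `θ`
          -- is onto the columns.
          two-rows : ∃[ r ] ∃[ r′ ] (R r × R r′ × r ≢ r′)
          two-rows with true-entry | false-entry
          ... | r , s , p , q , t | r′ , s′ , p′ , q′ , f with r ≟ r′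
          ... | no n = r , r′ , p , p′ , n
          ... | yes refl = let (u , pu , e) = θ-surj q ; (u′ , pu′ , e′) = θ-surj q′
                           in u , u′ , pu , pu′ , λ eq → f (subst (r ⟶_) (trans (sym e) (trans (cong θ eq) e′)) t)

          two-columns : ∃[ s ] ∃[ s′ ] (S s × S s′ × s ≢ s′)
          two-columns = let (r , r′ , p , p′ , n) = two-rows in θ r , θ r′ , θ∈S p , θ∈S p′ , λ e → n (θ-inj p p′ e)

        degreeX′ : ∀ {x} → IsX x → Three (x ⟶_)
        degreeX′ p = let (y , xy) = out-arc p ; (s , s′ , (e , n) , (e′ , n′) , m) = AtEdge.two-columns xy
                     in three xy e e′ (λ q → n (sym q)) (λ q → n′ (sym q)) m

        degreeY′ : ∀ {y} → IsY y → Three (_⟶ y)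
        degreeY′ p = let (x , xy) = in-arc p ; (s , s′ , (e , n) , (e′ , n′) , m) = AtEdge.two-rows xy
                     in three xy e e′ (λ q → n (sym q)) (λ q → n′ (sym q)) m

        AllButOne : Set
        AllButOne = ∀ {x y} → x ⟶ y →
          (∀ {r} → OtherTails x y r → ∃[ s ] (OtherHeads x y s × ¬ (r ⟶ s) × (∀ {t} → OtherHeads x y t → ¬ (r ⟶ t) → t ≡ s))) ×
          (∀ {s} → OtherHeads x y s → ∃[ r ] (OtherTails x y r × ¬ (r ⟶ s) × (∀ {t} → OtherTails x y t → ¬ (t ⟶ s) → t ≡ r)))

        allButOne⇒matching : AllButOne → PerfectMatchingComplement
        allButOne⇒matching abo = record
          { missingX = λ {x} {x′} {y} n xy x′y →
              let (s , (xs , s≢y) , x′s , u) = proj₁ (abo xy) (x′y , λ e → n (sym e))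
              in s , xs , x′s , λ {m} xm x′m → u (xm , λ { refl → x′m x′y }) x′m
          ; missingY = λ {y} {y′} {x} n xy xy′ →
              let (r , (ry , r≢x) , ry′ , u) = proj₂ (abo xy) (xy′ , λ e → n (sym e))
              in r , ry , ry′ , λ {m} my my′ → u (my , λ { refl → my′ xy′ }) my′
          ; degreeX = degreeX′ ; degreeY = degreeY′ }

        matching⇒allButOne : ∀ {x y} (xy : x ⟶ y) → let open AtEdge xy in on ≡ false → off ≡ true →
          (∀ {r} → R r → ∃[ s ] (S s × ¬ (r ⟶ s) × (∀ {t} → S t → ¬ (r ⟶ t) → t ≡ s))) ×
          (∀ {s} → S s → ∃[ r ] (R r × ¬ (r ⟶ s) × (∀ {t} → R t → ¬ (t ⟶ s) → t ≡ r)))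
        matching⇒allButOne xy on≡ off≡ =
          (λ {r} p → θ r , θ∈S p , no-entry on≡ (colour-on p) , λ q ¬a → dne λ n → ¬a (entry off≡ (colour-off p q n))) ,
          (λ {s} q → let (r , p , e) = θ-surj q in r , p , no-entry on≡ (subst (λ z → EdgeColour r z ≡ on) e (colour-on p)) ,
             λ {t} pt ¬a → θ-inj pt p (dne λ n → ¬a (entry off≡ (colour-off pt q λ e′ → n (trans (sym e′) (sym e))))))
          where open AtEdge xy

        -- Three common neighbours, seen from one of the edges involved, give a row with two true
        -- entries. At least one of them is off the matching, so `off` is `true`.
        threeCommon⇒allButOne : ThreeCommon → AllButOne
        threeCommon⇒allButOne (u , u′ , u≢u′ , three {v₁} {v₂} {v₃} (a₁ , b₁) (a₂ , b₂) (a₃ , b₃) n₁₂ n₁₃ n₂₃) xy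
          with edge-transitive a₁ xy
        ... | α , refl , refl = matching⇒allButOne xy (opposite-colour off-true on≢off) off-true
          where
          open AtEdge xy
          r = to α u′
          rR : R r
          rR = to-arc α b₁ , λ e → u≢u′ (sym (to-inj α e))
          s₂ : S (to α v₂)
          s₂ = to-arc α a₂ , λ e → n₁₂ (sym (to-inj α e))
          s₃ : S (to α v₃)
          s₃ = to-arc α a₃ , λ e → n₁₃ (sym (to-inj α e))
          opposite-colour : ∀ {c d} → d ≡ true → c ≢ d → c ≡ false
          opposite-colour {false} e n = refl
          opposite-colour {true} e n = ⊥-elim (n (sym e))
          off-true : off ≡ true
          off-true with to α v₂ ≟ θ r
          ... | no n = trans (sym (colour-off rR s₂ n)) (does-true (to-arc α b₂))
          ... | yes e = trans (sym (colour-off rR s₃ λ e′ → n₂₃ (to-inj α (trans e (sym e′))))) (does-true (to-arc α b₃))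

        module NoThreeCommon (¬three : ¬ ThreeCommon) where

          -- If the entries off the matching are true, then each row has at most one of them, so there are just two columns.
          allButOne-small : (∀ {x y} → x ⟶ y → ¬ Three (OtherHeads x y)) → AllButOne
          allButOne-small ¬four {x} {y} xy = go refl refl
            where
            open AtEdge xy
            other-column : ∀ c → ∃[ s ] (S s × s ≢ c)
            other-column c = let (s , s′ , p , p′ , n) = two-columns in pick s s′ p p′ n
              where
              pick : ∀ s s′ → S s → S s′ → s ≢ s′ → ∃[ s ] (S s × s ≢ c)
              pick s s′ p p′ n with s ≟ c
              ... | no m = s , p , m
              ... | yes refl = s′ , p′ , λ e → n (sym e)
            no-three : ∀ {s t u} → S s → S t → S u → s ≢ t → s ≢ u → t ≢ u → ⊥
            no-three p q r n n′ n″ = ¬four xy (three p q r n n′ n″)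
            module TrueOnly (on≡ : on ≡ true) (off≡ : off ≡ false) where
              rows : ∀ {r} → R r → ∃[ s ] (S s × ¬ (r ⟶ s) × (∀ {t} → S t → ¬ (r ⟶ t) → t ≡ s))
              rows {r} p = let (s , q , n) = other-column (θ r) in s , q , no-entry off≡ (colour-off p q n) ,
                λ {t} q′ ¬a → dne λ m → no-three (θ∈S p) q q′ (λ e → n (sym e)) (λ e → ¬a (subst (r ⟶_) e (entry on≡ (colour-on p)))) (λ e → m (sym e))
              columns : ∀ {s} → S s → ∃[ r ] (R r × ¬ (r ⟶ s) × (∀ {t} → R t → ¬ (t ⟶ s) → t ≡ r))
              columns {s} q = let (s′ , q′ , n) = other-column s ; (r , p , e) = θ-surj q′
                                  miss = λ e′ → n (trans (sym e) (sym e′))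
                              in r , p , no-entry off≡ (colour-off p q miss) ,
                λ {t} pt ¬a → dne λ m → no-three q q′ (θ∈S pt) (λ e′ → n (sym e′))
                  (λ e′ → ¬a (subst (t ⟶_) (sym e′) (entry on≡ (colour-on pt))))
                  (λ e′ → m (θ-inj pt p (trans (sym e′) (sym e))))
            go : ∀ {o f} → on ≡ o → off ≡ f →
              (∀ {r} → R r → ∃[ s ] (S s × ¬ (r ⟶ s) × (∀ {t} → S t → ¬ (r ⟶ t) → t ≡ s))) ×
              (∀ {s} → S s → ∃[ r ] (R r × ¬ (r ⟶ s) × (∀ {t} → R t → ¬ (t ⟶ s) → t ≡ r)))
            go {false} {true} on≡ off≡ = matching⇒allButOne xy on≡ off≡
            go {true} {true} on≡ off≡ = ⊥-elim (on≢off (trans on≡ (sym off≡)))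
            go {false} {false} on≡ off≡ = ⊥-elim (on≢off (trans on≡ (sym off≡)))
            go {true} {false} on≡ off≡ = TrueOnly.rows on≡ off≡ , TrueOnly.columns on≡ off≡

          module FourNeighbours {x b₁ b₂ b₃ b₄} (e₁ : x ⟶ b₁) (e₂ : x ⟶ b₂) (e₃ : x ⟶ b₃) (e₄ : x ⟶ b₄)
            (n₁₂ : b₁ ≢ b₂) (n₁₃ : b₁ ≢ b₃) (n₁₄ : b₁ ≢ b₄) (n₂₃ : b₂ ≢ b₃) (n₂₄ : b₂ ≢ b₄) (n₃₄ : b₃ ≢ b₄) where

            at-most-two : ∀ {u c₁ c₂ c₃} → x ≢ u → x ⟶ c₁ → x ⟶ c₂ → x ⟶ c₃ → c₁ ≢ c₂ → c₁ ≢ c₃ → c₂ ≢ c₃ →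
                          u ⟶ c₁ → u ⟶ c₂ → ¬ (u ⟶ c₃)
            at-most-two n a b c n₁ n₂ n₃ d e f = ¬three (x , _ , n , three (a , d) (b , e) (c , f) n₁ n₂ n₃)

            -- With three columns, a matching of false entries would leave two true entries in a row.
            other-common : ∀ {c c′ d d′} → x ⟶ c → x ⟶ c′ → x ⟶ d → x ⟶ d′ →
              c ≢ c′ → c ≢ d → c ≢ d′ → c′ ≢ d → c′ ≢ d′ → d ≢ d′ → ∃[ p ] (x ≢ p × p ⟶ c × p ⟶ c′)
            other-common {c} {c′} {d} {d′} a a′ k k′ cc′ cd cd′ c′d c′d′ dd′ = go refl refl
              where
              open AtEdge a
              sc′ : S c′
              sc′ = a′ , λ e → cc′ (sym e)
              sd : S d
              sd = k , λ e → cd (sym e)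
              sd′ : S d′
              sd′ = k′ , λ e → cd′ (sym e)
              go : ∀ {o f} → on ≡ o → off ≡ f → ∃[ p ] (x ≢ p × p ⟶ c × p ⟶ c′)
              go {true} on≡ _ = let (p , (pc , n) , e) = θ-surj sc′
                                in p , (λ e → n (sym e)) , pc , subst (p ⟶_) e (entry on≡ (colour-on (pc , n)))
              go {false} {false} on≡ off≡ = ⊥-elim (on≢off (trans on≡ (sym off≡)))
              go {false} {true} on≡ off≡ =
                let (p , (pc , n) , e) = θ-surj sc′ ; pR = pc , n
                in ⊥-elim (at-most-two (λ e → n (sym e)) a k k′ cd cd′ dd′ pc
                     (entry off≡ (colour-off pR sd λ e′ → c′d (trans (sym e) (sym e′))))
                     (entry off≡ (colour-off pR sd′ λ e′ → c′d′ (trans (sym e) (sym e′)))))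

            -- p, x, q have the common neighbour b₂ for q = qA but no common neighbour for q = qB,
            -- although swapping qA and qB is an automorphism of the induced path p, b₁, x, b₃, q.
            contradictory : ⊥
            contradictory with other-common e₁ e₂ e₃ e₄ n₁₂ n₁₃ n₁₄ n₂₃ n₂₄ n₃₄
              | other-common e₂ e₃ e₁ e₄ n₂₃ (λ e → n₁₂ (sym e)) n₂₄ (λ e → n₁₃ (sym e)) n₃₄ n₁₄
              | other-common e₃ e₄ e₁ e₂ n₃₄ (λ e → n₁₃ (sym e)) (λ e → n₂₃ (sym e)) (λ e → n₁₄ (sym e)) (λ e → n₂₄ (sym e)) n₁₂
            ... | p , x≢p , pb₁ , pb₂ | qA , x≢qA , qAb₂ , qAb₃ | qB , x≢qB , qBb₃ , qBb₄ = go (swapLeaves core leaves (inj₁ refl) (inj₂ refl))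
              where
              Q S : V → Set
              Q v = ((v ≡ x ⊎ v ≡ b₁) ⊎ v ≡ b₃) ⊎ v ≡ p
              S v = v ≡ qA ⊎ v ≡ qB
              ¬pb₃ : ¬ (p ⟶ b₃)
              ¬pb₃ = at-most-two x≢p e₁ e₂ e₃ n₁₂ n₁₃ n₂₃ pb₁ pb₂
              ¬qb₁ : ∀ {q} → S q → ¬ (q ⟶ b₁)
              ¬qb₁ (inj₁ refl) e = at-most-two x≢qA e₂ e₃ e₁ n₂₃ (λ e → n₁₂ (sym e)) (λ e → n₁₃ (sym e)) qAb₂ qAb₃ e
              ¬qb₁ (inj₂ refl) e = at-most-two x≢qB e₃ e₄ e₁ n₃₄ (λ e → n₁₃ (sym e)) (λ e → n₁₄ (sym e)) qBb₃ qBb₄ e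
              qb₃ : ∀ {q} → S q → q ⟶ b₃
              qb₃ (inj₁ refl) = qAb₃
              qb₃ (inj₂ refl) = qBb₃
              x≢q : ∀ {q} → S q → x ≢ q
              x≢q (inj₁ refl) = x≢qA
              x≢q (inj₂ refl) = x≢qB
              core : Core Q
              core = record
                { listing = listing-∪ (listing-∪ (listing-∪ (listing-≡ x) (listing-≡ b₁)) (listing-≡ b₃)) (listing-≡ p)
                ; root = x ; root∈Q = inj₁ (inj₁ (inj₁ refl))
                ; reach = λ { (inj₁ (inj₁ (inj₁ refl))) → here ; (inj₁ (inj₁ (inj₂ refl))) → here ▻ (inj₁ (inj₁ (inj₂ refl)) , inj₁ e₁)
                            ; (inj₁ (inj₂ refl)) → here ▻ (inj₁ (inj₂ refl) , inj₁ e₃)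
                            ; (inj₂ refl) → here ▻ (inj₁ (inj₁ (inj₂ refl)) , inj₁ e₁) ▻ (inj₂ refl , inj₂ pb₁) } }
              leaves : Leaves Q S
              leaves = record
                { listing = listing-∪ (listing-≡ qA) (listing-≡ qB)
                ; disjoint = λ { q (inj₁ (inj₁ (inj₁ refl))) → x≢q q refl ; q (inj₁ (inj₁ (inj₂ refl))) → no-2-arc e₁ (qb₃ q)
                               ; q (inj₁ (inj₂ refl)) → no-2-arc e₃ (qb₃ q) ; q (inj₂ refl) → ¬pb₃ (qb₃ q) }
                ; colour = λ q q′ → same-κ (tail-X (qb₃ q)) (tail-X (qb₃ q′))
                ; stem = b₃ ; stem∈Q = inj₁ (inj₂ refl) ; attached = inj₂ qb₃
                ; independent = λ q q′ e → no-2-arc e (qb₃ q′)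
                ; free = λ { q (inj₁ (inj₁ (inj₁ refl))) _ (inj₁ e) → no-2-arc e e₁ ; q (inj₁ (inj₁ (inj₁ refl))) _ (inj₂ e) → no-2-arc e (qb₃ q)
                           ; q (inj₁ (inj₁ (inj₂ refl))) _ (inj₁ e) → ¬qb₁ q e ; q (inj₁ (inj₁ (inj₂ refl))) _ (inj₂ e) → no-2-arc e₁ e
                           ; q (inj₁ (inj₂ refl)) n _ → n refl
                           ; q (inj₂ refl) _ (inj₁ e) → no-2-arc e pb₁ ; q (inj₂ refl) _ (inj₂ e) → no-2-arc e (qb₃ q) } }
              go : Σ[ α ∈ Automorphism ] (Fixes α Q × (∀ {u} → S u → to α u ≡ transpose qA qB u)) → ⊥
              go (α , fix , sw) = final (c ≟ b₂)
                where
                c = to α b₂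
                xc : x ⟶ c
                xc = subst (_⟶ c) (fix (inj₁ (inj₁ (inj₁ refl)))) (to-arc α e₂)
                pc : p ⟶ c
                pc = subst (_⟶ c) (fix (inj₂ refl)) (to-arc α pb₂)
                qc : qB ⟶ c
                qc = subst (_⟶ c) (trans (sw (inj₁ refl)) (transpose-ˡ qA qB)) (to-arc α qAb₂)
                b₁≢c : b₁ ≢ c
                b₁≢c e = n₁₂ (to-inj α (trans (fix (inj₁ (inj₁ (inj₂ refl)))) e))
                final : Dec (c ≡ b₂) → ⊥
                final (no n) = at-most-two x≢p e₁ e₂ xc n₁₂ b₁≢c (λ e → n (sym e)) pb₁ pb₂ pc
                final (yes e) = at-most-two x≢qB e₃ e₄ e₂ n₃₄ (λ e → n₂₃ (sym e)) (λ e → n₂₄ (sym e)) qBb₃ qBb₄ (subst (qB ⟶_) e qc)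

          allButOne : AllButOne
          allButOne = allButOne-small λ { xy (three (e₂ , m₂) (e₃ , m₃) (e₄ , m₄) n₁ n₂ n₃) →
            FourNeighbours.contradictory xy e₂ e₃ e₄ (λ e → m₂ (sym e)) (λ e → m₃ (sym e)) (λ e → m₄ (sym e)) n₁ n₂ n₃ }

        classify-fourCycle : Classified
        classify-fourCycle with dec ThreeCommon
        ... | yes t = classify-matching (allButOne⇒matching (threeCommon⇒allButOne t))
        ... | no ¬t = classify-matching (allButOne⇒matching (NoThreeCommon.allButOne ¬t))

  -- Absence of cycles when there are no four-cycles

  module Girth where

    open import Data.Fin.Properties using (toℕ<n; toℕ-fromℕ<; fromℕ<-toℕ)
    open import Data.List.Base using (allFin)
    open import Data.List.Membership.Propositional.Properties using (∈-allFin)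
    open import Data.Nat.Properties hiding (_≟_)
    open import Data.Nat.Induction using (<-rec)
    open import Data.Parity.Properties using (⁻¹-involutive; p≢p⁻¹)
    open import Relation.Binary.Definitions using (tri<; tri≈; tri>)
    open Base
    open Homogeneous
    open Arcs
    open BipartiteBasics
    open FourCycles
    open import Defs using (Cycle)
    open Aut

    module ReducedWalks (B : BipartiteHD) where
      open Bipartite B public

      record Reduced (j : ℕ) (z : ℕ → V) : Set where
        field
          adjacent : ∀ i → i < j → Adj (z i) (z (suc i))
          reduced  : ∀ i → suc i < j → z i ≢ z (suc (suc i))
      open Reduced public

      -- For reduced walks this means being an induced path; distinctness follows in
      -- `tight-injective`.
      Tight : ℕ → (ℕ → V) → Set
      Tight j z = ∀ i k → i ≤ j → k ≤ j → Adj (z i) (z k) → k ≡ suc i ⊎ i ≡ suc k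

      reduced-≤ : ∀ {j k z} → k ≤ j → Reduced j z → Reduced k z
      reduced-≤ p r = record { adjacent = λ i q → adjacent r i (≤-trans q p) ; reduced = λ i q → reduced r i (≤-trans q p) }

      reduced-tail : ∀ {j z} → Reduced (suc j) z → Reduced j (z ∘ suc)
      reduced-tail r = record { adjacent = λ i q → adjacent r (suc i) (s≤s q) ; reduced = λ i q → reduced r (suc i) (s≤s q) }

      Adj-irrefl : ∀ {v} → ¬ Adj v v
      Adj-irrefl (inj₁ a) = irrefl a
      Adj-irrefl (inj₂ a) = irrefl a

      no-repeat : ∀ {j z} → Reduced j z → Tight j z → ∀ {i k} → i < k → k ≤ j → z i ≢ z k
      no-repeat {j} {z} r t {i} {k} i<k k≤j eq
        with t k (suc i) k≤j (≤-trans i<k k≤j) (subst (λ v → Adj v (z (suc i))) eq (adjacent r i (≤-trans i<k k≤j)))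
      ... | inj₁ e = <-irrefl (suc-injective e) i<k
      ... | inj₂ refl = reduced r i k≤j eq

      tight-injective : ∀ {j z} → Reduced j z → Tight j z → ∀ {i k} → i ≤ j → k ≤ j → z i ≡ z k → i ≡ k
      tight-injective r t {i} {k} p q eq with <-cmp i k
      ... | tri≈ _ e _ = e
      ... | tri< i<k _ _ = ⊥-elim (no-repeat r t i<k q eq)
      ... | tri> _ _ k<i = ⊥-elim (no-repeat r t k<i p (sym eq))

      parts-agree : ∀ {j z w} → Reduced j z → Reduced j w → part (z 0) ≡ part (w 0) → ∀ i → i ≤ j → part (z i) ≡ part (w i)
      parts-agree r s eq zero p = eq
      parts-agree r s eq (suc i) p = trans (Adj-part (adjacent r i p))
        (trans (cong opposite (parts-agree r s eq i (<⇒≤ p))) (sym (Adj-part (adjacent s i p))))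

      walk-transitive : ∀ {j z w} → Reduced j z → Tight j z → Reduced j w → Tight j w → part (z 0) ≡ part (w 0) →
        Σ[ α ∈ Automorphism ] (∀ i → i ≤ j → to α (z i) ≡ w i)
      walk-transitive {j} {z} {w} rz tz rw tw eq =
        let (α , e) = homogeneous {Fin (suc j)} (z ∘ toℕ) (w ∘ toℕ) (allFin (suc j) , λ {i} _ → ∈-allFin i) zero reach
              (λ i → κ-part (parts-agree rz rw eq (toℕ i) (bound i)))
              (λ i k e → cong w (tight-injective rz tz (bound i) (bound k) e))
              (λ i k e → cong z (tight-injective rw tw (bound i) (bound k) e))
              (λ i k → carry rz tz rw eq (bound i) (bound k))
              (λ i k → carry rw tw rz (sym eq) (bound i) (bound k))
        in α , λ i i≤j → subst₂ (λ u v → to α u ≡ v) (cong z (toℕ-fromℕ< (s≤s i≤j))) (cong w (toℕ-fromℕ< (s≤s i≤j))) (e (fromℕ< (s≤s i≤j)))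
        where
        bound : (i : Fin (suc j)) → toℕ i ≤ j
        bound i = ≤-pred (toℕ<n i)
        carry : ∀ {z w} → Reduced j z → Tight j z → Reduced j w → part (z 0) ≡ part (w 0) →
                ∀ {i k} → i ≤ j → k ≤ j → z i ⟶ z k → w i ⟶ w k
        carry rz tz rw eq {i} {k} p q a = Adj-from-X (trans (sym (parts-agree rz rw eq i p)) (tail-X a)) (adj (tz i k p q (inj₁ a)))
          where
          adj : k ≡ suc i ⊎ i ≡ suc k → Adj _ _
          adj (inj₁ refl) = adjacent rw i q
          adj (inj₂ refl) = swap (adjacent rw k p)
        Step : Fin (suc j) → Fin (suc j) → Set
        Step i k = Adj (z (toℕ i)) (z (toℕ k))
        reachℕ : ∀ n (p : n < suc j) → Reach Step zero (fromℕ< p)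
        reachℕ zero (s≤s z≤n) = here
        reachℕ (suc n) p = reachℕ n (<⇒≤ p) ▻
          subst₂ (λ s t → Adj (z s) (z t)) (sym (toℕ-fromℕ< (<⇒≤ p))) (sym (toℕ-fromℕ< p)) (adjacent rz n (≤-pred p))
        reach : ∀ i → Reach Step zero i
        reach i = subst (Reach Step zero) (fromℕ<-toℕ i (toℕ<n i)) (reachℕ (toℕ i) (toℕ<n i))

      tight-0 : ∀ {z} → Tight 0 z
      tight-0 zero zero _ _ a = ⊥-elim (Adj-irrefl a)

      tight-suc : ∀ {j z} → (∀ w → Reduced j w → Tight j w) → Reduced (suc j) z → (1 ≤ j → ¬ Adj (z 0) (z (suc j))) → Tight (suc j) z
      tight-suc {j} {z} t r none = go
        where
        from-start : ∀ {j k} → k ≤ j → (∀ w → Reduced j w → Tight j w) → Reduced (suc j) z → (1 ≤ j → ¬ Adj (z 0) (z (suc j))) →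
                     Adj (z 0) (z (suc k)) → k ≡ 0
        from-start {j} {k} q t r none a with m≤n⇒m<n∨m≡n q
        ... | inj₁ k<j with t z (reduced-≤ (n≤1+n j) r) 0 (suc k) z≤n k<j a
        ...   | inj₁ e = suc-injective e
        from-start {zero} q t r none a | inj₂ refl = refl
        from-start {suc j} q t r none a | inj₂ refl = ⊥-elim (none (s≤s z≤n) a)
        go : Tight (suc j) z
        go zero zero p q a = ⊥-elim (Adj-irrefl a)
        go zero (suc k) p (s≤s q) a = inj₁ (cong suc (from-start q t r none a))
        go (suc i) zero (s≤s p) q a = inj₂ (cong suc (from-start p t r none (swap a)))
        go (suc i) (suc k) (s≤s p) (s≤s q) a with t _ (reduced-tail r) i k p q a
        ... | inj₁ e = inj₁ (cong suc e)
        ... | inj₂ e = inj₂ (cong suc e)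

      -- A cycle without its closing edge is a reduced walk, and the closing edge is a chord of it.
      all-tight⇒acyclic : (∀ j z → Reduced j z → Tight j z) → ¬ Cycle graph
      all-tight⇒acyclic tight record { len = zero ; 3≤len = () }
      all-tight⇒acyclic tight record { len = suc zero ; 3≤len = s≤s () }
      all-tight⇒acyclic tight record { len = suc (suc zero) ; 3≤len = s≤s (s≤s ()) }
      all-tight⇒acyclic tight record { len = suc (suc (suc n)) ; vertex = vertex ; injective = injective ; adjacent = adj }
        with tight m z reduced-z 0 m z≤n ≤-refl (swap last-first)
        where
        m : ℕ
        m = suc (suc n)
        z : ℕ → V
        z i with suc i ≤? suc m
        ... | yes p = vertex (fromℕ< p)
        ... | no _ = vertex zero
        z-vertex : ∀ {i} (p : i < suc m) → z i ≡ vertex (fromℕ< p)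
        z-vertex {i} p with suc i ≤? suc m
        ... | yes q = refl
        ... | no ¬p = contradiction p ¬p
        last-first : Adj (z m) (z 0)
        last-first = toAdj (subst₂ (Graph-~) (sym (z-vertex ≤-refl)) (sym (z-vertex (s≤s z≤n)))
          (adj (inj₂ (cong suc (toℕ-fromℕ< ≤-refl) , refl))))
          where
          open import Defs using (Graph)
          Graph-~ = Graph._~_ graph
        reduced-z : Reduced m z
        reduced-z = record
          { adjacent = λ i p → subst₂ Adj (sym (z-vertex (m<n⇒m<1+n p))) (sym (z-vertex (s≤s p)))
              (toAdj (adj (inj₁ (trans (toℕ-fromℕ< (s≤s p)) (cong suc (sym (toℕ-fromℕ< (m<n⇒m<1+n p))))))))
          ; reduced = λ i p eq → m≢1+n+m i {1} (trans (sym (toℕ-fromℕ< (m<n⇒m<1+n (<⇒≤ p)))) (trans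
              (cong toℕ (injective (trans (sym (z-vertex (m<n⇒m<1+n (<⇒≤ p)))) (trans eq (z-vertex (s≤s p))))))
              (toℕ-fromℕ< (s≤s p)))) }
      ... | inj₂ ()
      ... | inj₁ ()

    module _ (B : BipartiteHD) where
      open Bipartite B

      FourCycleFree : Set
      FourCycleFree = ∀ {x x′ y y′} → x ⟶ y → x ⟶ y′ → x′ ⟶ y → x′ ⟶ y′ → x ≡ x′ ⊎ y ≡ y′

    module _ (B : BipartiteHD) where
      open ReducedWalks B

      module LargeGirth (c4 : FourCycleFree B)
        (degree : ∀ {x} → IsX x → Three (x ⟶_)) (other : ∀ {x y} → x ⟶ y → ∃[ x′ ] (x′ ⟶ y × x′ ≢ x)) where

        square : ∀ {a b c d} → Adj a b → Adj b c → Adj c d → Adj d a → a ≡ c ⊎ b ≡ d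
        square {a} ab bc cd da with side a
        ... | inj₁ p = c4 (Adj-from-X p ab) (Adj-from-X p (swap da)) (Adj-from-Y q bc) (Adj-from-X r cd)
          where
          q = trans (Adj-part ab) (cong opposite p)
          r = trans (Adj-part bc) (cong opposite q)
        ... | inj₂ p = swap (c4 (Adj-from-Y p ab) (Adj-from-X q bc) (Adj-from-Y p (swap da)) (Adj-from-Y r cd))
          where
          q = trans (Adj-part ab) (cong opposite p)
          r = trans (Adj-part bc) (cong opposite q)

        list₅ : V → V → V → V → V → ℕ → V
        list₅ a b c d e 0 = a
        list₅ a b c d e 1 = b
        list₅ a b c d e 2 = c
        list₅ a b c d e 3 = d
        list₅ a b c d e (suc (suc (suc (suc _)))) = e

        reduced₅ : ∀ {a b c d e} → Adj a b → Adj b c → Adj c d → Adj d e → a ≢ c → b ≢ d → c ≢ e → Reduced 4 (list₅ a b c d e)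
        reduced₅ ab bc cd de ac bd ce = record
          { adjacent = λ { 0 _ → ab ; 1 _ → bc ; 2 _ → cd ; 3 _ → de ; (suc (suc (suc (suc _)))) (s≤s (s≤s (s≤s (s≤s ())))) }
          ; reduced = λ { 0 _ → ac ; 1 _ → bd ; 2 _ → ce ; (suc (suc (suc _))) (s≤s (s≤s (s≤s (s≤s ())))) } }

        avoiding : ∀ {P : V → Set} → Three P → ∀ a b → ∃[ y ] (P y × y ≢ a × y ≢ b)
        avoiding t a b = both-hold t (λ _ _ p q → trans (dne p) (sym (dne q))) (λ _ _ p q → trans (dne p) (sym (dne q)))

        same-tail : ∀ {x x′ y y′} → x ⟶ y → x ⟶ y′ → x′ ⟶ y → x′ ⟶ y′ → y ≢ y′ → x ≡ x′
        same-tail a b c d n with c4 a b c d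
        ... | inj₁ e = e
        ... | inj₂ e = ⊥-elim (n e)

        same-head : ∀ {x x′ y y′} → x ⟶ y → x ⟶ y′ → x′ ⟶ y → x′ ⟶ y′ → x ≢ x′ → y ≡ y′
        same-head a b c d n with c4 a b c d
        ... | inj₁ e = ⊥-elim (n e)
        ... | inj₂ e = e

        -- If all walks of length four close up to hexagons, three concurrent "lines" m₁, m₂, m₃
        -- through points of a line l can be mapped to three lines which are not concurrent.
        module Hexagons (closes : ∀ {a b c d e} → Reduced 4 (list₅ a b c d e) → ∃[ f ] (Adj f a × Adj f e)) where

          module Spider {l p₁ p₂ p₃ m₁ m₂} (lp₁ : l ⟶ p₁) (lp₂ : l ⟶ p₂) (lp₃ : l ⟶ p₃) (n₁₂ : p₁ ≢ p₂) (n₁₃ : p₁ ≢ p₃) (n₂₃ : p₂ ≢ p₃)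
            (m₁p₁ : m₁ ⟶ p₁) (m₂p₂ : m₂ ⟶ p₂) (m₁≢l : m₁ ≢ l) (m₂≢l : m₂ ≢ l) where

            ¬m₁p₂ : ¬ (m₁ ⟶ p₂)
            ¬m₁p₂ a = m₁≢l (same-tail m₁p₁ a lp₁ lp₂ n₁₂)
            ¬m₁p₃ : ¬ (m₁ ⟶ p₃)
            ¬m₁p₃ a = m₁≢l (same-tail m₁p₁ a lp₁ lp₃ n₁₃)
            ¬m₂p₁ : ¬ (m₂ ⟶ p₁)
            ¬m₂p₁ a = m₂≢l (same-tail a m₂p₂ lp₁ lp₂ n₁₂)
            ¬m₂p₃ : ¬ (m₂ ⟶ p₃)
            ¬m₂p₃ a = m₂≢l (same-tail m₂p₂ a lp₂ lp₃ n₂₃)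
            m₁≢m₂ : m₁ ≢ m₂
            m₁≢m₂ refl = ¬m₁p₂ m₂p₂

            Q : V → Set
            Q v = ((v ≡ l ⊎ (v ≡ p₁ ⊎ v ≡ p₂)) ⊎ v ≡ p₃) ⊎ (v ≡ m₁ ⊎ v ≡ m₂)

            core : Core Q
            core = record
              { listing = listing-∪ (listing-∪ (listing-∪ (listing-≡ l) (listing-∪ (listing-≡ p₁) (listing-≡ p₂))) (listing-≡ p₃))
                            (listing-∪ (listing-≡ m₁) (listing-≡ m₂))
              ; root = l ; root∈Q = inj₁ (inj₁ (inj₁ refl))
              ; reach = λ { (inj₁ (inj₁ (inj₁ refl))) → here
                          ; (inj₁ (inj₁ (inj₂ (inj₁ refl)))) → here ▻ (inj₁ (inj₁ (inj₂ (inj₁ refl))) , inj₁ lp₁)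
                          ; (inj₁ (inj₁ (inj₂ (inj₂ refl)))) → here ▻ (inj₁ (inj₁ (inj₂ (inj₂ refl))) , inj₁ lp₂)
                          ; (inj₁ (inj₂ refl)) → here ▻ (inj₁ (inj₂ refl) , inj₁ lp₃)
                          ; (inj₂ (inj₁ refl)) → here ▻ (inj₁ (inj₁ (inj₂ (inj₁ refl))) , inj₁ lp₁) ▻ (inj₂ (inj₁ refl) , inj₂ m₁p₁)
                          ; (inj₂ (inj₂ refl)) → here ▻ (inj₁ (inj₁ (inj₂ (inj₂ refl))) , inj₁ lp₂) ▻ (inj₂ (inj₂ refl) , inj₂ m₂p₂) } }

            leaves : ∀ {m m′} → (∀ {s} → s ≡ m ⊎ s ≡ m′ → s ⟶ p₃ × s ≢ l) → Leaves Q (λ s → s ≡ m ⊎ s ≡ m′)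
            leaves {m} {m′} spec = record
              { listing = listing-∪ (listing-≡ m) (listing-≡ m′)
              ; disjoint = λ { s (inj₁ (inj₁ (inj₁ refl))) → proj₂ (spec s) refl
                             ; s (inj₁ (inj₁ (inj₂ (inj₁ refl)))) → no-2-arc lp₁ (proj₁ (spec s))
                             ; s (inj₁ (inj₁ (inj₂ (inj₂ refl)))) → no-2-arc lp₂ (proj₁ (spec s))
                             ; s (inj₁ (inj₂ refl)) → no-2-arc lp₃ (proj₁ (spec s))
                             ; s (inj₂ (inj₁ refl)) → ¬m₁p₃ (proj₁ (spec s)) ; s (inj₂ (inj₂ refl)) → ¬m₂p₃ (proj₁ (spec s)) }
              ; colour = λ s t → same-κ (tail-X (proj₁ (spec s))) (tail-X (proj₁ (spec t)))
              ; stem = p₃ ; stem∈Q = inj₁ (inj₂ refl) ; attached = inj₂ (λ s → proj₁ (spec s))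
              ; independent = λ s t a → no-2-arc a (proj₁ (spec t))
              ; free = free }
              where
              free : ∀ {s u} → s ≡ m ⊎ s ≡ m′ → Q u → u ≢ p₃ → ¬ Adj s u
              free s (inj₁ (inj₁ (inj₁ refl))) _ (inj₁ a) = no-2-arc a lp₁
              free s (inj₁ (inj₁ (inj₁ refl))) _ (inj₂ a) = no-2-arc a (proj₁ (spec s))
              free s (inj₁ (inj₁ (inj₂ (inj₁ refl)))) _ (inj₁ a) = proj₂ (spec s) (same-tail a (proj₁ (spec s)) lp₁ lp₃ n₁₃)
              free s (inj₁ (inj₁ (inj₂ (inj₁ refl)))) _ (inj₂ a) = no-2-arc lp₁ a
              free s (inj₁ (inj₁ (inj₂ (inj₂ refl)))) _ (inj₁ a) = proj₂ (spec s) (same-tail a (proj₁ (spec s)) lp₂ lp₃ n₂₃)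
              free s (inj₁ (inj₁ (inj₂ (inj₂ refl)))) _ (inj₂ a) = no-2-arc lp₂ a
              free s (inj₁ (inj₂ refl)) n _ = n refl
              free s (inj₂ (inj₁ refl)) _ (inj₁ a) = no-2-arc a m₁p₁
              free s (inj₂ (inj₁ refl)) _ (inj₂ a) = no-2-arc a (proj₁ (spec s))
              free s (inj₂ (inj₂ refl)) _ (inj₁ a) = no-2-arc a m₂p₂
              free s (inj₂ (inj₂ refl)) _ (inj₂ a) = no-2-arc a (proj₁ (spec s))

            -- The automorphism exchanging the leaves `m₃` and `m₃′` fixes `m₁` and `m₂` and hence
            -- their only common point `r`. So `m₃′` passes through `r` and `p₃` as `m₃` does, and
            -- two points lie on only one line.
            concurrent : ∀ {r m₃ m₃′} → m₁ ⟶ r → m₂ ⟶ r → m₃ ⟶ r → m₃ ⟶ p₃ → m₃ ≢ l → m₃′ ⟶ p₃ → m₃′ ≢ l → m₃ ≡ m₃′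
            concurrent {r} {m₃} {m₃′} m₁r m₂r m₃r m₃p₃ m₃≢l m₃′p₃ m₃′≢l
              with swapLeaves core (leaves λ { (inj₁ refl) → m₃p₃ , m₃≢l ; (inj₂ refl) → m₃′p₃ , m₃′≢l }) (inj₁ refl) (inj₂ refl)
            ... | α , fix , sw = same-tail m₃r m₃p₃ (subst₂ _⟶_ (trans (sw (inj₁ refl)) (transpose-ˡ m₃ m₃′)) αr≡r (to-arc α m₃r)) m₃′p₃ r≢p₃
              where
              αr≡r : to α r ≡ r
              αr≡r = same-head (subst (_⟶ _) (fix (inj₂ (inj₁ refl))) (to-arc α m₁r)) m₁r
                               (subst (_⟶ _) (fix (inj₂ (inj₂ refl))) (to-arc α m₂r)) m₂r m₁≢m₂
              r≢p₃ : r ≢ p₃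
              r≢p₃ refl = ¬m₁p₃ m₁r

            contradictory : ⊥
            contradictory =
              let (r , rm₁ , rm₂) = closes (reduced₅ (inj₁ m₁p₁) (inj₂ lp₁) (inj₁ lp₂) (inj₂ m₂p₂) m₁≢l n₁₂ (λ e → m₂≢l (sym e)))
                  m₁r = Adj-from-X (tail-X m₁p₁) (swap rm₁)
                  m₂r = Adj-from-X (tail-X m₂p₂) (swap rm₂)
                  r≢p₁ = λ e → ¬m₂p₁ (subst (m₂ ⟶_) e m₂r)
                  (m₃ , m₃r′ , m₃p₃′) = closes (reduced₅ (inj₂ m₁r) (inj₁ m₁p₁) (inj₂ lp₁) (inj₁ lp₃) r≢p₁ m₁≢l n₁₃)
                  m₃r = Adj-from-Y (head-Y m₁r) (swap m₃r′)
                  m₃p₃ = Adj-from-Y (head-Y lp₃) (swap m₃p₃′)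
                  m₃≢l = λ e → m₁≢l (same-tail m₁r m₁p₁ (subst (_⟶ r) e m₃r) lp₁ r≢p₁)
                  m₁≢m₃ = λ e → ¬m₁p₃ (subst (_⟶ p₃) (sym e) m₃p₃)
                  m₂≢m₃ = λ e → ¬m₂p₃ (subst (_⟶ p₃) (sym e) m₃p₃)
                  (α , _ , αr) = edge-transitive m₁r lp₃
                  -- The degree hypothesis concerns points on a line. That three lines pass through
                  -- `p₃` is carried over from `r`, where `m₁`, `m₂` and `m₃` have just been found.
                  lines = three-map {Q = _⟶ p₃} (to α) (to-inj α) (λ {v} a → subst (to α v ⟶_) αr (to-arc α a)) (three m₁r m₂r m₃r m₁≢m₂ m₁≢m₃ m₂≢m₃)
                  (m₃′ , m₃′p₃ , m₃′≢l , m₃′≢m₃) = avoiding lines l m₃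
              in m₃′≢m₃ (sym (concurrent m₁r m₂r m₃r m₃p₃ m₃≢l m₃′p₃ m₃′≢l))

          contradictory : ⊥
          contradictory with degree (tail-X x₀y₀)
          ... | three lp₁ lp₂ lp₃ n₁₂ n₁₃ n₂₃ =
            let (m₁ , m₁p₁ , m₁≢l) = other lp₁ ; (m₂ , m₂p₂ , m₂≢l) = other lp₂
            in Spider.contradictory lp₁ lp₂ lp₃ n₁₂ n₁₃ n₂₃ m₁p₁ m₂p₂ m₁≢l m₂≢l

        two-steps : ∀ {u v w} → Adj u v → Adj v w → part w ≡ part u
        two-steps a b = trans (Adj-part b) (trans (cong opposite (Adj-part a)) (⁻¹-involutive _))

        part≢ : ∀ {u v} → Adj u v → part u ≢ part v
        part≢ a eq = p≢p⁻¹ _ (trans eq (Adj-part a))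

        open ArcSequences _⟶_ using (snoc; snoc-≤; snoc->)

        reduced-snoc : ∀ {j z v} → Reduced j z → Adj (z j) v → (∀ {i} → j ≡ suc i → z i ≢ v) → Reduced (suc j) (snoc z j v)
        reduced-snoc {j} {z} {v} r a n = record { adjacent = adjacent′ ; reduced = reduced′ }
          where
          adjacent′ : ∀ i → i < suc j → Adj (snoc z j v i) (snoc z j v (suc i))
          adjacent′ i (s≤s i≤j) with m≤n⇒m<n∨m≡n i≤j
          ... | inj₁ i<j = subst₂ Adj (sym (snoc-≤ i≤j)) (sym (snoc-≤ i<j)) (adjacent r i i<j)
          ... | inj₂ refl = subst₂ Adj (sym (snoc-≤ {z} {j} {v} i≤j)) (sym (snoc-> {z} j)) a
          reduced′ : ∀ i → suc i < suc j → snoc z j v i ≢ snoc z j v (suc (suc i))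
          reduced′ i (s≤s i<j) eq with m≤n⇒m<n∨m≡n i<j
          ... | inj₁ i+1<j = reduced r i i+1<j (trans (sym (snoc-≤ (<⇒≤ i<j))) (trans eq (snoc-≤ i+1<j)))
          ... | inj₂ refl = n refl (trans (sym (snoc-≤ (<⇒≤ i<j))) (trans eq (snoc-> {z} {v} j)))

        list₆ : V → V → V → V → V → V → ℕ → V
        list₆ a b c d e f 0 = a
        list₆ a b c d e f (suc n) = list₅ b c d e f n

        module LongCycle {k} (ih : ∀ {i} → i < 6 + k → ∀ z → Reduced i z → Tight i z) where

          j : ℕ
          j = suc (suc (suc (suc (suc k))))

          j′ : ℕ
          j′ = suc (suc (suc (suc k)))

          -- Replacing `z j` by a third neighbour `v` of `z j′` gives another walk of the same kind.
          -- The automorphism between the two fixes everything up to `z j′` and moves the closing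
          -- vertex `c` to `c′`; then `z 0`, `c`, `z j`, `z j′`, `v`, `c′` form a hexagon, which the
          -- induction hypothesis forbids.
          from-X : ∀ {z} → Reduced (suc j) z → Adj (z 0) (z (suc j)) → ¬ IsX (z j′)
          from-X {z} r chord p with avoiding (degree p) (z (suc (suc (suc k)))) (z j)
          ... | v , xv , v≢ , v≢zj = go (walk-transitive rj (ih ≤-refl z rj) rw (ih ≤-refl w rw) (cong part (sym (snoc-≤ {z} {j′} {v} z≤n))))
            where
            rj : Reduced j z
            rj = reduced-≤ (n≤1+n j) r
            w : ℕ → V
            w = snoc z j′ v
            rw : Reduced j w
            rw = reduced-snoc (reduced-≤ (n≤1+n j′) rj) (inj₁ xv) λ { refl e → v≢ (sym e) }
            go : Σ[ α ∈ Automorphism ] (∀ i → i ≤ j → to α (z i) ≡ w i) → ⊥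
            go (α , eq) = absurd (ih (s≤s (s≤s (s≤s (s≤s (s≤s (s≤s z≤n)))))) six r₆ 5 0 ≤-refl z≤n c′z₀)
              where
              c c′ : V
              c = z (suc j)
              c′ = to α c
              adj : ∀ {u v} → Adj u v → Adj (to α u) (to α v)
              adj (inj₁ a) = inj₁ (to-arc α a)
              adj (inj₂ a) = inj₂ (to-arc α a)
              c′z₀ : Adj c′ (z 0)
              c′z₀ = subst (Adj c′) (trans (eq 0 z≤n) (snoc-≤ {z} {j′} {v} z≤n)) (adj (swap chord))
              vc′ : Adj v c′
              vc′ = subst (λ u → Adj u c′) (trans (eq j ≤-refl) (snoc-> {z} j′)) (adj (adjacent r j ≤-refl))
              six : ℕ → V
              six = list₆ (z 0) c (z j) (z j′) v c′
              z₀≢zj : z 0 ≢ z j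
              z₀≢zj = no-repeat rj (ih ≤-refl z rj) (s≤s z≤n) ≤-refl
              zj′≢c′ : z j′ ≢ c′
              zj′≢c′ e with ih ≤-refl z rj j′ 0 (n≤1+n j′) z≤n (subst (λ u → Adj u (z 0)) (sym e) c′z₀)
              ... | inj₁ ()
              ... | inj₂ ()
              r₆ : Reduced 5 six
              r₆ = record
                { adjacent = λ { 0 _ → chord ; 1 _ → swap (adjacent r j ≤-refl) ; 2 _ → swap (adjacent r j′ (n≤1+n j)) ; 3 _ → inj₁ xv ; 4 _ → vc′
                               ; (suc (suc (suc (suc (suc _))))) (s≤s (s≤s (s≤s (s≤s (s≤s ()))))) }
                ; reduced = λ { 0 _ → z₀≢zj ; 1 _ e → reduced r j′ ≤-refl (sym e) ; 2 _ e → v≢zj (sym e) ; 3 _ → zj′≢c′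
                              ; (suc (suc (suc (suc _)))) (s≤s (s≤s (s≤s (s≤s (s≤s ()))))) } }
              absurd : ¬ (0 ≡ 6 ⊎ 5 ≡ 1)
              absurd (inj₁ ())
              absurd (inj₂ ())

          no-chord : ∀ {z} → Reduced (suc j) z → ¬ Adj (z 0) (z (suc j))
          no-chord {z} r chord with side (z j′)
          ... | inj₁ p = from-X r chord p
          -- Rotating the cycle by one step brings a vertex of the side with three neighbours to
          -- position `j′`.
          ... | inj₂ p = from-X {snoc (z ∘ suc) j (z 0)} (reduced-snoc (reduced-tail r) (swap chord) λ { refl e → z₀≢zj (sym e) })
                (subst₂ Adj (sym (snoc-≤ {z ∘ suc} {j} {z 0} z≤n)) (sym (snoc-> {z ∘ suc} j)) (swap (adjacent r 0 (s≤s z≤n))))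
                (subst IsX (sym (snoc-≤ {z ∘ suc} {j} {z 0} (n≤1+n j′))) (trans (Adj-part (adjacent r j′ (n≤1+n j))) (cong opposite p)))
            where
            rj : Reduced j z
            rj = reduced-≤ (n≤1+n j) r
            z₀≢zj : z 0 ≢ z j
            z₀≢zj = no-repeat rj (ih ≤-refl z rj) (s≤s z≤n) ≤-refl

        -- A chord between the ends of a walk of length `suc j` closes a cycle with `j + 2` edges.
        -- Three and five edges contradict the bipartition and four edges `c4`; the hexagon and the
        -- longer cycles have arguments of their own.
        all-tight : ∀ j z → Reduced j z → Tight j z
        all-tight = <-rec (λ j → ∀ z → Reduced j z → Tight j z) step
          where
          step : ∀ j → (∀ {i} → i < j → ∀ z → Reduced i z → Tight i z) → ∀ z → Reduced j z → Tight j z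
          step zero ih z r = tight-0
          step (suc j) ih z r = tight-suc (ih ≤-refl) r (no-chord j ih r)
            where
            no-chord : ∀ j → (∀ {i} → i < suc j → ∀ z → Reduced i z → Tight i z) → Reduced (suc j) z → 1 ≤ j → ¬ Adj (z 0) (z (suc j))
            no-chord 1 ih r _ a = part≢ a (sym (two-steps (adjacent r 0 (s≤s z≤n)) (adjacent r 1 ≤-refl)))
            no-chord 2 ih r _ a with square (adjacent r 0 (s≤s z≤n)) (adjacent r 1 (s≤s (s≤s z≤n))) (adjacent r 2 ≤-refl) (swap a)
            ... | inj₁ e = reduced r 0 (s≤s (s≤s z≤n)) e
            ... | inj₂ e = reduced r 1 ≤-refl e
            no-chord 3 ih r _ a = part≢ a (sym (trans (two-steps (adjacent r 2 (s≤s (s≤s (s≤s z≤n)))) (adjacent r 3 ≤-refl))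
                                                    (two-steps (adjacent r 0 (s≤s z≤n)) (adjacent r 1 (s≤s (s≤s z≤n))))))
            no-chord 4 ih r _ a = Hexagons.contradictory closes
              where
              r₄ : Reduced 4 z
              r₄ = reduced-≤ (n≤1+n 4) r
              adj : ∀ α {u v} → Adj u v → Adj (to α u) (to α v)
              adj α (inj₁ a) = inj₁ (to-arc α a)
              adj α (inj₂ a) = inj₂ (to-arc α a)
              closes : ∀ {a b c d e} → Reduced 4 (list₅ a b c d e) → ∃[ f ] (Adj f a × Adj f e)
              closes {a₀} rw with part (z 0) ≟ part a₀
              ... | yes eq = let (α , e) = walk-transitive r₄ (ih ≤-refl z r₄) rw (ih ≤-refl _ rw) eq
                             in to α (z 5) , subst (Adj _) (e 0 z≤n) (adj α (swap a)) , subst (Adj _) (e 4 ≤-refl) (adj α (swap (adjacent r 4 ≤-refl)))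
              -- Extensions must respect the sides, so a path that begins on the other side is
              -- compared with the hexagon shifted by one step.
              ... | no n = let (α , e) = walk-transitive (reduced-tail r) (ih ≤-refl _ (reduced-tail r)) rw (ih ≤-refl _ rw) (trans (Adj-part (adjacent r 0 (s≤s z≤n))) (other-part n))
                           in to α (z 0) , subst (Adj _) (e 0 z≤n) (adj α (adjacent r 0 (s≤s z≤n))) , subst (Adj _) (e 4 ≤-refl) (adj α a)
                where
                other-part : ∀ {p q} → p ≢ q → opposite p ≡ q
                other-part {0ℙ} {0ℙ} n = ⊥-elim (n refl)
                other-part {0ℙ} {1ℙ} n = refl
                other-part {1ℙ} {0ℙ} n = refl
                other-part {1ℙ} {1ℙ} n = ⊥-elim (n refl)
            no-chord (suc (suc (suc (suc (suc k))))) ih r _ a = LongCycle.no-chord ih r a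

        acyclic : ¬ Cycle graph
        acyclic = all-tight⇒acyclic all-tight

  -- The list of homogeneous bipartite graphs

  module Classification where

    open import Data.Fin.Base using (fromℕ)
    open import Data.Fin.Properties using (toℕ-fromℕ<; toℕ-fromℕ)
    open import Data.List.Base using (tabulate)
    open import Data.List.Membership.Propositional.Properties using (∈-tabulate⁺)
    open import Data.List.Relation.Unary.Any using (here; there)
    open import Data.Nat.Base using (parity)
    open import Data.Nat.Properties using (≤-refl; <⇒≤; +-comm)
    open import Data.Parity.Properties using (⁻¹-involutive; p≢p⁻¹)
    open import Function.Construct.Composition using (_↔-∘_)
    open import Function.Construct.Symmetry using (↔-sym)
    open import Function.Construct.Identity using (↔-id)
    open Base
    open Homogeneous
    open Arcs
    open Trees
    open BipartiteBasics
    open FourCycles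
    open Girth
    open import Defs using (Graph; Cycle; CyclicSuc; Neighbours; Finite; IsSemiregularTree; evenCycle) renaming (tree to listed-tree; cycle to listed-cycle)
    open Aut

    module _ (B : BipartiteHD) where
      open Bipartite B

      reach⇒star : ∀ {u v} → Reach Adj u v → Star (SymClosure _⟶_) u v
      reach⇒star here = ε
      reach⇒star (r ▻ a) = reach⇒star r ◅◅ (fromAdj a ◅ ε)

      neighbours-aut : ∀ (α : Automorphism) u → Neighbours graph u ↔ Neighbours graph (to α u)
      neighbours-aut α u = mk↔ₛ′
        (λ (w , [ a ]) → to α w , [ forth a ])
        (λ (w , [ a ]) → from α w , [ back a ])
        (λ (w , _) → value-injective (to∘from α w))
        (λ (w , _) → value-injective (from∘to α w))
        where
        forth : ∀ {w} → SymClosure _⟶_ u w → SymClosure _⟶_ (to α u) (to α w)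
        forth (fwd a) = fwd (to-arc α a)
        forth (bwd a) = bwd (to-arc α a)
        back : ∀ {w} → SymClosure _⟶_ (to α u) w → SymClosure _⟶_ u (from α w)
        back {w} (fwd a) = fwd (to-arc⁻ α (subst (to α u ⟶_) (sym (to∘from α w)) a))
        back {w} (bwd a) = bwd (to-arc⁻ α (subst (_⟶ to α u) (sym (to∘from α w)) a))

      neighbours-finite : ∀ v → Finite (Neighbours graph v)
      neighbours-finite v = listing⇒finite (listing-⊆ toAdj (listing-∪ (out-listing v) (in-listing v)))

      module _ (acyclic : ¬ Cycle graph)
        (other-head : ∀ {x y} → x ⟶ y → ∃[ y′ ] (x ⟶ y′ × y′ ≢ y))
        (other-tail : ∀ {x y} → x ⟶ y → ∃[ x′ ] (x′ ⟶ y × x′ ≢ x)) where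

        open Walks graph

        walk-on : ∀ {u v} → Adj u v → ∃[ w ] (Adj v w × w ≢ u)
        walk-on (inj₁ a) = let (x , b , n) = other-tail a in x , inj₂ b , n
        walk-on (inj₂ a) = let (y , b , n) = other-head a in y , inj₁ b , n

        walk : ℕ → Σ[ u ∈ V ] Σ[ v ∈ V ] Adj u v
        walk zero = x₀ , y₀ , inj₁ x₀y₀
        walk (suc n) = let (u , v , a) = walk n ; (w , b , _) = walk-on a in v , w , b

        z : ℕ → V
        z n = proj₁ (walk n)

        z-adjacent : ∀ n → Adj (z n) (z (suc n))
        z-adjacent n = proj₂ (proj₂ (walk n))

        z-reduced : ∀ n → z (suc (suc n)) ≢ z n
        z-reduced n = proj₂ (proj₂ (walk-on (proj₂ (proj₂ (walk n)))))

        trail : ℕ → List V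
        trail zero    = []
        trail (suc n) = z n ∷ trail n

        trail-walk : ∀ n → NonBacktracking (z n ∷ trail n)
        trail-walk zero = single
        trail-walk (suc zero) = pair (fromAdj (swap (z-adjacent 0)))
        trail-walk (suc (suc n)) = step (fromAdj (swap (z-adjacent (suc n)))) (z-reduced n) (trail-walk (suc n))

        ∈-trail : ∀ i d → z i ∈ trail (suc d + i)
        ∈-trail i zero = here refl
        ∈-trail i (suc d) = there (∈-trail i d)

        -- Every edge can be continued to a new neighbour, which gives an endless walk without
        -- backtracking; in a graph without cycles it never repeats a vertex.
        infinite : ¬ Finite V
        infinite (n , iso) with repetition z (tabulate (Inverse.from iso))
                                  (λ i → subst (_∈ _) (Inverse.strictlyInverseʳ iso (z i)) (∈-tabulate⁺ (Inverse.to iso (z i))))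
        ... | i , d , eq = not-closed acyclic (trail-walk (suc d + i))
              (subst (_∈ trail (suc d + i)) (trans eq (cong z (+-comm i (suc d)))) (∈-trail i d))

        semiregular : IsSemiregularTree (proj₁ (neighbours-finite x₀)) (proj₁ (neighbours-finite y₀)) bipartiteGraph
        semiregular = record
          { isTree = (x₀ , λ u v → reach⇒star (connected u v)) , acyclic
          ; infinite = infinite
          ; degreeX = degX ; degreeY = degY }
          where
          degX : ∀ {v} → IsX v → Neighbours graph v ↔ Fin (proj₁ (neighbours-finite x₀))
          degX {v} p with out-arc p
          ... | w , a with edge-transitive x₀y₀ a
          ... | α , refl , _ = proj₂ (neighbours-finite x₀) ↔-∘ ↔-sym (neighbours-aut α x₀)
          degY : ∀ {v} → IsY v → Neighbours graph v ↔ Fin (proj₁ (neighbours-finite y₀))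
          degY {v} p with in-arc p
          ... | w , a with edge-transitive x₀y₀ a
          ... | α , _ , refl = proj₂ (neighbours-finite y₀) ↔-∘ ↔-sym (neighbours-aut α y₀)

        classify-tree : Classified
        classify-tree = bipartiteGraph , listed-tree semiregular , record { bijection = ↔-id V ; edges = mk⇔ (λ a → a) (λ a → a) }

      flips : ℕ → Parity → Parity
      flips zero p    = p
      flips (suc n) p = opposite (flips n p)

      flips-even : ∀ n p → flips n p ≡ p → parity n ≡ 0ℙ
      flips-even zero p eq = refl
      flips-even (suc zero) p eq = ⊥-elim (p≢p⁻¹ p (sym eq))
      flips-even (suc (suc n)) p eq = flips-even n p (trans (sym (⁻¹-involutive (flips n p))) eq)

      -- A vertex on the cycle already has two neighbours there and can have no third, so by
      -- connectedness the cycle is the whole graph. Sides alternate along it, hence its length is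
      -- even.
      classify-cycle : (∀ v → ¬ Three (Adj v)) → Cycle graph → Classified
      classify-cycle deg record { len = zero ; 3≤len = () }
      classify-cycle deg record { len = suc zero ; 3≤len = s≤s () }
      classify-cycle deg record { len = suc (suc zero) ; 3≤len = s≤s (s≤s ()) }
      classify-cycle deg record { len = suc (suc (suc n)) ; vertex = vertex ; injective = injective ; adjacent = adjacent } =
        evenCycle size size-even , listed-cycle (s≤s (s≤s (s≤s z≤n))) size-even ,
        record { bijection = mk↔ₛ′ to′ vertex (λ i → injective (to-vertex (vertex i))) to-vertex
               ; edges = λ {u} {v} → mk⇔ (edge⇒ u v) (edge⇐ u v) }
        where
        open CyclicOrder {n}
        neighbour : ∀ i {w} → Adj (vertex i) w → ∃[ j ] (vertex j ≡ w × (CyclicSuc i j ⊎ CyclicSuc j i))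
        neighbour i {w} a with successor i | predecessor i
        ... | j , ij | k , ki with vertex j ≟ w | vertex k ≟ w
        ... | yes eq | _ = j , eq , inj₁ ij
        ... | no _ | yes eq = k , eq , inj₂ ki
        ... | no ¬j | no ¬k = ⊥-elim (deg (vertex i) (three (toAdj (adjacent ij)) (swap (toAdj (adjacent ki))) a
                                (λ eq → distinct i j k ij ki (injective eq)) ¬j ¬k))
        onto : ∀ v → ∃[ i ] vertex i ≡ v
        onto v = go (connected (vertex zero) v)
          where
          go : ∀ {v} → Reach Adj (vertex zero) v → ∃[ i ] vertex i ≡ v
          go here = zero , refl
          go (r ▻ a) with go r
          ... | i , refl = let (j , eq , _) = neighbour i a in j , eq
        to′ : V → Fin size
        to′ v = proj₁ (onto v)
        to-vertex : ∀ v → vertex (to′ v) ≡ v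
        to-vertex v = proj₂ (onto v)
        edge⇒ : ∀ u v → SymClosure _⟶_ u v → SymClosure CyclicSuc (to′ u) (to′ v)
        edge⇒ u v a with neighbour (to′ u) (subst (λ z → Adj z v) (sym (to-vertex u)) (toAdj a))
        ... | j , eq , c with injective (trans eq (sym (to-vertex v))) | c
        ... | refl | inj₁ s = fwd s
        ... | refl | inj₂ s = bwd s
        edge⇐ : ∀ u v → SymClosure CyclicSuc (to′ u) (to′ v) → SymClosure _⟶_ u v
        edge⇐ u v (fwd s) = subst₂ (SymClosure _⟶_) (to-vertex u) (to-vertex v) (adjacent s)
        edge⇐ u v (bwd s) = Graph.~-sym graph (subst₂ (SymClosure _⟶_) (to-vertex v) (to-vertex u) (adjacent s))
        parts : ∀ i (p : i < size) → part (vertex (fromℕ< p)) ≡ flips i (part (vertex zero))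
        parts zero (s≤s z≤n) = refl
        parts (suc i) p = trans (Adj-part (toAdj (adjacent (inj₁ (trans (toℕ-fromℕ< p) (cong suc (sym (toℕ-fromℕ< (<⇒≤ p)))))))))
                                (cong opposite (parts i (<⇒≤ p)))
        size-even : parity size ≡ 0ℙ
        size-even = flips-even size (part (vertex zero)) (sym (trans
          (Adj-part (toAdj (adjacent {fromℕ< ≤-refl} {zero} (inj₂ (cong suc (toℕ-fromℕ< ≤-refl) , refl)))))
          (cong opposite (parts (suc (suc n)) ≤-refl))))

      all-degreesX : ∃[ x ] Three (x ⟶_) → ∀ {x} → IsX x → Three (x ⟶_)
      all-degreesX (x₁ , t) {x} p with edge-transitive (Three.p₁ t) (proj₂ (out-arc p))
      ... | α , refl , _ = three-map (to α) (to-inj α) (to-arc α) t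

    module _ (B : BipartiteHD) where
      open Bipartite B

      cycle-op : Cycle graph → Cycle (Bipartite.graph (opB B))
      cycle-op c = record { Cycle c hiding (adjacent) ; adjacent = λ s → flip-sym (Cycle.adjacent c s) }
        where
        flip-sym : ∀ {u v} → SymClosure _⟶_ u v → SymClosure (flip _⟶_) u v
        flip-sym (fwd a) = bwd a
        flip-sym (bwd a) = fwd a

      -- The first decision asks for a path of three edges with non-adjacent ends, the second for a
      -- four-cycle. Without four-cycles, three neighbours on either side exclude all cycles, by
      -- `LargeGirth` for `B` or its opposite; with at most two neighbours everywhere a cycle
      -- exhausts the graph, and otherwise the graph is a tree.
      classify : Classified
      classify with dec (∃[ x ] ∃[ y ] ∃[ x′ ] ∃[ y′ ] (x ⟶ y × x′ ⟶ y × x ⟶ y′ × ¬ (x′ ⟶ y′)))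
      ... | no none = classify-complete λ {x} {y} {x′} {y′} a b c → dne λ n → none (x , y , x′ , y′ , a , b , c , n)
      ... | yes (a , b , a′ , b′ , ab , a′b , ab′ , ¬a′b′)
        with dec (∃[ x ] ∃[ y ] ∃[ x′ ] ∃[ y′ ] (x ⟶ y × x′ ⟶ y × x ⟶ y′ × x′ ⟶ y′ × x ≢ x′ × y ≢ y′))
      ... | yes (x , y , x′ , y′ , p , q , r , s , n , m) = FourCycle.classify-fourCycle B p q r s n m ab a′b ab′ ¬a′b′
      ... | no none = by-degree (dec (∃[ x ] Three (x ⟶_))) (dec (∃[ y ] Three (_⟶ y)))
        where
        c4 : FourCycleFree B
        c4 {x} {x′} {y} {y′} p q r s with x ≟ x′ | y ≟ y′
        ... | yes e | _ = inj₁ e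
        ... | no _ | yes e = inj₂ e
        ... | no n | no m = ⊥-elim (none (x , y , x′ , y′ , p , r , q , s , n , m))
        other-head : ∀ {x y} → x ⟶ y → ∃[ y′ ] (x ⟶ y′ × y′ ≢ y)
        other-head xy with edge-transitive ab xy
        ... | α , refl , refl = to α b′ , to-arc α ab′ , λ e → ¬a′b′ (subst (a′ ⟶_) (sym (to-inj α e)) a′b)
        other-tail : ∀ {x y} → x ⟶ y → ∃[ x′ ] (x′ ⟶ y × x′ ≢ x)
        other-tail xy with edge-transitive ab xy
        ... | α , refl , refl = to α a′ , to-arc α a′b , λ e → ¬a′b′ (subst (_⟶ b′) (sym (to-inj α e)) ab′)
        by-degree : Dec (∃[ x ] Three (x ⟶_)) → Dec (∃[ y ] Three (_⟶ y)) → Classified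
        by-degree (yes t) _ = classify-tree B (LargeGirth.acyclic B c4 (all-degreesX B t) other-tail) other-head other-tail
        by-degree (no _) (yes t) = classify-tree B
          (λ c → LargeGirth.acyclic (opB B) (λ p q r s → swap (c4 p r q s)) (all-degreesX (opB B) t) other-head (cycle-op c))
          other-head other-tail
        by-degree (no ¬x) (no ¬y) with dec (Cycle graph)
        ... | no acyclic = classify-tree B acyclic other-head other-tail
        ... | yes c = classify-cycle B small c
          where
          small : ∀ v → ¬ Three (Adj v)
          small v (three p q r m n o) with side v
          ... | inj₁ s = ¬x (v , three (Adj-from-X s p) (Adj-from-X s q) (Adj-from-X s r) m n o)
          ... | inj₂ s = ¬y (v , three (Adj-from-Y s p) (Adj-from-Y s q) (Adj-from-Y s r) m n o)

  -- The reachability relation and its classes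

  module Reachability where

    open import Data.List.Relation.Unary.Any using (here)
    open import Function.Construct.Composition using (_↔-∘_)
    open Base
    open Homogeneous
    open import Defs hiding (Automorphism)

    reach-trans : {I : Set} {T : I → I → Set} {i j k : I} → Reach T i j → Reach T j k → Reach T i k
    reach-trans r here    = r
    reach-trans r (s ▻ t) = reach-trans r s ▻ t

    reach-sym : {I : Set} {T : I → I → Set} → (∀ {i j} → T i j → T j i) → ∀ {i j} → Reach T i j → Reach T j i
    reach-sym σ here    = here
    reach-sym σ (r ▻ t) = reach-trans (here ▻ σ t) (reach-sym σ r)

    star⇒reach : {I : Set} {T U : I → I → Set} → (∀ {i j} → T i j → U i j) → ∀ {i j} → Star T i j → Reach U i j
    star⇒reach f ε       = here
    star⇒reach f (t ◅ s) = reach-trans (here ▻ f t) (star⇒reach f s)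

    reach⇒star′ : {I J : Set} {T : I → I → Set} {U : J → J → Set} (f : I → J) → (∀ {i j} → T i j → U (f i) (f j)) →
                  ∀ {i j} → Reach T i j → Star U (f i) (f j)
    reach⇒star′ f g here    = ε
    reach⇒star′ f g (r ▻ t) = reach⇒star′ f g r ◅◅ (g t ◅ ε)

    relIso-∘ : {A B C : Set} {R : A → A → Set} {S : B → B → Set} {T : C → C → Set} → RelIso R S → RelIso S T → RelIso R T
    relIso-∘ f g = record
      { bijection = RelIso.bijection g ↔-∘ RelIso.bijection f
      ; edges = mk⇔ (λ a → Equivalence.to (RelIso.edges g) (Equivalence.to (RelIso.edges f) a))
                    (λ a → Equivalence.from (RelIso.edges f) (Equivalence.from (RelIso.edges g) a)) }

    symClosure-iso : {A B : Set} {R : A → A → Set} {S : B → B → Set} → RelIso R S → RelIso (SymClosure R) (SymClosure S)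
    symClosure-iso f = record
      { bijection = RelIso.bijection f
      ; edges = mk⇔ (λ { (fwd a) → fwd (Equivalence.to (RelIso.edges f) a) ; (bwd a) → bwd (Equivalence.to (RelIso.edges f) a) })
                    (λ { (fwd a) → fwd (Equivalence.from (RelIso.edges f) a) ; (bwd a) → bwd (Equivalence.from (RelIso.edges f) a) }) }

    aut⇒relIso : {V K : Set} {κ : V → K} {R : V → V → Set} → Aut κ R → RelIso R R
    aut⇒relIso α = record
      { bijection = mk↔ₛ′ (Aut.to α) (Aut.from α) (Aut.to∘from α) (Aut.from∘to α)
      ; edges = mk⇔ (Aut.to-arc α) (Aut.to-arc⁻ α) }

    relIso⇒aut : {V : Set} {R : V → V → Set} → RelIso R R → Aut (λ _ → tt) R
    relIso⇒aut f = record
      { to = RelIso.to f ; from = RelIso.from f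
      ; to∘from = Inverse.strictlyInverseˡ (RelIso.bijection f) ; from∘to = Inverse.strictlyInverseʳ (RelIso.bijection f)
      ; to-κ = λ _ → refl ; to-arc = Equivalence.to (RelIso.edges f) ; to-arc⁻ = Equivalence.from (RelIso.edges f) }

    listing-refine : {A : Set} {P Q : A → Set} → Listing P → Listing {[ v ∈ A ∣ Q v ]} (λ r → P (value r))
    listing-refine {A} {P} {Q} l = listing-⊆ (λ {r} p → value r , p , refl) (listing-∃ l single)
      where
      single : ∀ x → Listing {[ v ∈ A ∣ Q v ]} (λ r → value r ≡ x)
      single x with dec (Q x)
      ... | yes q = (x , [ q ]) ∷ [] , λ eq → here (value-injective eq)
      ... | no ¬q = [] , λ { {r} refl → contradiction (proofOf r) ¬q }

    module ReachabilityClasses (D : Digraph) where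
      open Digraph D

      arc-proof : (e : Arc D) → tail D e ⟶ head D e
      arc-proof (_ , [ a ]) = recover a

      𝒜-refl : ∀ {e} → 𝒜 D e e
      𝒜-refl = forward , start forward

      -- The direction of the last arc is no obstacle: a walk that ended by traversing `f` the wrong
      -- way turns round at the tail of `f` and traverses it once more.
      𝒜-head : ∀ {e f g} → 𝒜 D e f → head D f ≡ head D g → 𝒜 D e g
      𝒜-head (forward , w) eq  = backward , atHead w eq
      𝒜-head {f = f} (backward , w) eq = backward , atHead (atTail {g = f} w refl) eq

      𝒜-tail : ∀ {e f g} → 𝒜 D e f → tail D f ≡ tail D g → 𝒜 D e g
      𝒜-tail (backward , w) eq = forward , atTail w eq
      𝒜-tail {f = f} (forward , w) eq  = forward , atTail (atHead {g = f} w refl) eq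

      𝒜-induction : ∀ {e} (P : Arc D → Set) → P e → (∀ {f g} → P f → head D f ≡ head D g → P g) →
                    (∀ {f g} → P f → tail D f ≡ tail D g → P g) → ∀ {f} → 𝒜 D e f → P f
      𝒜-induction {e} P p h t (_ , w) = go w
        where
        go : ∀ {d f} → AlternatingWalk D e d f → P f
        go (start d) = p
        go (atHead w eq) = h (go w) eq
        go (atTail w eq) = t (go w) eq

      𝒜-trans : ∀ {e f g} → 𝒜 D e f → 𝒜 D f g → 𝒜 D e g
      𝒜-trans {e} p = 𝒜-induction (𝒜 D e) p (λ {f} {g} → 𝒜-head {e} {f} {g}) (λ {f} {g} → 𝒜-tail {e} {f} {g})

      𝒜-sym : ∀ {e f} → 𝒜 D e f → 𝒜 D f e
      𝒜-sym {e} = 𝒜-induction (λ f → 𝒜 D f e) 𝒜-refl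
        (λ {f} {g} p eq → 𝒜-trans (𝒜-head {g} {g} {f} 𝒜-refl (sym eq)) p) (λ {f} {g} p eq → 𝒜-trans (𝒜-tail {g} {g} {f} 𝒜-refl (sym eq)) p)

      module _ {K : Set} {κ : V → K} (α : Aut κ _⟶_) where
        open Aut α using () renaming (to to α-to; from to α-from; to-arc to α-arc; to-arc⁻ to α-arc⁻; to∘from to α-to∘from; from∘to to α-from∘to)

        image : Arc D → Arc D
        image e = arc D (α-arc (arc-proof e))

        𝒜-image : ∀ {e f} → 𝒜 D e f → 𝒜 D (image e) (image f)
        𝒜-image {e} = 𝒜-induction (λ f → 𝒜 D (image e) (image f)) 𝒜-refl
          (λ p eq → 𝒜-head p (cong α-to eq)) (λ p eq → 𝒜-tail p (cong α-to eq))

        image-class : ∀ {e e′ f g} → 𝒜 D e f → 𝒜 D e′ (image f) → 𝒜 D e g → 𝒜 D e′ (image g)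
        image-class p q r = 𝒜-trans q (𝒜-image (𝒜-trans (𝒜-sym p) r))

      arc-≡ : ∀ {e f : Arc D} → tail D e ≡ tail D f → head D e ≡ head D f → e ≡ f
      arc-≡ p q = value-injective (cong₂ _,_ p q)

      InClass : Arc D → V → Set
      InClass e v = ∃[ f ] (𝒜 D e f × (v ≡ tail D f ⊎ v ≡ head D f))

      class-map : ∀ {K : Set} {κ : V → K} (α : Aut κ _⟶_) {e e′ f} → 𝒜 D e f → 𝒜 D e′ (image α f) →
                  ∀ {v} → InClass e v → InClass e′ (Aut.to α v)
      class-map α p q (g , r , inj₁ refl) = image α g , image-class α p q r , inj₁ refl
      class-map α p q (g , r , inj₂ refl) = image α g , image-class α p q r , inj₂ refl

      -- Automorphisms preserve 𝒜, so one arc of the first class landing in the second is enough to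
      -- match the two classes.
      classIso : ∀ {K : Set} {κ : V → K} (α : Aut κ _⟶_) {e e′ f} → 𝒜 D e f → 𝒜 D e′ (image α f) →
                 RelIso (Digraph._⟶_ (⟨𝒜_⟩ D e)) (Digraph._⟶_ (⟨𝒜_⟩ D e′))
      classIso α {e} {e′} {f} p q = record
        { bijection = mk↔ₛ′
            (λ (v , [ c ]) → Aut.to α v , [ class-map α p q c ])
            (λ (v , [ c ]) → Aut.from α v , [ class-map (inverse α) q p′ c ])
            (λ (v , _) → value-injective (Aut.to∘from α v))
            (λ (v , _) → value-injective (Aut.from∘to α v))
        ; edges = λ {u} {v} → mk⇔ (λ (a , r) → Aut.to-arc α a , image-class α p q r)
                      (λ (a , r) → Aut.to-arc⁻ α a ,
                        subst (𝒜 D e) (arc-≡ (Aut.from∘to α (value u)) (Aut.from∘to α (value v))) (image-class (inverse α) q p′ r)) }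
        where
        p′ : 𝒜 D e (image (inverse α) (image α f))
        p′ = subst (𝒜 D e) (arc-≡ (sym (Aut.from∘to α (tail D f))) (sym (Aut.from∘to α (head D f)))) p

      module _ (e : Arc D) where
        private
          Δ = ⟨𝒜_⟩ D e
          _⟶Δ_ = Digraph._⟶_ Δ

        AdjΔ : Digraph.V Δ → Digraph.V Δ → Set
        AdjΔ u v = u ⟶Δ v ⊎ v ⟶Δ u

        tailΔ headΔ : ∀ f → .(𝒜 D e f) → Digraph.V Δ
        tailΔ f p = tail D f , [ (f , p , inj₁ refl) ]
        headΔ f p = head D f , [ (f , p , inj₂ refl) ]

        arcΔ : ∀ f (p : 𝒜 D e f) → tailΔ f p ⟶Δ headΔ f p
        arcΔ f p = arc-proof f , p

        class-connected : ∀ u v → Reach AdjΔ u v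
        class-connected u v = reach-trans (reach-sym swap (from-root u)) (from-root v)
          where
          root : Digraph.V Δ
          root = tailΔ e 𝒜-refl
          along : ∀ {f} → 𝒜 D e f → Σ[ p ∈ 𝒜 D e f ] (Reach AdjΔ root (tailΔ f p) × Reach AdjΔ root (headΔ f p))
          along = 𝒜-induction (λ f → Σ[ p ∈ 𝒜 D e f ] (Reach AdjΔ root (tailΔ f p) × Reach AdjΔ root (headΔ f p)))
            (𝒜-refl , here , (here ▻ inj₁ (arcΔ e 𝒜-refl)))
            (λ { {f} {g} (p , _ , r) eq → let q = 𝒜-head p eq ; r′ = subst (Reach AdjΔ root) (value-injective eq) r
                                          in q , (r′ ▻ inj₂ (arcΔ g q)) , r′ })
            (λ { {f} {g} (p , r , _) eq → let q = 𝒜-tail p eq ; r′ = subst (Reach AdjΔ root) (value-injective eq) r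
                                          in q , r′ , (r′ ▻ inj₁ (arcΔ g q)) })
          from-root : ∀ v → Reach AdjΔ root v
          from-root v with proofOf v
          ... | f , p , inj₁ eq = subst (Reach AdjΔ root) (value-injective (sym eq)) (proj₁ (proj₂ (along p)))
          ... | f , p , inj₂ eq = subst (Reach AdjΔ root) (value-injective (sym eq)) (proj₂ (proj₂ (along p)))

  -- The direct statements about D

  module Forward where

    open import Data.Fin.Base using (inject₁)
    open import Data.Fin.Properties using (toℕ<n; toℕ-fromℕ<; fromℕ<-toℕ; toℕ-injective; toℕ-inject₁)
    open import Data.Nat.Properties using (≤-pred; m≢1+m+n; +-suc; _≤?_; m<n⇒m<1+n)
    open import Relation.Binary.Definitions using (Universal)
    open Base
    open Homogeneous
    open Arcs
    open InducedArcs
    open Alternating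
    open Descendants
    open Trees
    open BipartiteBasics
    open Classification
    open Reachability
    open import Defs hiding (edge)

    module _ {A : Set} {R : A → A → Set} where
      to⊎ : ∀ {u v} → SymClosure R u v → R u v ⊎ R v u
      to⊎ (fwd a) = inj₁ a
      to⊎ (bwd a) = inj₂ a

      from⊎ : ∀ {u v} → R u v ⊎ R v u → SymClosure R u v
      from⊎ (inj₁ a) = fwd a
      from⊎ (inj₂ a) = bwd a

    module _ (D : Digraph) (lf : LocallyFinite D) (ch : ConnectedHomogeneous D) where
      open Digraph D

      -- The vertex sets are the images of the two families. The isomorphism picks an index of each
      -- point; the conditions on equality make the choice immaterial.
      homogeneity : Homogeneity {V} {⊤} (λ _ → tt) _⟶_
      homogeneity {I} x y l i₀ reach _ x≡⇒y≡ y≡⇒x≡ x⟶⇒y⟶ y⟶⇒x⟶ = conclude (ch P Q finP conP finQ conQ f)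
        where
        P Q : V → Set
        P v = ∃[ i ] x i ≡ v
        Q v = ∃[ i ] y i ≡ v
        finP : Finite [ v ∈ V ∣ P v ]
        finP = listing⇒finite (listing-image x l λ (i , eq) → i , tt , eq)
        finQ : Finite [ v ∈ V ∣ Q v ]
        finQ = listing⇒finite (listing-image y l λ (i , eq) → i , tt , eq)
        connected-image : (w : I → V) → (∀ {i j} → x i ⟶ x j ⊎ x j ⟶ x i → w i ⟶ w j ⊎ w j ⟶ w i) →
                          Connected (underlying (induced D λ v → ∃[ i ] w i ≡ v))
        connected-image w adj = at i₀ , λ u v → subst₂ (Star _) (value-injective (proj₂ (proofOf u))) (value-injective (proj₂ (proofOf v)))
          (reach⇒star′ at (λ a → from⊎ (adj a)) (reach-trans (reach-sym swap (reach (proj₁ (proofOf u)))) (reach (proj₁ (proofOf v)))))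
          where
          at : I → [ v ∈ V ∣ ∃[ i ] w i ≡ v ]
          at i = w i , [ (i , refl) ]
        conP : Connected (underlying (induced D P))
        conP = connected-image x (λ a → a)
        conQ : Connected (underlying (induced D Q))
        conQ = connected-image y λ { (inj₁ a) → inj₁ (x⟶⇒y⟶ _ _ a) ; (inj₂ a) → inj₂ (x⟶⇒y⟶ _ _ a) }
        indexP : [ v ∈ V ∣ P v ] → I
        indexP u = proj₁ (proofOf u)
        x-index : ∀ u → x (indexP u) ≡ value u
        x-index u = proj₂ (proofOf u)
        indexQ : [ v ∈ V ∣ Q v ] → I
        indexQ u = proj₁ (proofOf u)
        y-index : ∀ u → y (indexQ u) ≡ value u
        y-index u = proj₂ (proofOf u)
        f : RelIso (Digraph._⟶_ (induced D P)) (Digraph._⟶_ (induced D Q))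
        f = record
          { bijection = mk↔ₛ′
              (λ u → y (indexP u) , [ (indexP u , refl) ])
              (λ u → x (indexQ u) , [ (indexQ u , refl) ])
              (λ u → value-injective (trans (x≡⇒y≡ _ _ (x-index (x (indexQ u) , [ (indexQ u , refl) ]))) (y-index u)))
              (λ u → value-injective (trans (y≡⇒x≡ _ _ (y-index (y (indexP u) , [ (indexP u , refl) ]))) (x-index u)))
          ; edges = λ {u} {v} → mk⇔ (λ a → x⟶⇒y⟶ _ _ (subst₂ _⟶_ (sym (x-index u)) (sym (x-index v)) a))
                                    (λ a → subst₂ _⟶_ (x-index u) (x-index v) (y⟶⇒x⟶ _ _ a)) }
        conclude : Σ[ α ∈ Automorphism D ] (∀ u → RelIso.to α (value u) ≡ value (RelIso.to f u)) → Σ[ α ∈ Aut (λ _ → tt) _⟶_ ] (∀ i → Aut.to α (x i) ≡ y i)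
        conclude (α , eq) = relIso⇒aut α , λ i → trans (eq (x i , [ (i , refl) ])) (x≡⇒y≡ _ _ (x-index (x i , [ (i , refl) ])))

      homogeneousDigraph : HomogeneousDigraph
      homogeneousDigraph = record
        { V = V ; K = ⊤ ; κ = λ _ → tt ; _⟶_ = _⟶_
        ; asym = λ a b → irrefl (antisym a b) a
        ; out-listing = λ v → finite⇒listing (proj₁ (lf v)) ; in-listing = λ v → finite⇒listing (proj₂ (lf v))
        ; homogeneous = homogeneity }

    -- With unique paths from `u`, their length is a depth function, and every vertex has at most
    -- one in-neighbour that can be reached from `u`, its parent.
    unique-paths⇒acyclic : (C : TriangleFreeCHD) (let open TriangleFreeCHD C) → (∀ l → UniquePaths.NoSplit C l) →
      ∀ u (G : Graph) (val : Graph.V G → V) → (∀ {x y} → val x ≡ val y → x ≡ y) →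
      (∀ {x y} → Graph._~_ G x y → Adj (val x) (val y)) → (∀ x → ∃[ k ] Paths.Path _⟶_ k u (val x)) → ¬ Cycle G
    unique-paths⇒acyclic C noSplit u G val val-inj adj path = parents⇒acyclic {G} depth parent edge
      where
      open TriangleFreeCHD C
      open Paths _⟶_
      depth : Graph.V G → ℕ
      depth x = proj₁ (path x)
      parent : Graph.V G → Graph.V G
      parent x with dec (∃[ y ] val y ⟶ val x)
      ... | yes (y , _) = y
      ... | no _ = x
      parent-≡ : ∀ {x y} → val y ⟶ val x → parent x ≡ y
      parent-≡ {x} {y} a with dec (∃[ y ] val y ⟶ val x)
      ... | yes (y′ , b) = val-inj (UniquePaths.unique-parent C noSplit (depth y′) (depth y) (proj₂ (path y′)) b (proj₂ (path y)) a)
      ... | no none = contradiction (y , a) none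
      depth-≡ : ∀ {x y} → val y ⟶ val x → depth x ≡ suc (depth y)
      depth-≡ {x} {y} a = UniquePaths.lengths-agree C (depth x) (λ _ → noSplit _) (suc (depth y)) (proj₂ (path x)) (path-snoc (depth y) (proj₂ (path y)) a)
      edge : ∀ {x y} → Graph._~_ G x y → (depth x ≡ suc (depth y) × parent x ≡ y) ⊎ (depth y ≡ suc (depth x) × parent y ≡ x)
      edge e with adj e
      ... | inj₁ a = inj₂ (depth-≡ a , parent-≡ a)
      ... | inj₂ a = inj₁ (depth-≡ a , parent-≡ a)

    module _ (D : Digraph) (con : Connected (underlying D)) (lf : LocallyFinite D) (tf : TriangleFree (underlying D))
             (ray : Ray (underlying D)) (ch : ConnectedHomogeneous D) where
      open Digraph D

      chd : TriangleFreeCHD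
      chd = record
        { homogeneousDigraph = homogeneousDigraph D lf ch
        ; κ-const = λ _ _ → refl
        ; triangleFree = λ a b c → tf (from⊎ a) (from⊎ b) (from⊎ c)
        ; connected = λ u v → star⇒reach to⊎ (proj₂ con u v)
        -- The vertices of the ray are distinct, so no list contains them all.
        ; infinite = λ xs → ¬∀⇒∃¬ λ all → let (i , d , eq) = repetition (Ray.vertex ray) xs (λ n → all _)
                                           in m≢1+m+n i (trans (Ray.injective ray eq) (+-suc i d))
        ; base = proj₁ con }

      open Basics chd using (karc-transitive; has-succ; two-arc-transitive; Diamond; diamond-complete) renaming (Automorphism to Auto; Arc to ArcSequence)
      open DirectedPaths chd
      open Paths _⟶_
      open ReachabilityClasses D

      highlyArcTransitive : HighlyArcTransitive D
      highlyArcTransitive k s t =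
        let (α , eq) = karc-transitive (all-arcs-induced chd k) (arc-of s) (arc-of t)
        in aut⇒relIso α , λ i → subst₂ (λ u v → Aut.to α u ≡ v) (at-of s i) (at-of t i) (eq (toℕ i) (≤-pred (toℕ<n i)))
        where
        at : KArc D k → ℕ → V
        at s i with i ≤? k
        ... | yes p = KArc.vertex s (fromℕ< (s≤s p))
        ... | no _ = KArc.vertex s zero
        at-≤ : ∀ s {i} (p : i < suc k) → at s i ≡ KArc.vertex s (fromℕ< p)
        at-≤ s {i} (s≤s p) with i ≤? k
        ... | yes q = cong (KArc.vertex s) (toℕ-injective (trans (toℕ-fromℕ< (s≤s q)) (sym (toℕ-fromℕ< (s≤s p)))))
        ... | no n = contradiction p n
        at-of : ∀ s i → at s (toℕ i) ≡ KArc.vertex s i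
        at-of s i = trans (at-≤ s (toℕ<n i)) (cong (KArc.vertex s) (fromℕ<-toℕ i (toℕ<n i)))
        arc-of : ∀ s → ArcSequence k (at s)
        arc-of s i i<k = subst₂ _⟶_
          (trans (cong (KArc.vertex s) (toℕ-injective (trans (toℕ-inject₁ (fromℕ< i<k)) (trans (toℕ-fromℕ< i<k) (sym (toℕ-fromℕ< (m<n⇒m<1+n i<k)))))))
                 (sym (at-≤ s (m<n⇒m<1+n i<k))))
          (sym (at-≤ s (s≤s i<k)))
          (KArc.steps s (fromℕ< i<k))

      𝒜⇒alternating : ∀ {e f} → 𝒜 D e f → ∃[ n ] Alt n (tail D e) (head D f)
      𝒜⇒alternating {e} = 𝒜-induction (λ f → ∃[ n ] Alt n (tail D e) (head D f)) (0 , one (arc-proof e))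
        (λ (n , w) eq → n , subst (Alt n _) eq w)
        (λ {f} {g} (n , w) eq → suc n , alt-snoc w (arc-proof f) (subst (_⟶ _) (sym eq) (arc-proof g)))

      𝒜-no-path : ∀ {e f} → 𝒜 D e f → ∀ k → ¬ Path (suc (suc k)) (tail D e) (head D f)
      𝒜-no-path r k p = let (n , w) = 𝒜⇒alternating r in no-alternating-path n k w p

      -- The two arcs of a 2-arc are unrelated, because the tail of the first and the head of the
      -- second are joined by a directed path of length two.
      not-universal : ¬ Universal (𝒜 D)
      not-universal all = let (v , a) = has-succ (proj₁ con) ; (w , b) = has-succ v
                          in 𝒜-no-path (all (arc D a) (arc D b)) 0 (v , a , w , b , refl)

      some-arc : Arc D
      some-arc = arc D (proj₂ (has-succ (proj₁ con)))

      module Class (e : Arc D) where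
        Δ : Digraph
        Δ = ⟨𝒜_⟩ D e
        VΔ = Digraph.V Δ
        _⟶Δ_ = Digraph._⟶_ Δ

        IsTail IsHead : V → Set
        IsTail v = ∃[ f ] (𝒜 D e f × v ≡ tail D f)
        IsHead v = ∃[ f ] (𝒜 D e f × v ≡ head D f)

        not-both : ∀ {v} → IsTail v → ¬ IsHead v
        not-both (f , p , refl) (g , q , eq) =
          𝒜-no-path (𝒜-trans (𝒜-sym q) p) 0 (head D g , arc-proof g , head D f , subst (_⟶ head D f) eq (arc-proof f) , refl)

        tail-or-head : (v : VΔ) → IsTail (value v) ⊎ IsHead (value v)
        tail-or-head v with proofOf v
        ... | f , p , inj₁ eq = inj₁ (f , p , eq)
        ... | f , p , inj₂ eq = inj₂ (f , p , eq)

        part : VΔ → Parity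
        part v with dec (IsTail (value v))
        ... | yes _ = 0ℙ
        ... | no _  = 1ℙ

        part-tail : ∀ {v} → IsTail (value v) → part v ≡ 0ℙ
        part-tail {v} t with dec (IsTail (value v))
        ... | yes _ = refl
        ... | no n = contradiction t n

        part-head : ∀ {v} → IsHead (value v) → part v ≡ 1ℙ
        part-head {v} h with dec (IsTail (value v))
        ... | yes t = contradiction h (not-both t)
        ... | no _ = refl

        tail-part : ∀ {v} → part v ≡ 0ℙ → IsTail (value v)
        tail-part {v} eq with dec (IsTail (value v))
        ... | yes t = t

        part-arc : ∀ {u v} → u ⟶Δ v → part u ≡ 0ℙ × part v ≡ 1ℙ
        part-arc {u} {v} (a , p) = part-tail {u} (arc D a , p , refl) , part-head {v} (arc D a , p , refl)

        -- The class is an induced subdigraph, because any other arc between its vertices would give a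
        -- directed path of length at least two between the ends of an alternating walk.
        induced-arc : ∀ {u v : VΔ} → value u ⟶ value v → u ⟶Δ v
        induced-arc {u} {v} a with tail-or-head u
        ... | inj₁ (f , p , eq) = a , 𝒜-tail p (sym eq)
        ... | inj₂ (f , p , eq) with tail-or-head v
        ...   | inj₂ (g , q , eq′) = a , 𝒜-head q (sym eq′)
        ...   | inj₁ (g , q , eq′) = ⊥-elim (𝒜-no-path (𝒜-trans (𝒜-sym p) q) 1
                  (head D f , arc-proof f , value v , subst (_⟶ value v) eq a , head D g , subst (_⟶ head D g) (sym eq′) (arc-proof g) , refl))

        -- A vertex together with its side determines the class: arcs with a common tail, or with a
        -- common head, are related.
        same-class : ∀ {u v : VΔ} (α : Auto) → Aut.to α (value u) ≡ value v → part u ≡ part v → ∃[ f ] (𝒜 D e f × 𝒜 D e (image α f))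
        same-class {u} {v} α eq parts with tail-or-head u
        ... | inj₁ t@(f , p , eq′) with tail-part {v} (trans (sym parts) (part-tail {u} t))
        ...   | g , q , eq″ = f , p , 𝒜-tail q (trans (sym eq″) (trans (sym eq) (cong (Aut.to α) eq′)))
        same-class {u} {v} α eq parts | inj₂ h@(f , p , eq′) with tail-or-head v
        ...   | inj₂ (g , q , eq″) = f , p , 𝒜-head q (trans (sym eq″) (trans (sym eq) (cong (Aut.to α) eq′)))
        ...   | inj₁ t with trans (sym (part-head {u} h)) (trans parts (part-tail {v} t))
        ...     | ()

        -- An extension to D restricts to the class because the side of one vertex is preserved;
        -- otherwise it could carry the class to the other class at the image of that vertex.
        homogeneousΔ : Homogeneity part _⟶Δ_
        homogeneousΔ x y l i₀ reach κ≡ x≡⇒y≡ y≡⇒x≡ x⟶⇒y⟶ y⟶⇒x⟶ =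
          restrict (homogeneity D lf ch (value ∘ x) (value ∘ y) l i₀
            (λ i → reach-map (λ i → i) (λ { (inj₁ a) → inj₁ (proj₁ a) ; (inj₂ a) → inj₂ (proj₁ a) }) (reach i)) (λ _ → refl)
            (λ i j eq → cong value (x≡⇒y≡ i j (value-injective eq))) (λ i j eq → cong value (y≡⇒x≡ i j (value-injective eq)))
            (λ i j a → proj₁ (x⟶⇒y⟶ i j (induced-arc {x i} {x j} a))) (λ i j a → proj₁ (y⟶⇒x⟶ i j (induced-arc {y i} {y j} a))))
          where
          restrict : Σ[ α ∈ Auto ] (∀ i → Aut.to α (value (x i)) ≡ value (y i)) → Σ[ β ∈ Aut part _⟶Δ_ ] (∀ i → Aut.to β (x i) ≡ y i)
          restrict (α , eq) with same-class {x i₀} {y i₀} α (eq i₀) (κ≡ i₀)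
          ... | f , p , q = record
                  { to = RelIso.to iso ; from = RelIso.from iso
                  ; to∘from = Inverse.strictlyInverseˡ (RelIso.bijection iso) ; from∘to = Inverse.strictlyInverseʳ (RelIso.bijection iso)
                  ; to-κ = parts ; to-arc = λ {u} {v} → Equivalence.to (RelIso.edges iso {u} {v}) ; to-arc⁻ = λ {u} {v} → Equivalence.from (RelIso.edges iso {u} {v}) } ,
                λ i → value-injective (eq i)
            where
            iso : RelIso _⟶Δ_ _⟶Δ_
            iso = classIso α p q
            parts : ∀ v → part (RelIso.to iso v) ≡ part v
            parts v with tail-or-head v
            ... | inj₁ t@(g , r , refl) = trans (part-tail {RelIso.to iso v} (image α g , image-class α p q r , refl)) (sym (part-tail {v} t))
            ... | inj₂ h@(g , r , refl) = trans (part-head {RelIso.to iso v} (image α g , image-class α p q r , refl)) (sym (part-head {v} h))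

        Δ-homogeneousDigraph : HomogeneousDigraph
        Δ-homogeneousDigraph = record
          { V = VΔ ; K = Parity ; κ = part ; _⟶_ = _⟶Δ_
          ; asym = λ (a , _) (b , _) → irrefl (antisym a b) a
          ; out-listing = λ v → listing-⊆ proj₁ (listing-refine {Q = InClass e} (finite⇒listing (proj₁ (lf (value v)))))
          ; in-listing = λ v → listing-⊆ proj₁ (listing-refine {Q = InClass e} (finite⇒listing (proj₂ (lf (value v)))))
          ; homogeneous = homogeneousΔ }

        Δ-bipartite : BipartiteHD
        Δ-bipartite = record
          { homogeneousDigraph = Δ-homogeneousDigraph
          ; part = part ; part-arc = part-arc ; κ-part = λ eq → eq
          ; connected = class-connected e
          ; x₀ = tailΔ e e 𝒜-refl ; y₀ = headΔ e e 𝒜-refl ; x₀y₀ = arcΔ e e 𝒜-refl }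

      Δ-isBipartite : Δ-satisfies D IsBipartite
      Δ-isBipartite = some-arc , λ e → Class.part e , Class.part-arc e

      class-transitive : ∀ e e′ → RelIso (Digraph._⟶_ (⟨𝒜_⟩ D e)) (Digraph._⟶_ (⟨𝒜_⟩ D e′))
      -- Each arc is prolonged by some successor, since transitivity is at hand for 2-arcs.
      class-transitive e e′ = via (two-arc-transitive (arc-proof e) (proj₂ (has-succ (head D e))) (arc-proof e′) (proj₂ (has-succ (head D e′))))
        where
        via : ∀ {c c′} → Σ[ α ∈ Auto ] (Aut.to α (tail D e) ≡ tail D e′ × Aut.to α (head D e) ≡ head D e′ × Aut.to α c ≡ c′) →
              RelIso (Digraph._⟶_ (⟨𝒜_⟩ D e)) (Digraph._⟶_ (⟨𝒜_⟩ D e′))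
        via (α , p , q , _) = classIso α {e} {e′} {e} 𝒜-refl (subst (𝒜 D e′) (arc-≡ (sym p) (sym q)) 𝒜-refl)

      Δ-classified : ∃[ B ] (Listed B × ΔIsomorphicTo D B)
      Δ-classified =
        let (B , listed , iso) = classify (Class.Δ-bipartite some-arc)
        in B , listed , some-arc , λ e → relIso-∘ (symClosure-iso (class-transitive e some-arc)) iso

      descendants-trees : MoreThanTwoEnds (underlying D) → ∀ u → IsTree (underlying (desc D u)) × IsTree (underlying (anc D u))
      descendants-trees (r , s , t , r≁s , r≁t , s≁t) u =
        ((root , λ v w → up-and-down (star (proofOf v)) (star (proofOf w))) ,
          unique-paths⇒acyclic chd (UniquePaths.noSplit chd noDiamond) u (underlying (desc D u)) value value-injective to⊎
            (λ v → star⇒path (proofOf v))) ,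
        ((root′ , λ v w → up-and-down′ (star′ (proofOf v)) (star′ (proofOf w))) ,
          unique-paths⇒acyclic (op chd) (UniquePaths.noSplit (op chd) (λ a b c d → noDiamond c d a b)) u
            (underlying (anc D u)) value value-injective (λ a → swap (to⊎ a)) (λ v → star⇒pathᵒᵖ (proofOf v)))
        where
        toRayIn : Ray (underlying D) → TwoEnds.RayIn chd
        toRayIn r = record { vertex = Ray.vertex r ; injective = Ray.injective r ; adjacent = λ n → to⊎ (Ray.adjacent r n) }
        fromRayIn : TwoEnds.RayIn chd → Ray (underlying D)
        fromRayIn r = record { vertex = TwoEnds.RayIn.vertex r ; injective = TwoEnds.RayIn.injective r ; adjacent = λ n → from⊎ (TwoEnds.RayIn.adjacent r n) }
        no-diamond : ¬ Diamond
        no-diamond d with two-ends chd (diamond-complete d) (diamond-complete′ chd d) (toRayIn r) (toRayIn s) (toRayIn t)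
        ... | inj₁ (q , m , m′) = r≁s (fromRayIn q , m , m′)
        ... | inj₂ (inj₁ (q , m , m′)) = r≁t (fromRayIn q , m , m′)
        ... | inj₂ (inj₂ (q , m , m′)) = s≁t (fromRayIn q , m , m′)
        noDiamond : NoDiamond chd
        noDiamond wa wa′ av a′v = dne λ n → no-diamond (_ , _ , _ , _ , wa , wa′ , av , a′v , n)
        star⇒path : ∀ {u v} → Star _⟶_ u v → ∃[ k ] Path k u v
        star⇒path ε = 0 , refl
        star⇒path (a ◅ s) = let (k , p) = star⇒path s in suc k , _ , a , p
        star⇒pathᵒᵖ : ∀ {u v} → Star _⟶_ v u → ∃[ k ] Paths.Path (flip _⟶_) k u v
        star⇒pathᵒᵖ ε = 0 , refl
        star⇒pathᵒᵖ (a ◅ s) = let (k , p) = star⇒pathᵒᵖ s in suc k , Paths.path-snoc (flip _⟶_) k p a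
        VD = Digraph.V (desc D u)
        VA = Digraph.V (anc D u)
        root : VD
        root = u , [ ε ]
        root′ : VA
        root′ = u , [ ε ]
        _~D_ = Graph._~_ (underlying (desc D u))
        _~A_ = Graph._~_ (underlying (anc D u))
        extend : ∀ {v w} (s : Star _⟶_ u v) (t : Star _⟶_ v w) → Star _~D_ (v , [ s ]) (w , [ s ◅◅ t ])
        extend s ε = ε
        extend s (a ◅ t) = fwd a ◅ extend (s ◅◅ (a ◅ ε)) t
        star : ∀ {v} (s : Star _⟶_ u v) → Star _~D_ root (v , [ s ])
        star s = extend ε s
        star′ : ∀ {v} (s : Star _⟶_ v u) → Star _~A_ (v , [ s ]) root′
        star′ ε = ε
        star′ (a ◅ s) = fwd a ◅ star′ s
        up-and-down : ∀ {v w} → Star _~D_ root v → Star _~D_ root w → Star _~D_ v w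
        up-and-down s t = reverseD s ◅◅ t
          where
          reverseD : ∀ {v w} → Star _~D_ v w → Star _~D_ w v
          reverseD ε = ε
          reverseD (a ◅ s) = reverseD s ◅◅ (Graph.~-sym (underlying (desc D u)) a ◅ ε)
        up-and-down′ : ∀ {v w} → Star _~A_ v root′ → Star _~A_ w root′ → Star _~A_ v w
        up-and-down′ s t = s ◅◅ reverseA t
          where
          reverseA : ∀ {v w} → Star _~A_ v w → Star _~A_ w v
          reverseA ε = ε
          reverseA (a ◅ s) = reverseA s ◅◅ (Graph.~-sym (underlying (anc D u)) a ◅ ε)

  -- Tree isomorphisms from compatible local bijections

  module TreeExtension where

    open import Data.List.Base using (map; filter)
    open import Data.List.Properties using (∷-injectiveˡ; ∷-injectiveʳ)
    open import Data.List.Membership.Propositional.Properties using (∈-filter⁺; ∈-filter⁻)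
    open import Data.List.Relation.Unary.Any using (here; there)
    open Base
    open Trees
    open import Defs using (Graph; IsTree)

    record BijectionOn {A B : Set} (P : A → Set) (Q : B → Set) (f : A → B) : Set where
      field
        maps       : ∀ {x} → P x → Q (f x)
        injective  : ∀ {x y} → P x → P y → f x ≡ f y → x ≡ y
        surjective : ∀ {y} → Q y → ∃[ x ] (P x × f x ≡ y)

    -- Correct f on the elements of xs one after another by transpositions of the target.
    extend-bijection : {A B : Set} {P : A → Set} {Q : B → Set} (xs : List A) (h : A → B) → (∀ {x} → x ∈ xs → P x → Q (h x)) →
      (∀ {x y} → x ∈ xs → y ∈ xs → P x → P y → h x ≡ h y → x ≡ y) →
      ∀ f → BijectionOn P Q f → Σ[ g ∈ (A → B) ] (BijectionOn P Q g × (∀ {x} → x ∈ xs → P x → g x ≡ h x))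
    extend-bijection [] h maps inj f bij = f , bij , λ ()
    extend-bijection {A} {B} {P} {Q} (x ∷ xs) h maps inj f bij
      with extend-bijection xs h (λ m → maps (there m)) (λ m m′ → inj (there m) (there m′)) f bij
    ... | g , bij-g , agree with dec (P x)
    ... | no ¬p = g , bij-g , λ { (here refl) p → contradiction p ¬p ; (there m) p → agree m p }
    ... | yes p = (λ y → transpose (g x) (h x) (g y)) , bij′ , agree′
      where
      module G = BijectionOn bij-g
      bij′ : BijectionOn P Q (λ y → transpose (g x) (h x) (g y))
      bij′ = record
        { maps = λ q → transpose-closed {P = Q} (G.maps p) (maps (here refl) p) (G.maps q)
        ; injective = λ q q′ eq → G.injective q q′ (transpose-injective (g x) (h x) eq)
        ; surjective = λ {y} q → let (z , r , eq) = G.surjective (transpose-closed {P = Q} (G.maps p) (maps (here refl) p) q)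
                                 in z , r , trans (cong (transpose (g x) (h x)) eq) (transpose-involutive (g x) (h x) y) }
      agree′ : ∀ {y} → y ∈ x ∷ xs → P y → transpose (g x) (h x) (g y) ≡ h y
      agree′ (here refl) _ = transpose-ˡ (g x) (h x)
      agree′ {y} (there m) q with y ≟ x
      ... | yes refl = transpose-ˡ (g x) (h x)
      ... | no n = trans (cong (transpose (g x) (h x)) (agree m q))
        (transpose-≢ (λ eq → n (G.injective q p (trans (agree m q) eq))) (λ eq → n (inj (there m) (here refl) q p eq)))

    bijection-refl : {A : Set} {P : A → Set} → BijectionOn P P (λ x → x)
    bijection-refl = record { maps = λ p → p ; injective = λ _ _ eq → eq ; surjective = λ q → _ , q , refl }

    extend-bijection-on : {A B : Set} {P : A → Set} {Q : B → Set} {S : A → Set} → Listing S → (h : A → B) →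
      (∀ {x} → S x → P x → Q (h x)) → (∀ {x y} → S x → S y → P x → P y → h x ≡ h y → x ≡ y) →
      ∀ f → BijectionOn P Q f → Σ[ g ∈ (A → B) ] (BijectionOn P Q g × (∀ {x} → S x → P x → g x ≡ h x))
    extend-bijection-on {S = S} (xs , complete) h maps inj f bij
      with extend-bijection (filter (λ x → dec (S x)) xs) h (λ m → maps (sound m)) (λ m m′ → inj (sound m) (sound m′)) f bij
      where
      sound : ∀ {x} → x ∈ filter (λ x → dec (S x)) xs → S x
      sound m = proj₂ (∈-filter⁻ (λ x → dec (S x)) {xs = xs} m)
    ... | g , bij-g , agree = g , bij-g , λ s → agree (∈-filter⁺ (λ x → dec (S x)) (complete s) s)

    -- Allowed v v′ γ: the bijection γ from the neighbours of v to those of v′ is allowed when v is mapped to v′.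
    module Extension (G G′ : Graph) {r} (rooted : Rooted G r) (tree′ : IsTree G′)
      (Allowed : Graph.V G → Graph.V G′ → (Graph.V G → Graph.V G′) → Set)
      (local : ∀ {v v′ γ} → Allowed v v′ γ → BijectionOn (Graph._~_ G v) (Graph._~_ G′ v′) γ)
      (r′ : Graph.V G′) (γ₀ : Graph.V G → Graph.V G′) (J₀ : Allowed r r′ γ₀)
      (child : ∀ {v u v′ γ} → Graph._~_ G v u → Rooted.path rooted u ≡ u ∷ Rooted.path rooted v → Allowed v v′ γ →
               ∃[ δ ] (Allowed u (γ u) δ × δ v ≡ v′)) where

      private
        module G = Graph G
        module G′ = Graph G′
      open Rooted rooted
      open Graph G

      -- The recursion follows the path to the root and returns the image of the first vertex
      -- together with the local map around it. Excluded middle selects a local map that fits that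
      -- of the parent.
      develop : List V → G′.V × (V → G′.V)
      develop [] = r′ , γ₀
      develop (u ∷ []) = r′ , γ₀
      develop (u ∷ l@(v ∷ _)) with develop l
      ... | v′ , γ with dec (∃[ δ ] (Allowed u (γ u) δ × δ v ≡ v′))
      ... | yes (δ , _) = γ u , δ
      -- An arbitrary value; on paths of the tree `child` rules this case out.
      ... | no _ = γ u , γ

      τ : V → G′.V
      τ v = proj₁ (develop (path v))

      δ : V → V → G′.V
      δ v = proj₂ (develop (path v))

      develop-child : ∀ {u v l} → Allowed v (proj₁ (develop (v ∷ l))) (proj₂ (develop (v ∷ l))) → v ~ u → path u ≡ u ∷ path v →
        Allowed u (proj₁ (develop (u ∷ v ∷ l))) (proj₂ (develop (u ∷ v ∷ l))) ×
        proj₁ (develop (u ∷ v ∷ l)) ≡ proj₂ (develop (v ∷ l)) u × proj₂ (develop (u ∷ v ∷ l)) v ≡ proj₁ (develop (v ∷ l))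
      develop-child {u} {v} {l} j a eq with dec (∃[ δ ] (Allowed u (proj₂ (develop (v ∷ l)) u) δ × δ v ≡ proj₁ (develop (v ∷ l))))
      ... | yes (δ , p , q) = p , refl , q
      ... | no none = contradiction (child a eq j) none

      child-facts : ∀ {u v} → Allowed v (τ v) (δ v) → v ~ u → path u ≡ u ∷ path v → Allowed u (τ u) (δ u) × τ u ≡ δ v u × δ u v ≡ τ v
      child-facts {u} {v} j a eq with path-head v
      ... | l , e = subst (λ p → Allowed u (proj₁ (develop p)) (proj₂ (develop p)) × proj₁ (develop p) ≡ δ v u × proj₂ (develop p) v ≡ τ v) (sym eq)
                      (subst (λ q → Allowed u (proj₁ (develop (u ∷ q))) (proj₂ (develop (u ∷ q))) ×
                                    proj₁ (develop (u ∷ q)) ≡ proj₂ (develop q) u × proj₂ (develop (u ∷ q)) v ≡ proj₁ (develop q)) (sym e)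
                        (develop-child {u} {v} {l} (subst (λ q → Allowed v (proj₁ (develop q)) (proj₂ (develop q))) e j) a eq))

      admissible : ∀ v → Allowed v (τ v) (δ v)
      admissible v = go (path v) v refl
        where
        go : ∀ l v → path v ≡ l → Allowed v (τ v) (δ v)
        go l v eq with parent v
        ... | inj₁ refl = subst (λ q → Allowed r (proj₁ (develop q)) (proj₂ (develop q))) (sym path-root) J₀
        go [] v eq | inj₂ (p , a , e) with trans (sym e) eq
        ... | ()
        go (_ ∷ l) v eq | inj₂ (p , a , e) = proj₁ (child-facts (go l p (∷-injectiveʳ (trans (sym e) eq))) (~-sym a) e)

      -- For children this is the definition of `τ`; for the parent it is the condition that the
      -- local map sends the parent to its image.
      τ-neighbour : ∀ {v u} → v ~ u → τ u ≡ δ v u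
      τ-neighbour {v} {u} a with path-edge a
      ... | inj₁ eq = sym (proj₂ (proj₂ (child-facts (admissible u) (~-sym a) eq)))
      ... | inj₂ eq = proj₁ (proj₂ (child-facts (admissible v) a eq))

      private
        module L v = BijectionOn (local (admissible v))

      τ-edge : ∀ {u v} → u ~ v → τ u G′.~ τ v
      τ-edge {u} a = subst (τ u G′.~_) (sym (τ-neighbour a)) (L.maps u a)

      τ-local : ∀ {v u w} → v ~ u → v ~ w → τ u ≡ τ w → u ≡ w
      τ-local {v} a b eq = L.injective v a b (trans (sym (τ-neighbour a)) (trans eq (τ-neighbour b)))

      τ-lift : ∀ {v u′} → τ v G′.~ u′ → ∃[ u ] (v ~ u × τ u ≡ u′)
      τ-lift {v} a = let (u , b , eq) = L.surjective v a in u , b , trans (τ-neighbour b) eq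

      τ-route : ∀ {x l} → Walks.Route G r x l → Walks.Route G′ (τ r) (τ x) (map τ l)
      τ-route Walks.stop = Walks.stop
      τ-route (Walks.first a) = Walks.first (τ-edge a)
      τ-route (Walks.next a n ρ) = Walks.next (τ-edge a) (λ eq → n (τ-local (~-sym a) (second ρ) eq)) (τ-route ρ)
        where
        second : ∀ {y w l} → Walks.Route G r y (y ∷ w ∷ l) → y ~ w
        second (Walks.first a) = a
        second (Walks.next a _ _) = a

      -- Local injectivity preserves the absence of backtracking, so routes to the root map to
      -- routes in `G′`. Routes there are unique, and the preimages are compared from the root
      -- outwards.
      τ-injective : ∀ {x y} → τ x ≡ τ y → x ≡ y
      τ-injective {x} {y} eq = go (path x) x y refl
        (Walks.route-unique G′ (proj₂ tree′) (τ-route (path-route x)) (subst (λ z → Walks.Route G′ (τ r) z (map τ (path y))) (sym eq) (τ-route (path-route y))))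
        where
        long : ∀ {x p} → map τ (r ∷ []) ≢ map τ (x ∷ path p)
        long {x} {p} eq with path-head p
        ... | l , e with trans eq (cong (λ q → map τ (x ∷ q)) e)
        ... | ()
        go : ∀ l x y → path x ≡ l → map τ (path x) ≡ map τ (path y) → x ≡ y
        go l x y e m with parent x | parent y
        ... | inj₁ refl | inj₁ refl = refl
        ... | inj₁ refl | inj₂ (q , b , eq) = contradiction (trans (cong (map τ) (sym path-root)) (trans m (cong (map τ) eq))) (long {y} {q})
        ... | inj₂ (p , a , eq) | inj₁ refl = contradiction (trans (cong (map τ) (sym path-root)) (trans (sym m) (cong (map τ) eq))) (long {x} {p})
        go [] x y e m | inj₂ (p , a , eq) | inj₂ (q , b , eq′) with trans (sym eq) e
        ... | ()
        go (_ ∷ l) x y e m | inj₂ (p , a , eq) | inj₂ (q , b , eq′)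
          with trans (cong (map τ) (sym eq)) (trans m (cong (map τ) eq′))
        ... | m′ with go l p q (∷-injectiveʳ (trans (sym eq) e)) (∷-injectiveʳ m′)
        ... | refl = τ-local (~-sym a) (~-sym b) (∷-injectiveˡ m′)

      τ-onto : ∀ v′ → ∃[ v ] τ v ≡ v′
      τ-onto v′ = go (proj₂ (proj₁ tree′) (τ r) v′) (r , refl)
        where
        go : ∀ {u′ v′} → Star G′._~_ u′ v′ → ∃[ u ] τ u ≡ u′ → ∃[ v ] τ v ≡ v′
        go ε p = p
        go (a ◅ s) (u , refl) = let (w , _ , eq) = τ-lift a in go s (w , eq)

      τ-edge⁻ : ∀ {u v} → τ u G′.~ τ v → u ~ v
      τ-edge⁻ {u} a = let (w , b , eq) = τ-lift a in subst (u ~_) (τ-injective eq) b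

  -- Side-preserving homogeneity of the listed graphs

  module BipartiteHomogeneity where

    open import Data.Fin.Base using (fromℕ) renaming (opposite to opposite-Fin)
    open import Data.Fin.Properties using (toℕ<n; toℕ-fromℕ<; fromℕ<-toℕ; toℕ-injective; opposite-prop; opposite-involutive)
    open import Data.List.Base using (allFin)
    open import Data.List.Membership.Propositional.Properties using (∈-allFin)
    open import Data.List.Relation.Unary.Any using (here)
    open import Data.List.Properties using (∷-injectiveʳ)
    open import Data.Nat.Base using (_∸_; parity)
    open import Data.Nat.Properties using (<⇒≤; suc-injective; +-∸-assoc; n∸n≡0; <-irrefl)
    open import Data.Sum.Properties using (inj₁-injective; inj₂-injective)
    open Base
    open Homogeneous
    open Trees
    open TreeExtension
    open import Defs using (BipartiteGraph; BipartiteEdge; edge; edge˘; bipartite; Always; always; CP; evenCycle; CyclicSuc; Listed; Neighbours; IsSemiregularTree) renaming (K to completeBipartite)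
    open Aut

    aut-∘ : {V K : Set} {κ : V → K} {R : V → V → Set} → Aut κ R → Aut κ R → Aut κ R
    aut-∘ α β = record
      { to = to β ∘ to α ; from = from α ∘ from β
      ; to∘from = λ v → trans (cong (to β) (to∘from α (from β v))) (to∘from β v)
      ; from∘to = λ v → trans (cong (from α) (from∘to β (to α v))) (from∘to α v)
      ; to-κ = λ v → trans (to-κ β (to α v)) (to-κ α v)
      ; to-arc = λ a → to-arc β (to-arc α a) ; to-arc⁻ = λ a → to-arc⁻ α (to-arc⁻ β a) }

    PartHomogeneous : BipartiteGraph → Set₁
    PartHomogeneous B = Homogeneity (BipartiteGraph.part B) (BipartiteGraph._~_ B)

    All : {A : Set} → A → Set
    All _ = ⊤

    module _ {m n : ℕ} (E : Fin m → Fin n → Set) where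
      private
        open module B = BipartiteGraph (bipartite {Fin m} {Fin n} E) using (part; _~_)

      permutations⇒aut : ∀ {f g} → BijectionOn All All f → BijectionOn All All g →
        (∀ {a b} → E a b → E (f a) (g b)) → (∀ {a b} → E (f a) (g b) → E a b) →
        Σ[ α ∈ Aut part _~_ ] ((∀ a → to α (inj₁ a) ≡ inj₁ (f a)) × (∀ b → to α (inj₂ b) ≡ inj₂ (g b)))
      permutations⇒aut {f} {g} F G E⇒ E⇐ = record
        { to = λ { (inj₁ a) → inj₁ (f a) ; (inj₂ b) → inj₂ (g b) }
        ; from = λ { (inj₁ a) → inj₁ (f⁻¹ a) ; (inj₂ b) → inj₂ (g⁻¹ b) }
        ; to∘from = λ { (inj₁ a) → cong inj₁ (proj₂ (proj₂ (F.surjective {a} tt))) ; (inj₂ b) → cong inj₂ (proj₂ (proj₂ (G.surjective {b} tt))) }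
        ; from∘to = λ { (inj₁ a) → cong inj₁ (F.injective tt tt (proj₂ (proj₂ (F.surjective {f a} tt))))
                      ; (inj₂ b) → cong inj₂ (G.injective tt tt (proj₂ (proj₂ (G.surjective {g b} tt)))) }
        ; to-κ = λ { (inj₁ a) → refl ; (inj₂ b) → refl }
        ; to-arc = λ { (edge e) → edge (E⇒ e) ; (edge˘ e) → edge˘ (E⇒ e) }
        ; to-arc⁻ = λ { {inj₁ _} {inj₂ _} (edge e) → edge (E⇐ e) ; {inj₂ _} {inj₁ _} (edge˘ e) → edge˘ (E⇐ e) } } , (λ _ → refl) , λ _ → refl
        where
        module F = BijectionOn F
        module G = BijectionOn G
        f⁻¹ : Fin m → Fin m
        f⁻¹ a = proj₁ (F.surjective {a} tt)
        g⁻¹ : Fin n → Fin n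
        g⁻¹ b = proj₁ (G.surjective {b} tt)

      is-left : ∀ {v} → part v ≡ 0ℙ → ∃[ a ] v ≡ inj₁ a
      is-left {inj₁ a} _ = a , refl

      is-right : ∀ {v} → part v ≡ 1ℙ → ∃[ b ] v ≡ inj₂ b
      is-right {inj₂ b} _ = b , refl

      module Images {I : Set} (x y : I → Fin m ⊎ Fin n) (κ≡ : ∀ i → part (x i) ≡ part (y i)) (x≡⇒y≡ : ∀ i j → x i ≡ x j → y i ≡ y j) where

        left-image : ∀ a → (∃[ i ] x i ≡ inj₁ a) → ∃[ a′ ] (∀ i → x i ≡ inj₁ a → y i ≡ inj₁ a′)
        left-image a (i , e) with is-left (trans (sym (κ≡ i)) (cong part e))
        ... | a′ , e′ = a′ , λ j e″ → trans (x≡⇒y≡ j i (trans e″ (sym e))) e′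

        right-image : ∀ b → (∃[ i ] x i ≡ inj₂ b) → ∃[ b′ ] (∀ i → x i ≡ inj₂ b → y i ≡ inj₂ b′)
        right-image b (i , e) with is-right (trans (sym (κ≡ i)) (cong part e))
        ... | b′ , e′ = b′ , λ j e″ → trans (x≡⇒y≡ j i (trans e″ (sym e))) e′

    finite-listing : ∀ {n} {S : Fin n → Set} → Listing S
    finite-listing = allFin _ , λ {a} _ → ∈-allFin a

    -- The sides can be permuted independently, so the two partial injections are extended
    -- separately.
    complete-homogeneous : ∀ {m n} → 1 ≤ m → 1 ≤ n → PartHomogeneous (completeBipartite m n)
    complete-homogeneous {suc m} {suc n} _ _ {I} x y _ i₀ _ κ≡ x≡⇒y≡ y≡⇒x≡ _ _ =
      let (h , h-spec) = left-images
          (k , k-spec) = right-images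
          (f , F , f≡) = extend-bijection-on {P = All} {Q = All} {S = λ a → ∃[ i ] x i ≡ inj₁ a} finite-listing h (λ _ _ → tt)
                           (λ { {a} {a′} (i , e) (j , e′) _ _ eq → inj₁-injective (trans (sym e)
                              (trans (y≡⇒x≡ i j (trans (h-spec a (i , e) i e) (trans (cong inj₁ eq) (sym (h-spec a′ (j , e′) j e′))))) e′)) })
                           (λ a → a) bijection-refl
          (g , G , g≡) = extend-bijection-on {P = All} {Q = All} {S = λ b → ∃[ i ] x i ≡ inj₂ b} finite-listing k (λ _ _ → tt)
                           (λ { {b} {b′} (i , e) (j , e′) _ _ eq → inj₂-injective (trans (sym e)
                              (trans (y≡⇒x≡ i j (trans (k-spec b (i , e) i e) (trans (cong inj₂ eq) (sym (k-spec b′ (j , e′) j e′))))) e′)) })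
                           (λ b → b) bijection-refl
          (α , α₁ , α₂) = permutations⇒aut Always F G (λ _ → always) (λ _ → always)
      in α , λ i → agree {h} {k} h-spec k-spec α (λ a s → trans (α₁ a) (cong inj₁ (f≡ s tt))) (λ b s → trans (α₂ b) (cong inj₂ (g≡ s tt))) i (x i) refl
      where
      open Images Always x y κ≡ x≡⇒y≡
      left-images : Σ[ h ∈ (Fin (suc m) → Fin (suc m)) ] (∀ a → (∃[ i ] x i ≡ inj₁ a) → ∀ i → x i ≡ inj₁ a → y i ≡ inj₁ (h a))
      left-images = choose {Q = λ a a′ → ∀ i → x i ≡ inj₁ a → y i ≡ inj₁ a′} left-image zero
      right-images : Σ[ k ∈ (Fin (suc n) → Fin (suc n)) ] (∀ b → (∃[ i ] x i ≡ inj₂ b) → ∀ i → x i ≡ inj₂ b → y i ≡ inj₂ (k b))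
      right-images = choose {Q = λ b b′ → ∀ i → x i ≡ inj₂ b → y i ≡ inj₂ b′} right-image zero
      agree : {h : Fin (suc m) → Fin (suc m)} {k : Fin (suc n) → Fin (suc n)} → (∀ a → (∃[ i ] x i ≡ inj₁ a) → ∀ i → x i ≡ inj₁ a → y i ≡ inj₁ (h a)) → (∀ b → (∃[ i ] x i ≡ inj₂ b) → ∀ i → x i ≡ inj₂ b → y i ≡ inj₂ (k b)) →
        ∀ (α : Aut (BipartiteGraph.part (completeBipartite (suc m) (suc n))) (BipartiteEdge Always)) → (∀ a → (∃[ i ] x i ≡ inj₁ a) → to α (inj₁ a) ≡ inj₁ (h a)) → (∀ b → (∃[ i ] x i ≡ inj₂ b) → to α (inj₂ b) ≡ inj₂ (k b)) →
        ∀ i v → x i ≡ v → to α (x i) ≡ y i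
      agree hs ks α p q i (inj₁ a) e = trans (cong (to α) e) (trans (p a (i , e)) (sym (hs a (i , e) i e)))
      agree hs ks α p q i (inj₂ b) e = trans (cong (to α) e) (trans (q b (i , e)) (sym (ks b (i , e) i e)))

    -- A side-preserving isomorphism is determined by one partial injection of the indices, since index a on one
    -- side and index b on the other are equal exactly when they are not adjacent.
    matching-homogeneous : ∀ {n} → 1 ≤ n → PartHomogeneous (CP n)
    matching-homogeneous {suc n} _ {I} x y _ i₀ _ κ≡ x≡⇒y≡ y≡⇒x≡ x~⇒y~ y~⇒x~ =
      let (h , h-spec) = choose {Q = Image} image zero
          (f , F , f≡) = extend-bijection-on {P = All} {Q = All} {S = Occurs} finite-listing h (λ _ _ → tt) (λ {a} {a′} s s′ _ _ eq → inj s s′ (h-spec a s) (h-spec a′ s′) eq)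
                           (λ a → a) bijection-refl
          (α , α₁ , α₂) = permutations⇒aut _≢_ F F (λ n eq → n (BijectionOn.injective F tt tt eq)) (λ n eq → n (cong f eq))
      in α , λ i → agree {h} α h-spec (λ a s → trans (α₁ a) (cong inj₁ (f≡ s tt))) (λ a s → trans (α₂ a) (cong inj₂ (f≡ s tt))) i (x i) refl
      where
      open Images _≢_ x y κ≡ x≡⇒y≡
      Occurs : Fin (suc n) → Set
      Occurs a = ∃[ i ] (x i ≡ inj₁ a ⊎ x i ≡ inj₂ a)
      Image : Fin (suc n) → Fin (suc n) → Set
      Image a a′ = (∀ i → x i ≡ inj₁ a → y i ≡ inj₁ a′) × (∀ i → x i ≡ inj₂ a → y i ≡ inj₂ a′)
      opposite-equal : ∀ {i j a b a′ b′} → x i ≡ inj₁ a → x j ≡ inj₂ b → y i ≡ inj₁ a′ → y j ≡ inj₂ b′ → (a ≡ b → a′ ≡ b′) × (a′ ≡ b′ → a ≡ b)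
      opposite-equal {i} {j} e f e′ f′ =
        (λ eq → dne λ n → no-edge e f eq (y~⇒x~ i j (subst₂ (BipartiteEdge _≢_) (sym e′) (sym f′) (edge n)))) ,
        (λ eq → dne λ n → no-edge e′ f′ eq (x~⇒y~ i j (subst₂ (BipartiteEdge _≢_) (sym e) (sym f) (edge n))))
        where
        no-edge : ∀ {u v a b} → u ≡ inj₁ a → v ≡ inj₂ b → a ≡ b → ¬ BipartiteEdge _≢_ u v
        no-edge refl refl eq (edge n) = n eq
      image : ∀ a → Occurs a → ∃[ a′ ] Image a a′
      image a (i , inj₁ e) with left-image a (i , e)
      ... | a′ , h = a′ , h , λ j e′ → let (b , k) = right-image a (j , e′)
                                       in trans (k j e′) (cong inj₂ (sym (proj₁ (opposite-equal e e′ (h i e) (k j e′)) refl)))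
      image a (i , inj₂ e) with right-image a (i , e)
      ... | a′ , k = a′ , (λ j e′ → let (b , h) = left-image a (j , e′)
                                    in trans (h j e′) (cong inj₁ (proj₁ (opposite-equal e′ e (h j e′) (k i e)) refl))) , k
      inj : ∀ {a b a′ b′} → Occurs a → Occurs b → Image a a′ → Image b b′ → a′ ≡ b′ → a ≡ b
      inj (i , inj₁ e) (j , inj₁ e′) (p , _) (q , _) eq = inj₁-injective (trans (sym e) (trans (y≡⇒x≡ i j (trans (p i e) (trans (cong inj₁ eq) (sym (q j e′))))) e′))
      inj (i , inj₂ e) (j , inj₂ e′) (_ , p) (_ , q) eq = inj₂-injective (trans (sym e) (trans (y≡⇒x≡ i j (trans (p i e) (trans (cong inj₂ eq) (sym (q j e′))))) e′))
      inj (i , inj₁ e) (j , inj₂ e′) (p , _) (_ , q) eq = proj₂ (opposite-equal e e′ (p i e) (q j e′)) eq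
      inj (i , inj₂ e) (j , inj₁ e′) (_ , p) (q , _) eq = sym (proj₂ (opposite-equal e′ e (q j e′) (p i e)) (sym eq))
      agree : {h : Fin (suc n) → Fin (suc n)} (α : Aut (BipartiteGraph.part (CP (suc n))) (BipartiteEdge _≢_)) → (∀ a → Occurs a → Image a (h a)) → (∀ a → Occurs a → to α (inj₁ a) ≡ inj₁ (h a)) → (∀ a → Occurs a → to α (inj₂ a) ≡ inj₂ (h a)) →
        ∀ i v → x i ≡ v → to α (x i) ≡ y i
      agree α hs p q i (inj₁ a) e = trans (cong (to α) e) (trans (p a (i , inj₁ e)) (sym (proj₁ (hs a (i , inj₁ e)) i e)))
      agree α hs p q i (inj₂ a) e = trans (cong (to α) e) (trans (q a (i , inj₂ e)) (sym (proj₂ (hs a (i , inj₂ e)) i e)))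

    module _ {a b : ℕ} {B : BipartiteGraph} (semiregular : IsSemiregularTree a b B) where
      open BipartiteGraph B
      open IsSemiregularTree semiregular

      part-step : ∀ {u v p} → u ~ v → part u ≡ p → part v ≡ opposite p
      part-step {u} {v} e refl with part u | part v | proper e
      ... | 0ℙ | 0ℙ | n = ⊥-elim (n refl)
      ... | 0ℙ | 1ℙ | n = refl
      ... | 1ℙ | 0ℙ | n = refl
      ... | 1ℙ | 1ℙ | n = ⊥-elim (n refl)

      some-bijection : ∀ v v′ → part v ≡ part v′ → Σ[ f ∈ (V → V) ] BijectionOn (v ~_) (v′ ~_) f
      some-bijection v v′ eq = go (part v) refl
        where
        between : ∀ {c} → Neighbours graph v ↔ Fin c → Neighbours graph v′ ↔ Fin c → Σ[ f ∈ (V → V) ] BijectionOn (v ~_) (v′ ~_) f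
        between i j = f , record { maps = maps ; injective = inj ; surjective = surj }
          where
          φ : Neighbours graph v → Neighbours graph v′
          φ u = Inverse.from j (Inverse.to i u)
          f : V → V
          f u with dec (v ~ u)
          ... | yes e = value (φ (u , [ e ]))
          ... | no _ = u
          f-≡ : ∀ {u} (e : v ~ u) → f u ≡ value (φ (u , [ e ]))
          f-≡ {u} e with dec (v ~ u)
          ... | yes _ = refl
          ... | no n = contradiction e n
          maps : ∀ {u} → v ~ u → v′ ~ f u
          maps e = subst (v′ ~_) (sym (f-≡ e)) (proofOf (φ (_ , [ e ])))
          inj : ∀ {u w} → v ~ u → v ~ w → f u ≡ f w → u ≡ w
          inj {u} {w} e e′ eq = cong value (↔-injective i {u , [ e ]} {w , [ e′ ]} (trans (sym (Inverse.strictlyInverseˡ j _))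
            (trans (cong (Inverse.to j) (value-injective (trans (sym (f-≡ e)) (trans eq (f-≡ e′))))) (Inverse.strictlyInverseˡ j _))))
          surj : ∀ {u} → v′ ~ u → ∃[ w ] (v ~ w × f w ≡ u)
          surj {u} e = let w = Inverse.from i (Inverse.to j (u , [ e ])) ; vw = proofOf w
                       in value w , vw , trans (f-≡ vw) (cong value (trans (cong (Inverse.from j) (Inverse.strictlyInverseˡ i _)) (Inverse.strictlyInverseʳ j _)))
        go : ∀ p → part v ≡ p → Σ[ f ∈ (V → V) ] BijectionOn (v ~_) (v′ ~_) f
        go 0ℙ e = between (degreeX e) (degreeX (trans (sym eq) e))
        go 1ℙ e = between (degreeY e) (degreeY (trans (sym eq) e))

      -- The tree is rooted at `x i₀`, and a local map around a point of the family is required to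
      -- agree with `y` on that point and its neighbours in the family. If `u` occurs in the family
      -- then so does its parent, so the requirements at both ends of the edge are consistent.
      tree-homogeneous : PartHomogeneous B
      tree-homogeneous {I} x y l i₀ reach κ≡ x≡⇒y≡ y≡⇒x≡ x~⇒y~ y~⇒x~ = automorphism , agree
        where
        rooted : Rooted graph (x i₀)
        rooted = tree⇒rooted isTree (x i₀)
        open Rooted rooted
        Agrees : V → V → (V → V) → Set
        Agrees v v′ γ = ∀ i → x i ≡ v → y i ≡ v′ × (∀ j → v ~ x j → γ (x j) ≡ y j)
        Allowed : V → V → (V → V) → Set
        Allowed v v′ γ = part v ≡ part v′ × BijectionOn (v ~_) (v′ ~_) γ × Agrees v v′ γ
        Occurs : V → Set
        Occurs w = ∃[ j ] x j ≡ w
        y-of : Σ[ h ∈ (V → V) ] (∀ w → Occurs w → ∀ j → x j ≡ w → y j ≡ h w)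
        y-of = choose {Q = λ w z → ∀ j → x j ≡ w → y j ≡ z} (λ w (j , e) → y j , λ k e′ → x≡⇒y≡ k j (trans e′ (sym e))) (x i₀)
        extend-at : ∀ i → ∃[ γ ] Allowed (x i) (y i) γ
        extend-at i with some-bijection (x i) (y i) (κ≡ i)
        ... | f , F with extend-bijection-on {S = Occurs} (listing-image x l λ (j , e) → j , tt , e) (proj₁ y-of)
                           (λ { {w} (j , refl) e → subst (y i ~_) (proj₂ y-of w (j , refl) j refl) (x~⇒y~ i j e) })
                           (λ { {w} {w′} (j , refl) (k , refl) _ _ eq → y≡⇒x≡ j k (trans (proj₂ y-of w (j , refl) j refl) (trans eq (sym (proj₂ y-of w′ (k , refl) k refl)))) })
                           f F
        ... | γ , Γ , γ≡ = γ , κ≡ i , Γ , λ j e → x≡⇒y≡ j i e , λ k e′ → trans (γ≡ (k , refl) e′) (sym (proj₂ y-of (x k) (k , refl) k refl))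
        child : ∀ {v u v′ γ} → v ~ u → path u ≡ u ∷ path v → Allowed v v′ γ → ∃[ δ ] (Allowed u (γ u) δ × δ v ≡ v′)
        child {v} {u} {v′} {γ} e eq (parts , Γ , agrees) with dec (Occurs u)
        ... | no none with some-bijection u (γ u) (trans (part-step e refl) (trans (cong opposite parts) (sym (part-step (BijectionOn.maps Γ e) refl))))
        ...   | f , F with extend-bijection-on {S = _≡ v} (listing-≡ v) (λ _ → v′) (λ _ _ → ~-sym (BijectionOn.maps Γ e)) (λ { refl refl _ _ _ → refl }) f F
        ...   | δ , Δ , δ≡ = δ , (trans (part-step e refl) (trans (cong opposite parts) (sym (part-step (BijectionOn.maps Γ e) refl))) , Δ ,
                              λ i e′ → contradiction (i , e′) none) , δ≡ refl (~-sym e)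
        child {v} {u} {v′} {γ} e eq (parts , Γ , agrees) | yes (i , refl) with parent-occurs
          where
          off-root : u ∉ path (x i₀)
          off-root m with subst (u ∈_) path-root m
          ... | here e₀ with path-head v
          ...   | l′ , e′ with trans (sym path-root) (trans (cong path (sym e₀)) (trans eq (cong (u ∷_) e′)))
          ...     | ()
          parent-occurs : Occurs v
          -- The family starts at the root, outside the subtree of `u`, and can enter that subtree
          -- only along the edge from `v`.
          parent-occurs with reach-crossing (λ k → u ∈ path (x k)) (reach i) off-root (path-self u)
          ... | k , k′ , t , n , m with enter-subtree (sym′ t) n m
            where
            sym′ : x k ~ x k′ ⊎ x k′ ~ x k → x k ~ x k′
            sym′ (inj₁ e) = e
            sym′ (inj₂ e) = ~-sym e
          ...   | u≡ , eq′ = k , path-injective (∷-injectiveʳ (trans (sym eq′) (trans (cong path (sym u≡)) eq)))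
        ... | j , refl with extend-at i
        ...   | δ , D@(_ , _ , δ-agrees) =
                δ , subst (λ z → Allowed (x i) z δ) (sym (proj₂ (agrees j refl) i e)) D ,
                trans (proj₂ (δ-agrees i refl) j (~-sym e)) (proj₁ (agrees j refl))
        γ₀ : V → V
        γ₀ = proj₁ (extend-at i₀)
        module Ext = Extension graph graph rooted isTree Allowed (λ (_ , Γ , _) → Γ) (y i₀) γ₀ (proj₂ (extend-at i₀)) child
        automorphism : Aut part _~_
        automorphism = record
          { to = Ext.τ ; from = λ v → proj₁ (Ext.τ-onto v)
          ; to∘from = λ v → proj₂ (Ext.τ-onto v)
          ; from∘to = λ v → Ext.τ-injective (proj₂ (Ext.τ-onto (Ext.τ v)))
          ; to-κ = λ v → sym (proj₁ (Ext.admissible v))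
          ; to-arc = Ext.τ-edge ; to-arc⁻ = Ext.τ-edge⁻ }
        agree : ∀ i → Ext.τ (x i) ≡ y i
        agree i = sym (proj₁ (proj₂ (proj₂ (Ext.admissible (x i))) i refl))

    module _ {n : ℕ} (even : parity (suc (suc (suc n))) ≡ 0ℙ) where
      open CyclicOrder {n}
      open BipartiteGraph (evenCycle size even) using (part; _~_; proper)

      successor-unique : ∀ {i j j′ : Fin size} → CyclicSuc i j → CyclicSuc i j′ → j ≡ j′
      successor-unique (inj₁ p) (inj₁ q) = toℕ-injective (trans p (sym q))
      successor-unique {j = j} (inj₁ p) (inj₂ (q , _)) = ⊥-elim (<-irrefl (trans p q) (toℕ<n j))
      successor-unique {j′ = j′} (inj₂ (p , _)) (inj₁ q) = ⊥-elim (<-irrefl (trans q p) (toℕ<n j′))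
      successor-unique (inj₂ (_ , p)) (inj₂ (_ , q)) = toℕ-injective (trans p (sym q))

      predecessor-unique : ∀ {i i′ j : Fin size} → CyclicSuc i j → CyclicSuc i′ j → i ≡ i′
      predecessor-unique (inj₁ p) (inj₁ q) = toℕ-injective (suc-injective (trans (sym p) q))
      predecessor-unique (inj₁ p) (inj₂ (_ , q)) with trans (sym p) q
      ... | ()
      predecessor-unique (inj₂ (_ , p)) (inj₁ q) with trans (sym q) p
      ... | ()
      predecessor-unique (inj₂ (p , _)) (inj₂ (q , _)) = toℕ-injective (suc-injective (trans p (sym q)))

      Rotation Symmetry : Set
      Rotation = Aut (λ _ → tt) (CyclicSuc {size})
      Symmetry = Aut (λ _ → tt) _~_

      shift : Rotation
      shift = record
        { to = s ; from = p
        ; to∘from = λ i → successor-unique (proj₂ (successor (p i))) (proj₂ (predecessor i))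
        ; from∘to = from∘to′
        ; to-κ = λ _ → refl
        ; to-arc = λ {i} {j} c → subst (λ z → CyclicSuc (s i) (s z)) (successor-unique (proj₂ (successor i)) c) (proj₂ (successor (s i)))
        ; to-arc⁻ = λ {i} {j} c → subst (CyclicSuc i) (s-injective (successor-unique (proj₂ (successor (s i))) c)) (proj₂ (successor i)) }
        where
        s p : Fin size → Fin size
        s i = proj₁ (successor i)
        p i = proj₁ (predecessor i)
        from∘to′ : ∀ i → p (s i) ≡ i
        from∘to′ i = predecessor-unique (proj₂ (predecessor (s i))) (proj₂ (successor i))
        s-injective : ∀ {i j} → s i ≡ s j → i ≡ j
        s-injective {i} {j} eq = trans (sym (from∘to′ i)) (trans (cong p eq) (from∘to′ j))

      rotation-from-zero : ∀ b → Σ[ α ∈ Rotation ] (to α zero ≡ b)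
      rotation-from-zero b = subst (λ b → Σ[ α ∈ Rotation ] (to α zero ≡ b)) (fromℕ<-toℕ b (toℕ<n b)) (go (toℕ b) (toℕ<n b))
        where
        identity : Rotation
        identity = record { to = λ i → i ; from = λ i → i ; to∘from = λ _ → refl ; from∘to = λ _ → refl ; to-κ = λ _ → refl ; to-arc = λ c → c ; to-arc⁻ = λ c → c }
        go : ∀ k (p : k < size) → Σ[ α ∈ Rotation ] (to α zero ≡ fromℕ< p)
        go zero (s≤s z≤n) = identity , refl
        go (suc k) p with go k (<⇒≤ p)
        ... | α , eq = aut-∘ α shift , trans (cong (to shift) eq) (successor-unique (proj₂ (successor (fromℕ< (<⇒≤ p))))
                         (inj₁ (trans (toℕ-fromℕ< p) (cong suc (sym (toℕ-fromℕ< (<⇒≤ p)))))))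

      rotation : ∀ a b → Σ[ α ∈ Rotation ] (to α a ≡ b)
      rotation a b with rotation-from-zero a | rotation-from-zero b
      ... | α , refl | β , refl = aut-∘ (inverse α) β , cong (to β) (from∘to α zero)

      rotation⇒symmetry : Rotation → Symmetry
      rotation⇒symmetry α = record
        { to = to α ; from = from α ; to∘from = to∘from α ; from∘to = from∘to α ; to-κ = λ _ → refl
        ; to-arc = λ { (fwd c) → fwd (to-arc α c) ; (bwd c) → bwd (to-arc α c) }
        ; to-arc⁻ = λ { (fwd c) → fwd (to-arc⁻ α c) ; (bwd c) → bwd (to-arc⁻ α c) } }

      reflect-arc : ∀ {i j : Fin size} → CyclicSuc i j → CyclicSuc (opposite-Fin j) (opposite-Fin i)
      reflect-arc {i} {j} (inj₁ p) = inj₁ (trans (opposite-prop i) (trans (+-∸-assoc 1 (subst (λ z → suc z ≤ size) p (toℕ<n j)))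
        (cong suc (trans (cong (λ z → size ∸ suc z) (sym p)) (sym (opposite-prop j))))))
      reflect-arc {i} {j} (inj₂ (p , q)) = inj₂ (cong suc (trans (opposite-prop j) (cong (λ z → size ∸ suc z) q)) ,
        trans (opposite-prop i) (trans (cong (size ∸_) p) (n∸n≡0 size)))

      reflection : Symmetry
      reflection = record
        { to = opposite-Fin ; from = opposite-Fin ; to∘from = opposite-involutive ; from∘to = opposite-involutive ; to-κ = λ _ → refl
        ; to-arc = reflect ; to-arc⁻ = λ {i} {j} c → subst₂ _~_ (opposite-involutive i) (opposite-involutive j) (reflect c) }
        where
        reflect : ∀ {i j} → i ~ j → opposite-Fin i ~ opposite-Fin j
        reflect (fwd c) = bwd (reflect-arc c)
        reflect (bwd c) = fwd (reflect-arc c)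

      edge-symmetry : ∀ {v w v′ w′} → v ~ w → v′ ~ w′ → Σ[ α ∈ Symmetry ] (to α v ≡ v′ × to α w ≡ w′)
      edge-symmetry {v} {w} {v′} (fwd c) (fwd d) with rotation v v′
      ... | α , refl = rotation⇒symmetry α , refl , successor-unique (to-arc α c) d
      edge-symmetry {v} {w} {v′} (bwd c) (bwd d) with rotation v v′
      ... | α , refl = rotation⇒symmetry α , refl , predecessor-unique (to-arc α c) d
      edge-symmetry {v} {w} {v′} (fwd c) (bwd d) with rotation (opposite-Fin v) v′
      ... | α , refl = aut-∘ reflection (rotation⇒symmetry α) , refl , predecessor-unique (to-arc α (reflect-arc c)) d
      edge-symmetry {v} {w} {v′} (bwd c) (fwd d) with rotation (opposite-Fin v) v′
      ... | α , refl = aut-∘ reflection (rotation⇒symmetry α) , refl , successor-unique (to-arc α (reflect-arc c)) d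

      two-neighbours : ∀ {u a b c} → u ~ a → u ~ b → u ~ c → b ≢ a → c ≢ a → b ≡ c
      two-neighbours (fwd a) (fwd b) _ n m = ⊥-elim (n (successor-unique b a))
      two-neighbours (fwd a) _ (fwd c) n m = ⊥-elim (m (successor-unique c a))
      two-neighbours (bwd a) (bwd b) _ n m = ⊥-elim (n (predecessor-unique b a))
      two-neighbours (bwd a) _ (bwd c) n m = ⊥-elim (m (predecessor-unique c a))
      two-neighbours (fwd a) (bwd b) (bwd c) n m = predecessor-unique b c
      two-neighbours (bwd a) (fwd b) (fwd c) n m = successor-unique b c

      cycle-connected : ∀ i → Reach _~_ zero i
      cycle-connected i = subst (Reach _~_ zero) (fromℕ<-toℕ i (toℕ<n i)) (go (toℕ i) (toℕ<n i))
        where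
        go : ∀ k (p : k < size) → Reach _~_ zero (fromℕ< p)
        go zero (s≤s z≤n) = here
        go (suc k) p = go k (<⇒≤ p) ▻ fwd (inj₁ (trans (toℕ-fromℕ< p) (cong suc (sym (toℕ-fromℕ< (<⇒≤ p))))))

      parts-preserved : ∀ (α : Symmetry) v → part (to α v) ≡ part v → ∀ w → part (to α w) ≡ part w
      parts-preserved α v eq w = from-zero (cycle-connected w) (to-zero (cycle-connected v) eq)
        where
        flip-part : ∀ {u v} → u ~ v → part v ≡ opposite (part u)
        flip-part {u} {v} e with part u | part v | proper e
        ... | 0ℙ | 0ℙ | n = ⊥-elim (n refl)
        ... | 0ℙ | 1ℙ | n = refl
        ... | 1ℙ | 0ℙ | n = refl
        ... | 1ℙ | 1ℙ | n = ⊥-elim (n refl)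
        Ok : Fin size → Set
        Ok u = part (to α u) ≡ part u
        forth : ∀ {u v} → u ~ v → Ok u → Ok v
        forth e p = trans (flip-part (to-arc α e)) (trans (cong opposite p) (sym (flip-part e)))
        from-zero : ∀ {u} → Reach _~_ zero u → Ok zero → Ok u
        from-zero here p = p
        from-zero (r ▻ e) p = forth e (from-zero r p)
        to-zero : ∀ {u} → Reach _~_ zero u → Ok u → Ok zero
        to-zero here p = p
        to-zero (r ▻ e) p = to-zero r (forth (BipartiteGraph.~-sym (evenCycle size even) e) p)

      -- The dihedral group is transitive on directed edges. Once two adjacent vertices are placed
      -- the rest is forced, because a vertex has only one neighbour besides a given one.
      cycle-homogeneous : PartHomogeneous (evenCycle size even)
      cycle-homogeneous {I} x y l i₀ reach κ≡ x≡⇒y≡ y≡⇒x≡ x~⇒y~ y~⇒x~ = upgrade (by-edge (dec (∃[ j ] Step i₀ j)))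
        where
        Step : I → I → Set
        Step i j = x i ~ x j ⊎ x j ~ x i
        flip~ : ∀ {u v} → u ~ v → v ~ u
        flip~ = BipartiteGraph.~-sym (evenCycle size even)
        adj : ∀ {i j} → Step i j → x i ~ x j
        adj (inj₁ e) = e
        adj (inj₂ e) = flip~ e
        upgrade : Σ[ α ∈ Symmetry ] (∀ i → to α (x i) ≡ y i) → Σ[ α ∈ Aut part _~_ ] (∀ i → to α (x i) ≡ y i)
        upgrade (α , eq) = record
          { to = to α ; from = from α ; to∘from = to∘from α ; from∘to = from∘to α
          ; to-κ = parts-preserved α (x i₀) (trans (cong part (eq i₀)) (sym (κ≡ i₀)))
          ; to-arc = to-arc α ; to-arc⁻ = to-arc⁻ α } , eq
        first-step : ∀ {k} → Reach Step i₀ k → k ≡ i₀ ⊎ (∃[ j ] Step i₀ j)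
        first-step here = inj₁ refl
        first-step (r ▻ t) with first-step r
        ... | inj₁ refl = inj₂ (_ , t)
        ... | inj₂ s = inj₂ s
        by-edge : Dec (∃[ j ] Step i₀ j) → Σ[ α ∈ Symmetry ] (∀ i → to α (x i) ≡ y i)
        by-edge (no none) with rotation (x i₀) (y i₀)
        ... | α , eq = rotation⇒symmetry α , λ i → only i (first-step (reach i))
          where
          only : ∀ i → i ≡ i₀ ⊎ (∃[ j ] Step i₀ j) → to α (x i) ≡ y i
          only i (inj₁ refl) = eq
          only i (inj₂ s) = contradiction s none
        by-edge (yes (j₀ , t₀)) with edge-symmetry (adj t₀) (x~⇒y~ i₀ j₀ (adj t₀))
        ... | α , eq , eq′ = α , λ i → proj₁ (along (reach i))
          where
          along : ∀ {k} → Reach Step i₀ k → to α (x k) ≡ y k × (∃[ j ] (Step k j × to α (x j) ≡ y j))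
          along here = eq , j₀ , t₀ , eq′
          along (_▻_ {i = k} {k′} r t) with along r
          ... | ek , j , s , ej = image , k , swap t , ek
            where
            image : to α (x k′) ≡ y k′
            image with x k′ ≟ x j
            ... | yes e = trans (cong (to α) e) (trans ej (x≡⇒y≡ j k′ (sym e)))
            ... | no n = two-neighbours {y k} {y j} (x~⇒y~ k j (adj s))
                    (subst (_~ to α (x k′)) ek (to-arc α (adj t))) (x~⇒y~ k k′ (adj t))
                    (λ e → n (to-inj α (trans e (sym ej)))) (λ e → n (y≡⇒x≡ k′ j e))

    listed-homogeneous : ∀ {B} → Listed B → PartHomogeneous B
    listed-homogeneous (Listed.cycle {suc (suc (suc n))} _ even) = cycle-homogeneous even
    listed-homogeneous (Listed.cycle {suc zero} (s≤s ()) _)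
    listed-homogeneous (Listed.cycle {suc (suc zero)} (s≤s (s≤s ())) _)
    listed-homogeneous (Listed.complete p q) = complete-homogeneous p q
    listed-homogeneous (Listed.matching (s≤s _)) = matching-homogeneous (s≤s z≤n)
    listed-homogeneous (Listed.tree semiregular) = tree-homogeneous semiregular

  -- Connectedness, triangles and reachability classes of DL(B)

  module LineDigraph where

    open import Data.List.Relation.Unary.Any using (here; there)
    open Base
    open Homogeneous
    open Trees
    open TreeExtension
    open Reachability
    open BipartiteHomogeneity using (PartHomogeneous)
    open import Defs hiding (edge)

    homogeneity⇒connectedHomogeneous : (D : Digraph) → Homogeneity {Digraph.V D} (λ _ → tt) (Digraph._⟶_ D) → ConnectedHomogeneous D
    homogeneity⇒connectedHomogeneous D hom P Q finP ((r , conP)) finQ conQ f =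
      let (α , eq) = hom {[ v ∈ V ∣ P v ]} value (λ u → value (RelIso.to f u)) listing r
                       (λ u → star⇒reach (λ { (fwd a) → inj₁ a ; (bwd a) → inj₂ a }) (conP r u)) (λ _ → refl)
                       (λ u v eq → cong (value ∘ RelIso.to f) (value-injective eq))
                       (λ u v eq → cong value (↔-injective (RelIso.bijection f) (value-injective eq)))
                       (λ u v a → Equivalence.to (RelIso.edges f) a) (λ u v a → Equivalence.from (RelIso.edges f) a)
      in aut⇒relIso α , eq
      where
      open Digraph D
      listing : Listing {[ v ∈ V ∣ P v ]} (λ _ → ⊤)
      listing = let (xs , c) = listing-refine {P = P} {Q = P} (finite⇒listing finP) in xs , λ {u} _ → c (proofOf u)

    -- It is enough that every point, if not every index, is reached.
    homogeneity-points : {V K : Set} {κ : V → K} {_⟶_ : V → V → Set} → Homogeneity κ _⟶_ →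
      {I : Set} (x y : I → V) → Listing {I} (λ _ → ⊤) → (i₀ : I) →
      (∀ i → ∃[ j ] (x i ≡ x j × Reach (λ i j → x i ⟶ x j ⊎ x j ⟶ x i) i₀ j)) → (∀ i → κ (x i) ≡ κ (y i)) →
      (∀ i j → x i ≡ x j → y i ≡ y j) → (∀ i j → y i ≡ y j → x i ≡ x j) →
      (∀ i j → x i ⟶ x j → y i ⟶ y j) → (∀ i j → y i ⟶ y j → x i ⟶ x j) →
      Σ[ α ∈ Aut κ _⟶_ ] (∀ i → Aut.to α (x i) ≡ y i)
    homogeneity-points {_⟶_ = _⟶_} hom {I} x y l i₀ reach κ≡ x≡⇒y≡ y≡⇒x≡ x⟶⇒y⟶ y⟶⇒x⟶ =
      let (α , eq) = hom {R} (x ∘ value) (y ∘ value) listing (i₀ , [ here ]) (λ u → lift (proofOf u) _) (κ≡ ∘ value)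
                       (λ u v → x≡⇒y≡ _ _) (λ u v → y≡⇒x≡ _ _) (λ u v → x⟶⇒y⟶ _ _) (λ u v → y⟶⇒x⟶ _ _)
      in α , λ i → let (j , e , r) = reach i in trans (cong (Aut.to α) e) (trans (eq (j , [ r ])) (x≡⇒y≡ j i (sym e)))
      where
      Step : I → I → Set
      Step i j = x i ⟶ x j ⊎ x j ⟶ x i
      R : Set
      R = [ i ∈ I ∣ Reach Step i₀ i ]
      listing : Listing {R} (λ _ → ⊤)
      listing = let (xs , c) = listing-refine {Q = Reach Step i₀} l in xs , λ _ → c tt
      lift : ∀ {i} → Reach Step i₀ i → .(p : Reach Step i₀ i) → Reach (λ (u v : R) → Step (value u) (value v)) (i₀ , [ here ]) (i , [ p ])
      lift here p = here
      lift (r ▻ t) p = lift r r ▻ t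

    record WellBehaved (B : BipartiteGraph) : Set₁ where
      open BipartiteGraph B
      field
        homogeneous : PartHomogeneous B
        reachable   : ∀ u v → Reach _~_ u v
        neighbours  : ∀ v → Listing (v ~_)
        u₀ v₀       : V
        u₀~v₀       : u₀ ~ v₀

      neighbour : ∀ v → ∃[ w ] v ~ w
      neighbour v = go (reachable u₀ v)
        where
        go : ∀ {v} → Reach _~_ u₀ v → ∃[ w ] v ~ w
        go here    = v₀ , u₀~v₀
        go (_ ▻ a) = _ , ~-sym a

    module DLTheory {B : BipartiteGraph} (wb : WellBehaved B) (L : LabelledTree B) where
      open BipartiteGraph B using (part; proper; _~_; ~-sym) renaming (V to VB)
      open WellBehaved wb
      open LabelledTree L
      open Digraph T using (_⟶_) renaming (V to Node; irrefl to T-irrefl; antisym to T-antisym)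

      D : Digraph
      D = DL B L

      Edge : Set
      Edge = Arc T

      tl hd : Edge → Node
      tl = tail T
      hd = head T

      _⇒_ : Edge → Edge → Set
      _⇒_ = Digraph._⟶_ D

      tree-arc : (e : Edge) → tl e ⟶ hd e
      tree-arc = ReachabilityClasses.arc-proof T

      asymT : ∀ {s t} → s ⟶ t → ¬ (t ⟶ s)
      asymT a b = T-irrefl (T-antisym a b) a

      tl≢hd : ∀ e → tl e ≢ hd e
      tl≢hd e eq = T-irrefl eq (tree-arc e)

      edge-≡ : ∀ {e f} → tl e ≡ tl f → hd e ≡ hd f → e ≡ f
      edge-≡ = ReachabilityClasses.arc-≡ T

      -- There is a copy of B at each node. An edge of `T` belongs to two of them: it is the
      -- X-vertex `xlab` in the copy at its head and the Y-vertex `ylab` in the copy at its tail.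
      xlab ylab : Edge → VB
      xlab ((a , b) , p) = value (Inverse.to (φ b) (a , p))
      ylab ((a , b) , p) = value (Inverse.to (ψ a) (b , p))

      xlab-part : ∀ e → part (xlab e) ≡ 0ℙ
      xlab-part ((a , b) , p) = proofOf (Inverse.to (φ b) (a , p))

      ylab-part : ∀ e → part (ylab e) ≡ 1ℙ
      ylab-part ((a , b) , p) = proofOf (Inverse.to (ψ a) (b , p))

      xlab-injective : ∀ {e f} → hd e ≡ hd f → xlab e ≡ xlab f → e ≡ f
      xlab-injective {(a , b) , p} {(c , .b) , q} refl eq =
        edge-≡ (cong value (↔-injective (φ b) {a , p} {c , q} (value-injective eq))) refl

      ylab-injective : ∀ {e f} → tl e ≡ tl f → ylab e ≡ ylab f → e ≡ f
      ylab-injective {(a , b) , p} {(.a , d) , q} refl eq =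
        edge-≡ refl (cong value (↔-injective (ψ a) {b , p} {d , q} (value-injective eq)))

      edge-in : ∀ t {v} → part v ≡ 0ℙ → ∃[ e ] (hd e ≡ t × xlab e ≡ v)
      edge-in t {v} p with Inverse.from (φ t) (v , [ p ]) in eq
      ... | a , q = ((a , t) , q) , refl , cong value (trans (cong (Inverse.to (φ t)) (sym eq)) (Inverse.strictlyInverseˡ (φ t) (v , [ p ])))

      edge-out : ∀ t {v} → part v ≡ 1ℙ → ∃[ e ] (tl e ≡ t × ylab e ≡ v)
      edge-out t {v} p with Inverse.from (ψ t) (v , [ p ]) in eq
      ... | b , q = ((t , b) , q) , refl , cong value (trans (cong (Inverse.to (ψ t)) (sym eq)) (Inverse.strictlyInverseˡ (ψ t) (v , [ p ])))

      parts-differ : ∀ {u v} → part u ≡ 0ℙ → part v ≡ 1ℙ → u ≢ v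
      parts-differ p q refl with trans (sym p) q
      ... | ()

      sideB : ∀ v → part v ≡ 0ℙ ⊎ part v ≡ 1ℙ
      sideB v with part v
      ... | 0ℙ = inj₁ refl
      ... | 1ℙ = inj₂ refl

      AdjD : Edge → Edge → Set
      AdjD e f = e ⇒ f ⊎ f ⇒ e

      edge-at : Node → VB → Edge
      edge-at t v with sideB v
      ... | inj₁ p = proj₁ (edge-in t p)
      ... | inj₂ p = proj₁ (edge-out t p)

      edge-at-X : ∀ t {v} → part v ≡ 0ℙ → hd (edge-at t v) ≡ t × xlab (edge-at t v) ≡ v
      edge-at-X t {v} p with sideB v
      ... | inj₁ q = proj₂ (edge-in t q)
      ... | inj₂ q = ⊥-elim (parts-differ p q refl)

      edge-at-Y : ∀ t {v} → part v ≡ 1ℙ → tl (edge-at t v) ≡ t × ylab (edge-at t v) ≡ v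
      edge-at-Y t {v} p with sideB v
      ... | inj₂ q = proj₂ (edge-out t q)
      ... | inj₁ q = ⊥-elim (parts-differ q p refl)

      edge-at-xlab : ∀ e → e ≡ edge-at (hd e) (xlab e)
      edge-at-xlab e = let (p , q) = edge-at-X (hd e) (xlab-part e) in xlab-injective (sym p) (sym q)

      edge-at-ylab : ∀ e → e ≡ edge-at (tl e) (ylab e)
      edge-at-ylab e = let (p , q) = edge-at-Y (tl e) (ylab-part e) in ylab-injective (sym p) (sym q)

      edges-adjacent : ∀ t {u v} → part u ≡ 0ℙ → part v ≡ 1ℙ → u ~ v → edge-at t u ⇒ edge-at t v
      edges-adjacent t p q a = let (h , x) = edge-at-X t p ; (l , y) = edge-at-Y t q
                               in trans h (sym l) , subst₂ _~_ (sym x) (sym y) a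

      edge-parts : ∀ {u v} → u ~ v → (part u ≡ 0ℙ × part v ≡ 1ℙ) ⊎ (part u ≡ 1ℙ × part v ≡ 0ℙ)
      edge-parts {u} {v} a with sideB u | sideB v
      ... | inj₁ p | inj₂ q = inj₁ (p , q)
      ... | inj₂ p | inj₁ q = inj₂ (p , q)
      ... | inj₁ p | inj₁ q = ⊥-elim (proper a (trans p (sym q)))
      ... | inj₂ p | inj₂ q = ⊥-elim (proper a (trans p (sym q)))

      bundle-reach : ∀ t {u v} → Reach _~_ u v → Reach AdjD (edge-at t u) (edge-at t v)
      bundle-reach t = reach-map (edge-at t) λ {u} {v} a → adj a (edge-parts a)
        where
        adj : ∀ {u v} → u ~ v → (part u ≡ 0ℙ × part v ≡ 1ℙ) ⊎ (part u ≡ 1ℙ × part v ≡ 0ℙ) → AdjD (edge-at t u) (edge-at t v)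
        adj a (inj₁ (p , q)) = inj₁ (edges-adjacent t p q a)
        adj a (inj₂ (p , q)) = inj₂ (edges-adjacent t q p (~-sym a))

      At : Edge → Node → Set
      At e t = tl e ≡ t ⊎ hd e ≡ t

      at-label : ∀ {e t} → At e t → ∃[ v ] e ≡ edge-at t v
      at-label {e} (inj₁ refl) = ylab e , edge-at-ylab e
      at-label {e} (inj₂ refl) = xlab e , edge-at-xlab e

      connect-at : ∀ {t e f} → At e t → At f t → Reach AdjD e f
      connect-at {t} p q with at-label p | at-label q
      ... | u , eq | v , eq′ = subst₂ (Reach AdjD) (sym eq) (sym eq′) (bundle-reach t (reachable u v))

      -- The copies of B at adjacent nodes share the edge between these nodes, and each copy is
      -- connected.
      connect : ∀ {s t} → Star (SymClosure _⟶_) s t → ∀ {e f} → At e s → At f t → Reach AdjD e f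
      connect ε p q = connect-at p q
      connect (fwd a ◅ s) p q = reach-trans (connect-at {f = arc T a} p (inj₁ refl)) (connect s (inj₂ refl) q)
      connect (bwd a ◅ s) p q = reach-trans (connect-at {f = arc T a} p (inj₂ refl)) (connect s (inj₁ refl) q)

      T-connected : ∀ s t → Star (SymClosure _⟶_) s t
      T-connected = proj₂ (proj₁ isTree)

      T-acyclic : ¬ Cycle (underlying T)
      T-acyclic = proj₂ isTree

      root : Node
      root = proj₁ (proj₁ isTree)

      DL-reach : ∀ e f → Reach AdjD e f
      DL-reach e f = connect (T-connected (hd e) (hd f)) (inj₂ refl) (inj₂ refl)

      DL-connected : Connected (underlying D)
      DL-connected = edge-at root u₀ , λ e f → reach⇒star′ (λ e → e) (λ { (inj₁ a) → fwd a ; (inj₂ a) → bwd a }) (DL-reach e f)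

      no-directed-triangle : ∀ {a b c} → a ⟶ b → b ⟶ c → ¬ (c ⟶ a)
      no-directed-triangle {a} {b} {c} ab bc ca = not-closed T-acyclic
        (step (fwd ab) (λ { refl → asymT ab bc }) (step (fwd bc) (λ { refl → T-irrefl refl ab }) (pair (fwd ca)))) (there (there (here refl)))
        where open Walks (underlying T)

      -- A transitive triangle would make head and tail of its middle edge equal, and a cyclic one
      -- would be a directed triangle in the tree.
      DL-triangleFree : TriangleFree (underlying D)
      DL-triangleFree {e} {f} {g} = λ { (fwd p) (fwd q) (fwd r) → transitive p q r ; (fwd p) (fwd q) (bwd r) → cyclic p q r
        ; (fwd p) (bwd q) (fwd r) → transitive r q p ; (fwd p) (bwd q) (bwd r) → transitive r p q
        ; (bwd p) (fwd q) (fwd r) → transitive p r q ; (bwd p) (fwd q) (bwd r) → transitive q r p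
        ; (bwd p) (bwd q) (fwd r) → cyclic r q p ; (bwd p) (bwd q) (bwd r) → transitive q p r }
        where
        transitive : ∀ {e f g} → e ⇒ f → f ⇒ g → ¬ (e ⇒ g)
        transitive {e} {f} {g} (p , _) (q , _) (r , _) = tl≢hd f (trans (sym p) (trans r (sym q)))
        cyclic : ∀ {e f g} → e ⇒ f → f ⇒ g → ¬ (g ⇒ e)
        cyclic {e} {f} {g} (p , _) (q , _) (r , _) =
          no-directed-triangle (tree-arc e) (subst (_⟶ hd f) (sym p) (tree-arc f)) (subst₂ _⟶_ (sym q) r (tree-arc g))

      DL-locallyFinite : LocallyFinite D
      DL-locallyFinite e =
        listing⇒finite (listing-image (edge-at (hd e)) (neighbours (xlab e)) λ { {f} (p , a) → ylab f , a , trans (cong (λ t → edge-at t (ylab f)) p) (sym (edge-at-ylab f)) }) ,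
        listing⇒finite (listing-image (edge-at (tl e)) (neighbours (ylab e)) λ { {f} (p , a) → xlab f , ~-sym a , trans (cong (λ t → edge-at t (xlab f)) (sym p)) (sym (edge-at-xlab f)) })

      module DR = ReachabilityClasses D

      module Class (c : Arc D) where

        t : Node
        t = hd (tail D c)

        tail-head : ∀ (g : Arc D) → hd (tail D g) ≡ tl (head D g)
        tail-head g = proj₁ (DR.arc-proof g)

        class-node : ∀ {g} → 𝒜 D c g → hd (tail D g) ≡ t
        class-node = DR.𝒜-induction (λ g → hd (tail D g) ≡ t) refl
          (λ {f} {g} p eq → trans (tail-head g) (trans (cong tl (sym eq)) (trans (sym (tail-head f)) p)))
          (λ {f} {g} p eq → trans (cong hd (sym eq)) p)

        -- With `class-node` this identifies the 𝒜-classes with the copies of B: a walk in B from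
        -- the label of the given arc is turned, edge by edge, into an alternating walk at `t`.
        node-class : ∀ g → hd (tail D g) ≡ t → 𝒜 D c g
        node-class g eq = go (reachable (xlab (tail D c)) (xlab (tail D g))) g eq
          (inj₁ (trans (edge-at-xlab (tail D g)) (cong (λ s → edge-at s (xlab (tail D g))) eq)))
          where
          go : ∀ {v} → Reach _~_ (xlab (tail D c)) v → ∀ g → hd (tail D g) ≡ t → tail D g ≡ edge-at t v ⊎ head D g ≡ edge-at t v → 𝒜 D c g
          go here g eq (inj₁ e) = DR.𝒜-tail DR.𝒜-refl (trans (edge-at-xlab (tail D c)) (sym e))
          go here g eq (inj₂ e) = ⊥-elim (tl≢hd (head D g) (trans (sym (tail-head g)) (trans eq
            (trans (sym (proj₁ (edge-at-X t (xlab-part (tail D c))))) (cong hd (sym e))))))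
          go (_▻_ {i = u} {v} r a) g eq e with edge-parts a
          ... | inj₁ (p , q) = finish e
            where
            h = arc D (edges-adjacent t p q a)
            h∈ : 𝒜 D c h
            h∈ = go r h (proj₁ (edge-at-X t p)) (inj₁ refl)
            finish : tail D g ≡ edge-at t v ⊎ head D g ≡ edge-at t v → 𝒜 D c g
            finish (inj₂ e) = DR.𝒜-head h∈ (sym e)
            finish (inj₁ e) = ⊥-elim (tl≢hd (edge-at t v) (trans (proj₁ (edge-at-Y t q)) (trans (sym eq) (cong hd e))))
          ... | inj₂ (p , q) = finish e
            where
            h = arc D (edges-adjacent t q p (~-sym a))
            h∈ : 𝒜 D c h
            h∈ = go r h (proj₁ (edge-at-X t q)) (inj₂ refl)
            finish : tail D g ≡ edge-at t v ⊎ head D g ≡ edge-at t v → 𝒜 D c g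
            finish (inj₁ e) = DR.𝒜-tail h∈ (sym e)
            finish (inj₂ e) = ⊥-elim (tl≢hd (edge-at t v) (trans (cong tl (sym e)) (trans (sym (tail-head g)) (trans eq (sym (proj₁ (edge-at-X t q)))))))

        Δ : Digraph
        Δ = ⟨𝒜_⟩ D c

        edge-in-class : ∀ v → DR.InClass c (edge-at t v)
        edge-in-class v with neighbour v
        ... | w , a with edge-parts a
        ... | inj₁ (p , q) = arc D (edges-adjacent t p q a) , node-class _ (proj₁ (edge-at-X t p)) , inj₁ refl
        ... | inj₂ (p , q) = arc D (edges-adjacent t q p (~-sym a)) , node-class _ (proj₁ (edge-at-X t q)) , inj₂ refl

        class-label : (f : Digraph.V Δ) → ∃[ v ] value f ≡ edge-at t v
        class-label f with proofOf f
        ... | g , m , inj₁ eq = at-label (inj₂ (trans (cong hd eq) (class-node m)))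
        ... | g , m , inj₂ eq = at-label (inj₁ (trans (cong tl eq) (trans (sym (tail-head g)) (class-node m))))

        edge-at-injective : ∀ {u v} → edge-at t u ≡ edge-at t v → u ≡ v
        edge-at-injective {u} {v} eq with sideB u | sideB v
        ... | inj₁ p | inj₁ q = trans (sym (proj₂ (proj₂ (edge-in t p)))) (trans (cong xlab eq) (proj₂ (proj₂ (edge-in t q))))
        ... | inj₂ p | inj₂ q = trans (sym (proj₂ (proj₂ (edge-out t p)))) (trans (cong ylab eq) (proj₂ (proj₂ (edge-out t q))))
        ... | inj₁ p | inj₂ q = ⊥-elim (tl≢hd (proj₁ (edge-out t q)) (trans (proj₁ (proj₂ (edge-out t q))) (trans (sym (proj₁ (proj₂ (edge-in t p)))) (cong hd eq))))
        ... | inj₂ p | inj₁ q = ⊥-elim (tl≢hd (proj₁ (edge-out t p)) (trans (proj₁ (proj₂ (edge-out t p))) (trans (sym (proj₁ (proj₂ (edge-in t q)))) (cong hd (sym eq)))))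

        arc-labels : ∀ {u v} → edge-at t u ⇒ edge-at t v → hd (edge-at t u) ≡ t → u ~ v
        arc-labels {u} {v} (m , a) h with sideB u | sideB v
        ... | inj₁ p | inj₂ q = subst₂ _~_ (proj₂ (proj₂ (edge-in t p))) (proj₂ (proj₂ (edge-out t q))) a
        ... | inj₁ p | inj₁ q = ⊥-elim (tl≢hd (proj₁ (edge-in t q)) (trans (trans (sym m) h) (sym (proj₁ (proj₂ (edge-in t q))))))
        ... | inj₂ p | _ = ⊥-elim (tl≢hd (proj₁ (edge-out t p)) (trans (proj₁ (proj₂ (edge-out t p))) (sym h)))

        classIso : RelIso (SymClosure (Digraph._⟶_ Δ)) _~_
        classIso = record
          { bijection = mk↔ₛ′ label (λ v → edge-at t v , [ edge-in-class v ])
              (λ v → edge-at-injective (sym (label-≡ (edge-at t v , [ edge-in-class v ]))))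
              (λ f → value-injective (sym (label-≡ f)))
          ; edges = λ {f} {g} → mk⇔ (forth {f} {g}) (back {f} {g}) }
          where
          label : Digraph.V Δ → VB
          label f = proj₁ (class-label f)
          label-≡ : ∀ f → value f ≡ edge-at t (label f)
          label-≡ f = proj₂ (class-label f)
          arc-forth : ∀ {f g} → Digraph._⟶_ Δ f g → label f ~ label g
          arc-forth {f} {g} (a , m) = arc-labels (subst₂ _⇒_ (label-≡ f) (label-≡ g) a) (trans (cong hd (sym (label-≡ f))) (class-node m))
          arc-back : ∀ {f g} → part (label f) ≡ 0ℙ → part (label g) ≡ 1ℙ → label f ~ label g → Digraph._⟶_ Δ f g
          arc-back {f} {g} p q a = let b = subst₂ _⇒_ (sym (label-≡ f)) (sym (label-≡ g)) (edges-adjacent t p q a)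
                                   in b , node-class (arc D b) (trans (cong hd (label-≡ f)) (proj₁ (edge-at-X t p)))
          forth : ∀ {f g} → SymClosure (Digraph._⟶_ Δ) f g → label f ~ label g
          forth {f} {g} (fwd a) = arc-forth {f} {g} a
          forth {f} {g} (bwd a) = ~-sym (arc-forth {g} {f} a)
          back : ∀ {f g} → label f ~ label g → SymClosure (Digraph._⟶_ Δ) f g
          back {f} {g} a with edge-parts a
          ... | inj₁ (p , q) = fwd (arc-back {f} {g} p q a)
          ... | inj₂ (p , q) = bwd (arc-back {g} {f} q p (~-sym a))

      ΔB : ΔIsomorphicTo D B
      ΔB = some-arc (edge-parts u₀~v₀) , λ c → Class.classIso c
        where
        some-arc : (part u₀ ≡ 0ℙ × part v₀ ≡ 1ℙ) ⊎ (part u₀ ≡ 1ℙ × part v₀ ≡ 0ℙ) → Arc D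
        some-arc (inj₁ (p , q)) = arc D (edges-adjacent root p q u₀~v₀)
        some-arc (inj₂ (p , q)) = arc D (edges-adjacent root q p (~-sym u₀~v₀))

  -- Extension of partial isomorphisms of DL(B)

  module LineHomogeneity where

    open import Data.List.Relation.Unary.Any using (here; there)
    open import Data.List.Properties using (∷-injectiveʳ)
    open Base
    open Homogeneous
    open Trees
    open TreeExtension
    open Reachability
    open LineDigraph
    open import Defs using (BipartiteGraph; LabelledTree; Digraph; underlying; arc; Graph; ConnectedHomogeneous)

    module _ {B : BipartiteGraph} (wb : WellBehaved B) (L : LabelledTree B) where
      open DLTheory wb L
      open WellBehaved wb
      open BipartiteGraph B using (part; proper; _~_; ~-sym) renaming (V to VB)
      open LabelledTree L using (T; isTree)
      open Digraph T using (_⟶_) renaming (V to Node)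

      BAut : Set
      BAut = Aut part _~_

      GT : Graph
      GT = underlying T

      module PartialIsomorphism {I : Set} (x y : I → Edge) (l : Listing {I} (λ _ → ⊤)) (i₀ : I)
        (reach : ∀ i → Reach (λ i j → AdjD (x i) (x j)) i₀ i)
        (x≡⇒y≡ : ∀ i j → x i ≡ x j → y i ≡ y j) (y≡⇒x≡ : ∀ i j → y i ≡ y j → x i ≡ x j)
        (x⇒y : ∀ i j → x i ⇒ x j → y i ⇒ y j) (y⇒x : ∀ i j → y i ⇒ y j → x i ⇒ x j) where

        Step : I → I → Set
        Step i j = AdjD (x i) (x j)

        LocalMap : Node → Node → BAut → Set
        LocalMap t t′ β = ∀ i → (tl (x i) ≡ t → tl (y i) ≡ t′ × ylab (y i) ≡ Aut.to β (ylab (x i))) ×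
                                (hd (x i) ≡ t → hd (y i) ≡ t′ × xlab (y i) ≡ Aut.to β (xlab (x i)))

        -- The edges x i at one node t form a connected subgraph of B, which is mapped into the bundle of one node.
        module Bundle (t : Node) (i₁ : I) (at₁ : At (x i₁) t) where
          open Rooted (tree⇒rooted {GT} isTree t)

          -- The vertex of the copy of B at `t` that the edge represents, depending on whether it
          -- leaves or enters `t`, and the label of its image in the same role. For edges away from
          -- `t` the values are arbitrary.
          lab lab′ : I → VB
          lab i with dec (tl (x i) ≡ t)
          ... | yes _ = ylab (x i)
          ... | no _  = xlab (x i)
          lab′ i with dec (tl (x i) ≡ t)
          ... | yes _ = ylab (y i)
          ... | no _  = xlab (y i)

          img : I → Node
          img i with dec (tl (x i) ≡ t)
          ... | yes _ = tl (y i)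
          ... | no _  = hd (y i)

          -- These record the outcome of the decision inside `lab`, `lab′` and `img` as equations,
          -- so that the decision is inspected only once.
          Out In : I → Set
          Out i = tl (x i) ≡ t × lab i ≡ ylab (x i) × lab′ i ≡ ylab (y i) × img i ≡ tl (y i)
          In i  = hd (x i) ≡ t × lab i ≡ xlab (x i) × lab′ i ≡ xlab (y i) × img i ≡ hd (y i)

          direction : ∀ i → At (x i) t → Out i ⊎ In i
          direction i p with dec (tl (x i) ≡ t)
          direction i p | yes q = inj₁ (q , refl , refl , refl)
          direction i (inj₁ q) | no n = contradiction q n
          direction i (inj₂ q) | no n = inj₂ (q , refl , refl , refl)

          out-in : ∀ {i j} → Out i → In j → x i ≢ x j
          out-in {i} (p , _) (q , _) eq = tl≢hd (x i) (trans p (trans (sym q) (cong hd (sym eq))))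

          same-point : ∀ {i j} → At (x i) t → At (x j) t → lab i ≡ lab j → x i ≡ x j
          same-point {i} {j} p q eq with direction i p | direction j q
          ... | inj₁ (a , b , _) | inj₁ (c , d , _) = ylab-injective (trans a (sym c)) (trans (sym b) (trans eq d))
          ... | inj₂ (a , b , _) | inj₂ (c , d , _) = xlab-injective (trans a (sym c)) (trans (sym b) (trans eq d))
          ... | inj₁ (a , b , _) | inj₂ (c , d , _) = ⊥-elim (parts-differ (xlab-part (x j)) (ylab-part (x i)) (trans (sym d) (trans (sym eq) b)))
          ... | inj₂ (a , b , _) | inj₁ (c , d , _) = ⊥-elim (parts-differ (xlab-part (x i)) (ylab-part (x j)) (trans (sym b) (trans eq d)))

          same-labels : ∀ {i j} → At (x i) t → At (x j) t → x i ≡ x j → lab i ≡ lab j × lab′ i ≡ lab′ j × img i ≡ img j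
          same-labels {i} {j} p q eq with direction i p | direction j q | x≡⇒y≡ i j eq
          ... | inj₁ (_ , a , b , c) | inj₁ (_ , a′ , b′ , c′) | eq′ =
            trans a (trans (cong ylab eq) (sym a′)) , trans b (trans (cong ylab eq′) (sym b′)) , trans c (trans (cong tl eq′) (sym c′))
          ... | inj₂ (_ , a , b , c) | inj₂ (_ , a′ , b′ , c′) | eq′ =
            trans a (trans (cong xlab eq) (sym a′)) , trans b (trans (cong xlab eq′) (sym b′)) , trans c (trans (cong hd eq′) (sym c′))
          ... | inj₁ o | inj₂ n | _ = ⊥-elim (out-in o n eq)
          ... | inj₂ n | inj₁ o | _ = ⊥-elim (out-in o n (sym eq))

          labels-adjacent : ∀ {i j} → At (x i) t → At (x j) t → x i ⇒ x j → lab i ~ lab j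
          labels-adjacent {i} {j} p q (m , a) with direction i p | direction j q
          ... | inj₂ (_ , b , _) | inj₁ (_ , c , _) = subst₂ _~_ (sym b) (sym c) a
          ... | inj₁ (b , _) | inj₁ (c , _) = ⊥-elim (tl≢hd (x i) (trans b (trans (sym c) (sym m))))
          ... | inj₂ (b , _) | inj₂ (c , _) = ⊥-elim (tl≢hd (x j) (trans (sym m) (trans b (sym c))))
          ... | inj₁ (b , _) | inj₂ (c , _) = ⊥-elim (asymT (tree-arc (x i)) (subst₂ _⟶_ (sym m) (trans c (sym b)) (tree-arc (x j))))

          adjacent-labels : ∀ {i j} → At (x i) t → At (x j) t → lab i ~ lab j →
            (In i × Out j × x i ⇒ x j) ⊎ (Out i × In j × x j ⇒ x i)
          adjacent-labels {i} {j} p q a with direction i p | direction j q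
          ... | inj₁ (_ , b , _) | inj₁ (_ , c , _) = ⊥-elim (proper (subst₂ _~_ b c a) (trans (ylab-part (x i)) (sym (ylab-part (x j)))))
          ... | inj₂ (_ , b , _) | inj₂ (_ , c , _) = ⊥-elim (proper (subst₂ _~_ b c a) (trans (xlab-part (x i)) (sym (xlab-part (x j)))))
          ... | inj₂ n@(b , c , _) | inj₁ o@(d , e , _) = inj₁ (n , o , trans b (sym d) , subst₂ _~_ c e a)
          ... | inj₁ o@(b , c , _) | inj₂ n@(d , e , _) = inj₂ (o , n , trans d (sym b) , subst₂ _~_ e c (~-sym a))

          It : Set
          It = [ i ∈ I ∣ At (x i) t ]

          at : (i : It) → At (x (value i)) t
          at = proofOf

          StepB : It → It → Set
          StepB i j = lab (value i) ~ lab (value j) ⊎ lab (value j) ~ lab (value i)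

          start : It
          start = i₁ , [ at₁ ]

          Other : Edge → Node → Set
          Other e o = (tl e ≡ t × hd e ≡ o) ⊎ (hd e ≡ t × tl e ≡ o)

          End : Edge → Node → Set
          End e z = z ≡ tl e ⊎ z ≡ hd e

          other : ∀ e → At e t → ∃[ o ] Other e o
          other e (inj₁ p) = hd e , inj₁ (p , refl)
          other e (inj₂ p) = tl e , inj₂ (p , refl)

          other≢ : ∀ e {o} → Other e o → o ≢ t
          other≢ e (inj₁ (p , q)) r = tl≢hd e (trans p (sym (trans q r)))
          other≢ e (inj₂ (p , q)) r = tl≢hd e (trans (trans q r) (sym p))

          other-edge : ∀ e {o} → Other e o → Graph._~_ GT o t
          other-edge e (inj₁ (p , q)) = bwd (subst₂ _⟶_ p q (tree-arc e))
          other-edge e (inj₂ (p , q)) = fwd (subst₂ _⟶_ q p (tree-arc e))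

          other-unique : ∀ e f {o} → Other e o → Other f o → e ≡ f
          other-unique e f (inj₁ (a , b)) (inj₁ (c , d)) = edge-≡ (trans a (sym c)) (trans b (sym d))
          other-unique e f (inj₂ (a , b)) (inj₂ (c , d)) = edge-≡ (trans b (sym d)) (trans a (sym c))
          other-unique e f (inj₁ (a , b)) (inj₂ (c , d)) =
            ⊥-elim (asymT (tree-arc e) (subst₂ _⟶_ (trans d (sym b)) (trans c (sym a)) (tree-arc f)))
          other-unique e f (inj₂ (a , b)) (inj₁ (c , d)) =
            ⊥-elim (asymT (tree-arc e) (subst₂ _⟶_ (trans c (sym a)) (trans d (sym b)) (tree-arc f)))

          other-end : ∀ e {o} → Other e o → End e o
          other-end e (inj₁ (_ , q)) = inj₂ (sym q)
          other-end e (inj₂ (_ , q)) = inj₁ (sym q)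

          ends : ∀ e {o z} → Other e o → End e z → z ≡ t ⊎ z ≡ o
          ends e (inj₁ (p , q)) (inj₁ r) = inj₁ (trans r p)
          ends e (inj₁ (p , q)) (inj₂ r) = inj₂ (trans r q)
          ends e (inj₂ (p , q)) (inj₁ r) = inj₂ (trans r q)
          ends e (inj₂ (p , q)) (inj₂ r) = inj₁ (trans r p)

          path-neighbour : ∀ {o} → Graph._~_ GT o t → path o ≡ o ∷ t ∷ []
          path-neighbour {o} a with path-edge a
          ... | inj₁ eq = trans eq (cong (o ∷_) path-root)
          ... | inj₂ eq with path-head o
          ...   | l , eq′ with trans (sym path-root) (trans eq (cong (t ∷_) eq′))
          ...     | ()

          -- While walking through the edges x k, remember the last edge at t, behind which the walk is.
          record Invariant (k : I) : Set where
            field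
              last    : It
              linked  : Reach StepB start last
              beyond  : Node
              is-last : Other (x (value last)) beyond
              behind  : ∀ z → End (x k) z → z ≡ t ⊎ beyond ∈ path z

          -- The end of `x k` other than `t` is a neighbour of `t` and lies behind `beyond`, so it
          -- is `beyond`; two edges with the same ends in a tree are equal.
          at-start : ∀ k → At (x k) t → (inv : Invariant k) → x k ≡ x (value (Invariant.last inv))
          at-start k p inv = conclude (behind u (other-end (x k) oth))
            where
            open Invariant inv
            u = proj₁ (other (x k) p)
            oth = proj₂ (other (x k) p)
            conclude : u ≡ t ⊎ beyond ∈ path u → x k ≡ x (value last)
            conclude (inj₁ eq) = ⊥-elim (other≢ (x k) oth eq)
            conclude (inj₂ m) with subst (beyond ∈_) (path-neighbour (other-edge (x k) oth)) m
            ... | here eq = other-unique (x k) (x (value last)) oth (subst (Other (x (value last))) eq is-last)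
            ... | there (here eq) = ⊥-elim (other≢ (x (value last)) is-last eq)

          initial : ∀ k (p : At (x k) t) → Reach StepB start (k , [ p ]) → Invariant k
          initial k p r = record
            { last = k , [ p ] ; linked = r ; beyond = o ; is-last = oth ; behind = λ z e → near (ends (x k) oth e) }
            where
            o = proj₁ (other (x k) p)
            oth = proj₂ (other (x k) p)
            near : ∀ {z} → z ≡ t ⊎ z ≡ o → z ≡ t ⊎ o ∈ path z
            near (inj₁ eq) = inj₁ eq
            near (inj₂ eq) = inj₂ (subst (λ z → o ∈ path z) (sym eq) (path-self o))

          At-of : ∀ e {s} → End e s → s ≡ t → At e t
          At-of e (inj₁ p) q = inj₁ (trans (sym p) q)
          At-of e (inj₂ p) q = inj₂ (trans (sym p) q)

          advance : ∀ k k′ s → End (x k) s → End (x k′) s → Step k k′ → Invariant k → Invariant k′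
          advance k k′ s e e′ adj inv = by-node (dec (s ≡ t))
            where
            open Invariant inv
            by-node : Dec (s ≡ t) → Invariant k′
            by-node (yes eq) = initial k′ p′ (linked ▻ stepB (subst (λ f → AdjD f (x k′)) (at-start k (At-of (x k) e eq) inv) adj))
              where
              p′ = At-of (x k′) e′ eq
              stepB : AdjD (x (value last)) (x k′) → StepB last (k′ , [ p′ ])
              stepB (inj₁ a) = inj₁ (labels-adjacent {value last} {k′} (at last) p′ a)
              stepB (inj₂ a) = inj₂ (labels-adjacent {k′} {value last} p′ (at last) a)
            by-node (no n) = record { last = last ; linked = linked ; beyond = beyond ; is-last = is-last ; behind = λ z → onward z e′ }
              where
              beyond∈s : beyond ∈ path s
              beyond∈s with behind s e
              ... | inj₁ eq = contradiction eq n
              ... | inj₂ m = m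
              along : ∀ z → Graph._~_ GT s z → z ≡ t ⊎ beyond ∈ path z
              along z a with path-edge a
              ... | inj₂ eq = inj₂ (subst (beyond ∈_) (sym eq) (there beyond∈s))
              ... | inj₁ eq with subst (beyond ∈_) eq beyond∈s
              ...   | there m = inj₂ m
              ...   | here eq′ = inj₁ (path-injective (trans (∷-injectiveʳ (trans (sym eq) (path-neighbour (subst (λ v → Graph._~_ GT v t) eq′ (other-edge (x (value last)) is-last))))) (sym path-root)))
              onward : ∀ z → End (x k′) s → End (x k′) z → z ≡ t ⊎ beyond ∈ path z
              onward z (inj₁ p) (inj₁ q) = inj₂ (subst (λ v → beyond ∈ path v) (trans p (sym q)) beyond∈s)
              onward z (inj₂ p) (inj₂ q) = inj₂ (subst (λ v → beyond ∈ path v) (trans p (sym q)) beyond∈s)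
              onward z (inj₁ p) (inj₂ q) = along z (fwd (subst₂ _⟶_ (sym p) (sym q) (tree-arc (x k′))))
              onward z (inj₂ p) (inj₁ q) = along z (bwd (subst₂ _⟶_ (sym q) (sym p) (tree-arc (x k′))))

          invariant : ∀ k → Invariant k
          invariant k = go (reach-trans (reach-sym swap (reach i₁)) (reach k))
            where
            go : ∀ {k} → Reach Step i₁ k → Invariant k
            go here = initial i₁ at₁ here
            go (_▻_ {i} {j} r (inj₁ a)) = advance i j (hd (x i)) (inj₂ refl) (inj₁ (proj₁ a)) (inj₁ a) (go r)
            go (_▻_ {i} {j} r (inj₂ a)) = advance i j (tl (x i)) (inj₁ refl) (inj₂ (sym (proj₁ a))) (inj₂ a) (go r)

          -- A walk that leaves `t` through an edge returns through the same edge, so cutting out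
          -- excursions leaves a walk inside the copy of B at `t`. It reaches the same point, though
          -- possibly under another index.
          reached : ∀ (i : It) → Σ[ j ∈ It ] (x (value i) ≡ x (value j) × Reach StepB start j)
          reached i = Invariant.last inv , at-start (value i) (at i) inv , Invariant.linked inv
            where
            inv = invariant (value i)

          image-constant : ∀ (i : It) → img (value i) ≡ img i₁
          image-constant i with reached i
          ... | j , eq , r = trans (proj₂ (proj₂ (same-labels (at i) (at j) eq))) (along r)
            where
            step : ∀ {i j : It} → lab (value i) ~ lab (value j) → img (value i) ≡ img (value j)
            step {i} {j} a with adjacent-labels (at i) (at j) a
            ... | inj₁ ((_ , _ , _ , p) , (_ , _ , _ , q) , b) = trans p (trans (proj₁ (x⇒y _ _ b)) (sym q))
            ... | inj₂ ((_ , _ , _ , p) , (_ , _ , _ , q) , b) = trans p (trans (sym (proj₁ (x⇒y _ _ b))) (sym q))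
            along : ∀ {j} → Reach StepB start j → img (value j) ≡ img i₁
            along here = refl
            along (_▻_ {i} {j} r (inj₁ a)) = trans (sym (step {i} {j} a)) (along r)
            along (_▻_ {i} {j} r (inj₂ a)) = trans (step {j} {i} a) (along r)

          same-image : ∀ {i j : It} → lab′ (value i) ≡ lab′ (value j) → y (value i) ≡ y (value j)
          same-image {i} {j} eq with direction (value i) (at i) | direction (value j) (at j) | trans (image-constant i) (sym (image-constant j))
          ... | inj₁ (_ , _ , b , c) | inj₁ (_ , _ , b′ , c′) | eq′ = ylab-injective (trans (sym c) (trans eq′ c′)) (trans (sym b) (trans eq b′))
          ... | inj₂ (_ , _ , b , c) | inj₂ (_ , _ , b′ , c′) | eq′ = xlab-injective (trans (sym c) (trans eq′ c′)) (trans (sym b) (trans eq b′))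
          ... | inj₁ (_ , _ , b , _) | inj₂ (_ , _ , b′ , _) | _ = ⊥-elim (parts-differ (xlab-part _) (ylab-part _) (trans (sym b′) (trans (sym eq) b)))
          ... | inj₂ (_ , _ , b , _) | inj₁ (_ , _ , b′ , _) | _ = ⊥-elim (parts-differ (xlab-part _) (ylab-part _) (trans (sym b) (trans eq b′)))

          image-adjacent : ∀ {i j : It} → lab (value i) ~ lab (value j) → lab′ (value i) ~ lab′ (value j)
          image-adjacent {i} {j} a with adjacent-labels (at i) (at j) a
          ... | inj₁ ((_ , _ , p , _) , (_ , _ , q , _) , b) = subst₂ _~_ (sym p) (sym q) (proj₂ (x⇒y _ _ b))
          ... | inj₂ ((_ , _ , p , _) , (_ , _ , q , _) , b) = subst₂ _~_ (sym p) (sym q) (~-sym (proj₂ (x⇒y _ _ b)))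

          adjacent-image : ∀ {i j : It} → lab′ (value i) ~ lab′ (value j) → lab (value i) ~ lab (value j)
          adjacent-image {i} {j} a with direction (value i) (at i) | direction (value j) (at j) | trans (image-constant i) (sym (image-constant j))
          ... | inj₁ (_ , _ , b , _) | inj₁ (_ , _ , b′ , _) | _ = ⊥-elim (proper (subst₂ _~_ b b′ a) (trans (ylab-part _) (sym (ylab-part _))))
          ... | inj₂ (_ , _ , b , _) | inj₂ (_ , _ , b′ , _) | _ = ⊥-elim (proper (subst₂ _~_ b b′ a) (trans (xlab-part _) (sym (xlab-part _))))
          ... | inj₂ (_ , p , b , c) | inj₁ (_ , p′ , b′ , c′) | eq =
            subst₂ _~_ (sym p) (sym p′) (proj₂ (y⇒x _ _ (trans (sym c) (trans eq c′) , subst₂ _~_ b b′ a)))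
          ... | inj₁ (_ , p , b , c) | inj₂ (_ , p′ , b′ , c′) | eq =
            subst₂ _~_ (sym p) (sym p′) (~-sym (proj₂ (y⇒x _ _ (trans (sym c′) (trans (sym eq) c) , subst₂ _~_ b′ b (~-sym a)))))

          same-parts : ∀ (i : It) → part (lab (value i)) ≡ part (lab′ (value i))
          same-parts i with direction (value i) (at i)
          ... | inj₁ (_ , p , q , _) = trans (cong part p) (trans (trans (ylab-part _) (sym (ylab-part _))) (cong part (sym q)))
          ... | inj₂ (_ , p , q , _) = trans (cong part p) (trans (trans (xlab-part _) (sym (xlab-part _))) (cong part (sym q)))

          listing-It : Listing {It} (λ _ → ⊤)
          listing-It = let (xs , c) = listing-refine {Q = λ i → At (x i) t} l in xs , λ _ → c tt

          equal-images : ∀ (i j : It) → lab (value i) ≡ lab (value j) → lab′ (value i) ≡ lab′ (value j)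
          equal-images i j eq = proj₁ (proj₂ (same-labels {value i} {value j} (at i) (at j) (same-point {value i} {value j} (at i) (at j) eq)))

          equal-labels : ∀ (i j : It) → lab′ (value i) ≡ lab′ (value j) → lab (value i) ≡ lab (value j)
          equal-labels i j eq = proj₁ (same-labels {value i} {value j} (at i) (at j) (y≡⇒x≡ (value i) (value j) (same-image {i} {j} eq)))

          all-reached : ∀ (i : It) → Σ[ j ∈ It ] (lab (value i) ≡ lab (value j) × Reach StepB start j)
          all-reached i = let (j , eq , r) = reached i in j , proj₁ (same-labels {value i} {value j} (at i) (at j) eq) , r

          automorphism : Σ[ β ∈ BAut ] (∀ (i : It) → Aut.to β (lab (value i)) ≡ lab′ (value i))
          automorphism = homogeneity-points {κ = part} {_⟶_ = _~_} homogeneous {It} (λ i → lab (value i)) (λ i → lab′ (value i)) listing-It start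
            all-reached same-parts equal-images equal-labels (λ i j → image-adjacent {i} {j}) (λ i j → adjacent-image {i} {j})

          localMap : ∃[ t′ ] ∃[ β ] LocalMap t t′ β
          localMap = build automorphism
            where
            build : Σ[ β ∈ BAut ] (∀ (i : It) → Aut.to β (lab (value i)) ≡ lab′ (value i)) → ∃[ t′ ] ∃[ β ] LocalMap t t′ β
            build (β , eq) = img i₁ , β , λ i → out i , inn i
              where
              out : ∀ i → tl (x i) ≡ t → tl (y i) ≡ img i₁ × ylab (y i) ≡ Aut.to β (ylab (x i))
              out i p = by (direction i (inj₁ p))
                where
                by : Out i ⊎ In i → tl (y i) ≡ img i₁ × ylab (y i) ≡ Aut.to β (ylab (x i))
                by (inj₁ (_ , a , b , c)) = trans (sym c) (image-constant (i , [ inj₁ p ])) ,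
                  trans (sym b) (trans (sym (eq (i , [ inj₁ p ]))) (cong (Aut.to β) a))
                by (inj₂ (q , _)) = ⊥-elim (tl≢hd (x i) (trans p (sym q)))
              inn : ∀ i → hd (x i) ≡ t → hd (y i) ≡ img i₁ × xlab (y i) ≡ Aut.to β (xlab (x i))
              inn i p = by (direction i (inj₂ p))
                where
                by : Out i ⊎ In i → hd (y i) ≡ img i₁ × xlab (y i) ≡ Aut.to β (xlab (x i))
                by (inj₂ (_ , a , b , c)) = trans (sym c) (image-constant (i , [ inj₂ p ])) ,
                  trans (sym b) (trans (sym (eq (i , [ inj₂ p ]))) (cong (Aut.to β) a))
                by (inj₁ (q , _)) = ⊥-elim (tl≢hd (x i) (trans q (sym p)))

        -- The local map `γ` is induced by an automorphism `β` of B, read through the labels at both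
        -- nodes; `LocalMap` makes it agree with the given partial isomorphism.
        Allowed : Node → Node → (Node → Node) → Set
        Allowed t t′ γ = Σ[ β ∈ BAut ]
          ((∀ e → tl e ≡ t → ∃[ f ] (tl f ≡ t′ × hd f ≡ γ (hd e) × ylab f ≡ Aut.to β (ylab e))) ×
           (∀ e → hd e ≡ t → ∃[ f ] (hd f ≡ t′ × tl f ≡ γ (tl e) × xlab f ≡ Aut.to β (xlab e))) ×
           LocalMap t t′ β)

        -- The neighbours of a node correspond to the vertices of B, so `β` determines `γ`. The last
        -- equation lets the caller recover the automorphism it supplied.
        allowed-from : ∀ t t′ (β : BAut) → LocalMap t t′ β → ∃[ γ ] Σ[ al ∈ Allowed t t′ γ ] proj₁ al ≡ β
        allowed-from t t′ β lm = proj₁ γ-choice , (β ,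
          (λ e p → proj₁ (proj₂ γ-choice (hd e) (subst (λ s → Graph._~_ GT s (hd e)) p (fwd (tree-arc e)))) e p refl) ,
          (λ e p → proj₂ (proj₂ γ-choice (tl e) (subst (λ s → Graph._~_ GT s (tl e)) p (bwd (tree-arc e)))) e p refl) , lm) , refl
          where
          Good : Node → Node → Set
          Good u z = (∀ e → tl e ≡ t → hd e ≡ u → ∃[ f ] (tl f ≡ t′ × hd f ≡ z × ylab f ≡ Aut.to β (ylab e))) ×
                     (∀ e → hd e ≡ t → tl e ≡ u → ∃[ f ] (hd f ≡ t′ × tl f ≡ z × xlab f ≡ Aut.to β (xlab e)))
          good : ∀ u → Graph._~_ GT t u → ∃[ z ] Good u z
          good u (fwd a) =
            let e₀ = arc T a ; (f , p , q) = edge-out t′ (trans (Aut.to-κ β (ylab e₀)) (ylab-part e₀))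
            in hd f , (λ e r s → f , p , refl , trans q (cong (Aut.to β ∘ ylab) (edge-≡ (sym r) (sym s)))) ,
                      (λ e r s → ⊥-elim (asymT a (subst₂ _⟶_ s r (tree-arc e))))
          good u (bwd a) =
            let e₀ = arc T a ; (f , p , q) = edge-in t′ (trans (Aut.to-κ β (xlab e₀)) (xlab-part e₀))
            in tl f , (λ e r s → ⊥-elim (asymT a (subst₂ _⟶_ r s (tree-arc e)))) ,
                      (λ e r s → f , p , refl , trans q (cong (Aut.to β ∘ xlab) (edge-≡ (sym s) (sym r))))
          γ-choice : Σ[ γ ∈ (Node → Node) ] (∀ u → Graph._~_ GT t u → Good u (γ u))
          γ-choice = choose {Q = Good} good t

        module AllowedProperties {t t′ γ} (al : Allowed t t′ γ) where
          β : BAut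
          β = proj₁ al
          outs : ∀ e → tl e ≡ t → ∃[ f ] (tl f ≡ t′ × hd f ≡ γ (hd e) × ylab f ≡ Aut.to β (ylab e))
          outs = proj₁ (proj₂ al)
          ins : ∀ e → hd e ≡ t → ∃[ f ] (hd f ≡ t′ × tl f ≡ γ (tl e) × xlab f ≡ Aut.to β (xlab e))
          ins = proj₁ (proj₂ (proj₂ al))
          localM : LocalMap t t′ β
          localM = proj₂ (proj₂ (proj₂ al))

          out-agrees : ∀ i → tl (x i) ≡ t → tl (y i) ≡ t′ × hd (y i) ≡ γ (hd (x i))
          out-agrees i p with outs (x i) p | proj₁ (localM i) p
          ... | f , q , r , s | q′ , s′ = q′ , trans (cong hd (ylab-injective (trans q′ (sym q)) (trans s′ (sym s)))) r

          in-agrees : ∀ i → hd (x i) ≡ t → hd (y i) ≡ t′ × tl (y i) ≡ γ (tl (x i))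
          in-agrees i p with ins (x i) p | proj₂ (localM i) p
          ... | f , q , r , s | q′ , s′ = q′ , trans (cong tl (xlab-injective (trans q′ (sym q)) (trans s′ (sym s)))) r

          arc-out : ∀ {u} → t ⟶ u → t′ ⟶ γ u
          arc-out a = let (f , p , q , _) = outs (arc T a) refl in subst₂ _⟶_ p q (tree-arc f)

          arc-in : ∀ {u} → u ⟶ t → γ u ⟶ t′
          arc-in a = let (f , p , q , _) = ins (arc T a) refl in subst₂ _⟶_ q p (tree-arc f)

          bijection : BijectionOn (Graph._~_ GT t) (Graph._~_ GT t′) γ
          bijection = record { maps = maps ; injective = injective ; surjective = surjective }
            where
            maps : ∀ {u} → Graph._~_ GT t u → Graph._~_ GT t′ (γ u)
            maps (fwd a) = fwd (arc-out a)
            maps (bwd a) = bwd (arc-in a)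
            injective : ∀ {u w} → Graph._~_ GT t u → Graph._~_ GT t w → γ u ≡ γ w → u ≡ w
            injective (fwd a) (fwd b) eq with outs (arc T a) refl | outs (arc T b) refl
            ... | f , p , q , r | f′ , p′ , q′ , r′ = cong hd (ylab-injective {arc T a} {arc T b} refl (Aut.to-inj β
              (trans (sym r) (trans (cong ylab (edge-≡ {f} {f′} (trans p (sym p′)) (trans q (trans eq (sym q′))))) r′))))
            injective (bwd a) (bwd b) eq with ins (arc T a) refl | ins (arc T b) refl
            ... | f , p , q , r | f′ , p′ , q′ , r′ = cong tl (xlab-injective {arc T a} {arc T b} refl (Aut.to-inj β
              (trans (sym r) (trans (cong xlab (edge-≡ {f} {f′} (trans q (trans eq (sym q′))) (trans p (sym p′)))) r′))))
            injective (fwd a) (bwd b) eq = ⊥-elim (asymT (arc-out a) (subst (_⟶ t′) (sym eq) (arc-in b)))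
            injective (bwd a) (fwd b) eq = ⊥-elim (asymT (arc-out b) (subst (_⟶ t′) eq (arc-in a)))
            surjective : ∀ {z} → Graph._~_ GT t′ z → ∃[ u ] (Graph._~_ GT t u × γ u ≡ z)
            surjective (fwd a) with edge-out t {Aut.from β (ylab (arc T a))} (trans (Aut.to-κ (inverse β) _) (ylab-part (arc T a)))
            ... | e , refl , q with outs e refl
            ...   | f , p , r , s = hd e , fwd (tree-arc e) , trans (sym r) (cong hd (ylab-injective {f} {arc T a} p
                      (trans s (trans (cong (Aut.to β) q) (Aut.to∘from β (ylab (arc T a)))))))
            surjective (bwd a) with edge-in t {Aut.from β (xlab (arc T a))} (trans (Aut.to-κ (inverse β) _) (xlab-part (arc T a)))
            ... | e , refl , q with ins e refl
            ...   | f , p , r , s = tl e , bwd (tree-arc e) , trans (sym r) (cong tl (xlab-injective {f} {arc T a} p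
                      (trans s (trans (cong (Aut.to β) q) (Aut.to∘from β (xlab (arc T a)))))))

        t₀ : Node
        t₀ = hd (x i₀)

        open Rooted (tree⇒rooted {GT} isTree t₀)

        -- An edge at `u` is the one to its parent `v` or lies entirely in the subtree of `u`.
        -- Consecutive edges of the connected family share a node, so it enters this subtree only by
        -- way of the edge between `u` and `v`.
        parent-edge : ∀ {u v} → path u ≡ u ∷ path v → ∀ k → At (x k) u →
          ∃[ j ] ((tl (x j) ≡ u × hd (x j) ≡ v) ⊎ (hd (x j) ≡ u × tl (x j) ≡ v))
        parent-edge {u} {v} eq k at-u = conclude (beyond-or-edge {x k} at-u)
          where
          Edge-uv : Edge → Set
          Edge-uv e = (tl e ≡ u × hd e ≡ v) ⊎ (hd e ≡ u × tl e ≡ v)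
          Beyond : Edge → Set
          Beyond e = u ∈ path (tl e) × u ∈ path (hd e)
          v-unique : ∀ {z} → path u ≡ u ∷ path z → z ≡ v
          v-unique eq′ = path-injective (∷-injectiveʳ (trans (sym eq′) eq))
          across : ∀ {w} → Graph._~_ GT u w → w ≡ v ⊎ u ∈ path w
          across a with path-edge a
          ... | inj₁ eq′ = inj₁ (v-unique eq′)
          ... | inj₂ eq′ = inj₂ (subst (u ∈_) (sym eq′) (there (path-self u)))
          beyond-or-edge : ∀ {e} → At e u → Edge-uv e ⊎ Beyond e
          beyond-or-edge {e} (inj₁ p) with across (subst (λ s → Graph._~_ GT s (hd e)) p (fwd (tree-arc e)))
          ... | inj₁ q = inj₁ (inj₁ (p , q))
          ... | inj₂ m = inj₂ (subst (λ s → u ∈ path s) (sym p) (path-self u) , m)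
          beyond-or-edge {e} (inj₂ p) with across (subst (λ s → Graph._~_ GT s (tl e)) p (bwd (tree-arc e)))
          ... | inj₁ q = inj₁ (inj₂ (p , q))
          ... | inj₂ m = inj₂ (m , subst (λ s → u ∈ path s) (sym p) (path-self u))
          off-root : u ∉ path t₀
          off-root m with subst (u ∈_) path-root m
          ... | here refl with path-head v
          ...   | _ , e with trans (sym path-root) (trans eq (cong (u ∷_) e))
          ...     | ()
          crossing : ∀ {z s} → Graph._~_ GT z s → u ∈ path s → u ∉ path z → s ≡ u × z ≡ v
          crossing a m n with enter-subtree a n m
          ... | refl , eq′ = refl , v-unique eq′
          shared : ∀ {e s} → s ≡ tl e ⊎ s ≡ hd e → u ∈ path s → ¬ Beyond e → Edge-uv e
          shared {e} (inj₁ refl) m n = let (p , q) = crossing (bwd (tree-arc e)) m (λ m′ → n (m , m′)) in inj₁ (p , q)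
          shared {e} (inj₂ refl) m n = let (p , q) = crossing (fwd (tree-arc e)) m (λ m′ → n (m′ , m)) in inj₂ (p , q)
          conclude : Edge-uv (x k) ⊎ Beyond (x k) → ∃[ j ] Edge-uv (x j)
          conclude (inj₁ p) = k , p
          conclude (inj₂ b) with reach-crossing (λ k → Beyond (x k)) (reach k) (λ (_ , m) → off-root m) b
          ... | i , j , inj₁ (p , _) , n , (m , _) = i , shared {x i} (inj₂ refl) (subst (λ s → u ∈ path s) (sym p) m) n
          ... | i , j , inj₂ (p , _) , n , (_ , m) = i , shared {x i} (inj₁ refl) (subst (λ s → u ∈ path s) p m) n

        transitive : ∀ {u v} → part u ≡ part v → Σ[ β ∈ BAut ] (Aut.to β u ≡ v)
        transitive {u} {v} eq =
          let (β , e) = homogeneous {⊤} (λ _ → u) (λ _ → v) (tt ∷ [] , λ _ → here refl) tt (λ _ → here) (λ _ → eq)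
                          (λ _ _ _ → refl) (λ _ _ _ → refl) (λ _ _ a → ⊥-elim (proper a refl)) (λ _ _ a → ⊥-elim (proper a refl))
          in β , e tt

        -- If the family touches `u`, the edge to the parent belongs to it, and the local map
        -- prescribed at `u` agrees with the one at `v` there. Otherwise only the image of that edge
        -- is prescribed, which is possible since automorphisms of B are transitive on each side.
        child : ∀ {v u v′ γ} → Graph._~_ GT v u → path u ≡ u ∷ path v → Allowed v v′ γ → ∃[ δ ] (Allowed u (γ u) δ × δ v ≡ v′)
        child {v} {u} {v′} {γ} a eq al with dec (∃[ k ] At (x k) u)
        ... | yes (k , at-u) = extend (Bundle.localMap u k at-u) (parent-edge eq k at-u)
          where
          open AllowedProperties al
          extend : ∃[ t′ ] ∃[ β ] LocalMap u t′ β → ∃[ j ] ((tl (x j) ≡ u × hd (x j) ≡ v) ⊎ (hd (x j) ≡ u × tl (x j) ≡ v)) → ∃[ δ ] (Allowed u (γ u) δ × δ v ≡ v′)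
          extend (t′ , β , lm) (j , inj₁ (p , q)) with allowed-from u t′ β lm
          ... | δ , al′ , _ = δ , subst (λ s → Allowed u s δ) t′≡ al′ ,
                trans (cong δ (sym q)) (trans (sym (proj₂ (AllowedProperties.out-agrees al′ j p))) (proj₁ (in-agrees j q)))
            where
            t′≡ : t′ ≡ γ u
            t′≡ = trans (sym (proj₁ (proj₁ (lm j) p))) (trans (proj₂ (in-agrees j q)) (cong γ p))
          extend (t′ , β , lm) (j , inj₂ (p , q)) with allowed-from u t′ β lm
          ... | δ , al′ , _ = δ , subst (λ s → Allowed u s δ) t′≡ al′ ,
                trans (cong δ (sym q)) (trans (sym (proj₂ (AllowedProperties.in-agrees al′ j p))) (proj₁ (out-agrees j q)))
            where
            t′≡ : t′ ≡ γ u
            t′≡ = trans (sym (proj₁ (proj₂ (lm j) p))) (trans (proj₂ (out-agrees j q)) (cong γ p))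
        ... | no none = free a
          where
          open AllowedProperties al
          vacuous : ∀ β → LocalMap u (γ u) β
          vacuous β i = (λ p → contradiction (i , inj₁ p) none) , (λ p → contradiction (i , inj₂ p) none)
          free : Graph._~_ GT v u → ∃[ δ ] (Allowed u (γ u) δ × δ v ≡ v′)
          free (fwd a) with transitive {xlab (arc T a)} {xlab (arc T (arc-out a))} (trans (xlab-part (arc T a)) (sym (xlab-part (arc T (arc-out a)))))
          ... | β , e with allowed-from u (γ u) β (vacuous β)
          ...   | δ , al′ , refl with AllowedProperties.ins al′ (arc T a) refl
          ...     | f , p , q , r = δ , al′ , trans (sym q) (cong tl (xlab-injective {f} {arc T (arc-out a)} p (trans r e)))
          free (bwd a) with transitive {ylab (arc T a)} {ylab (arc T (arc-in a))} (trans (ylab-part (arc T a)) (sym (ylab-part (arc T (arc-in a)))))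
          ... | β , e with allowed-from u (γ u) β (vacuous β)
          ...   | δ , al′ , refl with AllowedProperties.outs al′ (arc T a) refl
          ...     | f , p , q , r = δ , al′ , trans (sym q) (cong hd (ylab-injective {f} {arc T (arc-in a)} p (trans r e)))

        initial-map : ∃[ t′ ] ∃[ γ ] Allowed t₀ t′ γ
        initial-map =
          let (t′ , β , lm) = Bundle.localMap t₀ i₀ (inj₂ refl) ; (γ , al , _) = allowed-from t₀ t′ β lm in t′ , γ , al

        module Glued (t′ : Node) (γ₀ : Node → Node) (al₀ : Allowed t₀ t′ γ₀) where
          open Extension GT GT (tree⇒rooted {GT} isTree t₀) isTree Allowed (λ al → AllowedProperties.bijection al) t′ γ₀ al₀ child
          module At-node t = AllowedProperties (admissible t)

          τ-arc : ∀ {s t} → s ⟶ t → τ s ⟶ τ t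
          τ-arc {s} a = subst (τ s ⟶_) (sym (τ-neighbour (fwd a))) (At-node.arc-out s a)

          τ-arc⁻ : ∀ {s t} → τ s ⟶ τ t → s ⟶ t
          τ-arc⁻ {s} {t} a = orient (τ-edge⁻ (fwd a))
            where
            orient : Graph._~_ GT s t → s ⟶ t
            orient (fwd b) = b
            orient (bwd b) = ⊥-elim (asymT a (τ-arc b))

          τ⁻¹ : Node → Node
          τ⁻¹ t = proj₁ (τ-onto t)

          τ-τ⁻¹ : ∀ t → τ (τ⁻¹ t) ≡ t
          τ-τ⁻¹ t = proj₂ (τ-onto t)

          lift lower : Edge → Edge
          lift e = arc T (τ-arc (tree-arc e))
          lower e = arc T (τ-arc⁻ (subst₂ _⟶_ (sym (τ-τ⁻¹ (tl e))) (sym (τ-τ⁻¹ (hd e))) (tree-arc e)))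

          lift-xlab : ∀ e → xlab (lift e) ≡ Aut.to (At-node.β (hd e)) (xlab e)
          lift-xlab e = via (At-node.ins (hd e) e refl)
            where
            via : ∃[ f ] (hd f ≡ τ (hd e) × tl f ≡ δ (hd e) (tl e) × xlab f ≡ Aut.to (At-node.β (hd e)) (xlab e)) →
                  xlab (lift e) ≡ Aut.to (At-node.β (hd e)) (xlab e)
            via (f , p , q , r) = trans (cong xlab (edge-≡ {lift e} {f} (trans (τ-neighbour (bwd (tree-arc e))) (sym q)) (sym p))) r

          lift-ylab : ∀ e → ylab (lift e) ≡ Aut.to (At-node.β (tl e)) (ylab e)
          lift-ylab e = via (At-node.outs (tl e) e refl)
            where
            via : ∃[ f ] (tl f ≡ τ (tl e) × hd f ≡ δ (tl e) (hd e) × ylab f ≡ Aut.to (At-node.β (tl e)) (ylab e)) →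
                  ylab (lift e) ≡ Aut.to (At-node.β (tl e)) (ylab e)
            via (f , p , q , r) = trans (cong ylab (edge-≡ {lift e} {f} (sym p) (trans (τ-neighbour (fwd (tree-arc e))) (sym q)))) r

          lift-arc : ∀ {e f} → e ⇒ f → lift e ⇒ lift f
          lift-arc {e} {f} (p , a) = cong τ p , subst₂ _~_ (sym (lift-xlab e))
            (trans (cong (λ t → Aut.to (At-node.β t) (ylab f)) p) (sym (lift-ylab f))) (Aut.to-arc (At-node.β (hd e)) a)

          lift-arc⁻ : ∀ {e f} → lift e ⇒ lift f → e ⇒ f
          lift-arc⁻ {e} {f} (p , a) = eq , Aut.to-arc⁻ (At-node.β (hd e)) (subst₂ _~_ (lift-xlab e)
            (trans (lift-ylab f) (cong (λ t → Aut.to (At-node.β t) (ylab f)) (sym eq))) a)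
            where
            eq : hd e ≡ tl f
            eq = τ-injective p

          automorphism : Aut {K = ⊤} (λ _ → tt) _⇒_
          automorphism = record
            { to = lift ; from = lower
            ; to∘from = λ e → edge-≡ {lift (lower e)} {e} (τ-τ⁻¹ (tl e)) (τ-τ⁻¹ (hd e))
            ; from∘to = λ e → edge-≡ {lower (lift e)} {e} (τ-injective (τ-τ⁻¹ (τ (tl e)))) (τ-injective (τ-τ⁻¹ (τ (hd e))))
            ; to-κ = λ _ → refl
            ; to-arc = λ {e} {f} → lift-arc {e} {f} ; to-arc⁻ = λ {e} {f} → lift-arc⁻ {e} {f} }

          extends : ∀ i → lift (x i) ≡ y i
          extends i = let (p , q) = At-node.out-agrees (tl (x i)) i refl
                      in edge-≡ {lift (x i)} {y i} (sym p) (trans (τ-neighbour (fwd (tree-arc (x i)))) (sym q))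

        extension : Σ[ α ∈ Aut {K = ⊤} (λ _ → tt) _⇒_ ] (∀ i → Aut.to α (x i) ≡ y i)
        extension = glue initial-map
          where
          glue : ∃[ t′ ] ∃[ γ ] Allowed t₀ t′ γ → Σ[ α ∈ Aut {K = ⊤} (λ _ → tt) _⇒_ ] (∀ i → Aut.to α (x i) ≡ y i)
          glue (t′ , γ , al) = Glued.automorphism t′ γ al , Glued.extends t′ γ al

      DL-homogeneity : Homogeneity {Edge} {⊤} (λ _ → tt) _⇒_
      DL-homogeneity x y l i₀ reach _ x≡⇒y≡ y≡⇒x≡ x⇒y y⇒x = PartialIsomorphism.extension x y l i₀ reach x≡⇒y≡ y≡⇒x≡ x⇒y y⇒x

      DL-connectedHomogeneous : ConnectedHomogeneous D
      DL-connectedHomogeneous = homogeneity⇒connectedHomogeneous D DL-homogeneity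

  -- Existence of the labelled tree

  module Existence where

    open import Data.List.Base using (length; drop)
    open import Data.List.Relation.Unary.Any using (here)
    open import Data.Nat.Properties using (1+n≢n; m≢1+n+m)
    open Base
    open Homogeneous
    open Trees
    open Reachability
    open BipartiteHomogeneity using (listed-homogeneous; cycle-connected)
    open LineDigraph using (WellBehaved)
    open import Defs

    through : {V : Set} {_~_ : V → V → Set} → (∀ {u v} → u ~ v → v ~ u) → (r : V) → (∀ v → Reach _~_ r v) → ∀ u v → Reach _~_ u v
    through ~-sym r reach u v = reach-trans (reach-sym ~-sym (reach u)) (reach v)

    listing-sum : ∀ {m n} {P : Fin m ⊎ Fin n → Set} → Listing P
    listing-sum {m} {n} = listing-⊆ (λ {x} _ → side x) (listing-∪ (listing-Fin inj₁) (listing-Fin inj₂))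
      where
      side : (x : Fin m ⊎ Fin n) → (∃[ i ] inj₁ i ≡ x) ⊎ (∃[ j ] inj₂ j ≡ x)
      side (inj₁ i) = inj₁ (i , refl)
      side (inj₂ j) = inj₂ (j , refl)

    listed-wellBehaved : ∀ {B} → Listed B → WellBehaved B
    listed-wellBehaved {B} (cycle {suc (suc (suc n))} l even) = record
      { homogeneous = listed-homogeneous (cycle l even)
      ; reachable = through ~-sym zero (cycle-connected even)
      ; neighbours = λ _ → listing-⊆ (λ {i} _ → i , refl) (listing-Fin λ i → i)
      ; u₀ = zero ; v₀ = suc zero ; u₀~v₀ = fwd (inj₁ refl) }
      where open BipartiteGraph B
    listed-wellBehaved (cycle {suc zero} (s≤s ()) _)
    listed-wellBehaved (cycle {suc (suc zero)} (s≤s (s≤s ())) _)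
    listed-wellBehaved {B} (complete {suc m} {suc n} l k) = record
      { homogeneous = listed-homogeneous (complete l k)
      ; reachable = through ~-sym (inj₁ zero) reach
      ; neighbours = λ _ → listing-sum
      ; u₀ = inj₁ zero ; v₀ = inj₂ zero ; u₀~v₀ = edge always }
      where
      open BipartiteGraph B
      reach : ∀ v → Reach _~_ (inj₁ zero) v
      reach (inj₁ i) = here ▻ edge {b = zero} always ▻ edge˘ always
      reach (inj₂ j) = here ▻ edge always
    listed-wellBehaved {B} (matching {suc (suc (suc n))} l) = record
      { homogeneous = listed-homogeneous (matching l)
      ; reachable = through ~-sym (inj₁ zero) reach
      ; neighbours = λ _ → listing-sum
      ; u₀ = inj₁ zero ; v₀ = inj₂ (suc zero) ; u₀~v₀ = edge λ () }
      where
      open BipartiteGraph B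
      reach : ∀ v → Reach _~_ (inj₁ zero) v
      reach (inj₁ zero) = here
      reach (inj₁ (suc zero)) = here ▻ edge {b = suc (suc zero)} (λ ()) ▻ edge˘ (λ ())
      reach (inj₁ (suc (suc i))) = here ▻ edge {b = suc zero} (λ ()) ▻ edge˘ (λ ())
      -- The two vertices of index `zero` are matched and hence not adjacent; the walk between them
      -- needs three edges, with two further indices.
      reach (inj₂ zero) = here ▻ edge {b = suc (suc zero)} (λ ()) ▻ edge˘ {a = suc zero} (λ ()) ▻ edge (λ ())
      reach (inj₂ (suc j)) = here ▻ edge λ ()
    listed-wellBehaved (matching {suc zero} (s≤s ()))
    listed-wellBehaved (matching {suc (suc zero)} (s≤s (s≤s ())))
    listed-wellBehaved {B} (tree semiregular) = record
      { homogeneous = listed-homogeneous (tree semiregular)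
      ; reachable = reachable
      ; neighbours = neighbours
      ; u₀ = r ; v₀ = proj₁ some-edge ; u₀~v₀ = proj₂ some-edge }
      where
      open BipartiteGraph B
      open IsSemiregularTree semiregular
      r : V
      r = proj₁ (proj₁ isTree)
      reachable : ∀ u v → Reach _~_ u v
      reachable u v = star⇒reach (λ e → e) (proj₂ (proj₁ isTree) u v)
      neighbours : ∀ v → Listing (v ~_)
      neighbours v with part v in eq
      ... | 0ℙ = finite⇒listing (_ , degreeX eq)
      ... | 1ℙ = finite⇒listing (_ , degreeY eq)
      isolated : ¬ (∃[ v ] r ~ v) → ∀ {v} → Reach _~_ r v → v ≡ r
      isolated none here = refl
      isolated none (s ▻ e) = contradiction (_ , subst (_~ _) (isolated none s) e) none
      some-edge : ∃[ v ] r ~ v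
      some-edge = dne λ none → infinite
        (1 , mk↔ₛ′ (λ _ → zero) (λ _ → r) (λ { zero → refl }) (λ v → sym (isolated none (reachable r v))))

    -- Vertices are the reduced words over labelled steps, the last step first.  A vertex reached from its parent by a step in
    -- direction d sees that parent in the other direction, under the label default (reverse d).
    module Words (Label : Direction → Set) (default : ∀ d → Label d) where

      reverse : Direction → Direction
      reverse forward  = backward
      reverse backward = forward

      reverse≢ : ∀ d → d ≢ reverse d
      reverse≢ forward ()
      reverse≢ backward ()

      Word : Set
      Word = List (Σ Direction Label)

      -- Excludes only the step that would lead back to the parent, the one under the default label
      -- after a step in the opposite direction.
      Allowed : ∀ d → Label d → Word → Set
      Allowed d l []            = ⊤
      Allowed d l ((e , _) ∷ w) = d ≢ e → l ≢ default d

      Reduced : Word → Set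
      Reduced []            = ⊤
      Reduced ((d , l) ∷ w) = Allowed d l w × Reduced w

      reduced-drop : ∀ w → Reduced w → Reduced (drop 1 w)
      reduced-drop []      r       = r
      reduced-drop (_ ∷ w) (_ , r) = r

      Node : Set
      Node = [ w ∈ Word ∣ Reduced w ]

      parent : Node → Node
      parent (w , [ r ]) = drop 1 w , [ reduced-drop w r ]

      Next : Direction → Word → Word → Set
      Next d t w = (∃[ l ] w ≡ (d , l) ∷ t) ⊎ (∃[ l ] t ≡ (reverse d , l) ∷ w)

      longer : ∀ {A : Set} {x : A} {w : List A} → w ≢ x ∷ w
      longer eq = 1+n≢n (sym (cong length eq))

      longer₂ : ∀ {A : Set} {x y : A} {w : List A} → w ≢ x ∷ y ∷ w
      longer₂ eq = m≢1+n+m _ {1} (cong length eq)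

      label : ∀ {d t w} → Next d t w → Label d
      label     (inj₁ (l , _)) = l
      label {d} (inj₂ _)       = default d

      -- A label in direction `d` belongs to the word prolonged by that step if the step is allowed.
      -- The only other case is the default label after an opposite step, and it belongs to the
      -- parent.
      neighbours↔labels : ∀ d (t : Node) → [ w ∈ Node ∣ Next d (value t) (value w) ] ↔ Label d
      neighbours↔labels d (t , [ t-reduced ]) = mk↔ₛ′ (λ w → label (proofOf w)) (λ l → at l (dec _))
        (λ l → label-at l (dec _) (proofOf (at l (dec _)))) (λ w → value-injective (value-injective (at-label w (proofOf w) (dec _))))
        where
        blocked : ∀ {l} w → ¬ Allowed d l w → (∃[ m ] w ≡ (reverse d , m) ∷ drop 1 w) × l ≡ default d
        blocked [] n = ⊥-elim (n tt)
        blocked {l} ((e , m) ∷ w) n = (m′ d e m λ { refl → n λ ne → ⊥-elim (ne refl) }) , dne λ ne → n λ _ → ne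
          where
          m′ : ∀ d e m → d ≢ e → ∃[ m′ ] (e , m) ∷ w ≡ (reverse d , m′) ∷ w
          m′ forward forward m ne = ⊥-elim (ne refl)
          m′ forward backward m ne = m , refl
          m′ backward forward m ne = m , refl
          m′ backward backward m ne = ⊥-elim (ne refl)
        at : ∀ l → Dec (Allowed d l t) → [ w ∈ Node ∣ Next d t (value w) ]
        at l (yes a) = ((d , l) ∷ t , [ a , t-reduced ]) , [ inj₁ (l , refl) ]
        at l (no n)  = (drop 1 t , [ reduced-drop t t-reduced ]) , [ inj₂ (proj₁ (blocked t n)) ]
        label-at : ∀ l (a : Dec (Allowed d l t)) (p : Next d t (value (value (at l a)))) → label p ≡ l
        label-at l (yes a) (inj₁ (_ , refl)) = refl
        label-at l (yes a) (inj₂ (_ , eq)) = ⊥-elim (longer₂ eq)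
        label-at l (no n) (inj₁ (_ , eq)) = ⊥-elim (longer₂ (trans eq (cong (_ ∷_) (proj₂ (proj₁ (blocked t n))))))
        label-at l (no n) (inj₂ _) = sym (proj₂ (blocked t n))
        at-label : ∀ w (p : Next d t (value (value w))) (a : Dec (Allowed d (label p) t)) → value (value (at (label p) a)) ≡ value (value w)
        at-label w (inj₁ (l , eq)) (yes a) = sym eq
        at-label w (inj₁ (l , eq)) (no n) = ⊥-elim (n (proj₁ (subst Reduced eq (proofOf (value w)))))
        at-label w (inj₂ (l , eq)) (yes a) = ⊥-elim (subst (Allowed d (default d)) eq a (reverse≢ d) refl)
        at-label w (inj₂ (l , eq)) (no n) = cong (drop 1) eq

      T : Digraph
      T = record
        { V       = Node
        ; _⟶_     = λ u v → Next forward (value u) (value v)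
        ; irrefl  = λ { refl (inj₁ (_ , eq)) → longer eq ; refl (inj₂ (_ , eq)) → longer eq }
        ; antisym = λ p q → ⊥-elim (asymmetric p q)
        }
        where
        asymmetric : ∀ {u v} → Next forward u v → ¬ Next forward v u
        asymmetric (inj₁ (_ , refl)) (inj₁ (_ , eq)) = longer₂ eq
        asymmetric (inj₁ (_ , refl)) (inj₂ (_ , ()))
        asymmetric (inj₂ (_ , refl)) (inj₁ (_ , ()))
        asymmetric (inj₂ (_ , refl)) (inj₂ (_ , eq)) = longer₂ eq

      root : Node
      root = [] , [ tt ]

      T-tree : IsTree (underlying T)
      T-tree = (root , λ u v → reach⇒star′ (λ w → w) (λ e → e) (through (Graph.~-sym (underlying T)) root reach u v)) ,
               parents⇒acyclic {underlying T} (λ w → length (value w)) parent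
                 λ { (fwd a) → family a ; (bwd a) → swap (family a) }
        where
        reach : ∀ w → Reach (Graph._~_ (underlying T)) root w
        reach ([] , _) = here
        reach ((forward  , l) ∷ w , [ r ]) = reach (w , [ proj₂ r ]) ▻ fwd (inj₁ (l , refl))
        reach ((backward , l) ∷ w , [ r ]) = reach (w , [ proj₂ r ]) ▻ bwd (inj₂ (l , refl))
        family : ∀ {x y : Node} → Next forward (value x) (value y) →
                 (length (value x) ≡ suc (length (value y)) × parent x ≡ y) ⊎ (length (value y) ≡ suc (length (value x)) × parent y ≡ x)
        family (inj₁ (_ , eq)) = inj₂ (cong length eq , value-injective (cong (drop 1) eq))
        family (inj₂ (_ , eq)) = inj₁ (cong length eq , value-injective (cong (drop 1) eq))

    labelled-tree : (B : BipartiteGraph) → BipartiteGraph.X B → BipartiteGraph.Y B → LabelledTree B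
    labelled-tree B x y = record
      { T = T ; isTree = T-tree ; ψ = neighbours↔labels forward
      -- `Next forward w t` and `Next backward t w` have the same two alternatives in opposite
      -- order.
      ; φ = λ t → let open Inverse (neighbours↔labels backward t) in
                  mk↔ₛ′ (λ { (w , [ a ]) → to (w , [ swap a ]) }) (λ l → value (from l) , [ swap (proofOf (from l)) ])
                        strictlyInverseˡ (λ { (w , [ a ]) → value-injective (cong value (strictlyInverseʳ (w , [ swap a ]))) }) }
      where
      Label : Direction → Set
      Label forward  = BipartiteGraph.Y B
      Label backward = BipartiteGraph.X B
      default : ∀ d → Label d
      default forward  = y
      default backward = x
      open Words Label default

    wellBehaved⇒labelled-tree : {B : BipartiteGraph} → WellBehaved B → LabelledTree B
    wellBehaved⇒labelled-tree {B} wb with part u₀ in p | part v₀ in q | proper u₀~v₀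
      where
      open BipartiteGraph B
      open WellBehaved wb
    ... | 0ℙ | 1ℙ | _ = labelled-tree B (_ , [ p ]) (_ , [ q ])
    ... | 1ℙ | 0ℙ | _ = labelled-tree B (_ , [ q ]) (_ , [ p ])
    ... | 0ℙ | 0ℙ | ne = ⊥-elim (ne refl)
    ... | 1ℙ | 1ℙ | ne = ⊥-elim (ne refl)

open import Relation.Binary.Definitions using (Universal)
open import Defs
open Proof

theorem4p1 : ExcludedMiddle 0ℓ →
    ( (D : Digraph) →
    Connected (underlying D) →
    LocallyFinite D →
    TriangleFree (underlying D) →
    MoreThanOneEnd (underlying D) →
    ConnectedHomogeneous D →
    HighlyArcTransitive D
    × (¬ Universal (𝒜 D) × Δ-satisfies D IsBipartite)
    × (∃[ B ] (Listed B × ΔIsomorphicTo D B))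
    × ( MoreThanTwoEnds (underlying D) →
    (u : Digraph.V D) →
    IsTree (underlying (desc D u)) × IsTree (underlying (anc D u)) ) )
    ×
    ( (B : BipartiteGraph) → Listed B →
    LabelledTree B
    × ( (L : LabelledTree B) →
    Connected (underlying (DL B L))
    × TriangleFree (underlying (DL B L))
    × LocallyFinite (DL B L)
    × ConnectedHomogeneous (DL B L)
    × ΔIsomorphicTo (DL B L) B ) )
theorem4p1 em =
  (λ D con lf tf (ray , _) ch → let open Forward em in
    highlyArcTransitive D con lf tf ray ch , (not-universal D con lf tf ray ch , Δ-isBipartite D con lf tf ray ch) ,
    Δ-classified D con lf tf ray ch , descendants-trees D con lf tf ray ch) ,
  λ B listed → let open Existence em ; wb = listed-wellBehaved listed in
    wellBehaved⇒labelled-tree wb , λ L → let open LineDigraph.DLTheory em wb L in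
      DL-connected , (λ {e} {f} {g} → DL-triangleFree {e} {f} {g}) , DL-locallyFinite ,
      LineHomogeneity.DL-connectedHomogeneous em wb L , ΔB
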